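{- Let $(W,S)$ be a Coxeter system and $u,v\in W$ with $u\le v$. Then $$\widetilde F(u,v)=\sum_{\alpha}c_\alpha(u,v)\,M_\alpha=\sum_\alpha b_\alpha(u,v)\,L_\alpha,$$ the sums being over all compositions $\alpha$ (including the empty one). Moreover $\widetilde F(u,v)$ lies in the peak algebra $\Pi$; in fact $$\widetilde F(u,v)\in\Pi_{l(u,v)}\oplus\Pi_{l(u,v)-2}\oplus\Pi_{l(u,v)-4}\oplus\cdots.$$
   Context: Coxeter setting: $(W,S)$ Coxeter system, length $l$, reflections $T=\{wsw^{ -1}\}$, Bruhat order $\le$, $l(u,v)=l(v)-l(u)$. The $R$-polynomials $R_{u,v}(q)$ are defined by $(T_{v^{ -1}})^{ -1}=q^{ -l(v)}\sum_{u\le v}(-1)^{l(v)-l(u)}R_{u,v}(q)T_u$ in the Hecke algebra (free $\mathbb Z[q^{\pm1}]$-module on $T_w$, with $T_wT_s=T_{ws}$ if $l(ws)>l(w)$, $T_wT_s=qT_{ws}+(q-1)T_w$ otherwise). $\widetilde R_{u,v}\in\mathbb N[q]$ is the unique polynomial with $R_{u,v}(q)=q^{l(u,v)/2}\widetilde R_{u,v}(q^{1/2}-q^{ -1/2})$. Paths: fix a reflection ordering $<_T$ (a total order on $T$ such that for every dihedral reflection subgroup with canonical generators $\{a,b\}$ one has $a<_Taba<_Tababa<_T\cdots<_Tbab<_Tb$ or the reverse). The Bruhat graph has vertex set $W$ and an edge $x\to y$ iff $yx^{ -1}\in T$ and $l(x)<l(y)$; a Bruhat path $\Delta=(a_0,\dots,a_r)$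 is a directed path, of length $r$, with descent set $D(\Delta)=\{i\in[r-1]: a_ia_{i-1}^{ -1}>_Ta_{i+1}a_i^{ -1}\}$, and descent composition the composition of $r$ corresponding to $D(\Delta)$ under $\beta_1\cdots\beta_k\mapsto\{\beta_1,\beta_1+\beta_2,\dots,\beta_1+\cdots+\beta_{k-1}\}$. For compositions $\alpha,\beta$ of $n$, $\alpha\preceq\beta$ means $\alpha$ refines $\beta$. $b_\alpha(u,v)$ is the number of Bruhat paths from $u$ to $v$ of length $|\alpha|$ with descent composition equal to $\alpha$, and $c_\alpha(u,v)$ the number with descent composition $\succeq\alpha$ (for the empty composition both count paths of length $0$). Quasisymmetric functions: for a composition $\alpha=\alpha_1\cdots\alpha_k$, $M_\alpha=\sum_{i_1<\cdots<i_k}x_{i_1}^{\alpha_1}\cdots x_{i_k}^{\alpha_k}$ and $L_\beta=\sum_{\alpha\preceq\beta}M_\alpha$, with $M_\emptyset=L_\emptyset=1$; $L^{(n)}_T$ denotes $L_\beta$ for the composition $\beta$ of $n$ corresponding to $T\subseteq[n-1]$. Let ${\bf c},{\bf d}$ be noncommuting variables of degrees $1$ and $2$. For a ${\bf cd}$-word $w={\bf c}^{n_1}{\bf d}{\bf c}^{n_2}{\bf d}\cdots{\bf c}^{n_k}{\bf d}{\bf c}^{n_0}$ of degree $n$, let $m_j=\deg({\bf c}^{n_1}{\bf d}\cdots{\bf c}^{n_j}{\bf d})$, $\mathcal I^w=\{\{m_j-1,m_j\}:j=1,\dots,k\}$, $B[\mathcal I^w]=\{T\subseteq[n]: T\cap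 A\neq\emptyset\text{ and }([n]\setminus T)\cap A\ne\emptyset\ \forall A\in\mathcal I^w\}$, and $\Theta_w=\sum_{T\in B[\mathcal I^w]}L^{(n+1)}_T$ (so $\Theta_{\bf 1}=L_1$ for the empty word). The peak algebra $\Pi$ is the span of $1$ and all $\Theta_w$, and $\Pi_i$ is its homogeneous part of degree $i$. The $R$-quasisymmetric function is $\widetilde F(u,v)=\sum\widetilde R_{u_0,u_1}(x_1)\widetilde R_{u_1,u_2}(x_2)\cdots\widetilde R_{u_{k-1},u_k}(x_k)$, summed over all $k\ge1$ and multichains $u=u_0\le u_1\le\cdots\le u_{k-1}<u_k=v$ (with the convention $\widetilde F(u,u)=1$). -}

module Defs where

open import Level using (0ℓ)
open import Data.Bool using (Bool; true; false; if_then_else_; _∧_; _∨_; not)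
open import Data.Nat using (ℕ; zero; suc; _+_; _*_; _≤_; _<_; _∸_; _<ᵇ_; _≡ᵇ_)
open import Data.Nat.Properties using () renaming (_≟_ to _≟ℕ_)
open import Data.Integer as ℤ using (ℤ; 0ℤ; 1ℤ; -1ℤ)
open import Data.List using (List; []; _∷_; length; map; concat; concatMap; foldr; foldl; zipWith; replicate; _++_; upTo; drop)
open import Data.Nat.ListAction using (sum)
open import Data.List.Properties using (≡-dec)
open import Data.List.Relation.Unary.All using (All)
open import Data.List.Relation.Unary.Unique.Propositional using (Unique)
open import Data.List.Membership.Propositional using (_∈_)
open import Data.List.Relation.Binary.Pointwise using (Pointwise)
open import Data.Product using (Σ; ∃; _×_; _,_; proj₁; proj₂)
open import Data.Sum using (_⊎_)
open import Data.Unit using (⊤)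
open import Data.Empty using (⊥)
open import Relation.Nullary using (¬_; does)
open import Relation.Binary.Definitions using (DecidableEquality)
open import Relation.Binary.PropositionalEquality using (_≡_; _≢_)
open import Algebra.Bundles using (Group)
open import Algebra.Structures using (IsGroup)

prodOp : {A : Set} → (A → A → A) → A → List A → A
prodOp _∙_ ε = foldr _∙_ ε

powOp : {A : Set} → (A → A → A) → A → A → ℕ → A
powOp _∙_ ε x zero = ε
powOp _∙_ ε x (suc n) = x ∙ powOp _∙_ ε x n

sumℤ : List ℤ → ℤ
sumℤ = foldr ℤ._+_ 0ℤ

SumsTo : {A : Set} → (A → Set) → (A → ℤ) → ℤ → Set
SumsTo {A} P f z = Σ (List A) λ xs →
  Unique xs × (∀ x → x ∈ xs → P x) × (∀ x → P x → x ∈ xs) × sumℤ (map f xs) ≡ z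

Count : {A : Set} → (A → Set) → ℕ → Set
Count P n = SumsTo P (λ _ → 1ℤ) (ℤ.+ n)

-- Polynomials with integer coefficients (coefficient lists, constant first)

Poly : Set
Poly = List ℤ

coefP : Poly → ℕ → ℤ
coefP [] _ = 0ℤ
coefP (a ∷ p) zero = a
coefP (a ∷ p) (suc i) = coefP p i

PolyEq : Poly → Poly → Set
PolyEq p q = ∀ i → coefP p i ≡ coefP q i

addP : Poly → Poly → Poly
addP [] q = q
addP (a ∷ p) [] = a ∷ p
addP (a ∷ p) (b ∷ q) = (a ℤ.+ b) ∷ addP p q

scalP : ℤ → Poly → Poly
scalP a p = map (a ℤ.*_) p

mulP : Poly → Poly → Poly
mulP [] q = []
mulP (a ∷ p) q = addP (scalP a q) (0ℤ ∷ mulP p q)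

sumP : List Poly → Poly
sumP = foldr addP []

shiftP : ℕ → Poly → Poly
shiftP n p = replicate n 0ℤ ++ p

monoP : ℕ → Poly
monoP n = shiftP n (1ℤ ∷ [])

powP : Poly → ℕ → Poly
powP p zero = 1ℤ ∷ []
powP p (suc n) = mulP p (powP p n)

qP : Poly
qP = 0ℤ ∷ 1ℤ ∷ []

qm1P : Poly
qm1P = -1ℤ ∷ 1ℤ ∷ []

t2m1P : Poly
t2m1P = -1ℤ ∷ 0ℤ ∷ 1ℤ ∷ []

substSq : Poly → Poly
substSq p = concatMap (λ a → a ∷ 0ℤ ∷ []) p

sgn : ℕ → ℤ
sgn zero = 1ℤ
sgn (suc n) = ℤ.- sgn n

-- RtSpec l R Rt : R(q) = q^{l/2} Rt(q^{1/2} - q^{-1/2}).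
-- With t = q^{1/2} and d = length Rt, this is (after multiplying by t^d)
-- the polynomial identity  t^d R(t^2) = t^l Σ_{i<d} Rt_i t^{d-i} (t^2-1)^i.
RtSpec : ℕ → Poly → Poly → Set
RtSpec l r rt = PolyEq (shiftP d (substSq r))
  (shiftP l (sumP (zipWith (λ i a → scalP a (shiftP (d ∸ i) (powP t2m1P i))) (upTo d) rt)))
  where d = length rt

-- Compositions, quasisymmetric functions (as coefficient functions on
-- exponent vectors γ = (γ₁,…,γ_N) of monomials x₁^γ₁⋯x_N^γ_N)

anyᵇ : {A : Set} → (A → Bool) → List A → Bool
anyᵇ p = foldr (λ x b → p x ∨ b) false

allᵇ : {A : Set} → (A → Bool) → List A → Bool
allᵇ p = foldr (λ x b → p x ∧ b) true

memᵇ : ℕ → List ℕ → Bool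
memᵇ i xs = anyᵇ (i ≡ᵇ_) xs

allZeroᵇ : List ℕ → Bool
allZeroᵇ = allᵇ (_≡ᵇ 0)

incHead : List ℕ → List ℕ
incHead [] = []
incHead (a ∷ c) = suc a ∷ c

comps : ℕ → List (List ℕ)
comps zero = [] ∷ []
comps (suc zero) = (1 ∷ []) ∷ []
comps (suc (suc n)) = concatMap (λ c → (1 ∷ c) ∷ incHead c ∷ []) (comps (suc n))

subs : ℕ → List (List ℕ)
subs zero = [] ∷ []
subs (suc n) = subs n ++ map (λ T → T ++ (suc n ∷ [])) (subs n)

psums : ℕ → List ℕ → List ℕ
psums acc [] = []
psums acc (a ∷ []) = []
psums acc (a ∷ b ∷ r) = (acc + a) ∷ psums (acc + a) (b ∷ r)

compSet : List ℕ → List ℕ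
compSet = psums 0

-- composition of m corresponding to an increasing T ⊆ [m-1]
setToComp : ℕ → List ℕ → List ℕ
setToComp m = go 0
  where
  go : ℕ → List ℕ → List ℕ
  go prev [] = (m ∸ prev) ∷ []
  go prev (t ∷ ts) = (t ∸ prev) ∷ go t ts

refinesᵇ : List ℕ → List ℕ → Bool
refinesᵇ α β = (sum α ≡ᵇ sum β) ∧ allᵇ (λ i → memᵇ i (compSet α)) (compSet β)

flat : List ℕ → List ℕ
flat [] = []
flat (zero ∷ γ) = flat γ
flat (suc a ∷ γ) = suc a ∷ flat γ

Mser : List ℕ → List ℕ → ℤ
Mser α γ = if does (≡-dec _≟ℕ_ (flat γ) α) then 1ℤ else 0ℤ

Lser : List ℕ → List ℕ → ℤ
Lser β γ = sumℤ (map (λ α → if refinesᵇ α β then Mser α γ else 0ℤ) (comps (sum β)))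

oneSer : List ℕ → ℤ
oneSer γ = if allZeroᵇ γ then 1ℤ else 0ℤ

data CD : Set where
  𝐜 𝐝 : CD

degCD : List CD → ℕ
degCD [] = 0
degCD (𝐜 ∷ w) = suc (degCD w)
degCD (𝐝 ∷ w) = suc (suc (degCD w))

-- the numbers m_j = deg(c^{n1} d ⋯ c^{nj} d)
dEnds : List CD → List ℕ
dEnds = go 0
  where
  go : ℕ → List CD → List ℕ
  go acc [] = []
  go acc (𝐜 ∷ w) = go (suc acc) w
  go acc (𝐝 ∷ w) = (acc + 2) ∷ go (acc + 2) w

-- T ∈ B[I^w] (for T ⊆ [n], n = deg w; each A = {m-1,m} ⊆ [n])
inB : List CD → List ℕ → Bool
inB w T = allᵇ (λ m → (memᵇ (m ∸ 1) T ∨ memᵇ m T) ∧ (not (memᵇ (m ∸ 1) T) ∨ not (memᵇ m T))) (dEnds w)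

Θ : List CD → List ℕ → ℤ
Θ w γ = sumℤ (map (λ T → if inB w T then Lser (setToComp (suc n) T) γ else 0ℤ) (subs n))
  where n = degCD w

-- Coxeter systems.  W is a group (with decidable equality), S ⊆ W a set of
-- generators of order 2, and W has the presentation
-- ⟨ S | (st)^{m(s,t)} = e ⟩ with m(s,t) the order of st (universal property).

record CoxeterSystem : Set₁ where
  field
    W       : Set
    _·_     : W → W → W
    e       : W
    _⁻¹     : W → W
    isGroup : IsGroup _≡_ _·_ e _⁻¹
    _≟W_    : DecidableEquality W
    S       : W → Set
    generates : ∀ w → Σ (List W) λ ws → All S ws × prodOp _·_ e ws ≡ w
    invol     : ∀ s → S s → s · s ≡ e
    nontriv   : ∀ s → S s → s ≢ e
    universal : (G : Group 0ℓ 0ℓ) (f : W → Group.Carrier G) →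
      (∀ s t n → S s → S t → powOp _·_ e (s · t) n ≡ e →
        Group._≈_ G (powOp (Group._∙_ G) (Group.ε G) (Group._∙_ G (f s) (f t)) n) (Group.ε G)) →
      Σ (W → Group.Carrier G) λ φ →
        (∀ x y → Group._≈_ G (φ (x · y)) (Group._∙_ G (φ x) (φ y))) ×
        (∀ s → S s → Group._≈_ G (φ s) (f s))

module CoxDefs (C : CoxeterSystem) (len : CoxeterSystem.W C → ℕ) where
  open CoxeterSystem C

  prod : List W → W
  prod = prodOp _·_ e

  IsLength : Set
  IsLength = ∀ w →
    (Σ (List W) λ ws → All S ws × prod ws ≡ w × length ws ≡ len w) ×
    (∀ ws → All S ws → prod ws ≡ w → len w ≤ length ws)

  Reduced : List W → W → Set
  Reduced ws w = All S ws × prod ws ≡ w × length ws ≡ len w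

  IsRefl : W → Set
  IsRefl t = Σ W λ w → Σ W λ s → S s × t ≡ (w · s) · (w ⁻¹)

  Edge : W → W → Set
  Edge x y = IsRefl (y · (x ⁻¹)) × len x < len y

  PathFrom : W → List W → W → Set
  PathFrom x [] y = x ≡ y
  PathFrom x (a ∷ as) y = Edge x a × PathFrom a as y

  _≤B_ : W → W → Set
  x ≤B y = Σ (List W) λ as → PathFrom x as y

  _<B_ : W → W → Set
  x <B y = x ≤B y × x ≢ y

  -- Hecke algebra over ℤ[q]: finite formal sums Σ p_i T_{w_i}
  Elt : Set
  Elt = List (Poly × W)

  rmulTerm : Poly × W → W → Elt
  rmulTerm (p , w) s =
    if len w <ᵇ len (w · s) then (p , w · s) ∷ []
    else (mulP qP p , w · s) ∷ (mulP qm1P p , w) ∷ []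

  rmulS : Elt → W → Elt
  rmulS x s = concatMap (λ t → rmulTerm t s) x

  rmulWord : Elt → List W → Elt
  rmulWord = foldl rmulS

  Tword : List W → Elt                 -- T_{s₁⋯s_k}  (for a reduced word)
  Tword σ = rmulWord ((1ℤ ∷ [] , e) ∷ []) σ

  coefE : Elt → W → ℕ → ℤ
  coefE x w i = sumℤ (map (λ t → if does (proj₂ t ≟W w) then coefP (proj₁ t) i else 0ℤ) x)

  scaleE : Poly → Elt → Elt
  scaleE p x = map (λ t → (mulP p (proj₁ t) , proj₂ t)) x

  EltEq : Elt → Elt → Set
  EltEq x y = ∀ w i → coefE x w i ≡ coefE y w i

  -- R x v are the R-polynomials: (T_{v⁻¹})⁻¹ = q^{-l(v)} Σ_{u≤v} (-1)^{l(v)-l(u)} R_{u,v} T_u,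
  -- written equivalently as T_{v⁻¹} · Σ_{u≤v} (-1)^{l(v)-l(u)} R_{u,v} T_u = q^{l(v)} T_e.
  IsRPolys : (W → W → Poly) → Set
  IsRPolys R = ∀ v →
    Σ (List W) λ ρ → Reduced ρ (v ⁻¹) ×
    Σ (List W) λ I → Unique I × (∀ x → x ∈ I → x ≤B v) × (∀ x → x ≤B v → x ∈ I) ×
    Σ (List (List W)) λ σs → Pointwise (λ x σ → Reduced σ x) I σs ×
    EltEq (concat (zipWith (λ x σ → scaleE (scalP (sgn (len v ∸ len x)) (R x v)) (rmulWord (Tword ρ) σ)) I σs))
          ((monoP (len v) , e) ∷ [])

  IsRtildes : (W → W → Poly) → (W → W → Poly) → Set
  IsRtildes R Rt = ∀ u v → u ≤B v → RtSpec (len v ∸ len u) (R u v) (Rt u v)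

  InSub : W → W → W → Set
  InSub a b t = Σ (List Bool) λ bs → prod (map (λ β → if β then a else b) bs) ≡ t

  DihedralCanon : W → W → Set
  DihedralCanon a b = IsRefl a × IsRefl b × a ≢ b ×
    (∀ t → IsRefl t → InSub a b t → len (t · a) < len a → t ≡ a) ×
    (∀ t → IsRefl t → InSub a b t → len (t · b) < len b → t ≡ b)

  -- a < aba < ababa < ⋯ < bab < b   (listing of the reflections of ⟨a,b⟩)
  Pattern : (W → W → Set) → W → W → Set
  Pattern _<T_ a b =
    (∀ i j → i < j → (∀ k → k ≤ i → ak j ≢ ak k) → ak i <T ak j) ×
    (∀ i j → i < j → (∀ k → k ≤ i → bk j ≢ bk k) → bk j <T bk i) ×
    (∀ i j → (∀ k → ak k ≢ bk j) → ak i <T bk j)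
    where
    ak : ℕ → W
    ak k = powOp _·_ e (a · b) k · a
    bk : ℕ → W
    bk k = powOp _·_ e (b · a) k · b

  IsReflOrder : (W → W → Set) → Set
  IsReflOrder _<T_ =
    (∀ t → IsRefl t → ¬ (t <T t)) ×
    (∀ t t′ t″ → IsRefl t → IsRefl t′ → IsRefl t″ → t <T t′ → t′ <T t″ → t <T t″) ×
    (∀ t t′ → IsRefl t → IsRefl t′ → t ≢ t′ → (t <T t′) ⊎ (t′ <T t)) ×
    (∀ a b → DihedralCanon a b → Pattern _<T_ a b ⊎ Pattern _<T_ b a)

  labels : W → List W → List W
  labels u as = zipWith (λ x y → y · (x ⁻¹)) (u ∷ as) as

  DescAt : (W → W → Set) → List W → ℕ → Set
  DescAt _<T_ (x ∷ y ∷ r) (suc zero) = y <T x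
  DescAt _<T_ (x ∷ r) (suc (suc i)) = DescAt _<T_ r (suc i)
  DescAt _<T_ _ _ = ⊥

  HasDescComp : (W → W → Set) → W → List W → List ℕ → Set
  HasDescComp _<T_ u as α = All (0 <_) α × sum α ≡ length as ×
    (∀ i → (memᵇ i (compSet α) ≡ true → DescAt _<T_ (labels u as) i) ×
           (DescAt _<T_ (labels u as) i → memᵇ i (compSet α) ≡ true))

  bCount : (W → W → Set) → W → W → List ℕ → ℕ → Set
  bCount _<T_ u v α n = Count (λ as → PathFrom u as v × HasDescComp _<T_ u as α) n

  cCount : (W → W → Set) → W → W → List ℕ → ℕ → Set
  cCount _<T_ u v α n = Count (λ as → PathFrom u as v × length as ≡ sum α ×
    Σ (List ℕ) λ β → HasDescComp _<T_ u as β × refinesᵇ α β ≡ true) n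

  MC : W → List W → W → Set
  MC x [] v = ⊥
  MC x (y ∷ []) v = y ≡ v × x <B v
  MC x (y ∷ z ∷ zs) v = x ≤B y × MC y (z ∷ zs) v

  hd : List ℕ → ℕ
  hd [] = 0
  hd (a ∷ _) = a

  tl : List ℕ → List ℕ
  tl [] = []
  tl (_ ∷ γ) = γ

  -- coefficient of x^γ in Rt_{x,u₁}(x₁) Rt_{u₁,u₂}(x₂) ⋯
  weight : (W → W → Poly) → W → List W → List ℕ → ℤ
  weight Rt x [] γ = 1ℤ
  weight Rt x (y ∷ ys) γ = coefP (Rt x y) (hd γ) ℤ.* weight Rt y ys (tl γ)

  Contrib : (W → W → Poly) → W → W → ℕ → List ℕ → ℤ → Set
  Contrib Rt u v k γ z =
    if allZeroᵇ (drop k γ)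
    then SumsTo (λ ys → length ys ≡ k × MC u ys v) (λ ys → weight Rt u ys γ) z
    else z ≡ 0ℤ

  FCoef : (W → W → Poly) → W → W → List ℕ → ℤ → Set
  FCoef Rt u v γ z =
    (u ≡ v → z ≡ oneSer γ) ×
    (u ≢ v → Σ ℕ λ K → Σ (List ℤ) λ zs →
       Pointwise (λ k z′ → Contrib Rt u v (suc k) γ z′) (upTo K) zs ×
       (∀ k → K ≤ k → Contrib Rt u v (suc k) γ 0ℤ) ×
       sumℤ zs ≡ z)

  ClaimM : (W → W → Poly) → (W → W → Set) → W → W → Set
  ClaimM Rt _<T_ u v = ∀ γ → Σ (List ℕ) λ cs →
    Pointwise (cCount _<T_ u v) (comps (sum γ)) cs ×
    FCoef Rt u v γ (sumℤ (zipWith (λ α c → ℤ.+ c ℤ.* Mser α γ) (comps (sum γ)) cs))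

  ClaimL : (W → W → Poly) → (W → W → Set) → W → W → Set
  ClaimL Rt _<T_ u v = ∀ γ → Σ (List ℕ) λ bs →
    Pointwise (bCount _<T_ u v) (comps (sum γ)) bs ×
    FCoef Rt u v γ (sumℤ (zipWith (λ α b → ℤ.+ b ℤ.* Lser α γ) (comps (sum γ)) bs))

  -- F̃(u,v) = a·1 + Σ c_i Θ_{w_i}, with every occurring degree i allowed
  -- (deg 1 = 0, deg Θ_w = deg w + 1)
  PeakRep : (ℕ → Set) → (W → W → Poly) → W → W → Set
  PeakRep Allowed Rt u v = Σ ℤ λ a → Σ (List (ℤ × List CD)) λ ts →
    (a ≡ 0ℤ ⊎ Allowed 0) ×
    All (λ t → Allowed (suc (degCD (proj₂ t)))) ts ×
    (∀ γ → FCoef Rt u v γ (a ℤ.* oneSer γ ℤ.+ sumℤ (map (λ t → proj₁ t ℤ.* Θ (proj₂ t) γ) ts)))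

  InPeak : (W → W → Poly) → W → W → Set
  InPeak = PeakRep (λ _ → ⊤)

  InPeakGraded : (W → W → Poly) → W → W → Set
  InPeakGraded Rt u v = PeakRep (λ i → Σ ℕ λ j → len v ∸ len u ≡ i + 2 * j) Rt u v

{-# OPTIONS --safe #-}
-- Dyer's theorem, that R̃_{u,v} enumerates the increasing Bruhat paths from u to v,
-- rests on one property of a reflection order: for reflections r ≠ t, r is an
-- inversion of t iff t lies between r and trt. This is a statement about the
-- dihedral group ⟨r,t⟩ and its canonical generators. Given s ∈ S, right
-- multiplication by s carries a path to a path with the same labels, and by the
-- property above the places where a step x → xs can be inserted into an increasing
-- path alternate in direction; this yields the recursion of the R̃-polynomials for
-- increasing paths, while the Hecke algebra yields it for R̃.
--
-- The coefficients of F̃ in the M-basis therefore count paths with prescribed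
-- ascents. As the reversed order is again a reflection order, increasing and
-- decreasing paths are equinumerous, so that Σ (−1)ʲ (increasing paths of length i
-- followed by increasing paths of length j) vanishes for i + j = k > 0: the
-- functional h_γ ↦ [M_γ] F̃ kills h(q) h(−q) − 1. For such a functional the
-- generating function of descent sets is a polynomial in c = a + b and
-- d = ab + ba with integral coefficients, and expanding a cd-word into ab-words
-- is the definition of Θ. Parity of lengths restricts the degrees.
module Submission where

open import Defs
open import Algebra.Bundles using (Group)
import Algebra.Properties.Group as GroupProperties
open import Data.Bool using (Bool; true; false; not; _xor_; _∧_; _∨_; if_then_else_)
open import Data.Bool.Properties using (xor-assoc; xor-comm; xor-same; xor-identityʳ; not-involutive; ¬-not; T-≡; ∧-identityʳ; ∧-comm; ∧-assoc; ∨-zeroʳ; ∨-identityʳ) renaming (_≟_ to _≟B_)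
open import Data.Empty using (⊥; ⊥-elim)
open import Data.Integer as ℤ using (ℤ; 0ℤ; 1ℤ; -1ℤ) renaming (_+_ to _+ᶻ_; _*_ to _*ᶻ_; _-_ to _-ᶻ_; -_ to -ᶻ_)
import Data.Integer.Properties as ℤP
import Data.Integer.Tactic.RingSolver as ℤSolver
open import Data.List using (List; []; _∷_; _++_; foldr; map; length; filter; deduplicate; concat; concatMap; zipWith; take; drop; upTo; applyUpTo; _∷ʳ_; initLast; _∷ʳ′_)
open import Data.List.Membership.Propositional using (_∈_; _∉_)
import Data.List.Membership.DecPropositional as DecMem
open import Data.List.Membership.Propositional.Properties using (∈-map⁻; ∈-map⁺; ∈-++⁻; ∈-++⁺ˡ; ∈-++⁺ʳ; ∈-filter⁺; ∈-filter⁻; ∈-deduplicate⁺)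
import Data.List.Properties as LP
open import Data.List.Properties using (≡-dec)
open import Data.List.Relation.Binary.Pointwise using (Pointwise; []; _∷_)
open import Data.List.Relation.Unary.All as All using (All; []; _∷_)
import Data.List.Relation.Unary.All.Properties as AllP
open import Data.List.Relation.Unary.AllPairs using ([]; _∷_)
open import Data.List.Relation.Unary.Any using (here; there)
open import Data.List.Relation.Unary.Unique.Propositional using (Unique)
import Data.List.Relation.Unary.Unique.Propositional.Properties as UniqueP
import Data.List.Relation.Unary.Unique.DecPropositional.Properties as UniqueDecP
open import Data.Maybe using (Maybe; just; nothing)
open import Data.Nat using (ℕ; zero; suc; _+_; _*_; _∸_; _≤_; _<_; z≤n; s≤s; _<ᵇ_; _≡ᵇ_)
open import Data.Nat.ListAction using (sum)
import Data.Nat.Properties as ℕP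
import Data.Nat.Tactic.RingSolver as ℕSolver
open import Data.Product using (Σ; _×_; _,_; proj₁; proj₂)
open import Data.Sum as Sum using (_⊎_; inj₁; inj₂)
open import Data.Unit using (⊤; tt)
open import Function using (_∘_; id; flip)
open import Function.Bundles using (Equivalence)
open import Level using (0ℓ)
open import Relation.Binary.Definitions using (DecidableEquality; tri<; tri≈; tri>)
open import Relation.Binary.PropositionalEquality
import Relation.Binary.Reasoning.Setoid as SetoidReasoning
open import Relation.Nullary using (¬_; Dec; yes; no; does)
open import Relation.Nullary.Decidable using (dec-true; dec-false; decidable-stable)

-- A solver for group identities

-- No root system is used. Inversions come from the universal property, applied to the group of
-- pairs (w , f) with f a Boolean function on `W`: the image of w carries its set of inversions, and
-- the deletion property follows. Three obstacles shape the rest. Membership in a dihedral subgroup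
-- is not decided, so canonical generators exist only up to double negation; the property of
-- reflection orders is therefore cast as an equation of Booleans, which is stable. Infinitely many
-- edges may leave an element, so paths are built from their last edge, the inversions of the
-- endpoint being finite in number, and finite Bruhat lower sets are read off from the data in
-- `IsRPolys`. Finally, half-integral powers of q and division by 2: the identity between R and R̃
-- is homogenised in t = q^{1/2} until no negative power remains, and the recursion for
-- cd-coefficients yields only 2g, whose half is integral because the ab-coefficients are.

module GroupSolver (C : CoxeterSystem) where
  open CoxeterSystem C renaming (_·_ to infixl 7 _·_; _⁻¹ to infix 8 _⁻¹; _≟W_ to infix 5 _≟W_)

  group : Group 0ℓ 0ℓ
  group = record { isGroup = isGroup }

  open Group group public using (assoc; identityˡ; identityʳ; inverseˡ; inverseʳ)
  open GroupProperties group public using (⁻¹-involutive; ⁻¹-anti-homo-∙; ε⁻¹≈ε; ∙-cancelˡ; ∙-cancelʳ)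

  infixl 7 _⊙_
  infix 8 _⁻

  -- var k is an arbitrary element, ivar k an element known to be an involution
  data Expr : Set where
    var ivar : ℕ → Expr
    ε   : Expr
    _⊙_ : Expr → Expr → Expr
    _⁻  : Expr → Expr

  data Letter : Set where
    gen⁺ gen⁻ gen° : ℕ → Letter

  opp : Letter → Letter
  opp (gen⁺ k) = gen⁻ k
  opp (gen⁻ k) = gen⁺ k
  opp (gen° k) = gen° k

  _≟L_ : (l m : Letter) → Dec (l ≡ m)
  gen⁺ k ≟L gen⁺ j with k ℕP.≟ j
  ... | yes refl = yes refl
  ... | no ne = no λ { refl → ne refl }
  gen⁻ k ≟L gen⁻ j with k ℕP.≟ j
  ... | yes refl = yes refl
  ... | no ne = no λ { refl → ne refl }
  gen° k ≟L gen° j with k ℕP.≟ j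
  ... | yes refl = yes refl
  ... | no ne = no λ { refl → ne refl }
  gen⁺ _ ≟L gen⁻ _ = no λ ()
  gen⁺ _ ≟L gen° _ = no λ ()
  gen⁻ _ ≟L gen⁺ _ = no λ ()
  gen⁻ _ ≟L gen° _ = no λ ()
  gen° _ ≟L gen⁺ _ = no λ ()
  gen° _ ≟L gen⁻ _ = no λ ()

  invert : List Letter → List Letter
  invert [] = []
  invert (l ∷ ls) = invert ls ++ (opp l ∷ [])

  letters : Expr → List Letter
  letters (var k) = gen⁺ k ∷ []
  letters (ivar k) = gen° k ∷ []
  letters ε = []
  letters (a ⊙ b) = letters a ++ letters b
  letters (a ⁻) = invert (letters a)

  -- Cancels `l` against the first letter of a reduced word; folding it over a word gives the normal
  -- form in a free product of copies of ℤ and ℤ/2.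
  cons : Letter → List Letter → List Letter
  cons l [] = l ∷ []
  cons l (m ∷ ms) = if does (m ≟L opp l) then ms else l ∷ m ∷ ms

  norm : Expr → List Letter
  norm a = foldr cons [] (letters a)

  Invol : Set
  Invol = Σ W λ x → x · x ≡ e

  module _ (ρ : List W) (ι : List Invol) where
    lookupV : List W → ℕ → W
    lookupV [] _ = e
    lookupV (x ∷ _) zero = x
    lookupV (_ ∷ xs) (suc k) = lookupV xs k

    lookupI : List Invol → ℕ → Invol
    lookupI [] _ = e , identityˡ e
    lookupI (x ∷ _) zero = x
    lookupI (_ ∷ xs) (suc k) = lookupI xs k

    ⟦_⟧ : Expr → W
    ⟦ var k ⟧ = lookupV ρ k
    ⟦ ivar k ⟧ = proj₁ (lookupI ι k)
    ⟦ ε ⟧ = e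
    ⟦ a ⊙ b ⟧ = ⟦ a ⟧ · ⟦ b ⟧
    ⟦ a ⁻ ⟧ = ⟦ a ⟧ ⁻¹

    ⟦_⟧L : Letter → W
    ⟦ gen⁺ k ⟧L = lookupV ρ k
    ⟦ gen⁻ k ⟧L = lookupV ρ k ⁻¹
    ⟦ gen° k ⟧L = proj₁ (lookupI ι k)

    ⟦_⟧Ls : List Letter → W
    ⟦ [] ⟧Ls = e
    ⟦ l ∷ ls ⟧Ls = ⟦ l ⟧L · ⟦ ls ⟧Ls

    opp-inverse : ∀ l → ⟦ l ⟧L · ⟦ opp l ⟧L ≡ e
    opp-inverse (gen⁺ k) = inverseʳ _
    opp-inverse (gen⁻ k) = inverseˡ _
    opp-inverse (gen° k) = proj₂ (lookupI ι k)

    opp-sound : ∀ l → ⟦ opp l ⟧L ≡ ⟦ l ⟧L ⁻¹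
    opp-sound l = ∙-cancelˡ ⟦ l ⟧L _ _ (trans (opp-inverse l) (sym (inverseʳ _)))

    ++-sound : ∀ ls ms → ⟦ ls ++ ms ⟧Ls ≡ ⟦ ls ⟧Ls · ⟦ ms ⟧Ls
    ++-sound [] ms = sym (identityˡ _)
    ++-sound (l ∷ ls) ms = trans (cong (⟦ l ⟧L ·_) (++-sound ls ms)) (sym (assoc _ _ _))

    invert-sound : ∀ ls → ⟦ invert ls ⟧Ls ≡ ⟦ ls ⟧Ls ⁻¹
    invert-sound [] = sym ε⁻¹≈ε
    invert-sound (l ∷ ls) = begin
      ⟦ invert ls ++ opp l ∷ [] ⟧Ls      ≡⟨ ++-sound (invert ls) _ ⟩
      ⟦ invert ls ⟧Ls · (⟦ opp l ⟧L · e) ≡⟨ cong₂ _·_ (invert-sound ls) (trans (identityʳ _) (opp-sound l)) ⟩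
      ⟦ ls ⟧Ls ⁻¹ · ⟦ l ⟧L ⁻¹            ≡⟨ ⁻¹-anti-homo-∙ _ _ ⟨
      (⟦ l ⟧L · ⟦ ls ⟧Ls) ⁻¹             ∎
      where open ≡-Reasoning

    letters-sound : ∀ a → ⟦ letters a ⟧Ls ≡ ⟦ a ⟧
    letters-sound (var k) = identityʳ _
    letters-sound (ivar k) = identityʳ _
    letters-sound ε = refl
    letters-sound (a ⊙ b) = trans (++-sound (letters a) _) (cong₂ _·_ (letters-sound a) (letters-sound b))
    letters-sound (a ⁻) = trans (invert-sound (letters a)) (cong _⁻¹ (letters-sound a))

    cons-sound : ∀ l ls → ⟦ cons l ls ⟧Ls ≡ ⟦ l ⟧L · ⟦ ls ⟧Ls
    cons-sound l [] = refl
    cons-sound l (m ∷ ms) with m ≟L opp l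
    ... | no _ = refl
    ... | yes refl = begin
      ⟦ ms ⟧Ls                         ≡⟨ identityˡ _ ⟨
      e · ⟦ ms ⟧Ls                     ≡⟨ cong (_· ⟦ ms ⟧Ls) (opp-inverse l) ⟨
      (⟦ l ⟧L · ⟦ opp l ⟧L) · ⟦ ms ⟧Ls ≡⟨ assoc _ _ _ ⟩
      ⟦ l ⟧L · (⟦ opp l ⟧L · ⟦ ms ⟧Ls) ∎
      where open ≡-Reasoning

    foldr-cons-sound : ∀ ls → ⟦ foldr cons [] ls ⟧Ls ≡ ⟦ ls ⟧Ls
    foldr-cons-sound [] = refl
    foldr-cons-sound (l ∷ ls) = trans (cons-sound l (foldr cons [] ls)) (cong (⟦ l ⟧L ·_) (foldr-cons-sound ls))

    -- Proof by reflection: `norm` evaluates on closed expressions, so the callers supply `refl`.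
    grp : ∀ a b → norm a ≡ norm b → ⟦ a ⟧ ≡ ⟦ b ⟧
    grp a b eq = begin
      ⟦ a ⟧           ≡⟨ letters-sound a ⟨
      ⟦ letters a ⟧Ls ≡⟨ foldr-cons-sound (letters a) ⟨
      ⟦ norm a ⟧Ls    ≡⟨ cong ⟦_⟧Ls eq ⟩
      ⟦ norm b ⟧Ls    ≡⟨ foldr-cons-sound (letters b) ⟩
      ⟦ letters b ⟧Ls ≡⟨ letters-sound b ⟩
      ⟦ b ⟧           ∎
      where open ≡-Reasoning

-- Inversion sets from the universal property

xor-cancelˡ : ∀ a b → a xor (a xor b) ≡ b
xor-cancelˡ false b = refl
xor-cancelˡ true false = refl
xor-cancelˡ true true = refl

xorSum : ℕ → (ℕ → Bool) → Bool
xorSum zero f = false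
xorSum (suc n) f = f 0 xor xorSum n (f ∘ suc)

xorSum-cong : ∀ n {f g : ℕ → Bool} → (∀ k → f k ≡ g k) → xorSum n f ≡ xorSum n g
xorSum-cong zero eq = refl
xorSum-cong (suc n) eq = cong₂ _xor_ (eq 0) (xorSum-cong n (eq ∘ suc))

xorSum-+ : ∀ m n f → xorSum (m + n) f ≡ xorSum m f xor xorSum n (λ k → f (m + k))
xorSum-+ zero n f = refl
xorSum-+ (suc m) n f = trans (cong (f 0 xor_) (xorSum-+ m n (f ∘ suc))) (sym (xor-assoc (f 0) _ _))

-- N w is the indicator function of the set of left inversions of w.
module Cocycle (C : CoxeterSystem) where
  open CoxeterSystem C renaming (_·_ to infixl 7 _·_; _⁻¹ to infix 8 _⁻¹; _≟W_ to infix 5 _≟W_)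
  open GroupSolver C public

  infix 6 _==_

  _==_ : W → W → Bool
  x == y = does (x ≟W y)

  ==-refl : ∀ x → (x == x) ≡ true
  ==-refl x = dec-true (x ≟W x) refl

  ==-true : ∀ {x y} → (x == y) ≡ true → x ≡ y
  ==-true {x} {y} eq with x ≟W y
  ... | yes p = p

  ==-⇔ : ∀ {x y x′ y′} → (x ≡ y → x′ ≡ y′) → (x′ ≡ y′ → x ≡ y) → (x == y) ≡ (x′ == y′)
  ==-⇔ {x} {y} {x′} {y′} f g with x ≟W y
  ... | yes p = sym (dec-true (x′ ≟W y′) (f p))
  ... | no np = sym (dec-false (x′ ≟W y′) (np ∘ g))

  conj-≡ : ∀ {x y z} → x ⁻¹ · y · x ≡ z → y ≡ x · z · x ⁻¹
  conj-≡ {x} {y} refl = grp (x ∷ y ∷ []) [] (var 1) (var 0 ⊙ (var 0 ⁻ ⊙ var 1 ⊙ var 0) ⊙ var 0 ⁻) refl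

  conj-≡⁻ : ∀ {x y z} → y ≡ x · z · x ⁻¹ → x ⁻¹ · y · x ≡ z
  conj-≡⁻ {x} {y} {z} refl = grp (x ∷ z ∷ []) [] (var 0 ⁻ ⊙ (var 0 ⊙ var 1 ⊙ var 0 ⁻) ⊙ var 0) (var 1) refl

  -- A section w ↦ (w , N w) of the projection to `W` amounts to a cocycle: N (xy) is the sum modulo
  -- 2 of N x and the conjugate of N y by x. The functions live on all of `W` and not just on the
  -- reflections, because being a reflection is decided only later, by means of `N`.
  Semidirect : Group 0ℓ 0ℓ
  Semidirect = record
    { Carrier = W × (W → Bool)
    ; _≈_ = λ p q → proj₁ p ≡ proj₁ q × (∀ t → proj₂ p t ≡ proj₂ q t)
    ; _∙_ = λ p q → proj₁ p · proj₁ q , λ t → proj₂ p t xor proj₂ q (proj₁ p ⁻¹ · t · proj₁ p)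
    ; ε = e , λ _ → false
    ; _⁻¹ = λ p → proj₁ p ⁻¹ , λ t → proj₂ p (proj₁ p · t · proj₁ p ⁻¹)
    ; isGroup = record
      { isMonoid = record
        { isSemigroup = record
          { isMagma = record
            { isEquivalence = record
              { refl = refl , λ _ → refl
              ; sym = λ { (p , q) → sym p , λ t → sym (q t) }
              ; trans = λ { (p , q) (p′ , q′) → trans p p′ , λ t → trans (q t) (q′ t) }
              }
            ; ∙-cong = λ { {_ , f} {_ , g} {_ , f′} {_ , g′} (refl , q) (refl , q′) →
                refl , λ t → cong₂ _xor_ (q t) (q′ _) }
            }
          ; assoc = λ { (x , f) (y , g) (z , h) → assoc x y z , λ t →
              trans (xor-assoc (f t) _ _) (cong (λ w → f t xor (g (x ⁻¹ · t · x) xor h w))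
                (grp (x ∷ y ∷ t ∷ []) []
                  ((var 0 ⊙ var 1) ⁻ ⊙ var 2 ⊙ (var 0 ⊙ var 1))
                  (var 1 ⁻ ⊙ (var 0 ⁻ ⊙ var 2 ⊙ var 0) ⊙ var 1) refl)) }
          }
        ; identity =
            (λ { (x , f) → identityˡ x , λ t → cong f (grp (t ∷ []) [] (ε ⁻ ⊙ var 0 ⊙ ε) (var 0) refl) }) ,
            (λ { (x , f) → identityʳ x , λ t → xor-identityʳ (f t) })
        }
      ; inverse =
          (λ { (x , f) → inverseˡ x , λ t → trans (cong (λ w → f (x · t · x ⁻¹) xor f w)
                (grp (x ∷ t ∷ []) [] (var 0 ⁻ ⁻ ⊙ var 1 ⊙ var 0 ⁻) (var 0 ⊙ var 1 ⊙ var 0 ⁻) refl))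
              (xor-same (f (x · t · x ⁻¹))) }) ,
          (λ { (x , f) → inverseʳ x , λ t → trans (cong (λ w → f t xor f w)
                (grp (x ∷ t ∷ []) [] (var 0 ⊙ (var 0 ⁻ ⊙ var 1 ⊙ var 0) ⊙ var 0 ⁻) (var 1) refl))
              (xor-same (f t)) })
      ; ⁻¹-cong = λ { {_ , f} (refl , q) → refl , λ t → q _ }
      }
    }

  open Group Semidirect using () renaming (_∙_ to _⋉_; ε to 1⋉; _≈_ to _≈⋉_; Carrier to Carrier⋉)

  pw : W → ℕ → W
  pw = powOp _·_ e

  pw-+ : ∀ x m n → pw x (m + n) ≡ pw x m · pw x n
  pw-+ x zero n = sym (identityˡ _)
  pw-+ x (suc m) n = trans (cong (x ·_) (pw-+ x m n)) (sym (assoc _ _ _))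

  pw-comm : ∀ x n → pw x n · x ≡ x · pw x n
  pw-comm x zero = trans (identityˡ x) (sym (identityʳ x))
  pw-comm x (suc n) = trans (assoc _ _ _) (cong (x ·_) (pw-comm x n))

  gen : W → Carrier⋉
  gen s = s , λ t → t == s

  module _ (s t : W) (s²≡e : s · s ≡ e) (t²≡e : t · t ≡ e) where
    private
      p : ℕ → W
      p k = pw (s · t) k · s

      p-conj : ∀ k → (s · t) · p k · (s · t) ⁻¹ ≡ p (2 + k)
      p-conj k = begin
        (s · t) · (r · s) · (s · t) ⁻¹   ≡⟨ grp (r ∷ []) ι ((ivar 0 ⊙ ivar 1) ⊙ (var 0 ⊙ ivar 0) ⊙ (ivar 0 ⊙ ivar 1) ⁻)
                                              ((ivar 0 ⊙ ivar 1) ⊙ (var 0 ⊙ (ivar 0 ⊙ ivar 1)) ⊙ ivar 0) refl ⟩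
        (s · t) · (r · (s · t)) · s      ≡⟨ cong (λ z → (s · t) · z · s) (pw-comm (s · t) k) ⟩
        (s · t) · ((s · t) · r) · s      ∎
        where
        open ≡-Reasoning
        r = pw (s · t) k
        ι = (s , s²≡e) ∷ (t , t²≡e) ∷ []

    -- Each factor `gen s ⋉ gen t` contributes s = `p 0` and sts⁻¹ = `p 1`, and conjugation by st
    -- moves the sequence `p` on by two places.
    pow⋉ : ∀ n → powOp _⋉_ 1⋉ (gen s ⋉ gen t) n ≈⋉ (pw (s · t) n , λ u → xorSum (n + n) (λ k → u == p k))
    pow⋉ zero = refl , λ _ → refl
    pow⋉ (suc n) with pow⋉ n
    ... | eq₁ , eq₂ = cong ((s · t) ·_) eq₁ , λ u →
      trans (xor-assoc (u == s) (s ⁻¹ · u · s == t) _)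
        (trans (cong₂ _xor_ (==-⇔ (λ eq → trans eq (sym (identityˡ s))) (λ eq → trans eq (identityˡ s)))
                 (cong₂ _xor_
                   (==-⇔ (λ eq → trans (conj-≡ eq) st) (λ eq → conj-≡⁻ (trans eq (sym st))))
                   (trans (eq₂ _) (xorSum-cong (n + n) λ k →
                     ==-⇔ (λ eq → trans (conj-≡ eq) (p-conj k)) (λ eq → conj-≡⁻ (trans eq (sym (p-conj k))))))))
               (cong (λ m → xorSum (suc m) (λ k → u == p k)) (sym (ℕP.+-suc n n))))
      where
      st : s · t · s ⁻¹ ≡ (s · t) · e · s
      st = grp [] ((s , s²≡e) ∷ (t , t²≡e) ∷ []) (ivar 0 ⊙ ivar 1 ⊙ ivar 0 ⁻) ((ivar 0 ⊙ ivar 1) ⊙ ε ⊙ ivar 0) refl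

    -- if (st)ⁿ = e, then the sequence (st)ᵏs has period n, so every
    -- reflection occurs an even number of times among its first 2n terms
    relation⋉ : ∀ n → pw (s · t) n ≡ e → powOp _⋉_ 1⋉ (gen s ⋉ gen t) n ≈⋉ 1⋉
    relation⋉ n stⁿ = trans (proj₁ (pow⋉ n)) stⁿ , λ u →
      trans (proj₂ (pow⋉ n) u) (trans (xorSum-+ n n _)
        (trans (cong (xorSum n (λ k → u == p k) xor_) (xorSum-cong n λ k → cong (u ==_) (periodic k)))
          (xor-same (xorSum n (λ k → u == p k)))))
      where
      periodic : ∀ k → p (n + k) ≡ p k
      periodic k = cong (_· s) (trans (pw-+ (s · t) n k) (trans (cong (_· pw (s · t) k) stⁿ) (identityˡ _)))

  private
    hom : Σ (W → Carrier⋉) λ φ → (∀ x y → φ (x · y) ≈⋉ (φ x ⋉ φ y)) × (∀ s → S s → φ s ≈⋉ gen s)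
    hom = universal Semidirect gen λ s t n Ss St → relation⋉ s t (invol s Ss) (invol t St) n

    φ : W → Carrier⋉
    φ = proj₁ hom

    φ₁-e : proj₁ (φ e) ≡ e
    φ₁-e = ∙-cancelˡ (proj₁ (φ e)) _ _ (trans (sym (proj₁ (proj₁ (proj₂ hom) e e)))
             (trans (cong (proj₁ ∘ φ) (identityˡ e)) (sym (identityʳ _))))

    φ₁-prod : ∀ ws → All S ws → proj₁ (φ (prodOp _·_ e ws)) ≡ prodOp _·_ e ws
    φ₁-prod [] [] = φ₁-e
    φ₁-prod (s ∷ ws) (Ss ∷ Sws) = trans (proj₁ (proj₁ (proj₂ hom) s _))
      (cong₂ _·_ (proj₁ (proj₂ (proj₂ hom) s Ss)) (φ₁-prod ws Sws))

    -- The first component of `φ` is an endomorphism fixing the generators; hence `φ` is a section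
    -- and its second component a cocycle.
    φ₁-id : ∀ w → proj₁ (φ w) ≡ w
    φ₁-id w with generates w
    ... | ws , Sws , refl = φ₁-prod ws Sws

  N : W → W → Bool
  N w = proj₂ (φ w)

  N-· : ∀ x y t → N (x · y) t ≡ N x t xor N y (x ⁻¹ · t · x)
  N-· x y t = trans (proj₂ (proj₁ (proj₂ hom) x y) t) (cong (λ z → N x t xor N y (z ⁻¹ · t · z)) (φ₁-id x))

  N-gen : ∀ {s} → S s → ∀ t → N s t ≡ (t == s)
  N-gen {s} Ss t = proj₂ (proj₂ (proj₂ hom) s Ss) t

  N-e : ∀ t → N e t ≡ false
  N-e t = begin
    N e t                    ≡⟨ xor-cancelˡ (N e t) (N e t) ⟨
    N e t xor (N e t xor N e t) ≡⟨ cong (λ b → N e t xor b) eq ⟩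
    N e t xor N e t          ≡⟨ xor-same (N e t) ⟩
    false ∎
    where
    open ≡-Reasoning
    eq : N e t xor N e t ≡ N e t
    eq = trans (cong (λ z → N e t xor N e z) (sym (grp (t ∷ []) [] (ε ⁻ ⊙ var 0 ⊙ ε) (var 0) refl)))
           (trans (sym (N-· e e t)) (cong (λ z → N z t) (identityˡ e)))

  N-⁻¹ : ∀ w t → N (w ⁻¹) (w ⁻¹ · t · w) ≡ N w t
  N-⁻¹ w t = begin
    N (w ⁻¹) (w ⁻¹ · t · w)                   ≡⟨ xor-cancelˡ (N w t) _ ⟨
    N w t xor (N w t xor N (w ⁻¹) (w ⁻¹ · t · w)) ≡⟨ cong (N w t xor_) (trans (sym (N-· w (w ⁻¹) t))
                                                     (trans (cong (λ z → N z t) (inverseʳ w)) (N-e t))) ⟩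
    N w t xor false                            ≡⟨ xor-identityʳ _ ⟩
    N w t                                      ∎
    where open ≡-Reasoning

  parityGroup : Group 0ℓ 0ℓ
  parityGroup = record
    { Carrier = Bool ; _≈_ = _≡_ ; _∙_ = _xor_ ; ε = false ; _⁻¹ = id
    ; isGroup = record
      { isMonoid = record
        { isSemigroup = record
          { isMagma = record { isEquivalence = isEquivalence ; ∙-cong = cong₂ _xor_ }
          ; assoc = xor-assoc }
        ; identity = (λ _ → refl) , xor-identityʳ }
      ; inverse = xor-same , xor-same
      ; ⁻¹-cong = id } }

  private
    -- The sign character exists because every relator (st)ⁿ has even length.
    parityHom : Σ (W → Bool) λ ψ → (∀ x y → ψ (x · y) ≡ ψ x xor ψ y) × (∀ s → S s → ψ s ≡ true)
    parityHom = universal parityGroup (λ _ → true) λ s t n _ _ _ → pow-false n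
      where
      pow-false : ∀ n → powOp _xor_ false false n ≡ false
      pow-false zero = refl
      pow-false (suc n) = pow-false n

  par : W → Bool
  par = proj₁ parityHom

  par-· : ∀ x y → par (x · y) ≡ par x xor par y
  par-· = proj₁ (proj₂ parityHom)

  par-gen : ∀ {s} → S s → par s ≡ true
  par-gen = proj₂ (proj₂ parityHom) _

  par-e : par e ≡ false
  par-e = trans (sym (xor-cancelˡ (par e) (par e)))
            (trans (cong (par e xor_) (trans (sym (par-· e e)) (cong par (identityˡ e)))) (xor-same (par e)))

  par-⁻¹ : ∀ w → par (w ⁻¹) ≡ par w
  par-⁻¹ w = trans (sym (xor-cancelˡ (par w) _)) (trans (cong (par w xor_)
    (trans (sym (par-· w (w ⁻¹))) (trans (cong par (inverseʳ w)) par-e))) (xor-identityʳ _))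

-- Inversions and length

true≢false : true ≢ false
true≢false ()

odd : ℕ → Bool
odd zero = false
odd (suc n) = not (odd n)

not-xor : ∀ a b → not a xor b ≡ not (a xor b)
not-xor false b = refl
not-xor true false = refl
not-xor true true = refl

module Inversions (C : CoxeterSystem) (len : CoxeterSystem.W C → ℕ) (isLen : CoxDefs.IsLength C len) where
  open CoxeterSystem C renaming (_·_ to infixl 7 _·_; _⁻¹ to infix 8 _⁻¹; _≟W_ to infix 5 _≟W_) public
  open CoxDefs C len public
  open Cocycle C public

  invol⁻¹ : ∀ {x} → x · x ≡ e → x ⁻¹ ≡ x
  invol⁻¹ {x} xx = grp [] ((x , xx) ∷ []) (ivar 0 ⁻) (ivar 0) refl

  S⇒refl : ∀ {s} → S s → IsRefl s
  S⇒refl {s} Ss = e , s , Ss , grp (s ∷ []) [] (var 0) (ε ⊙ var 0 ⊙ ε ⁻) refl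

  refl-invol : ∀ {t} → IsRefl t → t · t ≡ e
  refl-invol (w , s , Ss , refl) = grp (w ∷ []) ((s , invol s Ss) ∷ [])
    (var 0 ⊙ ivar 0 ⊙ var 0 ⁻ ⊙ (var 0 ⊙ ivar 0 ⊙ var 0 ⁻)) ε refl

  refl-conj : ∀ x {t} → IsRefl t → IsRefl (x · t · x ⁻¹)
  refl-conj x (w , s , Ss , refl) = x · w , s , Ss , grp (x ∷ w ∷ s ∷ []) []
    (var 0 ⊙ (var 1 ⊙ var 2 ⊙ var 1 ⁻) ⊙ var 0 ⁻) ((var 0 ⊙ var 1) ⊙ var 2 ⊙ (var 0 ⊙ var 1) ⁻) refl

  refl-conj-refl : ∀ {x t} → IsRefl x → IsRefl t → IsRefl (x · t · x)
  refl-conj-refl {x} {t} Rx Rt = subst (λ z → IsRefl (x · t · z)) (invol⁻¹ (refl-invol Rx)) (refl-conj x Rt)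

  par-refl : ∀ {t} → IsRefl t → par t ≡ true
  par-refl (w , s , Ss , refl) = begin
    par (w · s · w ⁻¹)             ≡⟨ par-· _ _ ⟩
    par (w · s) xor par (w ⁻¹)     ≡⟨ cong₂ _xor_ (par-· w s) (par-⁻¹ w) ⟩
    (par w xor par s) xor par w    ≡⟨ cong (λ b → (par w xor b) xor par w) (par-gen Ss) ⟩
    (par w xor true) xor par w     ≡⟨ lemma (par w) ⟩
    true ∎
    where
    open ≡-Reasoning
    lemma : ∀ b → (b xor true) xor b ≡ true
    lemma true = refl
    lemma false = refl

  -- For a word s₁s₂⋯ these are the conjugates of sᵢ by the prefixes s₁⋯sᵢ₋₁; left multiplication by
  -- the i-th one deletes the letter sᵢ.
  refls : List W → List W
  refls [] = []
  refls (s ∷ ws) = s ∷ map (λ r → s · r · s ⁻¹) (refls ws)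

  N-prod : ∀ {ws} → All S ws → ∀ {t} → N (prod ws) t ≡ true → t ∈ refls ws
  N-prod [] {t} eq = ⊥-elim (true≢false (trans (sym eq) (N-e t)))
  N-prod {s ∷ ws} (Ss ∷ Sws) {t} eq with t ≟W s
  ... | yes p = here p
  ... | no np = there (subst (_∈ map _ (refls ws)) (sym (conj-≡ refl)) (∈-map⁺ _ (N-prod Sws eq′)))
    where
    eq′ : N (prod ws) (s ⁻¹ · t · s) ≡ true
    eq′ = begin
      N (prod ws) (s ⁻¹ · t · s)           ≡⟨ cong (_xor N (prod ws) (s ⁻¹ · t · s)) (trans (N-gen Ss t) (dec-false (t ≟W s) np)) ⟨
      N s t xor N (prod ws) (s ⁻¹ · t · s) ≡⟨ N-· s (prod ws) t ⟨
      N (s · prod ws) t                    ≡⟨ eq ⟩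
      true ∎
      where open ≡-Reasoning

  len-prod : ∀ {ws} → All S ws → len (prod ws) ≤ length ws
  len-prod {ws} Sws = proj₂ (isLen (prod ws)) ws Sws refl

  word : W → List W
  word w = proj₁ (proj₁ (isLen w))

  word-S : ∀ w → All S (word w)
  word-S w = proj₁ (proj₂ (proj₁ (isLen w)))

  word-prod : ∀ w → prod (word w) ≡ w
  word-prod w = proj₁ (proj₂ (proj₂ (proj₁ (isLen w))))

  word-length : ∀ w → length (word w) ≡ len w
  word-length w = proj₂ (proj₂ (proj₂ (proj₁ (isLen w))))

  deletion : ∀ {ws t} → All S ws → t ∈ refls ws →
    Σ (List W) λ ws′ → All S ws′ × prod ws′ ≡ t · prod ws × length ws ≡ suc (length ws′)
  deletion {s ∷ ws} (Ss ∷ Sws) (here refl) =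
    ws , Sws , grp (prod ws ∷ []) ((s , invol s Ss) ∷ []) (var 0) (ivar 0 ⊙ (ivar 0 ⊙ var 0)) refl , refl
  deletion {s ∷ ws} (Ss ∷ Sws) (there t∈) with ∈-map⁻ _ t∈
  ... | r , r∈ , refl with deletion Sws r∈
  ... | ws′ , Sws′ , eq , l = s ∷ ws′ , Ss ∷ Sws′ ,
    trans (cong (s ·_) eq) (grp (s ∷ r ∷ prod ws ∷ []) []
      (var 0 ⊙ (var 1 ⊙ var 2)) (var 0 ⊙ var 1 ⊙ var 0 ⁻ ⊙ (var 0 ⊙ var 2)) refl) ,
    cong suc l

  -- The prefix s₁⋯sᵢ₋₁ serves as conjugator. That it is shorter than the word drives the induction
  -- that finds canonical generators.
  refls-presentation : ∀ {ws t} → All S ws → t ∈ refls ws →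
    Σ W λ w → Σ W λ s → S s × t ≡ w · s · w ⁻¹ × len w < length ws
  refls-presentation {s ∷ ws} (Ss ∷ Sws) (here refl) =
    e , s , Ss , grp (s ∷ []) [] (var 0) (ε ⊙ var 0 ⊙ ε ⁻) refl , s≤s (ℕP.≤-trans (len-prod []) z≤n)
  refls-presentation {s ∷ ws} (Ss ∷ Sws) (there t∈) with ∈-map⁻ _ t∈
  ... | r , r∈ , refl with refls-presentation Sws r∈
  ... | w , s′ , Ss′ , refl , l = s · w , s′ , Ss′ ,
    grp (s ∷ w ∷ s′ ∷ []) [] (var 0 ⊙ (var 1 ⊙ var 2 ⊙ var 1 ⁻) ⊙ var 0 ⁻) ((var 0 ⊙ var 1) ⊙ var 2 ⊙ (var 0 ⊙ var 1) ⁻) refl ,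
    s≤s (ℕP.≤-trans (subst (λ z → len (s · z) ≤ suc (length (word w))) (word-prod w) (len-prod (Ss ∷ word-S w)))
           (subst (λ n → suc n ≤ length ws) (sym (word-length w)) l))

  N-word : ∀ {w t} → N w t ≡ true → t ∈ refls (word w)
  N-word {w} {t} eq = N-prod (word-S w) (trans (cong (λ z → N z t) (word-prod w)) eq)

  N⇒presentation : ∀ {w t} → N w t ≡ true →
    Σ W λ x → Σ W λ s → S s × t ≡ x · s · x ⁻¹ × len x < len w
  N⇒presentation {w} eq with refls-presentation (word-S w) (N-word eq)
  ... | x , s , Ss , p , l = x , s , Ss , p , subst (len x <_) (word-length w) l

  N⇒refl : ∀ {w t} → N w t ≡ true → IsRefl t
  N⇒refl eq with N⇒presentation eq
  ... | x , s , Ss , p , _ = x , s , Ss , p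

  N⇒< : ∀ {w t} → N w t ≡ true → len (t · w) < len w
  N⇒< {w} {t} eq with deletion (word-S w) (N-word eq)
  ... | ws′ , Sws′ , p , l = subst₂ _<_ (cong len (trans p′ refl)) (word-length w)
          (subst (suc (len (prod ws′)) ≤_) (sym l) (s≤s (len-prod Sws′)))
    where
    p′ : prod ws′ ≡ t · w
    p′ = trans p (cong (t ·_) (word-prod w))

  -- The cocycle rule for three factors; `N-⁻¹` turns the contribution of w⁻¹ into one of w, taken
  -- at the conjugate of t by wsw⁻¹.
  N-conj-gen : ∀ w {s} → S s → ∀ t →
    N (w · s · w ⁻¹) t ≡ (N w t xor (t == w · s · w ⁻¹)) xor N w (w · s · w ⁻¹ · t · (w · s · w ⁻¹))
  N-conj-gen w {s} Ss t = begin
    N (w · s · w ⁻¹) t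
      ≡⟨ N-· _ _ _ ⟩
    N (w · s) t xor N (w ⁻¹) ((w · s) ⁻¹ · t · (w · s))
      ≡⟨ cong₂ _xor_ (trans (N-· w s t) (cong (N w t xor_)
           (trans (N-gen Ss _) (==-⇔ conj-≡ conj-≡⁻))))
           (trans (cong (N (w ⁻¹)) (grp (w ∷ t ∷ []) ((s , invol s Ss) ∷ [])
             ((var 0 ⊙ ivar 0) ⁻ ⊙ var 1 ⊙ (var 0 ⊙ ivar 0))
             (var 0 ⁻ ⊙ (var 0 ⊙ ivar 0 ⊙ var 0 ⁻ ⊙ var 1 ⊙ (var 0 ⊙ ivar 0 ⊙ var 0 ⁻)) ⊙ var 0) refl))
             (N-⁻¹ w _)) ⟩
    (N w t xor (t == w · s · w ⁻¹)) xor N w (w · s · w ⁻¹ · t · (w · s · w ⁻¹)) ∎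
    where open ≡-Reasoning

  invol-conj-self : ∀ {t} → t · t ≡ e → t · t · t ≡ t
  invol-conj-self {t} t²≡e = grp [] ((t , t²≡e) ∷ []) (ivar 0 ⊙ ivar 0 ⊙ ivar 0) (ivar 0) refl

  -- At t itself the two contributions of w in `N-conj-gen` are equal and cancel, which leaves the
  -- middle term.
  N-self : ∀ {t} → IsRefl t → N t t ≡ true
  N-self Rt@(w , s , Ss , refl) = begin
    N t t                                        ≡⟨ N-conj-gen w Ss t ⟩
    (N w t xor (t == t)) xor N w (t · t · t)     ≡⟨ cong₂ (λ b z → (N w t xor b) xor N w z) (==-refl t) (invol-conj-self (refl-invol Rt)) ⟩
    (N w t xor true) xor N w t                   ≡⟨ lemma (N w t) ⟩
    true ∎
    where
    open ≡-Reasoning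
    t = w · s · w ⁻¹
    lemma : ∀ b → (b xor true) xor b ≡ true
    lemma true = refl
    lemma false = refl

  N-refl· : ∀ {t} → IsRefl t → ∀ w x → N (t · w) x ≡ N t x xor N w (t · x · t)
  N-refl· {t} Rt w x = trans (N-· t w x) (cong (λ z → N t x xor N w (z · x · t)) (invol⁻¹ (refl-invol Rt)))

  N-refl·-self : ∀ {t} → IsRefl t → ∀ w → N (t · w) t ≡ not (N w t)
  N-refl·-self {t} Rt w = trans (N-refl· Rt w t) (cong₂ _xor_ (N-self Rt) (cong (N w) (invol-conj-self (refl-invol Rt))))

  refl·refl· : ∀ {t} → IsRefl t → ∀ w → t · (t · w) ≡ w
  refl·refl· {t} Rt w = grp (w ∷ []) ((t , refl-invol Rt) ∷ []) (ivar 0 ⊙ (ivar 0 ⊙ var 0)) (var 0) refl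

  -- Left multiplication by t toggles t as an inversion, so `N⇒<` applies to tw.
  ¬N⇒> : ∀ {w t} → IsRefl t → N w t ≡ false → len w < len (t · w)
  ¬N⇒> {w} {t} Rt eq = subst (λ z → len z < len (t · w)) (refl·refl· Rt w)
    (N⇒< (trans (N-refl·-self Rt w) (cong not eq)))

  <⇒N : ∀ {w t} → IsRefl t → len (t · w) < len w → N w t ≡ true
  <⇒N {w} {t} Rt l with N w t in eq
  ... | true = refl
  ... | false = ⊥-elim (ℕP.<-asym l (¬N⇒> Rt eq))

  -- `N` vanishes off the reflections and is true on the diagonal at each of them.
  refl? : ∀ t → Dec (IsRefl t)
  refl? t with N t t in eq
  ... | true = yes (N⇒refl eq)
  ... | false = no λ Rt → true≢false (trans (sym (N-self Rt)) eq)

  Inv : W → List W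
  Inv w = filter (λ t → N w t ≟B true) (deduplicate _≟W_ (refls (word w)))

  Inv-unique : ∀ w → Unique (Inv w)
  Inv-unique w = UniqueP.filter⁺ (λ t → N w t ≟B true) (UniqueDecP.deduplicate-! _≟W_ (refls (word w)))

  Inv⇒N : ∀ {w t} → t ∈ Inv w → N w t ≡ true
  Inv⇒N {w} t∈ = proj₂ (∈-filter⁻ (λ t → N w t ≟B true) {xs = deduplicate _≟W_ (refls (word w))} t∈)

  N⇒Inv : ∀ {w t} → N w t ≡ true → t ∈ Inv w
  N⇒Inv {w} eq = ∈-filter⁺ (λ t → N w t ≟B true) (∈-deduplicate⁺ _≟W_ (N-word eq)) eq

  par-len : ∀ w → par w ≡ odd (len w)
  par-len w = trans (cong par (sym (word-prod w))) (trans (par-prod (word-S w)) (cong odd (word-length w)))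
    where
    par-prod : ∀ {ws} → All S ws → par (prod ws) ≡ odd (length ws)
    par-prod [] = par-e
    par-prod (Ss ∷ Sws) = trans (par-· _ _) (cong₂ _xor_ (par-gen Ss) (par-prod Sws))

  -- The reflection that realises right multiplication by s as a left multiplication. Right descents
  -- thereby become left inversions: s is a descent of w iff `N w (right w s)`.
  right : W → W → W
  right w s = w · s · w ⁻¹

  right-refl : ∀ w {s} → S s → IsRefl (right w s)
  right-refl w Ss = w , _ , Ss , refl

  right-· : ∀ w s → right w s · w ≡ w · s
  right-· w s = grp (w ∷ s ∷ []) [] (var 0 ⊙ var 1 ⊙ var 0 ⁻ ⊙ var 0) (var 0 ⊙ var 1) refl

  N-·gen : ∀ w {s} → S s → ∀ t → N (w · s) t ≡ N w t xor (t == right w s)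
  N-·gen w Ss t = trans (N-· w _ t) (cong (N w t xor_) (trans (N-gen Ss _) (==-⇔ conj-≡ conj-≡⁻)))

  ·gen-≤ : ∀ w {s} → S s → len (w · s) ≤ suc (len w)
  ·gen-≤ w {s} Ss = subst₂ (λ z n → len z ≤ n) eq₁ eq₂ (len-prod (AllP.++⁺ (word-S w) (Ss ∷ [])))
    where
    prod-++ : ∀ xs ys → prod (xs ++ ys) ≡ prod xs · prod ys
    prod-++ [] ys = sym (identityˡ _)
    prod-++ (x ∷ xs) ys = trans (cong (x ·_) (prod-++ xs ys)) (sym (assoc _ _ _))
    eq₁ : prod (word w ++ s ∷ []) ≡ w · s
    eq₁ = trans (prod-++ (word w) _) (cong₂ _·_ (word-prod w) (identityʳ s))
    eq₂ : length (word w ++ s ∷ []) ≡ suc (len w)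
    eq₂ = trans (LP.length-++ (word w)) (trans (ℕP.+-comm _ 1) (cong suc (word-length w)))

  ·gen·gen : ∀ w {s} → S s → w · s · s ≡ w
  ·gen·gen w {s} Ss = grp (w ∷ []) ((s , invol s Ss) ∷ []) (var 0 ⊙ ivar 0 ⊙ ivar 0) (var 0) refl

  ascent-len : ∀ w {s} → S s → N w (right w s) ≡ false → len (w · s) ≡ suc (len w)
  ascent-len w {s} Ss eq = ℕP.≤-antisym (·gen-≤ w Ss)
    (subst (λ z → len w < len z) (right-· w s) (¬N⇒> (right-refl w Ss) eq))

  descent-len : ∀ w {s} → S s → N w (right w s) ≡ true → len w ≡ suc (len (w · s))
  descent-len w {s} Ss eq = ℕP.≤-antisym (subst (λ z → len z ≤ suc (len (w · s))) (·gen·gen w Ss) (·gen-≤ (w · s) Ss))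
    (subst (λ z → len z < len w) (right-· w s) (N⇒< eq))

  right-·gen : ∀ w {s} → S s → right (w · s) s ≡ right w s
  right-·gen w {s} Ss = grp (w ∷ []) ((s , invol s Ss) ∷ [])
    (var 0 ⊙ ivar 0 ⊙ ivar 0 ⊙ (var 0 ⊙ ivar 0) ⁻) (var 0 ⊙ ivar 0 ⊙ var 0 ⁻) refl

  descent-flip : ∀ w {s} → S s → N (w · s) (right w s) ≡ not (N w (right w s))
  descent-flip w {s} Ss = trans (N-·gen w Ss (right w s)) (trans (cong (N w (right w s) xor_) (==-refl (right w s)))
    (trans (xor-comm (N w (right w s)) true) refl))

-- Dihedral reflection subgroups

xorSum-false : ∀ n {f} → (∀ k → k < n → f k ≡ false) → xorSum n f ≡ false
xorSum-false zero h = refl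
xorSum-false (suc n) h = cong₂ _xor_ (h 0 (s≤s z≤n)) (xorSum-false n λ k l → h (suc k) (s≤s l))

xorSum-single : ∀ n {f} i → i < n → f i ≡ true → (∀ k → k < n → k ≢ i → f k ≡ false) → xorSum n f ≡ true
xorSum-single (suc n) zero _ h₁ h = cong₂ _xor_ h₁ (xorSum-false n λ k l → h (suc k) (s≤s l) λ ())
xorSum-single (suc n) (suc i) (s≤s l) h₁ h = cong₂ _xor_ (h 0 (s≤s z≤n) λ ())
  (xorSum-single n i l h₁ λ k l ne → h (suc k) (s≤s l) (ne ∘ ℕP.suc-injective))

xorSum-witness : ∀ n {f} → xorSum n f ≡ true → Σ ℕ λ i → i < n × f i ≡ true
xorSum-witness (suc n) {f} eq with f 0 in f0
... | true = 0 , s≤s z≤n , f0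
... | false with xorSum-witness n eq
... | i , l , fi = suc i , s≤s l , fi

module Dihedral (C : CoxeterSystem) (len : CoxeterSystem.W C → ℕ) (isLen : CoxDefs.IsLength C len) where
  open Inversions C len isLen

  module Pair (a b : W) (Ra : IsRefl a) (Rb : IsRefl b) where
    L : Bool → W
    L β = if β then a else b

    L-refl : ∀ g → IsRefl (L g)
    L-refl true = Ra
    L-refl false = Rb

    LL : ∀ g → L g · L g ≡ e
    LL g = refl-invol (L-refl g)

    -- Powers of ab and of its inverse ba. With them `P true` runs through a, aba, ababa, ... and
    -- `P false` through b, bab, ...; the Boolean lets each statement serve both ends of the
    -- dihedral group.
    rot : Bool → ℕ → W
    rot true = pw (a · b)
    rot false = pw (b · a)

    rot-suc : ∀ g k → rot g (suc k) ≡ L g · L (not g) · rot g k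
    rot-suc true k = refl
    rot-suc false k = refl

    rot-zero : ∀ g → rot g 0 ≡ e
    rot-zero true = refl
    rot-zero false = refl

    rot-+ : ∀ g m n → rot g (m + n) ≡ rot g m · rot g n
    rot-+ true = pw-+ _
    rot-+ false = pw-+ _

    P : Bool → ℕ → W
    P g k = rot g k · L g

    P-zero : ∀ g → P g 0 ≡ L g
    P-zero true = identityˡ _
    P-zero false = identityˡ _

    P-+ : ∀ g m n → P g (m + n) ≡ rot g m · P g n
    P-+ g m n = trans (cong (_· L g) (rot-+ g m n)) (assoc _ _ _)

    L·rot : ∀ g k → L g · rot (not g) k ≡ P g k
    L·rot g zero = trans (cong (L g ·_) (rot-zero (not g))) (trans (identityʳ _) (sym (P-zero g)))
    L·rot g (suc k) = begin
      L g · rot (not g) (suc k)                     ≡⟨ cong (L g ·_) (rot-suc (not g) k) ⟩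
      L g · (L (not g) · L (not (not g)) · rot (not g) k) ≡⟨ cong (λ β → L g · (L (not g) · L β · rot (not g) k)) (not-involutive g) ⟩
      L g · (L (not g) · L g · rot (not g) k)       ≡⟨ grp (L g ∷ L (not g) ∷ rot (not g) k ∷ []) []
                                                        (var 0 ⊙ (var 1 ⊙ var 0 ⊙ var 2)) (var 0 ⊙ var 1 ⊙ (var 0 ⊙ var 2)) refl ⟩
      L g · L (not g) · (L g · rot (not g) k)       ≡⟨ cong (L g · L (not g) ·_) (L·rot g k) ⟩
      L g · L (not g) · (rot g k · L g)             ≡⟨ assoc _ _ _ ⟨
      L g · L (not g) · rot g k · L g               ≡⟨ cong (_· L g) (rot-suc g k) ⟨
      P g (suc k) ∎
      where open ≡-Reasoning

    P-conj : ∀ g k → L g · P (not g) k · L g ≡ P g (suc k)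
    P-conj g k = begin
      L g · (rot (not g) k · L (not g)) · L g  ≡⟨ grp (L g ∷ L (not g) ∷ rot (not g) k ∷ []) []
                                                   (var 0 ⊙ (var 2 ⊙ var 1) ⊙ var 0) (var 0 ⊙ var 2 ⊙ (var 1 ⊙ var 0)) refl ⟩
      L g · rot (not g) k · (L (not g) · L g)  ≡⟨ cong (_· (L (not g) · L g)) (L·rot g k) ⟩
      rot g k · L g · (L (not g) · L g)        ≡⟨ grp (L g ∷ L (not g) ∷ rot g k ∷ []) []
                                                   (var 2 ⊙ var 0 ⊙ (var 1 ⊙ var 0)) (var 2 ⊙ (var 0 ⊙ var 1 ⊙ ε) ⊙ var 0) refl ⟩
      rot g k · (L g · L (not g) · e) · L g    ≡⟨ cong (λ z → rot g k · z · L g) (trans (cong (L g · L (not g) ·_) (sym (rot-zero g))) (sym (rot-suc g 0))) ⟩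
      rot g k · rot g 1 · L g                  ≡⟨ cong (_· L g) (rot-+ g k 1) ⟨
      rot g (k + 1) · L g                      ≡⟨ cong (P g) (ℕP.+-comm k 1) ⟩
      P g (suc k) ∎
      where open ≡-Reasoning

    P-refl : ∀ g k → IsRefl (P g k)
    P-refl g zero = subst IsRefl (sym (P-zero g)) (L-refl g)
    P-refl g (suc k) = subst IsRefl (P-conj g k) (refl-conj-refl (L-refl g) (P-refl (not g) k))

    rot-par : ∀ g k → par (rot g k) ≡ false
    rot-par g zero = trans (cong par (rot-zero g)) par-e
    rot-par g (suc k) = trans (cong par (rot-suc g k)) (trans (par-· _ _)
      (cong₂ _xor_ (trans (par-· _ _) (cong₂ _xor_ (par-refl (L-refl g)) (par-refl (L-refl (not g))))) (rot-par g k)))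

    L·P : ∀ g k → L g · P g k ≡ rot (not g) k
    L·P g k = trans (cong (L g ·_) (sym (L·rot g k)))
      (grp (rot (not g) k ∷ []) ((L g , LL g) ∷ []) (ivar 0 ⊙ (ivar 0 ⊙ var 0)) (var 0) refl)

    notL·P : ∀ g k → L (not g) · P g k ≡ rot (not g) (suc k)
    notL·P g k = trans (cong (L (not g) ·_) (trans (sym (L·rot g k)) (cong (λ β → L β · rot (not g) k) (sym (not-involutive g)))))
      (trans (sym (assoc _ _ _)) (sym (rot-suc (not g) k)))

    data Normal (x : W) : Set where
      rotation   : ∀ g k → x ≡ rot g k → Normal x
      reflection : ∀ g k → x ≡ P g k → Normal x

    L·normal : ∀ β {x} → Normal x → Normal (L β · x)
    L·normal β (rotation g zero refl) = reflection β 0 (trans (cong (L β ·_) (rot-zero g)) (trans (identityʳ _) (sym (P-zero β))))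
    L·normal true (rotation true (suc k) refl) = reflection false k (trans (cong (a ·_) (assoc a b _))
      (trans (refl·refl· Ra _) (L·rot false k)))
    L·normal true (rotation false (suc k) refl) = reflection true (suc k) (L·rot true (suc k))
    L·normal false (rotation true (suc k) refl) = reflection false (suc k) (L·rot false (suc k))
    L·normal false (rotation false (suc k) refl) = reflection true k (trans (cong (b ·_) (assoc b a _))
      (trans (refl·refl· Rb _) (L·rot true k)))
    L·normal true (reflection true k refl) = rotation false k (L·P true k)
    L·normal true (reflection false k refl) = rotation true (suc k) (notL·P false k)
    L·normal false (reflection true k refl) = rotation false (suc k) (notL·P true k)
    L·normal false (reflection false k refl) = rotation true k (L·P false k)

    normalize : ∀ bs → Normal (prod (map L bs))
    normalize [] = rotation true 0 refl
    normalize (β ∷ bs) = L·normal β (normalize bs)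

    odd-normal : ∀ {x} → InSub a b x → par x ≡ true → Σ Bool λ g → Σ ℕ λ k → x ≡ P g k
    odd-normal (bs , refl) p with normalize bs
    ... | rotation g k eq = ⊥-elim (true≢false (trans (sym p) (trans (cong par eq) (rot-par g k))))
    ... | reflection g k eq = g , k , eq

    odd-refl : ∀ {x} → InSub a b x → par x ≡ true → IsRefl x
    odd-refl i p with odd-normal i p
    ... | g , k , refl = P-refl g k

    InSub-· : ∀ {x y} → InSub a b x → InSub a b y → InSub a b (x · y)
    InSub-· (bs , refl) (cs , refl) = bs ++ cs , lemma bs
      where
      lemma : ∀ bs → prod (map L (bs ++ cs)) ≡ prod (map L bs) · prod (map L cs)
      lemma [] = sym (identityˡ _)
      lemma (β ∷ bs) = trans (cong (L β ·_) (lemma bs)) (sym (assoc _ _ _))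

    InSub-L : ∀ g → InSub a b (L g)
    InSub-L g = g ∷ [] , identityʳ _

    InSub-rot : ∀ g k → InSub a b (rot g k)
    InSub-rot g zero = [] , sym (rot-zero g)
    InSub-rot g (suc k) = subst (InSub a b) (sym (rot-suc g k)) (InSub-· (InSub-· (InSub-L g) (InSub-L (not g))) (InSub-rot g k))

    rot-inverse : ∀ g k → rot g k · rot (not g) k ≡ e
    rot-inverse g k = begin
      rot g k · rot (not g) k                ≡⟨ grp (rot g k ∷ rot (not g) k ∷ []) ((L g , LL g) ∷ [])
                                                 (var 0 ⊙ var 1) (var 0 ⊙ ivar 0 ⊙ (ivar 0 ⊙ var 1)) refl ⟩
      P g k · (L g · rot (not g) k)          ≡⟨ cong (P g k ·_) (L·rot g k) ⟩
      P g k · P g k                          ≡⟨ refl-invol (P-refl g k) ⟩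
      e ∎
      where open ≡-Reasoning

    P-not : ∀ g k → P (not g) k · L g ≡ rot (not g) (suc k)
    P-not true k = trans (assoc _ _ _) (trans (cong (rot false k ·_) (sym (identityʳ _))) (trans (sym (pw-+ (b · a) k 1)) (cong (rot false) (ℕP.+-comm k 1))))
    P-not false k = trans (assoc _ _ _) (trans (cong (rot true k ·_) (sym (identityʳ _))) (trans (sym (pw-+ (a · b) k 1)) (cong (rot true) (ℕP.+-comm k 1))))

    -- P (not g) k = ρ⁻ᵏ⁻¹ · L g for ρ = L g · L (not g)
    P-not-≡ : ∀ g k m → rot g (k + suc m) ≡ e → P (not g) m ≡ P g k
    P-not-≡ g k m eq = ∙-cancelʳ (L g) _ _ (begin
      P (not g) m · L g                          ≡⟨ P-not g m ⟩
      rot (not g) (suc m)                        ≡⟨ identityˡ _ ⟨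
      e · rot (not g) (suc m)                    ≡⟨ cong (_· rot (not g) (suc m)) (trans (sym eq) (rot-+ g k (suc m))) ⟩
      rot g k · rot g (suc m) · rot (not g) (suc m) ≡⟨ assoc _ _ _ ⟩
      rot g k · (rot g (suc m) · rot (not g) (suc m)) ≡⟨ cong (rot g k ·_) (rot-inverse g (suc m)) ⟩
      rot g k · e                                ≡⟨ cong (rot g k ·_) (LL g) ⟨
      rot g k · (L g · L g)                      ≡⟨ assoc _ _ _ ⟨
      P g k · L g ∎)
      where open ≡-Reasoning

    P-not-≡⁻ : ∀ g k m → P g k ≡ P (not g) m → rot g (k + suc m) ≡ e
    P-not-≡⁻ g k m eq = begin
      rot g (k + suc m)                           ≡⟨ rot-+ g k (suc m) ⟩
      rot g k · rot g (suc m)                     ≡⟨ grp (rot g k ∷ rot g (suc m) ∷ []) ((L g , LL g) ∷ []) (var 0 ⊙ var 1) (var 0 ⊙ ivar 0 ⊙ ivar 0 ⊙ var 1) refl ⟩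
      P g k · L g · rot g (suc m)                 ≡⟨ cong (λ z → z · L g · rot g (suc m)) eq ⟩
      P (not g) m · L g · rot g (suc m)           ≡⟨ cong (_· rot g (suc m)) (P-not g m) ⟩
      rot (not g) (suc m) · rot g (suc m)         ≡⟨ cong (λ β → rot (not g) (suc m) · rot β (suc m)) (not-involutive g) ⟨
      rot (not g) (suc m) · rot (not (not g)) (suc m) ≡⟨ rot-inverse (not g) (suc m) ⟩
      e ∎
      where open ≡-Reasoning

    rot-mult : ∀ g m n → rot g m ≡ e → rot g (n * m) ≡ e
    rot-mult g m zero eq = rot-zero g
    rot-mult g m (suc n) eq = trans (rot-+ g m (n * m)) (trans (cong₂ _·_ eq (rot-mult g m n eq)) (identityˡ e))

    -- On the indices of the sequence `P g`, conjugation by the j-th reflection is the point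
    -- reflection in j. This is why t lies between r and trt within the sequence.
    P-reflect : ∀ g {i i′} j → i + i′ ≡ j + j → P g j · P g i · P g j ≡ P g i′
    P-reflect g {i} {i′} j eq = begin
      X · l · (Y · l) · (X · l)         ≡⟨ grp (X ∷ Y ∷ l ∷ []) [] (var 0 ⊙ var 2 ⊙ (var 1 ⊙ var 2) ⊙ (var 0 ⊙ var 2))
                                            (var 0 ⊙ (var 2 ⊙ var 1 ⊙ var 2) ⊙ (var 0 ⊙ var 2)) refl ⟩
      X · (l · Y · l) · (X · l)         ≡⟨ cong (λ z → X · z · (X · l)) lYl ⟩
      X · Y ⁻¹ · (X · l)                ≡⟨ grp (X ∷ Y ∷ l ∷ []) [] (var 0 ⊙ var 1 ⁻ ⊙ (var 0 ⊙ var 2))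
                                            (var 1 ⁻ ⊙ (var 1 ⊙ var 0) ⊙ (var 1 ⁻ ⊙ (var 0 ⊙ var 2))) refl ⟩
      Y ⁻¹ · (Y · X) · (Y ⁻¹ · (X · l)) ≡⟨ cong (λ z → Y ⁻¹ · z · (Y ⁻¹ · (X · l)))
                                            (trans (sym (rot-+ g i j)) (trans (cong (rot g) (ℕP.+-comm i j)) (rot-+ g j i))) ⟩
      Y ⁻¹ · (X · Y) · (Y ⁻¹ · (X · l)) ≡⟨ grp (X ∷ Y ∷ l ∷ []) [] (var 1 ⁻ ⊙ (var 0 ⊙ var 1) ⊙ (var 1 ⁻ ⊙ (var 0 ⊙ var 2)))
                                            (var 1 ⁻ ⊙ (var 0 ⊙ var 0) ⊙ var 2) refl ⟩
      Y ⁻¹ · (X · X) · l                ≡⟨ cong (λ z → Y ⁻¹ · z · l) (trans (sym (rot-+ g j j)) (trans (cong (rot g) (sym eq)) (rot-+ g i i′))) ⟩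
      Y ⁻¹ · (Y · rot g i′) · l         ≡⟨ grp (Y ∷ rot g i′ ∷ l ∷ []) [] (var 0 ⁻ ⊙ (var 0 ⊙ var 1) ⊙ var 2) (var 1 ⊙ var 2) refl ⟩
      P g i′ ∎
      where
      open ≡-Reasoning
      X = rot g j
      Y = rot g i
      l = L g
      lYl : l · Y · l ≡ Y ⁻¹
      lYl = ∙-cancelˡ Y _ _ (trans (cong (Y ·_) (trans (assoc _ _ _) (L·P g i))) (trans (rot-inverse g i) (sym (inverseʳ Y))))

    module Canonical (can : DihedralCanon a b) where
      N-L : ∀ g {x} → IsRefl x → InSub a b x → N (L g) x ≡ (x == L g)
      N-L g {x} Rx ix with x ≟W L g
      ... | yes refl = N-self Rx
      ... | no ne = ¬-not λ eq → ne (minimal g (N⇒< eq))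
        where
        minimal : ∀ g → len (x · L g) < len (L g) → x ≡ L g
        minimal true = proj₁ (proj₂ (proj₂ (proj₂ can))) x Rx ix
        minimal false = proj₂ (proj₂ (proj₂ (proj₂ can))) x Rx ix

      L-conj-≡ : ∀ g {x y z} → L g · y · L g ≡ z → (L g ⁻¹ · x · L g == y) ≡ (x == z)
      L-conj-≡ g {x} {y} eq = ==-⇔ (λ p → trans (conj-≡ p) eq′) (λ p → conj-≡⁻ (trans p (sym eq′)))
        where eq′ = trans (cong (L g · y ·_) (invol⁻¹ (LL g))) eq

      InSub-conj : ∀ g {x} → InSub a b x → InSub a b (L g ⁻¹ · x · L g)
      InSub-conj g i = subst (λ z → InSub a b (z · _ · L g)) (sym (invol⁻¹ (LL g)))
        (InSub-· (InSub-· (InSub-L g) i) (InSub-L g))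

      IsRefl-conj : ∀ g {x} → IsRefl x → IsRefl (L g ⁻¹ · x · L g)
      IsRefl-conj g i = subst (λ z → IsRefl (z · _ · L g)) (sym (invol⁻¹ (LL g))) (refl-conj-refl (L-refl g) i)

      P-conj′ : ∀ g k → L (not g) · P g k · L (not g) ≡ P (not g) (suc k)
      P-conj′ true k = P-conj false k
      P-conj′ false k = P-conj true k

      -- The computation of `pow⋉` with a and b in place of two simple generators: by canonicity,
      -- `N (L g)` restricted to ⟨a,b⟩ is the indicator of `L g`.
      N-rot : ∀ g j {x} → IsRefl x → InSub a b x → N (rot g j) x ≡ xorSum (j + j) (λ i → x == P g i)
      N-rot g zero {x} Rx ix = trans (cong (λ z → N z x) (rot-zero g)) (N-e x)
      N-rot g (suc j) {x} Rx ix = begin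
        N (rot g (suc j)) x
          ≡⟨ cong (λ z → N z x) (trans (rot-suc g j) (assoc _ _ _)) ⟩
        N (L g · (L h · rot g j)) x
          ≡⟨ N-· (L g) _ x ⟩
        N (L g) x xor N (L h · rot g j) y
          ≡⟨ cong₂ _xor_ (trans (N-L g Rx ix) (cong (x ==_) (sym (P-zero g)))) (N-· (L h) (rot g j) y) ⟩
        (x == P g 0) xor (N (L h) y xor N (rot g j) z)
          ≡⟨ cong ((x == P g 0) xor_) (cong₂ _xor_
               (trans (N-L h Ry iy) (L-conj-≡ g (trans (cong (λ w → L g · w · L g) (sym (P-zero h))) (P-conj g 0))))
               (trans (N-rot g j (IsRefl-conj h Ry) (InSub-conj h iy)) (xorSum-cong (j + j) λ i →
                  trans (L-conj-≡ h (P-conj′ g i)) (L-conj-≡ g (P-conj g (suc i)))))) ⟩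
        xorSum (2 + (j + j)) (λ i → x == P g i)
          ≡⟨ cong (λ m → xorSum (suc m) (λ i → x == P g i)) (ℕP.+-suc j j) ⟨
        xorSum (suc j + suc j) (λ i → x == P g i) ∎
        where
        open ≡-Reasoning
        h = not g
        y = L g ⁻¹ · x · L g
        z = L h ⁻¹ · y · L h
        Ry = IsRefl-conj g Rx
        iy = InSub-conj g ix

      N-P : ∀ g j {x} → IsRefl x → InSub a b x → N (P g j) x ≡ xorSum (suc (j + j)) (λ i → x == P g i)
      N-P g j {x} Rx ix = begin
        N (rot g j · L g) x
          ≡⟨ N-· (rot g j) (L g) x ⟩
        N (rot g j) x xor N (L g) y
          ≡⟨ cong₂ _xor_ (N-rot g j Rx ix) (trans (N-L g Ry iy) (==-⇔ (λ p → trans (conj-≡ p) eq) (λ p → conj-≡⁻ (trans p (sym eq))))) ⟩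
        xorSum (j + j) (λ i → x == P g i) xor (x == P g (j + j))
          ≡⟨ cong (xorSum (j + j) (λ i → x == P g i) xor_) (trans (cong (λ k → x == P g k) (sym (ℕP.+-identityʳ (j + j)))) (sym (xor-identityʳ _))) ⟩
        xorSum (j + j) (λ i → x == P g i) xor xorSum 1 (λ i → x == P g (j + j + i))
          ≡⟨ xorSum-+ (j + j) 1 _ ⟨
        xorSum (j + j + 1) (λ i → x == P g i)
          ≡⟨ cong (λ m → xorSum m (λ i → x == P g i)) (ℕP.+-comm (j + j) 1) ⟩
        xorSum (suc (j + j)) (λ i → x == P g i) ∎
        where
        open ≡-Reasoning
        ρ⁻¹ : rot g j ⁻¹ ≡ rot (not g) j
        ρ⁻¹ = ∙-cancelˡ (rot g j) _ _ (trans (inverseʳ _) (sym (rot-inverse g j)))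
        y = rot g j ⁻¹ · x · rot g j
        Ry : IsRefl y
        Ry = subst (λ z → IsRefl (rot g j ⁻¹ · x · z)) (⁻¹-involutive _) (refl-conj (rot g j ⁻¹) Rx)
        iy : InSub a b y
        iy = InSub-· (InSub-· (subst (InSub a b) (sym ρ⁻¹) (InSub-rot (not g) j)) ix) (InSub-rot g j)
        eq : rot g j · L g · rot g j ⁻¹ ≡ P g (j + j)
        eq = trans (cong (rot g j · L g ·_) ρ⁻¹) (trans (assoc _ _ _) (trans (cong (rot g j ·_) (L·rot g j)) (sym (P-+ g j j))))

      IsPattern : (W → W → Set) → Bool → Set
      IsPattern _≺_ g =
        (∀ i j → i < j → (∀ k → k ≤ i → P g j ≢ P g k) → P g i ≺ P g j) ×
        (∀ i j → i < j → (∀ k → k ≤ i → P (not g) j ≢ P (not g) k) → P (not g) j ≺ P (not g) i) ×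
        (∀ i j → (∀ k → P g k ≢ P (not g) j) → P g i ≺ P (not g) j)

      -- Reading the order backwards exchanges the two ends; only the third clause is not literally
      -- symmetric.
      IsPattern-swap : ∀ {_≺_} g → IsPattern _≺_ g → IsPattern (flip _≺_) (not g)
      IsPattern-swap {_≺_} g (p₁ , p₂ , p₃) = p₂ , subst (λ h → ∀ i j → i < j → (∀ k → k ≤ i → P h j ≢ P h k) → P h i ≺ P h j) (sym (not-involutive g)) p₁ ,
        subst (λ h → ∀ i j → (∀ k → P (not g) k ≢ P h j) → P h j ≺ P (not g) i) (sym (not-involutive g))
          -- A common member of the two sequences makes the rotation of exponent d = k + i + 1
          -- trivial. The multiple (j + 1) d exceeds j, and the difference, less one, is an index of
          -- `P g j` in the other sequence.
          λ i j ne → p₃ j i λ k eq → ne ((k + i) * suc j) (P-not-≡ g j ((k + i) * suc j)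
            (subst (λ m → rot g m ≡ e) (index i j k) (rot-mult g (k + suc i) (suc j) (P-not-≡⁻ g k i eq))))
        where
        index : ∀ i j k → suc j * (k + suc i) ≡ j + suc ((k + i) * suc j)
        index = ℕSolver.solve-∀

      -- The negative half is doubly negated because it rests on comparing a reflection with the
      -- infinitely many terms of a sequence.
      Separation : (W → W → Set) → W → W → Set
      Separation _≺_ t r =
        (N t r ≡ true → (r ≺ t × t ≺ (t · r · t)) ⊎ (t ≺ r × (t · r · t) ≺ t)) ×
        (N t r ≡ false → ¬ ¬ ((r ≺ t × (t · r · t) ≺ t) ⊎ (t ≺ r × t ≺ (t · r · t))))

      Separation-flip : ∀ {_≺_} t r → Separation (flip _≺_) t r → Separation _≺_ t r
      Separation-flip t r (f , g) = Sum.swap ∘ f , λ eq k → g eq (k ∘ Sum.swap)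

      N-conj-self : ∀ {t} → IsRefl t → ∀ r → N t (t · r · t) ≡ N t r
      N-conj-self {t} Rt r = begin
        N t (t · r · t)                    ≡⟨ cong (λ z → N z (t · r · t)) (invol⁻¹ (refl-invol Rt)) ⟨
        N (t ⁻¹) (t · r · t)               ≡⟨ cong (λ z → N (t ⁻¹) (z · r · t)) (invol⁻¹ (refl-invol Rt)) ⟨
        N (t ⁻¹) (t ⁻¹ · r · t)            ≡⟨ N-⁻¹ t r ⟩
        N t r ∎
        where open ≡-Reasoning

      module _ (_≺_ : W → W → Set) (g : Bool) (pat : IsPattern _≺_ g) (j : ℕ)
               (distinct : ∀ {i i′} → i < i′ → i′ < suc (j + j) → P g i ≢ P g i′) where
        private
          t = P g j
          Rt = P-refl g j
          p₁ = proj₁ pat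
          p₂ = proj₁ (proj₂ pat)
          p₃ = proj₂ (proj₂ pat)

        distinct′ : ∀ {i i′} → i ≢ i′ → i < suc (j + j) → i′ < suc (j + j) → P g i ≢ P g i′
        distinct′ {i} {i′} ne l l′ eq with ℕP.<-cmp i i′
        ... | tri< lt _ _ = distinct lt l′ eq
        ... | tri≈ _ p _ = ne p
        ... | tri> _ _ gt = distinct gt l (sym eq)

        -- A reflection that is none of `P g 0`, ..., `P g (j + j)` either occurs later in the same
        -- sequence or lies only in the other one; both put it above t. Which of the two holds is
        -- not decided, hence the double negation.
        outside : ∀ {x} → IsRefl x → InSub a b x → N t x ≡ false → ¬ ¬ (t ≺ x)
        outside {x} Rx ix eq k with odd-normal ix (par-refl Rx)
        ... | g′ , i , refl = above g′ refl
          where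
          new : ∀ l → l ≤ j → x ≢ P g l
          new l l≤j x≡ = true≢false (trans (sym (trans (N-P g j Rx ix)
            (xorSum-single (suc (j + j)) l (s≤s (ℕP.≤-trans l≤j (ℕP.m≤m+n j j))) (trans (cong (_== P g l) x≡) (==-refl _))
              λ m m< m≢l → dec-false (x ≟W P g m) λ x≡′ →
                distinct′ (m≢l ∘ sym) (s≤s (ℕP.≤-trans l≤j (ℕP.m≤m+n j j))) m< (trans (sym x≡) x≡′)))) eq)
          above-g : ∀ i → x ≡ P g i → ⊥
          above-g i x≡ with ℕP.≤-<-connex i j
          ... | inj₁ i≤j = new i i≤j x≡
          ... | inj₂ j<i = k (subst (t ≺_) (sym x≡) (p₁ j i j<i λ l l≤ → new l l≤ ∘ trans x≡))
          above-not : ∀ i → x ≡ P (not g) i → ⊥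
          above-not i x≡ = k (subst (t ≺_) (sym x≡) (p₃ j i λ l eq → above-g l (trans x≡ (sym eq))))
          above : ∀ g′ → x ≡ P g′ i → ⊥
          above g′ with g′ ≟B g
          ... | yes refl = above-g i
          ... | no ne = subst (λ h → x ≡ P h i → ⊥) (sym (¬-not ne)) (above-not i)

        -- The inversions of t in the subgroup are `P g 0`, ..., `P g (j + j)`, listed increasingly
        -- with t in the middle, and conjugation by t reverses this list.
        separation-minimal : ∀ {r} → IsRefl r → InSub a b r → r ≢ t → Separation _≺_ t r
        separation-minimal {r} Rr ir r≢t = inside , outside₂
          where
          inside : N t r ≡ true → (r ≺ t × t ≺ (t · r · t)) ⊎ (t ≺ r × (t · r · t) ≺ t)
          inside eq with xorSum-witness (suc (j + j)) (trans (sym (N-P g j Rr ir)) eq)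
          ... | i , i<2j , r==Pi = subst (λ x → (x ≺ t × t ≺ (t · x · t)) ⊎ (t ≺ x × (t · x · t) ≺ t)) (sym r≡)
            (subst (λ z → (P g i ≺ t × t ≺ z) ⊎ (t ≺ P g i × z ≺ t)) (sym (P-reflect g j i+i′)) sides)
            where
            r≡ : r ≡ P g i
            r≡ = ==-true {r} {P g i} r==Pi
            i′ = j + j ∸ i
            i+i′ : i + i′ ≡ j + j
            i+i′ = ℕP.m+[n∸m]≡n (ℕP.≤-pred i<2j)
            i′<2j : i′ < suc (j + j)
            i′<2j = s≤s (ℕP.m∸n≤m (j + j) i)
            j<2j : j < suc (j + j)
            j<2j = s≤s (ℕP.m≤m+n j j)
            order : ∀ {i k} → i < k → k < suc (j + j) → P g i ≺ P g k
            order {i} {k} i<k k<2j = p₁ i k i<k λ l l≤i → distinct′ (λ k≡l → ℕP.<⇒≱ i<k (subst (_≤ i) (sym k≡l) l≤i)) k<2j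
              (ℕP.≤-<-trans l≤i (ℕP.<-trans i<k k<2j))
            sides : (P g i ≺ t × t ≺ P g i′) ⊎ (t ≺ P g i × P g i′ ≺ t)
            sides with ℕP.≤-<-connex j i
            ... | inj₂ i<j = inj₁ (order i<j j<2j , order (ℕP.≰⇒> λ i′≤j → ℕP.<⇒≢ (ℕP.+-mono-<-≤ i<j i′≤j) i+i′) i′<2j)
            ... | inj₁ j≤i = inj₂ (order j<i i<2j , order (ℕP.≰⇒> λ j≤i′ → ℕP.<⇒≢ (ℕP.+-mono-<-≤ j<i j≤i′) (sym i+i′)) j<2j)
              where
              j<i : j < i
              j<i = ℕP.≤∧≢⇒< j≤i λ j≡i → r≢t (trans r≡ (cong (P g) (sym j≡i)))
          outside₂ : N t r ≡ false → ¬ ¬ ((r ≺ t × (t · r · t) ≺ t) ⊎ (t ≺ r × t ≺ (t · r · t)))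
          outside₂ eq k = outside Rr ir eq λ t≺r → outside (refl-conj-refl Rt Rr)
            (InSub-· (InSub-· it ir) it) (trans (N-conj-self Rt r) eq) λ t≺trt → k (inj₂ (t≺r , t≺trt))
            where
            it : InSub a b t
            it = InSub-· (InSub-rot g j) (InSub-L g)

      -- A coincidence makes the rotation of exponent m = i′ - i trivial, where 0 < m ≤ 2j. Then
      -- `P g j` already occurs m places earlier or, if m > j, in the other sequence at m - 1 - j,
      -- which is less than j.
      shorten : ∀ g j {i i′} → i < i′ → i′ < suc (j + j) → P g i ≡ P g i′ → Σ Bool λ g′ → Σ ℕ λ j′ → j′ < j × P g j ≡ P g′ j′
      shorten g j {i} {i′} i<i′ i′<2j eq with ℕP.≤-<-connex (i′ ∸ i) j
      ... | inj₁ m≤j = g , j ∸ m , ℕP.∸-monoʳ-< (ℕP.m<n⇒0<n∸m i<i′) m≤j ,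
              trans (cong (P g) (sym (ℕP.m+[n∸m]≡n m≤j))) (trans (P-+ g m (j ∸ m)) (trans (cong (_· P g (j ∸ m)) rot-m) (identityˡ _)))
        where
        m = i′ ∸ i
        rot-m : rot g m ≡ e
        rot-m = ∙-cancelʳ (P g i) _ _ (trans (sym (P-+ g m i)) (trans (cong (P g) (ℕP.m∸n+n≡m (ℕP.<⇒≤ i<i′))) (trans (sym eq) (sym (identityˡ _)))))
      ... | inj₂ j<m = not g , m ∸ suc j , ℕP.≤-trans (s≤s (ℕP.∸-monoˡ-≤ (suc j) (ℕP.≤-trans (ℕP.m∸n≤m i′ i) (ℕP.≤-pred i′<2j)))) (last j j<m (ℕP.≤-trans (ℕP.m∸n≤m i′ i) (ℕP.≤-pred i′<2j))) ,
              sym (P-not-≡ g j (m ∸ suc j) (trans (cong (rot g) (trans (ℕP.+-suc j _) (ℕP.m+[n∸m]≡n j<m))) rot-m))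
        where
        m = i′ ∸ i
        rot-m : rot g m ≡ e
        rot-m = ∙-cancelʳ (P g i) _ _ (trans (sym (P-+ g m i)) (trans (cong (P g) (ℕP.m∸n+n≡m (ℕP.<⇒≤ i<i′))) (trans (sym eq) (sym (identityˡ _)))))
        last : ∀ j → j < m → m ≤ j + j → j + j ∸ suc j < j
        last zero j<m m≤0 = ⊥-elim (ℕP.<⇒≱ j<m m≤0)
        last (suc j) _ _ = s≤s (ℕP.≤-reflexive (trans (cong (_∸ suc j) (ℕP.+-suc j j)) (ℕP.m+n∸m≡n (suc j) j)))

      -- Induction on j. A repetition among the first 2j + 1 terms, found by finite search, lets t
      -- be rewritten with a smaller index. Without one `separation-minimal` applies, to the
      -- reversed order if t is given in the sequence of the upper end.
      separation-step : ∀ (_≺_ : W → W → Set) g₀ → IsPattern _≺_ g₀ → ∀ n g j → j < n → ∀ {r} → IsRefl r → InSub a b r → r ≢ P g j → Separation _≺_ (P g j) r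
      separation-step _≺_ g₀ pat (suc n) g j (s≤s j≤n) {r} Rr ir r≢t
        with ℕP.anyUpTo? (λ i′ → ℕP.anyUpTo? (λ i → P g i ≟W P g i′) i′) (suc (j + j))
      ... | yes (i′ , i′< , i , i<i′ , eq) with shorten g j i<i′ i′< eq
      ... | g′ , j′ , j′<j , t≡ = subst (λ t → Separation _≺_ t r) (sym t≡)
              (separation-step _≺_ g₀ pat n g′ j′ (ℕP.<-≤-trans j′<j j≤n) Rr ir (r≢t ∘ flip trans (sym t≡)))
      separation-step _≺_ g₀ pat (suc n) g j (s≤s j≤n) {r} Rr ir r≢t | no nc with g ≟B g₀
      ... | yes refl = separation-minimal _≺_ g pat j (λ l l′ eq → nc (_ , l′ , _ , l , eq)) Rr ir r≢t
      ... | no ne = Separation-flip {_≺_} (P g j) r (separation-minimal (flip _≺_) g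
              (subst (IsPattern (flip _≺_)) (sym (¬-not ne)) (IsPattern-swap {_≺_} g₀ pat)) j (λ l l′ eq → nc (_ , l′ , _ , l , eq)) Rr ir r≢t)

      separation-canonical : ∀ {_≺_} → Pattern _≺_ a b ⊎ Pattern _≺_ b a → ∀ {r t} →
        IsRefl r → IsRefl t → InSub a b r → InSub a b t → r ≢ t → Separation _≺_ t r
      separation-canonical {_≺_} pat {r} {t} Rr Rt ir it r≢t with odd-normal it (par-refl Rt)
      ... | g , j , refl with pat
      ... | inj₁ p = separation-step _≺_ true p (suc j) g j ℕP.≤-refl Rr ir r≢t
      ... | inj₂ p = separation-step _≺_ false p (suc j) g j ℕP.≤-refl Rr ir r≢t

  -- The canonical generators of the dihedral reflection subgroup ⟨r,t⟩ are
  -- its reflections whose only inversion inside ⟨r,t⟩ is themselves.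
  module _ (r t : W) (Rr : IsRefl r) (Rt : IsRefl t) (r≢t : r ≢ t) where
    private
      module D = Pair r t Rr Rt

      χ : W → Set
      χ x = IsRefl x × InSub r t x × (∀ t′ → IsRefl t′ → InSub r t t′ → len (t′ · x) < len x → t′ ≡ x)

      Generated : W → Set
      Generated x = Σ (List W) λ xs → All χ xs × prod xs ≡ x

      Generated-· : ∀ {x y} → Generated x → Generated y → Generated (x · y)
      Generated-· ([] , [] , refl) g = subst Generated (sym (identityˡ _)) g
      Generated-· (z ∷ xs , χz ∷ χxs , refl) g with Generated-· (xs , χxs , refl) g
      ... | zs , χzs , eq = z ∷ zs , χz ∷ χzs , trans (cong (z ·_) eq) (sym (assoc _ _ _))

      -- Induction on the length of w. An inversion y of w inside ⟨r,t⟩ is a conjugate of a simple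
      -- generator by a shorter element, and so is y t₀ y = (yw)s(yw)⁻¹; hence t₀ = y(y t₀ y)y is
      -- generated. If there is no such y, `N-conj-gen` shows that t₀ has no inversion in ⟨r,t⟩
      -- except itself. The existence of y is not decided, hence the double negation.
      generated : ∀ n w {s} → S s → len w < n → InSub r t (w · s · w ⁻¹) → ¬ ¬ Generated (w · s · w ⁻¹)
      generated (suc n) w {s} Ss (s≤s w≤n) i k = k (t₀ ∷ [] , (R₀ , i , minimal) ∷ [] , identityʳ _)
        where
        t₀ = w · s · w ⁻¹
        R₀ : IsRefl t₀
        R₀ = w , s , Ss , refl
        shorter : ∀ {y} → InSub r t y → N w y ≡ true → ⊥
        shorter {y} iy eq with N⇒presentation eq
        ... | x , s′ , Ss′ , refl , l =
          generated n x Ss′ (ℕP.<-≤-trans l w≤n) iy λ gy →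
          generated n (y · w) Ss (ℕP.<-≤-trans (N⇒< eq) w≤n) (subst (InSub r t) conj (D.InSub-· (D.InSub-· iy i) iy)) λ gz →
          k (subst Generated back (Generated-· (Generated-· gy gz) gy))
          where
          Ry : IsRefl y
          Ry = N⇒refl eq
          conj : y · t₀ · y ≡ y · w · s · (y · w) ⁻¹
          conj = grp (w ∷ s ∷ []) ((y , refl-invol Ry) ∷ [])
            (ivar 0 ⊙ (var 0 ⊙ var 1 ⊙ var 0 ⁻) ⊙ ivar 0) (ivar 0 ⊙ var 0 ⊙ var 1 ⊙ (ivar 0 ⊙ var 0) ⁻) refl
          back : y · (y · w · s · (y · w) ⁻¹) · y ≡ t₀
          back = grp (w ∷ s ∷ []) ((y , refl-invol Ry) ∷ [])
            (ivar 0 ⊙ (ivar 0 ⊙ var 0 ⊙ var 1 ⊙ (ivar 0 ⊙ var 0) ⁻) ⊙ ivar 0) (var 0 ⊙ var 1 ⊙ var 0 ⁻) refl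
        minimal : ∀ t′ → IsRefl t′ → InSub r t t′ → len (t′ · t₀) < len t₀ → t′ ≡ t₀
        minimal t′ R′ i′ l with t′ ≟W t₀
        ... | yes p = p
        ... | no ne with N w t′ in eq₁ | N w (t₀ · t′ · t₀) in eq₂
        ... | true | _ = ⊥-elim (shorter i′ eq₁)
        ... | false | true = ⊥-elim (shorter (D.InSub-· (D.InSub-· i i′) i) eq₂)
        ... | false | false = ⊥-elim (true≢false (trans (sym (<⇒N R′ l)) (trans (N-conj-gen w Ss t′)
              (cong₂ _xor_ (cong₂ _xor_ eq₁ (dec-false (t′ ≟W t₀) ne)) eq₂))))

      generated-refl : ∀ {x} → IsRefl x → InSub r t x → ¬ ¬ Generated x
      generated-refl (w , s , Ss , refl) i = generated (suc (len w)) w Ss ℕP.≤-refl i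

      N-χ : ∀ {x} → χ x → ∀ {y} → IsRefl y → InSub r t y → y ≢ x → N x y ≡ false
      N-χ (Rx , ix , min) Ry iy ne = ¬-not λ eq → ne (min _ Ry iy (N⇒< eq))

      -- the reflection bac would have none of b, bab, bacab as an inversion, not even itself
      no-three : ∀ {a b c} → χ a → χ b → χ c → a ≢ b → b ≢ c → a ≢ c → ⊥
      no-three {a} {b} {c} χa@(Ra , ia , _) χb@(Rb , ib , _) χc@(Rc , ic , _) a≢b b≢c a≢c =
        true≢false (trans (sym (N-self Rx)) (trans (N-refl· Rb (a · c) x) (cong₂ _xor_ (N-χ χb Rx ix x≢b)
          (trans (N-refl· Ra c _) (cong₂ _xor_ (N-χ χa (refl-conj-refl Rb Rx) (ix′ ib ix) x≢bab) (N-χ χc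
            (refl-conj-refl Ra (refl-conj-refl Rb Rx)) (ix′ ia (ix′ ib ix)) x≢bacab))))))
        where
        x = b · (a · c)
        ix : InSub r t x
        ix = D.InSub-· ib (D.InSub-· ia ic)
        ix′ : ∀ {y z} → InSub r t y → InSub r t z → InSub r t (y · z · y)
        ix′ iy iz = D.InSub-· (D.InSub-· iy iz) iy
        Rx : IsRefl x
        Rx = D.odd-refl ix (trans (par-· _ _) (cong₂ _xor_ (par-refl Rb) (trans (par-· _ _) (cong₂ _xor_ (par-refl Ra) (par-refl Rc)))))
        ι = (a , refl-invol Ra) ∷ (b , refl-invol Rb) ∷ (c , refl-invol Rc) ∷ []
        A = ivar 0
        B = ivar 1
        C′ = ivar 2
        x≢b : x ≢ b
        x≢b eq = a≢c (trans (grp [] ι A (B ⊙ (B ⊙ (A ⊙ C′)) ⊙ C′) refl) (trans (cong (λ z → b · z · c) eq) (grp [] ι (B ⊙ B ⊙ C′) C′ refl)))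
        x≢bab : b · x · b ≢ a
        x≢bab eq = b≢c (sym (trans (grp [] ι C′ (A ⊙ (B ⊙ (B ⊙ (A ⊙ C′)) ⊙ B) ⊙ B) refl) (trans (cong (λ z → a · z · b) eq) (grp [] ι (A ⊙ A ⊙ B) B refl))))
        x≢bacab : a · (b · x · b) · a ≢ c
        x≢bacab eq = a≢b (sym (trans (grp [] ι B (C′ ⊙ (A ⊙ (B ⊙ (B ⊙ (A ⊙ C′)) ⊙ B) ⊙ A) ⊙ A) refl) (trans (cong (λ z → c · z · a) eq) (grp [] ι (C′ ⊙ C′ ⊙ A) A refl))))

      all-equal : ∀ {a x} → IsRefl a → IsRefl x → ∀ {xs} → All (_≡ a) xs → prod xs ≡ x → x ≡ a
      all-equal {a} {x} Ra Rx {xs} eqs eq with powers xs eqs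
        where
        powers : ∀ xs → All (_≡ a) xs → prod xs ≡ e ⊎ prod xs ≡ a
        powers [] [] = inj₁ refl
        powers (_ ∷ xs) (refl ∷ eqs) with powers xs eqs
        ... | inj₁ p = inj₂ (trans (cong (a ·_) p) (identityʳ a))
        ... | inj₂ p = inj₁ (trans (cong (a ·_) p) (refl-invol Ra))
      ... | inj₁ p = ⊥-elim (true≢false (trans (sym (par-refl Rx)) (trans (cong par (trans (sym eq) p)) par-e)))
      ... | inj₂ p = trans (sym eq) p

      differ : ∀ a {xs} → All χ xs → All (_≡ a) xs ⊎ (Σ W λ b → χ b × b ≢ a)
      differ a [] = inj₁ []
      differ a (_∷_ {x} χx χxs) with x ≟W a
      ... | no ne = inj₂ (x , χx , ne)
      ... | yes p with differ a χxs
      ... | inj₁ ps = inj₁ (p ∷ ps)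
      ... | inj₂ q = inj₂ q

      -- By `no-three` every letter of the product is a or b.
      InSub-generated : ∀ {a b} → χ a → χ b → a ≢ b → ∀ {xs} → All χ xs → InSub a b (prod xs)
      InSub-generated χa χb a≢b [] = [] , refl
      InSub-generated {a} {b} χa χb a≢b (_∷_ {x} χx χxs) with InSub-generated χa χb a≢b χxs | x ≟W a | x ≟W b
      ... | bs , eq | yes p | _ = true ∷ bs , cong₂ _·_ (sym p) eq
      ... | bs , eq | no _ | yes p = false ∷ bs , cong₂ _·_ (sym p) eq
      ... | _ | no p | no q = ⊥-elim (no-three χa χb χx a≢b (q ∘ sym) (p ∘ sym))

      InSub-trans : ∀ {a b} → χ a → χ b → ∀ {x} → InSub a b x → InSub r t x
      InSub-trans (_ , ia , _) (_ , ib , _) ([] , refl) = [] , refl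
      InSub-trans χa@(_ , ia , _) χb (true ∷ bs , refl) = D.InSub-· ia (InSub-trans χa χb (bs , refl))
      InSub-trans χa χb@(_ , ib , _) (false ∷ bs , refl) = D.InSub-· ib (InSub-trans χa χb (bs , refl))

    canonical-generators : ¬ ¬ (Σ W λ a → Σ W λ b → DihedralCanon a b × InSub a b r × InSub a b t)
    canonical-generators k =
      generated-refl Rr (true ∷ [] , identityʳ r) λ { (xs , χxs , xs≡r) →
      generated-refl Rt (false ∷ [] , identityʳ t) λ { (ys , χys , ys≡t) → finish xs χxs xs≡r ys χys ys≡t } }
      where
      build : ∀ {a b} → χ a → χ b → a ≢ b → ∀ {xs ys} → All χ xs → prod xs ≡ r → All χ ys → prod ys ≡ t → ⊥
      build {a} {b} χa χb a≢b χxs xs≡r χys ys≡t = k (a , b ,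
        (proj₁ χa , proj₁ χb , a≢b ,
          (λ t′ R i → proj₂ (proj₂ χa) t′ R (InSub-trans χa χb i)) , (λ t′ R i → proj₂ (proj₂ χb) t′ R (InSub-trans χa χb i))) ,
        subst (InSub a b) xs≡r (InSub-generated χa χb a≢b χxs) ,
        subst (InSub a b) ys≡t (InSub-generated χa χb a≢b χys))

      finish : ∀ xs → All χ xs → prod xs ≡ r → ∀ ys → All χ ys → prod ys ≡ t → ⊥
      finish [] _ e≡r _ _ _ = true≢false (trans (sym (par-refl Rr)) (trans (cong par (sym e≡r)) par-e))
      finish xs@(a ∷ _) χxs@(χa ∷ _) xs≡r ys χys ys≡t with differ a χxs | differ a χys
      -- If every letter of both words were a, then r = a = t.
      ... | inj₁ p | inj₁ q = r≢t (trans (all-equal (proj₁ χa) Rr p xs≡r) (sym (all-equal (proj₁ χa) Rt q ys≡t)))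
      ... | inj₂ (b , χb , b≢a) | _ = build χa χb (b≢a ∘ sym) χxs xs≡r χys ys≡t
      ... | inj₁ _ | inj₂ (b , χb , b≢a) = build χa χb (b≢a ∘ sym) χxs xs≡r χys ys≡t

-- Finite sums

infixr 8 _▹_

_▹_ : Bool → ℤ → ℤ
b ▹ z = if b then z else 0ℤ

▹-+ : ∀ b x y → b ▹ (x +ᶻ y) ≡ b ▹ x +ᶻ b ▹ y
▹-+ true x y = refl
▹-+ false x y = refl

▹-- : ∀ b x y → b ▹ (x -ᶻ y) ≡ b ▹ x -ᶻ b ▹ y
▹-- true x y = refl
▹-- false x y = refl

▹-zero : ∀ b → b ▹ 0ℤ ≡ 0ℤ
▹-zero true = refl
▹-zero false = refl

▹-∧ : ∀ a b x → (a ∧ b) ▹ x ≡ a ▹ (b ▹ x)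
▹-∧ true b x = refl
▹-∧ false b x = refl

▹-* : ∀ b x → b ▹ x ≡ (b ▹ 1ℤ) *ᶻ x
▹-* true x = sym (ℤP.*-identityˡ x)
▹-* false x = sym (ℤP.*-zeroˡ x)

▹-*ʳ : ∀ b x y → b ▹ (x *ᶻ y) ≡ x *ᶻ (b ▹ y)
▹-*ʳ true x y = refl
▹-*ʳ false x y = sym (ℤP.*-zeroʳ x)

+-interchange : ∀ a b c d → (a +ᶻ b) +ᶻ (c +ᶻ d) ≡ (a +ᶻ c) +ᶻ (b +ᶻ d)
+-interchange = ℤSolver.solve-∀

module _ {A : Set} where
  ∑ : List A → (A → ℤ) → ℤ
  ∑ xs f = sumℤ (map f xs)

  ∑-cong : ∀ xs {f g} → (∀ {x} → x ∈ xs → f x ≡ g x) → ∑ xs f ≡ ∑ xs g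
  ∑-cong [] h = refl
  ∑-cong (x ∷ xs) h = cong₂ _+ᶻ_ (h (here refl)) (∑-cong xs (h ∘ there))

  ∑-zero : ∀ xs {f} → (∀ {x} → x ∈ xs → f x ≡ 0ℤ) → ∑ xs f ≡ 0ℤ
  ∑-zero [] h = refl
  ∑-zero (x ∷ xs) h = cong₂ _+ᶻ_ (h (here refl)) (∑-zero xs (h ∘ there))

  ∑-+ : ∀ xs f g → ∑ xs (λ x → f x +ᶻ g x) ≡ ∑ xs f +ᶻ ∑ xs g
  ∑-+ [] f g = refl
  ∑-+ (x ∷ xs) f g = trans (cong (f x +ᶻ g x +ᶻ_) (∑-+ xs f g)) (+-interchange (f x) (g x) _ _)

  ∑-* : ∀ c xs f → ∑ xs (λ x → c *ᶻ f x) ≡ c *ᶻ ∑ xs f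
  ∑-* c [] f = sym (ℤP.*-zeroʳ c)
  ∑-* c (x ∷ xs) f = trans (cong (c *ᶻ f x +ᶻ_) (∑-* c xs f)) (sym (ℤP.*-distribˡ-+ c (f x) _))

  ∑-*ʳ : ∀ c xs f → ∑ xs (λ x → f x *ᶻ c) ≡ ∑ xs f *ᶻ c
  ∑-*ʳ c xs f = trans (∑-cong xs λ {x} _ → ℤP.*-comm (f x) c) (trans (∑-* c xs f) (ℤP.*-comm c _))

  ∑-▹ : ∀ b xs f → ∑ xs (λ x → b ▹ f x) ≡ b ▹ ∑ xs f
  ∑-▹ true xs f = refl
  ∑-▹ false xs f = ∑-zero xs λ _ → refl

  ∑-++ : ∀ xs ys f → ∑ (xs ++ ys) f ≡ ∑ xs f +ᶻ ∑ ys f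
  ∑-++ [] ys f = sym (ℤP.+-identityˡ _)
  ∑-++ (x ∷ xs) ys f = trans (cong (f x +ᶻ_) (∑-++ xs ys f)) (sym (ℤP.+-assoc (f x) _ _))

  ∑-filter : ∀ {P : A → Set} (P? : ∀ x → Dec (P x)) xs f → ∑ (filter P? xs) f ≡ ∑ xs (λ x → does (P? x) ▹ f x)
  ∑-filter P? [] f = refl
  ∑-filter P? (x ∷ xs) f with P? x
  ... | yes _ = cong (f x +ᶻ_) (∑-filter P? xs f)
  ... | no _ = trans (∑-filter P? xs f) (sym (ℤP.+-identityˡ _))

module _ {A B : Set} where
  ∑-map : ∀ (g : A → B) xs f → ∑ (map g xs) f ≡ ∑ xs (f ∘ g)
  ∑-map g [] f = refl
  ∑-map g (x ∷ xs) f = cong (f (g x) +ᶻ_) (∑-map g xs f)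

  ∑-concatMap : ∀ (g : A → List B) xs f → ∑ (concatMap g xs) f ≡ ∑ xs (λ x → ∑ (g x) f)
  ∑-concatMap g [] f = refl
  ∑-concatMap g (x ∷ xs) f = trans (∑-++ (g x) _ f) (cong (∑ (g x) f +ᶻ_) (∑-concatMap g xs f))

  ∑-swap : ∀ (xs : List A) (ys : List B) (f : A → B → ℤ) → ∑ xs (λ x → ∑ ys (f x)) ≡ ∑ ys (λ y → ∑ xs (λ x → f x y))
  ∑-swap [] ys f = sym (∑-zero ys λ _ → refl)
  ∑-swap (x ∷ xs) ys f = trans (cong (∑ ys (f x) +ᶻ_) (∑-swap xs ys f)) (sym (∑-+ ys (f x) (λ y → ∑ xs (λ x′ → f x′ y))))

module _ {A : Set} (_≟_ : DecidableEquality A) where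
  ∑-δ-∉ : ∀ x ys (f : A → ℤ) → x ∉ ys → ∑ ys (λ y → does (x ≟ y) ▹ f y) ≡ 0ℤ
  ∑-δ-∉ x ys f x∉ = ∑-zero ys λ {y} y∈ → cong (_▹ f y) (dec-false (x ≟ y) λ { refl → x∉ y∈ })

  ∑-δ : ∀ {x ys} (f : A → ℤ) → Unique ys → x ∈ ys → ∑ ys (λ y → does (x ≟ y) ▹ f y) ≡ f x
  ∑-δ {x} {y ∷ ys} f (y∉ ∷ u) (here refl) = trans (cong₂ _+ᶻ_ (cong (_▹ f x) (dec-true (x ≟ x) refl))
    (∑-δ-∉ x ys f λ x∈ → All.lookup y∉ x∈ refl)) (ℤP.+-identityʳ _)
  ∑-δ {x} {y ∷ ys} f (y∉ ∷ u) (there x∈) = trans (cong₂ _+ᶻ_ (cong (_▹ f y) (dec-false (x ≟ y)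
    λ { refl → All.lookup y∉ x∈ refl })) (∑-δ f u x∈)) (ℤP.+-identityˡ _)

  -- Both sums equal the double sum of f over the pairs x = y, taken in either order.
  ∑-support : ∀ {xs ys} (f : A → ℤ) → Unique xs → Unique ys →
    (∀ {x} → x ∈ xs → x ∉ ys → f x ≡ 0ℤ) → (∀ {x} → x ∈ ys → x ∉ xs → f x ≡ 0ℤ) → ∑ xs f ≡ ∑ ys f
  ∑-support {xs} {ys} f uxs uys h₁ h₂ = begin
    ∑ xs f                                              ≡⟨ ∑-cong xs expand ⟨
    ∑ xs (λ x → ∑ ys (λ y → does (x ≟ y) ▹ f y))        ≡⟨ ∑-swap xs ys _ ⟩
    ∑ ys (λ y → ∑ xs (λ x → does (x ≟ y) ▹ f y))        ≡⟨ ∑-cong ys (λ {y} y∈ → trans (∑-cong xs (λ {x} _ → flip-≟ x y)) (contract y∈)) ⟩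
    ∑ ys f ∎
    where
    open ≡-Reasoning
    _∈?_ = DecMem._∈?_ _≟_
    expand : ∀ {x} → x ∈ xs → ∑ ys (λ y → does (x ≟ y) ▹ f y) ≡ f x
    expand {x} x∈ with x ∈? ys
    ... | yes x∈ys = ∑-δ f uys x∈ys
    ... | no x∉ys = trans (∑-δ-∉ x ys f x∉ys) (sym (h₁ x∈ x∉ys))
    flip-≟ : ∀ x y → does (x ≟ y) ▹ f y ≡ does (y ≟ x) ▹ f x
    flip-≟ x y with x ≟ y
    ... | yes refl = cong (_▹ f x) (sym (dec-true (x ≟ x) refl))
    ... | no ne = cong (_▹ f x) (sym (dec-false (y ≟ x) (ne ∘ sym)))
    contract : ∀ {y} → y ∈ ys → ∑ xs (λ x → does (y ≟ x) ▹ f x) ≡ f y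
    contract {y} y∈ with y ∈? xs
    ... | yes y∈xs = ∑-δ f uxs y∈xs
    ... | no y∉xs = trans (∑-δ-∉ y xs f y∉xs) (sym (h₂ y∈ y∉xs))

  ∑-unique : ∀ {xs ys} (f : A → ℤ) → Unique xs → Unique ys →
    (∀ {x} → x ∈ xs → x ∈ ys) → (∀ {x} → x ∈ ys → x ∈ xs) → ∑ xs f ≡ ∑ ys f
  ∑-unique f u v h₁ h₂ = ∑-support f u v (λ x∈ x∉ → ⊥-elim (x∉ (h₁ x∈))) (λ x∈ x∉ → ⊥-elim (x∉ (h₂ x∈)))

-- Reflection orders

xor-true⇒ : ∀ {a b} → a xor b ≡ true → b ≡ not a
xor-true⇒ {true} {false} eq = refl
xor-true⇒ {false} {true} eq = refl

module ReflectionOrders (C : CoxeterSystem) (len : CoxeterSystem.W C → ℕ) (isLen : CoxDefs.IsLength C len) where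
  open Inversions C len isLen public
  open Dihedral C len isLen

  trt≢t : ∀ {r t} → IsRefl t → r ≢ t → t · r · t ≢ t
  trt≢t {r} {t} Rt r≢t eq = r≢t (trans (grp (r ∷ []) ((t , refl-invol Rt) ∷ [])
    (var 0) (ivar 0 ⊙ (ivar 0 ⊙ var 0 ⊙ ivar 0) ⊙ ivar 0) refl) (trans (cong (λ z → t · z · t) eq) (invol-conj-self (refl-invol Rt))))

  -- separated: r is an inversion of t iff t lies strictly between r and trt
  record ReflectionOrder (lt : W → W → Bool) : Set where
    field
      lt-irrefl : ∀ t → lt t t ≡ false
      lt-total  : ∀ {s t} → IsRefl s → IsRefl t → s ≢ t → lt t s ≡ not (lt s t)
      lt-trans  : ∀ {s t u} → IsRefl s → IsRefl t → IsRefl u → lt s t ≡ true → lt t u ≡ true → lt s u ≡ true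
      separated : ∀ {r t} → IsRefl r → IsRefl t → r ≢ t → N t r ≡ lt r t xor lt (t · r · t) t

    lt-asym : ∀ {s t} → IsRefl s → IsRefl t → lt s t ≡ true → lt t s ≡ false
    lt-asym {s} {t} Rs Rt eq = ¬-not λ eq′ → true≢false (trans (sym (lt-trans Rs Rt Rs eq eq′)) (lt-irrefl s))

  -- Reversal complements both terms of the exclusive or in `separated`, which leaves its value
  -- unchanged.
  flip-order : ∀ {lt} → ReflectionOrder lt → ReflectionOrder (flip lt)
  flip-order {lt} O = record
    { lt-irrefl = lt-irrefl
    ; lt-total = λ Rs Rt ne → lt-total Rt Rs (ne ∘ sym)
    ; lt-trans = λ Rs Rt Ru p q → lt-trans Ru Rt Rs q p
    ; separated = λ {r} {t} Rr Rt ne → trans (separated Rr Rt ne) (sym (trans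
        (cong₂ _xor_ (lt-total Rr Rt ne) (lt-total (refl-conj-refl Rt Rr) Rt (trt≢t Rt ne)))
        (not-xor-not (lt r t) _)))
    }
    where
    open ReflectionOrder O
    not-xor-not : ∀ a b → not a xor not b ≡ a xor b
    not-xor-not true b = refl
    not-xor-not false true = refl
    not-xor-not false false = refl

  module Decide (_<T_ : W → W → Set) (isRO : IsReflOrder _<T_) where
    private
      irr = proj₁ isRO
      tra = proj₁ (proj₂ isRO)
      tot = proj₁ (proj₂ (proj₂ isRO))
      pat = proj₂ (proj₂ (proj₂ isRO))

    -- The hypotheses on the order concern reflections only. The default `false` elsewhere makes the
    -- value `true` a certificate that both arguments are reflections.
    lt : W → W → Bool
    lt s t with refl? s | refl? t | s ≟W t
    ... | yes Rs | yes Rt | no ne with tot s t Rs Rt ne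
    ... | inj₁ _ = true
    ... | inj₂ _ = false
    lt s t | yes _ | yes _ | yes _ = false
    lt s t | yes _ | no _ | _ = false
    lt s t | no _ | _ | _ = false

    lt⇒< : ∀ {s t} → lt s t ≡ true → s <T t
    lt⇒< {s} {t} eq with refl? s | refl? t | s ≟W t
    ... | yes Rs | yes Rt | no ne with tot s t Rs Rt ne
    ... | inj₁ p = p

    lt⇒refl : ∀ {s t} → lt s t ≡ true → IsRefl s
    lt⇒refl {s} {t} eq with refl? s
    ... | yes Rs = Rs

    <⇒lt : ∀ {s t} → IsRefl s → IsRefl t → s <T t → lt s t ≡ true
    <⇒lt {s} {t} Rs Rt s<t with refl? s | refl? t | s ≟W t
    ... | no n | _ | _ = ⊥-elim (n Rs)
    ... | yes _ | no n | _ = ⊥-elim (n Rt)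
    ... | yes _ | yes _ | yes refl = ⊥-elim (irr s Rs s<t)
    ... | yes Rs′ | yes Rt′ | no ne with tot s t Rs′ Rt′ ne
    ... | inj₁ _ = refl
    ... | inj₂ t<s = ⊥-elim (irr s Rs (tra s t s Rs Rt Rs s<t t<s))

    ≮⇒lt : ∀ {s t} → IsRefl s → IsRefl t → t <T s → lt s t ≡ false
    ≮⇒lt Rs Rt t<s = ¬-not λ eq → irr _ Rs (tra _ _ _ Rs Rt Rs (lt⇒< eq) t<s)

    order : ReflectionOrder lt
    order = record
      { lt-irrefl = λ t → ¬-not (irrefl t)
      ; lt-total = total
      ; lt-trans = λ Rs Rt Ru p q → <⇒lt Rs Ru (tra _ _ _ Rs Rt Ru (lt⇒< p) (lt⇒< q))
      -- An equation of Booleans is stable under double negation, which absorbs the double negations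
      -- in `canonical-generators` and in `Separation`.
      ; separated = λ {r} {t} Rr Rt ne → decidable-stable (N t r ≟B (lt r t xor lt (t · r · t) t)) λ k →
          canonical-generators r t Rr Rt ne λ { (a , b , can , ir , it) →
            sep Rr Rt (Pair.Canonical.separation-canonical a b (proj₁ can) (proj₁ (proj₂ can)) can {_<T_} (pat a b can) Rr Rt ir it ne) k }
      }
      where
      irrefl : ∀ t → lt t t ≢ true
      irrefl t eq = irr t (lt⇒refl eq) (lt⇒< eq)
      total : ∀ {s t} → IsRefl s → IsRefl t → s ≢ t → lt t s ≡ not (lt s t)
      total {s} {t} Rs Rt ne with tot s t Rs Rt ne
      ... | inj₁ s<t = trans (≮⇒lt Rt Rs s<t) (cong not (sym (<⇒lt Rs Rt s<t)))
      ... | inj₂ t<s = trans (<⇒lt Rt Rs t<s) (cong not (sym (≮⇒lt Rs Rt t<s)))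
      sep : ∀ {r t} → IsRefl r → IsRefl t →
        ((N t r ≡ true → (r <T t × t <T (t · r · t)) ⊎ (t <T r × (t · r · t) <T t)) ×
         (N t r ≡ false → ¬ ¬ ((r <T t × (t · r · t) <T t) ⊎ (t <T r × t <T (t · r · t))))) →
        ¬ ¬ (N t r ≡ lt r t xor lt (t · r · t) t)
      sep {r} {t} Rr Rt (f , g) k with N t r
      ... | true with f refl
      ... | inj₁ (p , q) = k (sym (cong₂ _xor_ (<⇒lt Rr Rt p) (≮⇒lt (refl-conj-refl Rt Rr) Rt q)))
      ... | inj₂ (p , q) = k (sym (cong₂ _xor_ (≮⇒lt Rr Rt p) (<⇒lt (refl-conj-refl Rt Rr) Rt q)))
      sep {r} {t} Rr Rt (f , g) k | false = g refl λ
        { (inj₁ (p , q)) → k (sym (cong₂ _xor_ (<⇒lt Rr Rt p) (<⇒lt (refl-conj-refl Rt Rr) Rt q)))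
        ; (inj₂ (p , q)) → k (sym (cong₂ _xor_ (≮⇒lt Rr Rt p) (≮⇒lt (refl-conj-refl Rt Rr) Rt q))) }

-- Counting increasing paths

module Counting (C : CoxeterSystem) (len : CoxeterSystem.W C → ℕ) (isLen : CoxDefs.IsLength C len)
                (lt : CoxeterSystem.W C → CoxeterSystem.W C → Bool)
                (O : ReflectionOrders.ReflectionOrder C len isLen lt) where
  open ReflectionOrders C len isLen
  open ReflectionOrder O

  below : Maybe W → W → Bool
  below nothing t = true
  below (just c) t = lt t c

  -- G n u w c is the number of increasing paths of length n from u to w all of
  -- whose labels lie below c; the recursion removes the last edge tw → w.
  G : ℕ → W → W → Maybe W → ℤ
  G zero u w c = (u == w) ▹ 1ℤ
  G (suc n) u w c = ∑ (Inv w) λ t → below c t ▹ G n u (t · w) (just t)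

  -- coefficients of q · Σₙ G n qⁿ
  qG : ℕ → W → W → Maybe W → ℤ
  qG zero u w c = 0ℤ
  qG (suc n) u w c = G n u w c

  ∑-Inv-ascent : ∀ w {s} → S s → N w (right w s) ≡ false → ∀ f →
    ∑ (Inv (w · s)) f ≡ f (right w s) +ᶻ ∑ (Inv w) f
  ∑-Inv-ascent w {s} Ss asc f = ∑-unique _≟W_ {ys = r ∷ Inv w} f (Inv-unique (w · s)) (All.tabulate fresh ∷ Inv-unique w) to from
    where
    r = right w s
    fresh : ∀ {t} → t ∈ Inv w → r ≢ t
    fresh t∈ refl = true≢false (trans (sym (Inv⇒N t∈)) asc)
    to : ∀ {t} → t ∈ Inv (w · s) → t ∈ r ∷ Inv w
    to {t} t∈ with t ≟W r | N-·gen w Ss t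
    ... | yes p | _ = here p
    ... | no np | eq = there (N⇒Inv (trans (sym (xor-identityʳ _)) (trans (sym eq) (Inv⇒N t∈))))
    from : ∀ {t} → t ∈ r ∷ Inv w → t ∈ Inv (w · s)
    from (here refl) = N⇒Inv (trans (descent-flip w Ss) (cong not asc))
    from {t} (there t∈) = N⇒Inv (trans (N-·gen w Ss t) (cong₂ _xor_ (Inv⇒N t∈) (dec-false (t ≟W r) (fresh t∈ ∘ sym))))

  module Ladder (a s : W) (Ss : S s) (asc : N a (right a s) ≡ false) where
    private
      b : W
      b = a · s

    -- The two cases of the recursion of R̃, with lower element b or a, refined by a bound on the
    -- labels. They are proved together because the inductive step exchanges w and w′ at some labels
    -- and thereby mixes them.
    Rel : ℕ → W → W → Maybe W → Set
    Rel n w w′ c = G n a w c ≡ G n b w′ c × G n a w′ c ≡ G n b w c +ᶻ qG n a w c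

    ReflBound : Maybe W → Set
    ReflBound nothing = ⊥ → ⊥
    ReflBound (just c) = IsRefl c

    below-trans : ∀ c {t r} → ReflBound c → IsRefl t → IsRefl r → lt t r ≡ true → below c r ≡ true → below c t ≡ true
    below-trans nothing _ _ _ _ _ = refl
    below-trans (just c) Rc Rt Rr p q = lt-trans Rt Rr Rc p q

    -- The side condition says that a final step from w up to w′ is admissible under c, or that one
    -- from w′ up to w is not. Paths are sorted by their last label t. For t ≠ r the elements tw and
    -- tw′ again differ by s on the right, with trt in place of r, and `separated` turns the side
    -- condition for them, under the bound t, into `N w r xor lt r t`; where this fails, the
    -- condition holds with tw and tw′ exchanged. The label t = r joins w and w′ themselves and
    -- accounts for the terms left over.
    ladder : ∀ n w {w′} c → ReflBound c → w′ ≡ w · s → N w (right w s) xor below c (right w s) ≡ true → Rel n w w′ c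
    ladder zero w c _ refl _ =
      cong (_▹ 1ℤ) (==-⇔ (cong (_· s)) (∙-cancelʳ s _ _)) ,
      trans (cong (_▹ 1ℤ) (==-⇔ (λ eq → trans (cong (_· s) eq) (·gen·gen w Ss)) (λ eq → trans (sym (·gen·gen a Ss)) (cong (_· s) eq))))
        (sym (ℤP.+-identityʳ _))
    ladder (suc n) w {.(w · s)} c Rc refl cond = result (N w r) refl
      where
      w′ = w · s
      r = right w s
      Rr = right-refl w Ss
      right-t· : ∀ {t} → IsRefl t → right (t · w) s ≡ t · r · t
      right-t· {t} Rt = grp (w ∷ s ∷ []) ((t , refl-invol Rt) ∷ [])
        (ivar 0 ⊙ var 0 ⊙ var 1 ⊙ (ivar 0 ⊙ var 0) ⁻) (ivar 0 ⊙ (var 0 ⊙ var 1 ⊙ var 0 ⁻) ⊙ ivar 0) refl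
      flip-side : ∀ {t} → IsRefl t → t ≢ r → N (t · w) (t · r · t) xor lt (t · r · t) t ≡ N w r xor lt r t
      flip-side {t} Rt t≢r = begin
        N (t · w) r′ xor lt r′ t                              ≡⟨ cong (_xor lt r′ t) (N-refl· Rt w r′) ⟩
        (N t r′ xor N w (t · r′ · t)) xor lt r′ t             ≡⟨ cong₂ (λ x y → (x xor N w y) xor lt r′ t) (N-conj-self Rt)
                                                                (grp (r ∷ []) ((t , refl-invol Rt) ∷ []) (ivar 0 ⊙ (ivar 0 ⊙ var 0 ⊙ ivar 0) ⊙ ivar 0) (var 0) refl) ⟩
        (N t r xor N w r) xor lt r′ t                         ≡⟨ cong (λ x → (x xor N w r) xor lt r′ t) (separated Rr Rt (t≢r ∘ sym)) ⟩
        ((lt r t xor lt r′ t) xor N w r) xor lt r′ t          ≡⟨ rearrange (lt r t) (lt r′ t) (N w r) ⟩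
        N w r xor lt r t ∎
        where
        open ≡-Reasoning
        r′ = t · r · t
        rearrange : ∀ x y z → ((x xor y) xor z) xor y ≡ z xor x
        rearrange true true true = refl
        rearrange true true false = refl
        rearrange true false true = refl
        rearrange true false false = refl
        rearrange false true true = refl
        rearrange false true false = refl
        rearrange false false true = refl
        rearrange false false false = refl
        N-conj-self : ∀ {t} → IsRefl t → N t (t · r · t) ≡ N t r
        N-conj-self {t} Rt = trans (cong₂ (λ y z → N y (z · r · t)) (sym (invol⁻¹ (refl-invol Rt))) (sym (invol⁻¹ (refl-invol Rt)))) (N-⁻¹ t r)
      straight : ∀ {t} → IsRefl t → t ≢ r → N w r xor lt r t ≡ true → Rel n (t · w) (t · w′) (just t)
      straight {t} Rt t≢r eq = ladder n (t · w) (just t) Rt (sym (assoc t w s))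
        (trans (cong (λ x → N (t · w) x xor lt x t) (right-t· Rt)) (trans (flip-side Rt t≢r) eq))
      crossed : ∀ {t} → IsRefl t → t ≢ r → N w r xor lt r t ≡ false → Rel n (t · w′) (t · w) (just t)
      crossed {t} Rt t≢r eq = ladder n (t · w′) (just t) Rt (trans (cong (t ·_) (sym (·gen·gen w Ss))) (sym (assoc t w′ s)))
        (trans (cong (λ x → N (t · w′) x xor lt x t) (trans (trans (cong (λ x → right x s) (sym (assoc t w s))) (right-·gen (t · w) Ss)) (right-t· Rt)))
          (trans (cong (_xor lt (t · r · t) t) flipped) (trans (not-xor (N (t · w) (t · r · t)) _) (cong not (trans (flip-side Rt t≢r) eq)))))
        where
        flipped : N (t · w′) (t · r · t) ≡ not (N (t · w) (t · r · t))
        flipped = trans (cong₂ N (sym (assoc t w s)) (sym (right-t· Rt)))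
          (trans (descent-flip (t · w) Ss) (cong (not ∘ N (t · w)) (right-t· Rt)))
      b-side : N b (right b s) ≡ true
      b-side = trans (cong (N b) (right-·gen a Ss)) (trans (descent-flip a Ss) (cong not asc))

      result : ∀ x → N w r ≡ x → Rel (suc n) w w′ c
      result false Nwr = first , second
        where
        open ≡-Reasoning
        cr : below c r ≡ true
        cr = subst (λ x → x xor below c r ≡ true) Nwr cond
        Inv≢r : ∀ {t} → t ∈ Inv w → t ≢ r
        Inv≢r t∈ refl = true≢false (trans (sym (Inv⇒N t∈)) Nwr)
        cond′ : ∀ {t} → N w r xor lt r t ≡ lt r t
        cond′ {t} = cong (_xor lt r t) Nwr
        -- A path of length 0 would force b = w, but s is a descent of b and not of w.
        not-b : ∀ n → n ≡ 0 → G n b w (just r) ≡ 0ℤ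
        not-b .0 refl = cong (_▹ 1ℤ) (dec-false (b ≟W w) λ { refl → true≢false (trans (sym b-side) Nwr) })
        -- The surplus terms arise at the labels below r, where w and w′ are exchanged. Together
        -- they count the paths from b to w that can be continued by the edge labelled r up to w′.
        lower-sum : ∀ n → (∀ w {w′} c → ReflBound c → w′ ≡ w · s → N w (right w s) xor below c (right w s) ≡ true → Rel n w w′ c) →
          ∑ (Inv w) (λ t → lt t r ▹ qG n a (t · w′) (just t)) ≡ G n b w (just r)
        lower-sum zero _ = trans (∑-zero (Inv w) λ {t} _ → ▹-zero (lt t r)) (sym (not-b 0 refl))
        lower-sum (suc m) ih = begin
          ∑ (Inv w) f                  ≡⟨ ℤP.+-identityˡ _ ⟨
          0ℤ +ᶻ ∑ (Inv w) f            ≡⟨ cong (λ x → x ▹ G m a (r · w′) (just r) +ᶻ ∑ (Inv w) f) (lt-irrefl r) ⟨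
          f r +ᶻ ∑ (Inv w) f           ≡⟨ ∑-Inv-ascent w Ss Nwr f ⟨
          G (suc m) a w′ (just r)      ≡⟨ proj₁ (ih w′ (just r) Rr (sym (·gen·gen w Ss)) (trans (cong (λ x → N w′ x xor lt x r) (right-·gen w Ss))
                                            (cong₂ _xor_ (trans (descent-flip w Ss) (cong not Nwr)) (lt-irrefl r)))) ⟩
          G (suc m) b w (just r) ∎
          where
          f = λ t → lt t r ▹ G m a (t · w′) (just t)
        first-term : ∀ {t} → t ∈ Inv w → below c t ▹ G n a (t · w) (just t) ≡
          below c t ▹ G n b (t · w′) (just t) +ᶻ lt t r ▹ qG n a (t · w′) (just t)
        first-term {t} t∈ with lt r t in eq
        ... | true rewrite lt-asym Rr (N⇒refl (Inv⇒N t∈)) eq =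
          trans (cong (below c t ▹_) (proj₁ (straight (N⇒refl (Inv⇒N t∈)) (Inv≢r t∈) (trans cond′ eq)))) (sym (ℤP.+-identityʳ _))
        ... | false rewrite trans (lt-total Rr (N⇒refl (Inv⇒N t∈)) (Inv≢r t∈ ∘ sym)) (cong not eq)
            | below-trans c Rc (N⇒refl (Inv⇒N t∈)) Rr (trans (lt-total Rr (N⇒refl (Inv⇒N t∈)) (Inv≢r t∈ ∘ sym)) (cong not eq)) cr =
          proj₂ (crossed (N⇒refl (Inv⇒N t∈)) (Inv≢r t∈) (trans cond′ eq))
        first : G (suc n) a w c ≡ G (suc n) b w′ c
        first = begin
          ∑ (Inv w) (λ t → below c t ▹ G n a (t · w) (just t))
            ≡⟨ ∑-cong (Inv w) first-term ⟩
          ∑ (Inv w) (λ t → below c t ▹ G n b (t · w′) (just t) +ᶻ lt t r ▹ qG n a (t · w′) (just t))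
            ≡⟨ ∑-+ (Inv w) _ _ ⟩
          ∑ (Inv w) f +ᶻ ∑ (Inv w) (λ t → lt t r ▹ qG n a (t · w′) (just t))
            ≡⟨ cong (∑ (Inv w) f +ᶻ_) (lower-sum n (ladder n)) ⟩
          ∑ (Inv w) f +ᶻ G n b w (just r)
            ≡⟨ ℤP.+-comm (∑ (Inv w) f) _ ⟩
          G n b w (just r) +ᶻ ∑ (Inv w) f
            ≡⟨ cong₂ (λ x y → x ▹ G n b y (just r) +ᶻ ∑ (Inv w) f) (sym cr) (sym rw′) ⟩
          f r +ᶻ ∑ (Inv w) f
            ≡⟨ ∑-Inv-ascent w Ss Nwr f ⟨
          G (suc n) b w′ c ∎
          where
          f = λ t → below c t ▹ G n b (t · w′) (just t)
          rw′ : r · w′ ≡ w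
          rw′ = trans (cong (_· w′) (sym (right-·gen w Ss))) (trans (right-· w′ s) (·gen·gen w Ss))
        -- Paths from a to w under the bound c split according to whether their last label lies
        -- above or below r.
        upper-sum : ∀ n → ∑ (Inv w) (λ t → (lt r t ∧ below c t) ▹ qG n a (t · w) (just t)) +ᶻ G n a w (just r) ≡ G n a w c
        upper-sum zero = trans (cong (_+ᶻ G 0 a w (just r)) (∑-zero (Inv w) λ {t} _ → ▹-zero (lt r t ∧ below c t))) (ℤP.+-identityˡ _)
        upper-sum (suc m) = trans (sym (∑-+ (Inv w) _ _)) (∑-cong (Inv w) term)
          where
          term : ∀ {t} → t ∈ Inv w → (lt r t ∧ below c t) ▹ G m a (t · w) (just t) +ᶻ lt t r ▹ G m a (t · w) (just t) ≡ below c t ▹ G m a (t · w) (just t)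
          term {t} t∈ with lt r t in eq
          ... | true rewrite lt-asym Rr (N⇒refl (Inv⇒N t∈)) eq = ℤP.+-identityʳ _
          ... | false rewrite trans (lt-total Rr (N⇒refl (Inv⇒N t∈)) (Inv≢r t∈ ∘ sym)) (cong not eq)
            | below-trans c Rc (N⇒refl (Inv⇒N t∈)) Rr (trans (lt-total Rr (N⇒refl (Inv⇒N t∈)) (Inv≢r t∈ ∘ sym)) (cong not eq)) cr = ℤP.+-identityˡ _
        second-term : ∀ {t} → t ∈ Inv w → below c t ▹ G n a (t · w′) (just t) ≡
          below c t ▹ G n b (t · w) (just t) +ᶻ (lt r t ∧ below c t) ▹ qG n a (t · w) (just t)
        second-term {t} t∈ with lt r t in eq
        ... | true = trans (cong (below c t ▹_) (proj₂ (straight (N⇒refl (Inv⇒N t∈)) (Inv≢r t∈) (trans cond′ eq))))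
                       (▹-+ (below c t) _ _)
        ... | false = trans (cong (below c t ▹_) (proj₁ (crossed (N⇒refl (Inv⇒N t∈)) (Inv≢r t∈) (trans cond′ eq)))) (sym (ℤP.+-identityʳ _))
        second : G (suc n) a w′ c ≡ G (suc n) b w c +ᶻ G n a w c
        second = begin
          G (suc n) a w′ c
            ≡⟨ ∑-Inv-ascent w Ss Nwr f ⟩
          f r +ᶻ ∑ (Inv w) f
            ≡⟨ cong₂ (λ x y → x ▹ G n a y (just r) +ᶻ ∑ (Inv w) f) cr rw′ ⟩
          G n a w (just r) +ᶻ ∑ (Inv w) f
            ≡⟨ cong (G n a w (just r) +ᶻ_) (trans (∑-cong (Inv w) second-term) (∑-+ (Inv w) _ _)) ⟩
          G n a w (just r) +ᶻ (G (suc n) b w c +ᶻ x)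
            ≡⟨ rearrange (G n a w (just r)) (G (suc n) b w c) x ⟩
          G (suc n) b w c +ᶻ (x +ᶻ G n a w (just r))
            ≡⟨ cong (G (suc n) b w c +ᶻ_) (upper-sum n) ⟩
          G (suc n) b w c +ᶻ G n a w c ∎
          where
          f = λ t → below c t ▹ G n a (t · w′) (just t)
          x = ∑ (Inv w) (λ t → (lt r t ∧ below c t) ▹ qG n a (t · w) (just t))
          rw′ : r · w′ ≡ w
          rw′ = trans (cong (_· w′) (sym (right-·gen w Ss))) (trans (right-· w′ s) (·gen·gen w Ss))
          rearrange : ∀ x y z → x +ᶻ (y +ᶻ z) ≡ y +ᶻ (z +ᶻ x)
          rearrange = ℤSolver.solve-∀
      -- Now w′ is shorter than w and r is not below c. Hence no label below c lies above r, so w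
      -- and w′ are never exchanged, and the edge labelled r is excluded by the bound.
      result true Nwr = first , second
        where
        open ≡-Reasoning
        cr : below c r ≡ false
        cr = trans (xor-true⇒ cond) (cong not Nwr)
        Nw′r : N w′ (right w′ s) ≡ false
        Nw′r = trans (cong (N w′) (right-·gen w Ss)) (trans (descent-flip w Ss) (cong not Nwr))
        Inv≢r : ∀ {t} → t ∈ Inv w′ → t ≢ r
        Inv≢r t∈ refl = true≢false (trans (sym (Inv⇒N t∈)) (trans (cong (N w′) (sym (right-·gen w Ss))) Nw′r))
        rel : ∀ {t} → t ∈ Inv w′ → below c t ≡ true → Rel n (t · w) (t · w′) (just t)
        rel {t} t∈ ct = straight Rt (Inv≢r t∈) (trans (cong (_xor lt r t) Nwr) (cong not (¬-not λ rt →
            true≢false (trans (sym (below-trans c Rc Rr Rt rt ct)) cr))))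
          where
          Rt = N⇒refl (Inv⇒N t∈)
        sum-w : ∀ (f : W → ℤ) → below c r ▹ f r +ᶻ ∑ (Inv w′) (λ t → below c t ▹ f t) ≡ ∑ (Inv w′) (λ t → below c t ▹ f t)
        sum-w f = trans (cong (λ x → x ▹ f r +ᶻ ∑ (Inv w′) (λ t → below c t ▹ f t)) cr) (ℤP.+-identityˡ _)
        Inv-w : ∀ (f : W → ℤ) → ∑ (Inv w) (λ t → below c t ▹ f t) ≡ ∑ (Inv w′) (λ t → below c t ▹ f t)
        Inv-w f = trans (cong (λ z → ∑ (Inv z) (λ t → below c t ▹ f t)) (sym (·gen·gen w Ss)))
          (trans (∑-Inv-ascent w′ Ss Nw′r (λ t → below c t ▹ f t))
            (trans (cong (λ z → below c z ▹ f z +ᶻ ∑ (Inv w′) (λ t → below c t ▹ f t)) (right-·gen w Ss)) (sum-w f)))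
        below-cong : ∀ t {x y} → (below c t ≡ true → x ≡ y) → below c t ▹ x ≡ below c t ▹ y
        below-cong t h with below c t
        ... | true = h refl
        ... | false = refl
        first : G (suc n) a w c ≡ G (suc n) b w′ c
        first = trans (Inv-w _) (∑-cong (Inv w′) λ {t} t∈ → below-cong t λ ct → proj₁ (rel t∈ ct))
        not-a : ∀ n → n ≡ 0 → 0ℤ ≡ G n a w c
        not-a .0 refl = sym (cong (_▹ 1ℤ) (dec-false (a ≟W w) λ { refl → true≢false (trans (sym Nwr) asc) }))
        q-sum : ∀ n → ∑ (Inv w′) (λ t → below c t ▹ qG n a (t · w) (just t)) ≡ G n a w c
        q-sum zero = trans (∑-zero (Inv w′) λ {t} _ → ▹-zero (below c t)) (not-a 0 refl)
        q-sum (suc m) = sym (Inv-w _)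
        second : G (suc n) a w′ c ≡ G (suc n) b w c +ᶻ G n a w c
        second = begin
          G (suc n) a w′ c
            ≡⟨ ∑-cong (Inv w′) (λ {t} t∈ → trans (below-cong t λ ct → proj₂ (rel t∈ ct)) (▹-+ (below c t) _ _)) ⟩
          ∑ (Inv w′) (λ t → below c t ▹ G n b (t · w) (just t) +ᶻ below c t ▹ qG n a (t · w) (just t))
            ≡⟨ ∑-+ (Inv w′) _ _ ⟩
          ∑ (Inv w′) (λ t → below c t ▹ G n b (t · w) (just t)) +ᶻ ∑ (Inv w′) (λ t → below c t ▹ qG n a (t · w) (just t))
            ≡⟨ cong₂ _+ᶻ_ (sym (Inv-w _)) (q-sum n) ⟩
          G (suc n) b w c +ᶻ G n a w c ∎

-- Power series

Series : Set
Series = ℕ → ℤ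

infix 4 _≐_
_≐_ : Series → Series → Set
f ≐ g = ∀ i → f i ≡ g i

module ≐-Reasoning = SetoidReasoning (ℕ →-setoid ℤ)

≐-sym : ∀ {f g} → f ≐ g → g ≐ f
≐-sym p i = sym (p i)

≐-trans : ∀ {f g h} → f ≐ g → g ≐ h → f ≐ h
≐-trans p q i = trans (p i) (q i)

infixl 6 _⊕_ _⊖_

_⊕_ _⊖_ : Series → Series → Series
(f ⊕ g) i = f i +ᶻ g i
(f ⊖ g) i = f i -ᶻ g i

infixr 7 _⊛_

_⊛_ : ℤ → Series → Series
(a ⊛ f) i = a *ᶻ f i

𝟎 : Series
𝟎 _ = 0ℤ

𝟏 : Series
𝟏 zero = 1ℤ
𝟏 (suc _) = 0ℤ

sh : Series → Series
sh f zero = 0ℤ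
sh f (suc i) = f i

shs : ℕ → Series → Series
shs zero f = f
shs (suc n) f = sh (shs n f)

⊕-cong : ∀ {f f′ g g′} → f ≐ f′ → g ≐ g′ → f ⊕ g ≐ f′ ⊕ g′
⊕-cong p q i = cong₂ _+ᶻ_ (p i) (q i)

⊖-cong : ∀ {f f′ g g′} → f ≐ f′ → g ≐ g′ → f ⊖ g ≐ f′ ⊖ g′
⊖-cong p q i = cong₂ _-ᶻ_ (p i) (q i)

⊛-cong : ∀ a {f g} → f ≐ g → a ⊛ f ≐ a ⊛ g
⊛-cong a p i = cong (a *ᶻ_) (p i)

sh-cong : ∀ {f g} → f ≐ g → sh f ≐ sh g
sh-cong p zero = refl
sh-cong p (suc i) = p i

sh-injective : ∀ {f g} → sh f ≐ sh g → f ≐ g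
sh-injective p i = p (suc i)

sh-⊕ : ∀ f g → sh (f ⊕ g) ≐ sh f ⊕ sh g
sh-⊕ f g zero = refl
sh-⊕ f g (suc i) = refl

sh-⊖ : ∀ f g → sh (f ⊖ g) ≐ sh f ⊖ sh g
sh-⊖ f g zero = refl
sh-⊖ f g (suc i) = refl

sh-⊛ : ∀ a f → sh (a ⊛ f) ≐ a ⊛ sh f
sh-⊛ a f zero = sym (ℤP.*-zeroʳ a)
sh-⊛ a f (suc i) = refl

shs-cong : ∀ n {f g} → f ≐ g → shs n f ≐ shs n g
shs-cong zero p = p
shs-cong (suc n) p = sh-cong (shs-cong n p)

shs-injective : ∀ n {f g} → shs n f ≐ shs n g → f ≐ g
shs-injective zero p = p
shs-injective (suc n) p = shs-injective n (sh-injective p)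

shs-⊕ : ∀ n f g → shs n (f ⊕ g) ≐ shs n f ⊕ shs n g
shs-⊕ zero f g _ = refl
shs-⊕ (suc n) f g = ≐-trans (sh-cong (shs-⊕ n f g)) (sh-⊕ (shs n f) (shs n g))

shs-⊖ : ∀ n f g → shs n (f ⊖ g) ≐ shs n f ⊖ shs n g
shs-⊖ zero f g _ = refl
shs-⊖ (suc n) f g = ≐-trans (sh-cong (shs-⊖ n f g)) (sh-⊖ (shs n f) (shs n g))

shs-sh : ∀ n f → shs n (sh f) ≐ sh (shs n f)
shs-sh zero f _ = refl
shs-sh (suc n) f = sh-cong (shs-sh n f)

shs-+ : ∀ m n f → shs (m + n) f ≐ shs m (shs n f)
shs-+ zero n f _ = refl
shs-+ (suc m) n f = sh-cong (shs-+ m n f)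

-- substitution of t² for q
sq : Series → Series
sq f zero = f 0
sq f (suc zero) = 0ℤ
sq f (suc (suc i)) = sq (f ∘ suc) i

sq-cong : ∀ {f g} → f ≐ g → sq f ≐ sq g
sq-cong p zero = p 0
sq-cong p (suc zero) = refl
sq-cong p (suc (suc i)) = sq-cong (p ∘ suc) i

sq-⊕ : ∀ f g → sq (f ⊕ g) ≐ sq f ⊕ sq g
sq-⊕ f g zero = refl
sq-⊕ f g (suc zero) = refl
sq-⊕ f g (suc (suc i)) = sq-⊕ (f ∘ suc) (g ∘ suc) i

sq-⊖ : ∀ f g → sq (f ⊖ g) ≐ sq f ⊖ sq g
sq-⊖ f g zero = refl
sq-⊖ f g (suc zero) = refl
sq-⊖ f g (suc (suc i)) = sq-⊖ (f ∘ suc) (g ∘ suc) i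

sq-sh : ∀ f → sq (sh f) ≐ sh (sh (sq f))
sq-sh f zero = refl
sq-sh f (suc zero) = refl
sq-sh f (suc (suc i)) = refl

sq-𝟏 : sq 𝟏 ≐ 𝟏
sq-𝟏 zero = refl
sq-𝟏 (suc zero) = refl
sq-𝟏 (suc (suc i)) = sq-𝟎 i
  where
  sq-𝟎 : ∀ i → sq 𝟎 i ≡ 0ℤ
  sq-𝟎 zero = refl
  sq-𝟎 (suc zero) = refl
  sq-𝟎 (suc (suc i)) = sq-𝟎 i

-- multiplication by t² − 1
τ : Series → Series
τ f = sh (sh f) ⊖ f

τ-cong : ∀ {f g} → f ≐ g → τ f ≐ τ g
τ-cong p = ⊖-cong (sh-cong (sh-cong p)) p

τ-⊕ : ∀ f g → τ (f ⊕ g) ≐ τ f ⊕ τ g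
τ-⊕ f g zero = lemma (f 0) (g 0)
  where
  lemma : ∀ a b → 0ℤ -ᶻ (a +ᶻ b) ≡ (0ℤ -ᶻ a) +ᶻ (0ℤ -ᶻ b)
  lemma = ℤSolver.solve-∀
τ-⊕ f g (suc i) = trans (cong (_-ᶻ (f (suc i) +ᶻ g (suc i))) (sh-⊕ f g i)) (lemma (sh f i) (sh g i) (f (suc i)) (g (suc i)))
  where
  lemma : ∀ a b c d → (a +ᶻ b) -ᶻ (c +ᶻ d) ≡ (a -ᶻ c) +ᶻ (b -ᶻ d)
  lemma = ℤSolver.solve-∀

τ-⊛ : ∀ a f → τ (a ⊛ f) ≐ a ⊛ τ f
τ-⊛ a f i = trans (cong (_-ᶻ a *ᶻ f i) (trans (sh-cong (sh-⊛ a f) i) (sh-⊛ a (sh f) i))) (lemma a (sh (sh f) i) (f i))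
  where
  lemma : ∀ a x y → a *ᶻ x -ᶻ a *ᶻ y ≡ a *ᶻ (x -ᶻ y)
  lemma = ℤSolver.solve-∀

τ-sh : ∀ f → τ (sh f) ≐ sh (τ f)
τ-sh f zero = refl
τ-sh f (suc i) = refl

τ-shs : ∀ n f → τ (shs n f) ≐ shs n (τ f)
τ-shs zero f _ = refl
τ-shs (suc n) f = ≐-trans (τ-sh (shs n f)) (sh-cong (τ-shs n f))

-- H d f = Σ_{i<d} fᵢ t^{d−i} (t²−1)ⁱ, the homogenised value of Σ fᵢ xⁱ at x = t − t⁻¹
H : ℕ → Series → Series
H zero f = 𝟎
H (suc d) f = f 0 ⊛ shs (suc d) 𝟏 ⊕ τ (H d (f ∘ suc))

H-cong : ∀ d {f g} → f ≐ g → H d f ≐ H d g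
H-cong zero p _ = refl
H-cong (suc d) p = ⊕-cong (λ i → cong (_*ᶻ shs (suc d) 𝟏 i) (p 0)) (τ-cong (H-cong d (p ∘ suc)))

H-⊕ : ∀ d f g → H d (f ⊕ g) ≐ H d f ⊕ H d g
H-⊕ zero f g _ = refl
H-⊕ (suc d) f g i = trans (cong₂ _+ᶻ_ (ℤP.*-distribʳ-+ (shs (suc d) 𝟏 i) (f 0) (g 0))
  (trans (τ-cong (H-⊕ d (f ∘ suc) (g ∘ suc)) i) (τ-⊕ (H d (f ∘ suc)) (H d (g ∘ suc)) i)))
  (+-interchange (f 0 *ᶻ shs (suc d) 𝟏 i) (g 0 *ᶻ shs (suc d) 𝟏 i) _ _)

τs : ℕ → Series → Series
τs zero f = f
τs (suc n) f = τ (τs n f)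

pw-τ : ℕ → Series
pw-τ n = τs n 𝟏

-- The definition splits off the lowest coefficient of f. Splitting off the highest one allows
-- coefficients to be compared from the top downwards.
H-last : ∀ d f → H (suc d) f ≐ sh (H d f) ⊕ f d ⊛ sh (pw-τ d)
H-last zero f i = trans (cong (f 0 *ᶻ sh 𝟏 i +ᶻ_) (τ𝟎 i)) (trans (ℤP.+-comm (f 0 *ᶻ sh 𝟏 i) 0ℤ) (cong (_+ᶻ f 0 *ᶻ sh 𝟏 i) (sh𝟎 i)))
  where
  τ𝟎 : ∀ i → τ 𝟎 i ≡ 0ℤ
  τ𝟎 zero = refl
  τ𝟎 (suc zero) = refl
  τ𝟎 (suc (suc i)) = refl
  sh𝟎 : ∀ i → 0ℤ ≡ sh 𝟎 i
  sh𝟎 zero = refl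
  sh𝟎 (suc i) = refl
H-last (suc d) f = begin
  f 0 ⊛ sh (shs (suc d) 𝟏) ⊕ τ (H (suc d) f′)
    ≈⟨ ⊕-cong (≐-sym (sh-⊛ (f 0) (shs (suc d) 𝟏))) (τ-cong (H-last d f′)) ⟩
  sh (f 0 ⊛ shs (suc d) 𝟏) ⊕ τ (sh (H d f′) ⊕ f′ d ⊛ sh (pw-τ d))
    ≈⟨ ⊕-cong {sh (f 0 ⊛ shs (suc d) 𝟏)} (λ _ → refl) (≐-trans (τ-⊕ (sh (H d f′)) (f′ d ⊛ sh (pw-τ d))) (⊕-cong (τ-sh (H d f′)) (≐-trans (τ-⊛ (f′ d) (sh (pw-τ d))) (⊛-cong (f′ d) (τ-sh (pw-τ d)))))) ⟩
  sh (f 0 ⊛ shs (suc d) 𝟏) ⊕ (sh (τ (H d f′)) ⊕ f′ d ⊛ sh (pw-τ (suc d)))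
    ≈⟨ (λ i → sym (ℤP.+-assoc (sh (f 0 ⊛ shs (suc d) 𝟏) i) (sh (τ (H d f′)) i) ((f′ d ⊛ sh (pw-τ (suc d))) i))) ⟩
  sh (f 0 ⊛ shs (suc d) 𝟏) ⊕ sh (τ (H d f′)) ⊕ f′ d ⊛ sh (pw-τ (suc d))
    ≈⟨ ⊕-cong (≐-sym (sh-⊕ (f 0 ⊛ shs (suc d) 𝟏) (τ (H d f′)))) (λ _ → refl) ⟩
  sh (H (suc d) f) ⊕ f′ d ⊛ sh (pw-τ (suc d)) ∎
  where
  open ≐-Reasoning
  f′ = f ∘ suc

H-zero : ∀ d f → H d f 0 ≡ 0ℤ
H-zero zero f = refl
H-zero (suc d) f = trans (cong₂ _+ᶻ_ (ℤP.*-zeroʳ (f 0)) (trans (ℤP.+-identityˡ _) (cong -ᶻ_ (H-zero d (f ∘ suc))))) refl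

pw-τ-zero : ∀ d → pw-τ d 0 ≡ sgn d
pw-τ-zero zero = refl
pw-τ-zero (suc d) = trans (ℤP.+-identityˡ _) (cong -ᶻ_ (pw-τ-zero d))

sgn-sgn : ∀ n → sgn n *ᶻ sgn n ≡ 1ℤ
sgn-sgn zero = refl
sgn-sgn (suc n) = trans (lemma (sgn n)) (sgn-sgn n)
  where
  lemma : ∀ x → -ᶻ x *ᶻ -ᶻ x ≡ x *ᶻ x
  lemma = ℤSolver.solve-∀

*-sgn-cancel : ∀ n {x y} → x *ᶻ sgn n ≡ y *ᶻ sgn n → x ≡ y
*-sgn-cancel n {x} {y} eq = trans (expand x) (trans (cong (_*ᶻ sgn n) eq) (sym (expand y)))
  where
  expand : ∀ x → x ≡ x *ᶻ sgn n *ᶻ sgn n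
  expand x = trans (sym (ℤP.*-identityʳ x)) (trans (cong (x *ᶻ_) (sym (sgn-sgn n))) (sym (ℤP.*-assoc x _ _)))

-- In the sum of the f i · t^{d+1-i} (t²-1)ⁱ only i = d contributes to the coefficient of t, with
-- the invertible factor (-1)^d.
H-top : ∀ d {f g} → H (suc d) f ≐ H (suc d) g → f d ≡ g d
H-top d {f} {g} eq = *-sgn-cancel d (trans (sym (coef f)) (trans (eq 1) (coef g)))
  where
  coef : ∀ f → H (suc d) f 1 ≡ f d *ᶻ sgn d
  coef f = trans (H-last d f 1) (trans (cong₂ _+ᶻ_ (H-zero d f) (cong (f d *ᶻ_) (pw-τ-zero d))) (ℤP.+-identityˡ _))

+-cancelʳ : ∀ x y z → x +ᶻ z ≡ y +ᶻ z → x ≡ y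
+-cancelʳ x y z eq = trans (expand x z) (trans (cong (_-ᶻ z) eq) (sym (expand y z)))
  where
  expand : ∀ x z → x ≡ x +ᶻ z -ᶻ z
  expand = ℤSolver.solve-∀

H-injective : ∀ d {f g} → H d f ≐ H d g → ∀ i → i < d → f i ≡ g i
H-injective (suc d) {f} {g} eq i (s≤s i≤d) with ℕP.m≤n⇒m<n∨m≡n i≤d
... | inj₂ refl = H-top d {f} {g} eq
... | inj₁ i<d = H-injective d (sh-injective λ j → +-cancelʳ _ _ (f d *ᶻ sh (pw-τ d) j) (trans (sym (H-last d f j)) (trans (eq j)
        (trans (H-last d g j) (cong (λ x → sh (H d g) j +ᶻ x *ᶻ sh (pw-τ d) j) (sym (H-top d {f} {g} eq))))))) i i<d

-- Coefficient series of list polynomials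

coefP-addP : ∀ p q → coefP (addP p q) ≐ coefP p ⊕ coefP q
coefP-addP [] q i = sym (ℤP.+-identityˡ _)
coefP-addP (a ∷ p) [] i = sym (ℤP.+-identityʳ _)
coefP-addP (a ∷ p) (b ∷ q) zero = refl
coefP-addP (a ∷ p) (b ∷ q) (suc i) = coefP-addP p q i

coefP-scalP : ∀ a p → coefP (scalP a p) ≐ a ⊛ coefP p
coefP-scalP a [] i = sym (ℤP.*-zeroʳ a)
coefP-scalP a (b ∷ p) zero = refl
coefP-scalP a (b ∷ p) (suc i) = coefP-scalP a p i

coefP-0∷ : ∀ p → coefP (0ℤ ∷ p) ≐ sh (coefP p)
coefP-0∷ p zero = refl
coefP-0∷ p (suc i) = refl

coefP-shiftP : ∀ n p → coefP (shiftP n p) ≐ shs n (coefP p)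
coefP-shiftP zero p i = refl
coefP-shiftP (suc n) p i = trans (coefP-0∷ (shiftP n p) i) (sh-cong (coefP-shiftP n p) i)

coefP-one : coefP (1ℤ ∷ []) ≐ 𝟏
coefP-one zero = refl
coefP-one (suc i) = refl

coefP-monoP : ∀ n → coefP (monoP n) ≐ shs n 𝟏
coefP-monoP n = ≐-trans (coefP-shiftP n _) (shs-cong n coefP-one)

coefP-mulP-∷ : ∀ a c p → coefP (mulP (a ∷ c) p) ≐ a ⊛ coefP p ⊕ sh (coefP (mulP c p))
coefP-mulP-∷ a c p = ≐-trans (coefP-addP (scalP a p) (0ℤ ∷ mulP c p)) (⊕-cong (coefP-scalP a p) (coefP-0∷ (mulP c p)))

coefP-mulP-one : ∀ c {p} → coefP p ≐ 𝟏 → coefP (mulP c p) ≐ coefP c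
coefP-mulP-one [] h i = refl
coefP-mulP-one (a ∷ c) {p} h i = trans (coefP-mulP-∷ a c p i) (trans (cong₂ _+ᶻ_ (cong (a *ᶻ_) (h i)) (sh-cong (coefP-mulP-one c h) i)) (go i))
  where
  go : ∀ i → a *ᶻ 𝟏 i +ᶻ sh (coefP c) i ≡ coefP (a ∷ c) i
  go zero = trans (ℤP.+-identityʳ _) (ℤP.*-identityʳ a)
  go (suc i) = trans (cong (_+ᶻ coefP c i) (ℤP.*-zeroʳ a)) (ℤP.+-identityˡ _)

-- `mulP` recurses on its left factor, so linearity in the right one needs induction on c. It is
-- used for the scalar of `scaleE`, which stands to the left of the coefficients that the Hecke
-- rules change.
coefP-mulP-sh : ∀ c {p p′} → coefP p′ ≐ sh (coefP p) → coefP (mulP c p′) ≐ sh (coefP (mulP c p))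
coefP-mulP-sh [] h zero = refl
coefP-mulP-sh [] h (suc i) = refl
coefP-mulP-sh (a ∷ c) {p} {p′} h = begin
  coefP (mulP (a ∷ c) p′)                    ≈⟨ coefP-mulP-∷ a c p′ ⟩
  a ⊛ coefP p′ ⊕ sh (coefP (mulP c p′))      ≈⟨ ⊕-cong (≐-trans (⊛-cong a h) (≐-sym (sh-⊛ a (coefP p)))) (sh-cong (coefP-mulP-sh c h)) ⟩
  sh (a ⊛ coefP p) ⊕ sh (sh (coefP (mulP c p))) ≈⟨ ≐-sym (sh-⊕ (a ⊛ coefP p) (sh (coefP (mulP c p)))) ⟩
  sh (a ⊛ coefP p ⊕ sh (coefP (mulP c p)))   ≈⟨ sh-cong (≐-sym (coefP-mulP-∷ a c p)) ⟩
  sh (coefP (mulP (a ∷ c) p)) ∎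
  where open ≐-Reasoning

coefP-mulP-⊖ : ∀ c {p p′ p″} → coefP p ≐ coefP p′ ⊖ coefP p″ → coefP (mulP c p) ≐ coefP (mulP c p′) ⊖ coefP (mulP c p″)
coefP-mulP-⊖ [] h i = refl
coefP-mulP-⊖ (a ∷ c) {p} {p′} {p″} h i = trans (coefP-mulP-∷ a c p i) (trans
  (cong₂ (λ x y → a *ᶻ x +ᶻ y) (h i) (trans (sh-cong (coefP-mulP-⊖ c h) i) (sh-⊖ (coefP (mulP c p′)) (coefP (mulP c p″)) i)))
  (trans (lemma a (coefP p′ i) (coefP p″ i) (sh (coefP (mulP c p′)) i) _)
    (sym (cong₂ _-ᶻ_ (coefP-mulP-∷ a c p′ i) (coefP-mulP-∷ a c p″ i)))))
  where
  lemma : ∀ a x y z w → a *ᶻ (x -ᶻ y) +ᶻ (z -ᶻ w) ≡ a *ᶻ x +ᶻ z -ᶻ (a *ᶻ y +ᶻ w)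
  lemma = ℤSolver.solve-∀

coefP-qP : ∀ p → coefP (mulP qP p) ≐ sh (coefP p)
coefP-qP p i = trans (coefP-mulP-∷ 0ℤ (1ℤ ∷ []) p i) (trans (cong₂ _+ᶻ_ (ℤP.*-zeroˡ (coefP p i)) (sh-cong q′ i)) (ℤP.+-identityˡ _))
  where
  q′ : coefP (mulP (1ℤ ∷ []) p) ≐ coefP p
  q′ i = trans (coefP-mulP-∷ 1ℤ [] p i) (trans (cong₂ _+ᶻ_ (ℤP.*-identityˡ (coefP p i)) (sh-𝟎 i)) (ℤP.+-identityʳ _))
    where
    sh-𝟎 : ∀ i → sh (coefP []) i ≡ 0ℤ
    sh-𝟎 zero = refl
    sh-𝟎 (suc i) = refl

coefP-qm1P : ∀ p → coefP (mulP qm1P p) ≐ sh (coefP p) ⊖ coefP p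
coefP-qm1P p i = trans (coefP-mulP-∷ -1ℤ (1ℤ ∷ []) p i) (trans (cong (-1ℤ *ᶻ coefP p i +ᶻ_)
  (trans (sym (trans (coefP-mulP-∷ 0ℤ (1ℤ ∷ []) p i) (trans (cong (_+ᶻ sh (coefP (mulP (1ℤ ∷ []) p)) i) (ℤP.*-zeroˡ (coefP p i))) (ℤP.+-identityˡ _)))) (coefP-qP p i)))
  (lemma (coefP p i) (sh (coefP p) i)))
  where
  lemma : ∀ x y → -1ℤ *ᶻ x +ᶻ y ≡ y -ᶻ x
  lemma = ℤSolver.solve-∀

coefP-t2m1P : ∀ p → coefP (mulP t2m1P p) ≐ τ (coefP p)
coefP-t2m1P p i = trans (coefP-mulP-∷ -1ℤ (0ℤ ∷ 1ℤ ∷ []) p i) (trans (cong (-1ℤ *ᶻ coefP p i +ᶻ_) (sh-cong (coefP-qP p) i)) (lemma (coefP p i) _))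
  where
  lemma : ∀ x y → -1ℤ *ᶻ x +ᶻ y ≡ y -ᶻ x
  lemma = ℤSolver.solve-∀

coefP-powP : ∀ n → coefP (powP t2m1P n) ≐ pw-τ n
coefP-powP zero = coefP-one
coefP-powP (suc n) = ≐-trans (coefP-t2m1P (powP t2m1P n)) (τ-cong (coefP-powP n))

coefP-substSq : ∀ p → coefP (substSq p) ≐ sq (coefP p)
coefP-substSq [] i = sym (zero-sq i)
  where
  zero-sq : ∀ i → sq (coefP []) i ≡ 0ℤ
  zero-sq zero = refl
  zero-sq (suc zero) = refl
  zero-sq (suc (suc i)) = zero-sq i
coefP-substSq (a ∷ p) zero = refl
coefP-substSq (a ∷ p) (suc zero) = refl
coefP-substSq (a ∷ p) (suc (suc i)) = coefP-substSq p i

coefP-≥ : ∀ p i → length p ≤ i → coefP p i ≡ 0ℤ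
coefP-≥ [] i _ = refl
coefP-≥ (a ∷ p) (suc i) (s≤s l) = coefP-≥ p i l

τs-⊕ : ∀ n f g → τs n (f ⊕ g) ≐ τs n f ⊕ τs n g
τs-⊕ zero f g _ = refl
τs-⊕ (suc n) f g = ≐-trans (τ-cong (τs-⊕ n f g)) (τ-⊕ (τs n f) (τs n g))

τs-⊛ : ∀ n a f → τs n (a ⊛ f) ≐ a ⊛ τs n f
τs-⊛ zero a f _ = refl
τs-⊛ (suc n) a f = ≐-trans (τ-cong (τs-⊛ n a f)) (τ-⊛ a (τs n f))

τs-shs : ∀ n m f → τs n (shs m f) ≐ shs m (τs n f)
τs-shs zero m f _ = refl
τs-shs (suc n) m f = ≐-trans (τ-cong (τs-shs n m f)) (τ-shs m (τs n f))

τs-τ : ∀ n f → τs n (τ f) ≐ τ (τs n f)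
τs-τ zero f _ = refl
τs-τ (suc n) f = τ-cong (τs-τ n f)

τs-𝟎 : ∀ n → τs n 𝟎 ≐ 𝟎
τs-𝟎 zero i = refl
τs-𝟎 (suc n) i = trans (τ-cong (τs-𝟎 n) i) (τ-𝟎 i)
  where
  τ-𝟎 : ∀ i → τ 𝟎 i ≡ 0ℤ
  τ-𝟎 zero = refl
  τ-𝟎 (suc zero) = refl
  τ-𝟎 (suc (suc i)) = refl

-- The function f stands for i ↦ k + i, since unfolding `upTo` produces `applyUpTo` of successive
-- shifts. In the tail that starts at k every power of t² - 1 is larger by k than in `H`, whence
-- `τs k`.
homogenised : ∀ d k rt (f : ℕ → ℕ) → (∀ i → f i ≡ k + i) → d ≡ k + length rt →
  coefP (sumP (zipWith (λ i a → scalP a (shiftP (d ∸ i) (powP t2m1P i))) (applyUpTo f (length rt)) rt)) ≐ τs k (H (length rt) (coefP rt))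
homogenised d k [] f _ _ = ≐-sym (τs-𝟎 k)
homogenised d k (a ∷ rt) f fk dk = begin
  coefP (addP (scalP a top) rest)
    ≈⟨ coefP-addP (scalP a top) rest ⟩
  coefP (scalP a top) ⊕ coefP rest
    ≈⟨ ⊕-cong (≐-trans (coefP-scalP a top) (⊛-cong a (≐-trans (coefP-shiftP (d ∸ f 0) (powP t2m1P (f 0))) first)))
              (homogenised d (suc k) rt (f ∘ suc) (λ i → trans (fk (suc i)) (ℕP.+-suc k i)) (trans dk (ℕP.+-suc k _))) ⟩
  a ⊛ τs k (shs (suc n) 𝟏) ⊕ τ (τs k (H n (coefP rt)))
    ≈⟨ ⊕-cong (≐-sym (τs-⊛ k a (shs (suc n) 𝟏))) (≐-sym (τs-τ k (H n (coefP rt)))) ⟩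
  τs k (a ⊛ shs (suc n) 𝟏) ⊕ τs k (τ (H n (coefP rt)))
    ≈⟨ ≐-sym (τs-⊕ k (a ⊛ shs (suc n) 𝟏) (τ (H n (coefP rt)))) ⟩
  τs k (H (suc n) (coefP (a ∷ rt))) ∎
  where
  open ≐-Reasoning
  n = length rt
  top = shiftP (d ∸ f 0) (powP t2m1P (f 0))
  rest = sumP (zipWith (λ i a → scalP a (shiftP (d ∸ i) (powP t2m1P i))) (applyUpTo (f ∘ suc) n) rt)
  f0 : f 0 ≡ k
  f0 = trans (fk 0) (ℕP.+-identityʳ k)
  first : shs (d ∸ f 0) (coefP (powP t2m1P (f 0))) ≐ τs k (shs (suc n) 𝟏)
  first i = trans (cong₂ (λ m j → shs m (coefP (powP t2m1P j)) i)
      (trans (cong₂ _∸_ dk f0) (ℕP.m+n∸m≡n k (suc n))) f0)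
    (trans (shs-cong (suc n) (coefP-powP k) i) (sym (τs-shs k (suc n) 𝟏 i)))

RtSpec⇒ : ∀ l r rt → RtSpec l r rt → shs (length rt) (sq (coefP r)) ≐ shs l (H (length rt) (coefP rt))
RtSpec⇒ l r rt spec = begin
  shs d (sq (coefP r))         ≈⟨ shs-cong d (≐-sym (coefP-substSq r)) ⟩
  shs d (coefP (substSq r))    ≈⟨ ≐-sym (coefP-shiftP d (substSq r)) ⟩
  coefP (shiftP d (substSq r)) ≈⟨ spec ⟩
  coefP (shiftP l hom)         ≈⟨ coefP-shiftP l hom ⟩
  shs l (coefP hom)            ≈⟨ shs-cong l (homogenised d 0 rt id (λ _ → refl) refl) ⟩
  shs l (H d (coefP rt)) ∎
  where
  open ≐-Reasoning
  d = length rt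
  hom = sumP (zipWith (λ i a → scalP a (shiftP (d ∸ i) (powP t2m1P i))) (upTo d) rt)

H-stable : ∀ d k {f} → (∀ i → d ≤ i → f i ≡ 0ℤ) → H (k + d) f ≐ shs k (H d f)
H-stable d zero _ i = refl
H-stable d (suc k) {f} vanish i = trans (H-last (k + d) f i) (trans (cong₂ _+ᶻ_ (sh-cong (H-stable d k vanish) i)
  (cong (_*ᶻ sh (pw-τ (k + d)) i) (vanish (k + d) (ℕP.m≤n+m d k)))) (trans (cong (shs (suc k) (H d f) i +ᶻ_) (ℤP.*-zeroˡ (sh (pw-τ (k + d)) i))) (ℤP.+-identityʳ _)))

-- The degree bound `length rt` may be raised, since both sides gain the factor t^k. This provides a
-- common bound for `Rt` and the path counts.
RtSpec-extend : ∀ l r rt k → RtSpec l r rt → shs (k + length rt) (sq (coefP r)) ≐ shs l (H (k + length rt) (coefP rt))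
RtSpec-extend l r rt k spec = begin
  shs (k + d) (sq (coefP r))           ≈⟨ shs-+ k d (sq (coefP r)) ⟩
  shs k (shs d (sq (coefP r)))         ≈⟨ shs-cong k (RtSpec⇒ l r rt spec) ⟩
  shs k (shs l (H d (coefP rt)))       ≈⟨ ≐-sym (shs-+ k l (H d (coefP rt))) ⟩
  shs (k + l) (H d (coefP rt))         ≡⟨ cong (λ n → shs n (H d (coefP rt))) (ℕP.+-comm k l) ⟩
  shs (l + k) (H d (coefP rt))         ≈⟨ shs-+ l k (H d (coefP rt)) ⟩
  shs l (shs k (H d (coefP rt)))       ≈⟨ shs-cong l (≐-sym (H-stable d k (coefP-≥ rt))) ⟩
  shs l (H (k + d) (coefP rt)) ∎
  where
  open ≐-Reasoning
  d = length rt

-- The Hecke algebra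

-- op d x y is the coefficient of (Σ F_w T_w) T_s at T_w, where x = F_{ws},
-- y = F_w and d tells whether ws < w; likewise for left multiplication.
op : Bool → Series → Series → Series
op true x y = x ⊕ (sh y ⊖ y)
op false x y = sh x

op-cong : ∀ d {x x′ y y′} → x ≐ x′ → y ≐ y′ → op d x y ≐ op d x′ y′
op-cong true p q = ⊕-cong p (⊖-cong (sh-cong q) q)
op-cong false p q = sh-cong p

op-⊕ : ∀ d x x′ y y′ → op d (x ⊕ x′) (y ⊕ y′) ≐ op d x y ⊕ op d x′ y′
op-⊕ true x x′ y y′ i = trans (cong (λ z → x i +ᶻ x′ i +ᶻ (z -ᶻ (y i +ᶻ y′ i))) (sh-⊕ y y′ i)) (lemma (x i) (x′ i) (y i) (y′ i) (sh y i) (sh y′ i))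
  where
  lemma : ∀ a b c d e f → a +ᶻ b +ᶻ (e +ᶻ f -ᶻ (c +ᶻ d)) ≡ a +ᶻ (e -ᶻ c) +ᶻ (b +ᶻ (f -ᶻ d))
  lemma = ℤSolver.solve-∀
op-⊕ false x x′ y y′ = sh-⊕ x x′

op-⊖ : ∀ d x x′ y y′ → op d (x ⊖ x′) (y ⊖ y′) ≐ op d x y ⊖ op d x′ y′
op-⊖ true x x′ y y′ i = trans (cong (λ z → x i -ᶻ x′ i +ᶻ (z -ᶻ (y i -ᶻ y′ i))) (sh-⊖ y y′ i)) (lemma (x i) (x′ i) (y i) (y′ i) (sh y i) (sh y′ i))
  where
  lemma : ∀ a b c d e f → a -ᶻ b +ᶻ (e -ᶻ f -ᶻ (c -ᶻ d)) ≡ a +ᶻ (e -ᶻ c) -ᶻ (b +ᶻ (f -ᶻ d))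
  lemma = ℤSolver.solve-∀
op-⊖ false x x′ y y′ = sh-⊖ x x′

op-sh : ∀ d x y → op d (sh x) (sh y) ≐ sh (op d x y)
op-sh true x y zero = refl
op-sh true x y (suc i) = refl
op-sh false x y i = refl

-- Commutation of a left and a right multiplication whose descent conditions are independent; z, y,
-- x, f stand for the coefficients at swt, sw, wt, w.
op-interchange : ∀ d d′ z y x f → op d (op d′ z y) (op d′ x f) ≐ op d′ (op d z x) (op d y f)
op-interchange true true z y x f zero = lemma (z 0) (y 0) (x 0) (f 0)
  where
  lemma : ∀ z y x f → z +ᶻ (0ℤ -ᶻ y) +ᶻ (0ℤ -ᶻ (x +ᶻ (0ℤ -ᶻ f))) ≡ z +ᶻ (0ℤ -ᶻ x) +ᶻ (0ℤ -ᶻ (y +ᶻ (0ℤ -ᶻ f)))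
  lemma = ℤSolver.solve-∀
op-interchange true true z y x f (suc i) = lemma (z (suc i)) (y i) (y (suc i)) (x i) (x (suc i)) (sh f i) (f i) (f (suc i))
  where
  lemma : ∀ z y y′ x x′ g f f′ → z +ᶻ (y -ᶻ y′) +ᶻ (x +ᶻ (g -ᶻ f) -ᶻ (x′ +ᶻ (f -ᶻ f′))) ≡
    z +ᶻ (x -ᶻ x′) +ᶻ (y +ᶻ (g -ᶻ f) -ᶻ (y′ +ᶻ (f -ᶻ f′)))
  lemma = ℤSolver.solve-∀
op-interchange true false z y x f zero = refl
op-interchange true false z y x f (suc i) = refl
op-interchange false true z y x f zero = refl
op-interchange false true z y x f (suc i) = refl
op-interchange false false z y x f i = refl

op-𝟎 : ∀ d → op d 𝟎 𝟎 ≐ 𝟎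
op-𝟎 true zero = refl
op-𝟎 true (suc i) = refl
op-𝟎 false zero = refl
op-𝟎 false (suc i) = refl

op-true-𝟎 : ∀ c → op true c 𝟎 ≐ c
op-true-𝟎 c zero = ℤP.+-identityʳ (c 0)
op-true-𝟎 c (suc i) = ℤP.+-identityʳ (c (suc i))

op-𝟎-true : ∀ c → op true 𝟎 c ≐ sh c ⊖ c
op-𝟎-true c i = ℤP.+-identityˡ _

sh-𝟎 : sh 𝟎 ≐ 𝟎
sh-𝟎 zero = refl
sh-𝟎 (suc i) = refl

shs-𝟎 : ∀ n → shs n 𝟎 ≐ 𝟎
shs-𝟎 zero i = refl
shs-𝟎 (suc n) i = trans (sh-cong (shs-𝟎 n) i) (sh-𝟎 i)

sgn-+ : ∀ m n → sgn (m + n) ≡ sgn m *ᶻ sgn n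
sgn-+ zero n = sym (ℤP.*-identityˡ _)
sgn-+ (suc m) n = trans (cong -ᶻ_ (sgn-+ m n)) (ℤP.neg-distribˡ-* (sgn m) (sgn n))

sgn-∸ : ∀ {m n} → n ≤ m → sgn (m ∸ n) ≡ sgn (m + n)
sgn-∸ {m} {n} n≤m = begin
  sgn (m ∸ n)                        ≡⟨ ℤP.*-identityʳ _ ⟨
  sgn (m ∸ n) *ᶻ 1ℤ                  ≡⟨ cong (sgn (m ∸ n) *ᶻ_) (sgn-sgn n) ⟨
  sgn (m ∸ n) *ᶻ (sgn n *ᶻ sgn n)    ≡⟨ ℤP.*-assoc (sgn (m ∸ n)) _ _ ⟨
  sgn (m ∸ n) *ᶻ sgn n *ᶻ sgn n      ≡⟨ cong (_*ᶻ sgn n) (sgn-+ (m ∸ n) n) ⟨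
  sgn (m ∸ n + n) *ᶻ sgn n           ≡⟨ cong (λ k → sgn k *ᶻ sgn n) (ℕP.m∸n+n≡m n≤m) ⟩
  sgn m *ᶻ sgn n                     ≡⟨ sgn-+ m n ⟨
  sgn (m + n) ∎
  where open ≡-Reasoning

module Hecke (C : CoxeterSystem) (len : CoxeterSystem.W C → ℕ) (isLen : CoxDefs.IsLength C len) where
  open Inversions C len isLen

  -- an element Σ F_w T_w of the completed Hecke algebra
  Fn : Set
  Fn = W → Series

  infix 4 _≑_
  _≑_ : Fn → Fn → Set
  F ≑ F′ = ∀ w → F w ≐ F′ w

  ≑-trans : ∀ {F F′ F″} → F ≑ F′ → F′ ≑ F″ → F ≑ F″
  ≑-trans p q w i = trans (p w i) (q w i)

  ≑-sym : ∀ {F F′} → F ≑ F′ → F′ ≑ F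
  ≑-sym p w i = sym (p w i)

  -- `rmul*` is right multiplication by T_s - (q - 1) = q T_s⁻¹, an inverse up to a power of q that
  -- stays polynomial.
  rmul lmul rmul* : W → Fn → Fn
  rmul s F w = op (N w (right w s)) (F (w · s)) (F w)
  lmul s F w = op (N w s) (F (s · w)) (F w)
  rmul* s F w = rmul s F w ⊖ (sh (F w) ⊖ F w)

  rmul-cong : ∀ s {F F′} → F ≑ F′ → rmul s F ≑ rmul s F′
  rmul-cong s h w = op-cong (N w (right w s)) (h _) (h w)

  lmul-cong : ∀ s {F F′} → F ≑ F′ → lmul s F ≑ lmul s F′
  lmul-cong s h w = op-cong (N w s) (h _) (h w)

  rmul*-cong : ∀ s {F F′} → F ≑ F′ → rmul* s F ≑ rmul* s F′
  rmul*-cong s h w = ⊖-cong (rmul-cong s h w) (⊖-cong (sh-cong (h w)) (h w))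

  N-gen· : ∀ {s} → S s → ∀ w t → N (s · w) t ≡ (t == s) xor N w (s · t · s)
  N-gen· {s} Ss w t = trans (N-refl· (S⇒refl Ss) w t) (cong (_xor N w (s · t · s)) (N-gen Ss t))

  -- If s ≠ wtw⁻¹, each multiplication preserves the descent condition of the other and
  -- `op-interchange` applies. If s = wtw⁻¹, then sw = wt, and the two operators have equal values
  -- at w and at sw. This takes the place of associativity of the Hecke algebra.
  lmul-rmul : ∀ {s t} → S s → S t → ∀ F → lmul s (rmul t F) ≑ rmul t (lmul s F)
  lmul-rmul {s} {t} Ss St F w with s ≟W right w t
  ... | no ne = begin
    op (N w s) (op (N (s · w) (right (s · w) t)) (F (s · w · t)) (F (s · w))) (op (N w r) (F (w · t)) (F w))
      ≡⟨ cong (λ d → op (N w s) (op d (F (s · w · t)) (F (s · w))) (op (N w r) (F (w · t)) (F w))) right-same ⟩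
    op (N w s) (op (N w r) (F (s · w · t)) (F (s · w))) (op (N w r) (F (w · t)) (F w))
      ≈⟨ op-interchange (N w s) (N w r) (F (s · w · t)) (F (s · w)) (F (w · t)) (F w) ⟩
    op (N w r) (op (N w s) (F (s · w · t)) (F (w · t))) (op (N w s) (F (s · w)) (F w))
      ≡⟨ cong₂ (λ d x → op (N w r) (op d (F x) (F (w · t))) (op (N w s) (F (s · w)) (F w))) (sym left-same) (assoc s w t) ⟩
    op (N w r) (op (N (w · t) s) (F (s · (w · t))) (F (w · t))) (op (N w s) (F (s · w)) (F w)) ∎
    where
    open ≐-Reasoning
    r = right w t
    left-same : N (w · t) s ≡ N w s
    left-same = trans (N-·gen w St s) (trans (cong (N w s xor_) (dec-false (s ≟W r) ne)) (xor-identityʳ _))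
    right-same : N (s · w) (right (s · w) t) ≡ N w r
    right-same = trans (N-gen· Ss w _) (cong₂ _xor_ (dec-false (right (s · w) t ≟W s) λ eq → ne
        (trans (grp [] ((s , invol s Ss) ∷ []) (ivar 0) (ivar 0 ⊙ ivar 0 ⊙ ivar 0) refl) (trans (cong (λ z → s · z · s) (sym eq))
          (grp (w ∷ t ∷ []) ((s , invol s Ss) ∷ []) (ivar 0 ⊙ (ivar 0 ⊙ var 0 ⊙ var 1 ⊙ (ivar 0 ⊙ var 0) ⁻) ⊙ ivar 0) (var 0 ⊙ var 1 ⊙ var 0 ⁻) refl))))
      (cong (N w) (grp (w ∷ t ∷ []) ((s , invol s Ss) ∷ []) (ivar 0 ⊙ (ivar 0 ⊙ var 0 ⊙ var 1 ⊙ (ivar 0 ⊙ var 0) ⁻) ⊙ ivar 0) (var 0 ⊙ var 1 ⊙ var 0 ⁻) refl)))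
  ... | yes s≡r = op-same d≡ sw≡wt (agree (s · w) d≡′ (sw·t) ) (agree w d≡ sw≡wt)
    where
    sw≡wt : s · w ≡ w · t
    sw≡wt = trans (cong (_· w) s≡r) (right-· w t)
    d≡ : N w s ≡ N w (right w t)
    d≡ = cong (N w) s≡r
    d≡′ : N (s · w) s ≡ N (s · w) (right (s · w) t)
    d≡′ = cong (N (s · w)) (trans s≡r (trans (sym (right-·gen w St)) (cong (λ z → right z t) (sym sw≡wt))))
    sw·t : s · (s · w) ≡ s · w · t
    sw·t = trans (cong (s ·_) sw≡wt) (sym (assoc s w t))
    agree : ∀ x → N x s ≡ N x (right x t) → s · x ≡ x · t → rmul t F x ≐ lmul s F x
    agree x d≡ eq i = cong₂ (λ d y → op d (F y) (F x) i) (sym d≡) (sym eq)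
    op-same : ∀ {d d′} → d ≡ d′ → s · w ≡ w · t → rmul t F (s · w) ≐ lmul s F (s · w) → rmul t F w ≐ lmul s F w →
      op d (rmul t F (s · w)) (rmul t F w) ≐ op d′ (lmul s F (w · t)) (lmul s F w)
    op-same {d} refl eq p q = op-cong d (λ i → trans (p i) (cong (λ x → lmul s F x i) eq)) q

  lmul-rmul* : ∀ {s t} → S s → S t → ∀ F → lmul s (rmul* t F) ≑ rmul* t (lmul s F)
  lmul-rmul* {s} {t} Ss St F w = begin
    op d (rmul t F (s · w) ⊖ (sh (F (s · w)) ⊖ F (s · w))) (rmul t F w ⊖ (sh (F w) ⊖ F w))
      ≈⟨ op-⊖ d (rmul t F (s · w)) (sh (F (s · w)) ⊖ F (s · w)) (rmul t F w) (sh (F w) ⊖ F w) ⟩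
    lmul s (rmul t F) w ⊖ op d (sh (F (s · w)) ⊖ F (s · w)) (sh (F w) ⊖ F w)
      ≈⟨ ⊖-cong (lmul-rmul Ss St F w) (≐-trans (op-⊖ d (sh (F (s · w))) (F (s · w)) (sh (F w)) (F w))
           (⊖-cong (op-sh d (F (s · w)) (F w)) (λ _ → refl))) ⟩
    rmul t (lmul s F) w ⊖ (sh (lmul s F w) ⊖ lmul s F w) ∎
    where
    open ≐-Reasoning
    d = N w s

  -- The quadratic relation T_s (T_s - (q - 1)) = q.
  rmul*-rmul : ∀ {s} → S s → ∀ F → rmul* s (rmul s F) ≑ λ w → sh (F w)
  rmul*-rmul {s} Ss F w with N w (right w s) | N (w · s) (right (w · s) s) | trans (cong (N (w · s)) (right-·gen w Ss)) (descent-flip w Ss)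
  ... | true | .false | refl = λ i → trans (lemma (sh (F (w · s · s)) i) _) (cong (λ z → sh (F z) i) (·gen·gen w Ss))
    where
    lemma : ∀ x y → x +ᶻ y -ᶻ y ≡ x
    lemma = ℤSolver.solve-∀
  ... | false | .true | refl = λ
    { zero → refl
    ; (suc i) → trans (lemma (F (w · s · s) i) (sh (F (w · s)) i) (F (w · s) i)) (cong (λ z → F z i) (·gen·gen w Ss)) }
    where
    lemma : ∀ x y z → x +ᶻ (y -ᶻ z) -ᶻ (y -ᶻ z) ≡ x
    lemma = ℤSolver.solve-∀

  gen·gen· : ∀ {s} → S s → ∀ w → s · (s · w) ≡ w
  gen·gen· Ss = refl·refl· (S⇒refl Ss)

  -- If sw is longer than w, the value at w is q F (sw) and recovers F (sw); the value at sw then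
  -- recovers F w.
  lmul-injective : ∀ {s} → S s → ∀ {F F′} → lmul s F ≑ lmul s F′ → F ≑ F′
  lmul-injective {s} Ss {F} {F′} h w with N w s in eq
  ... | true = λ i → trans (cong (λ z → F z i) (sym (gen·gen· Ss w))) (trans (below i) (cong (λ z → F′ z i) (gen·gen· Ss w)))
    where
    below : F (s · (s · w)) ≐ F′ (s · (s · w))
    below = sh-injective (subst (λ d → op d (F (s · (s · w))) (F (s · w)) ≐ op d (F′ (s · (s · w))) (F′ (s · w)))
      (trans (N-refl·-self (S⇒refl Ss) w) (cong not eq)) (h (s · w)))
  ... | false = λ i → trans (cong (λ z → F z i) (sym (gen·gen· Ss w))) (trans (above i) (cong (λ z → F′ z i) (gen·gen· Ss w)))
    where
    lower : F (s · w) ≐ F′ (s · w)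
    lower = sh-injective (subst (λ d → op d (F (s · w)) (F w) ≐ op d (F′ (s · w)) (F′ w)) eq (h w))
    upper : op true (F (s · (s · w))) (F (s · w)) ≐ op true (F′ (s · (s · w))) (F′ (s · w))
    upper = subst (λ d → op d (F (s · (s · w))) (F (s · w)) ≐ op d (F′ (s · (s · w))) (F′ (s · w)))
      (trans (N-refl·-self (S⇒refl Ss) w) (cong not eq)) (h (s · w))
    above : F (s · (s · w)) ≐ F′ (s · (s · w))
    above i = +-cancelʳ _ _ (sh (F (s · w)) i -ᶻ F (s · w) i) (trans (upper i)
      (cong (F′ (s · (s · w)) i +ᶻ_) (sym (cong₂ _-ᶻ_ (sh-cong lower i) (lower i)))))

  -- δ x c is the element c T_x
  δ : W → Series → Fn
  δ x c w i = (x == w) ▹ c i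

  δ-≡ : ∀ {x w} c → x ≡ w → δ x c w ≐ c
  δ-≡ {x} c refl i = cong (_▹ c i) (==-refl x)

  δ-≢ : ∀ {x w} c → x ≢ w → δ x c w ≐ 𝟎
  δ-≢ {x} {w} c ne i = cong (_▹ c i) (dec-false (x ≟W w) ne)

  ·gen≢ : ∀ {x s} → S s → x ≢ x · s
  ·gen≢ {x} {s} Ss eq = nontriv s Ss (∙-cancelˡ x _ _ (trans (sym eq) (sym (identityʳ x))))

  ·gen-swap : ∀ {x w s} → S s → x ≡ w · s → w ≡ x · s
  ·gen-swap {w = w} Ss refl = sym (·gen·gen w Ss)

  rmul-δ : ∀ x {s} → S s → ∀ c w → rmul s (δ x c) w ≐
    (if N x (right x s) then (λ i → (x · s == w) ▹ sh c i +ᶻ (x == w) ▹ (sh c i -ᶻ c i)) else δ (x · s) c w)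
  rmul-δ x {s} Ss c w with w ≟W x · s
  ... | yes refl = λ i → trans (op-cong (N (x · s) (right (x · s) s)) (δ-≡ c (sym (·gen·gen x Ss))) (δ-≢ c (·gen≢ Ss)) i)
          (trans (cong (λ d → op d c 𝟎 i) (trans (cong (N (x · s)) (right-·gen x Ss)) (descent-flip x Ss))) (compute (N x (right x s)) i))
    where
    compute : ∀ d → op (not d) c 𝟎 ≐ (if d then (λ i → (x · s == x · s) ▹ sh c i +ᶻ (x == x · s) ▹ (sh c i -ᶻ c i)) else δ (x · s) c (x · s))
    compute true i = sym (trans (cong₂ (λ p q → p ▹ sh c i +ᶻ q ▹ (sh c i -ᶻ c i)) (==-refl (x · s)) (dec-false (x ≟W x · s) (·gen≢ Ss))) (ℤP.+-identityʳ _))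
    compute false i = trans (op-true-𝟎 c i) (sym (δ-≡ {x · s} c refl i))
  ... | no ne with w ≟W x
  ... | yes refl = λ i → trans (op-cong (N x (right x s)) (δ-≢ c (·gen≢ Ss)) (δ-≡ {x} c refl) i) (compute (N x (right x s)) i)
    where
    compute : ∀ d → op d 𝟎 c ≐ (if d then (λ i → (x · s == x) ▹ sh c i +ᶻ (x == x) ▹ (sh c i -ᶻ c i)) else δ (x · s) c x)
    compute true i = trans (op-𝟎-true c i) (sym (trans (cong₂ (λ p q → p ▹ sh c i +ᶻ q ▹ (sh c i -ᶻ c i)) (dec-false (x · s ≟W x) (·gen≢ Ss ∘ sym)) (==-refl x)) (ℤP.+-identityˡ _)))
    compute false i = trans (sh-𝟎 i) (sym (δ-≢ c (·gen≢ Ss ∘ sym) i))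
  ... | no ne′ = λ i → trans (op-cong (N w (right w s)) (δ-≢ c (ne ∘ ·gen-swap Ss)) (δ-≢ c (ne′ ∘ sym)) i) (trans (op-𝟎 (N w (right w s)) i) (compute (N x (right x s)) i))
    where
    compute : ∀ d → 𝟎 ≐ (if d then (λ i → (x · s == w) ▹ sh c i +ᶻ (x == w) ▹ (sh c i -ᶻ c i)) else δ (x · s) c w)
    compute true i = sym (cong₂ (λ p q → p ▹ sh c i +ᶻ q ▹ (sh c i -ᶻ c i)) (dec-false (x · s ≟W w) (ne ∘ sym)) (dec-false (x ≟W w) (ne′ ∘ sym)))
    compute false i = sym (δ-≢ c (ne ∘ sym) i)

  rmul-⊕ : ∀ s F F′ → rmul s (λ w → F w ⊕ F′ w) ≑ λ w → rmul s F w ⊕ rmul s F′ w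
  rmul-⊕ s F F′ w = op-⊕ (N w (right w s)) (F (w · s)) (F′ (w · s)) (F w) (F′ w)

  lmul-⊕ : ∀ s F F′ → lmul s (λ w → F w ⊕ F′ w) ≑ λ w → lmul s F w ⊕ lmul s F′ w
  lmul-⊕ s F F′ w = op-⊕ (N w s) (F (s · w)) (F′ (s · w)) (F w) (F′ w)

  -- For σ = s₁⋯sₖ: multiplication by T_{s₁}⋯T_{sₖ} from the right, by the same product from the
  -- left, and from the right by the factors q T_{sᵢ}⁻¹ in reverse order, so that `Yop σ` undoes
  -- `Rop σ` up to qᵏ.
  Rop Lop Yop : List W → Fn → Fn
  Rop [] F = F
  Rop (s ∷ σ) F = Rop σ (rmul s F)
  Lop [] F = F
  Lop (s ∷ σ) F = lmul s (Lop σ F)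
  Yop [] F = F
  Yop (s ∷ σ) F = rmul* s (Yop σ F)

  Rop-cong : ∀ σ {F F′} → F ≑ F′ → Rop σ F ≑ Rop σ F′
  Rop-cong [] h = h
  Rop-cong (s ∷ σ) h = Rop-cong σ (rmul-cong s h)

  Lop-cong : ∀ σ {F F′} → F ≑ F′ → Lop σ F ≑ Lop σ F′
  Lop-cong [] h = h
  Lop-cong (s ∷ σ) h = lmul-cong s (Lop-cong σ h)

  Yop-cong : ∀ σ {F F′} → F ≑ F′ → Yop σ F ≑ Yop σ F′
  Yop-cong [] h = h
  Yop-cong (s ∷ σ) h = rmul*-cong s (Yop-cong σ h)

  Lop-⊕ : ∀ σ F F′ → Lop σ (λ w → F w ⊕ F′ w) ≑ λ w → Lop σ F w ⊕ Lop σ F′ w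
  Lop-⊕ [] F F′ w i = refl
  Lop-⊕ (s ∷ σ) F F′ = ≑-trans (lmul-cong s (Lop-⊕ σ F F′)) (lmul-⊕ s (Lop σ F) (Lop σ F′))

  Lop-𝟎 : ∀ σ → Lop σ (λ _ → 𝟎) ≑ λ _ → 𝟎
  Lop-𝟎 [] w i = refl
  Lop-𝟎 (s ∷ σ) w i = trans (lmul-cong s (Lop-𝟎 σ) w i) (op-𝟎 (N w s) i)

  lmul-Rop : ∀ {s} → S s → ∀ {σ} → All S σ → ∀ F → lmul s (Rop σ F) ≑ Rop σ (lmul s F)
  lmul-Rop Ss [] F w i = refl
  lmul-Rop {s} Ss {t ∷ σ} (St ∷ Sσ) F = ≑-trans (lmul-Rop Ss Sσ (rmul t F)) (Rop-cong σ (lmul-rmul Ss St F))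

  Lop-Rop : ∀ {ρ} → All S ρ → ∀ {σ} → All S σ → ∀ F → Lop ρ (Rop σ F) ≑ Rop σ (Lop ρ F)
  Lop-Rop [] Sσ F w i = refl
  Lop-Rop {s ∷ ρ} (Ss ∷ Sρ) Sσ F = ≑-trans (lmul-cong s (Lop-Rop Sρ Sσ F)) (lmul-Rop Ss Sσ (Lop ρ F))

  lmul-Yop : ∀ {s} → S s → ∀ {σ} → All S σ → ∀ F → lmul s (Yop σ F) ≑ Yop σ (lmul s F)
  lmul-Yop Ss [] F w i = refl
  lmul-Yop Ss {t ∷ σ} (St ∷ Sσ) F = ≑-trans (lmul-rmul* Ss St (Yop σ F)) (rmul*-cong t (lmul-Yop Ss Sσ F))

  Lop-Yop : ∀ {ρ} → All S ρ → ∀ {σ} → All S σ → ∀ F → Lop ρ (Yop σ F) ≑ Yop σ (Lop ρ F)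
  Lop-Yop [] Sσ F w i = refl
  Lop-Yop {s ∷ ρ} (Ss ∷ Sρ) Sσ F = ≑-trans (lmul-cong s (Lop-Yop Sρ Sσ F)) (lmul-Yop Ss Sσ (Lop ρ F))

  rmul*-sh : ∀ s n F → rmul* s (λ w → shs n (F w)) ≑ λ w → shs n (rmul* s F w)
  rmul*-sh s n F w = ≐-trans (⊖-cong (op-shs n) (⊖-cong (≐-sym (shs-sh n (F w))) (λ _ → refl)))
    (≐-sym (≐-trans (shs-⊖ n (rmul s F w) (sh (F w) ⊖ F w)) (⊖-cong {shs n (rmul s F w)} (λ _ → refl) (shs-⊖ n (sh (F w)) (F w)))))
    where
    d = N w (right w s)
    op-shs : ∀ n → op d (shs n (F (w · s))) (shs n (F w)) ≐ shs n (op d (F (w · s)) (F w))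
    op-shs zero i = refl
    op-shs (suc n) = ≐-trans (op-sh d (shs n (F (w · s))) (shs n (F w))) (sh-cong (op-shs n))

  Yop-Rop : ∀ {ρ} → All S ρ → ∀ F → Yop ρ (Rop ρ F) ≑ λ w → shs (length ρ) (F w)
  Yop-Rop [] F w i = refl
  Yop-Rop {s ∷ ρ} (Ss ∷ Sρ) F w = ≐-trans (rmul*-cong s (Yop-Rop Sρ (rmul s F)) w)
    (≐-trans (rmul*-sh s (length ρ) (rmul s F) w) (≐-trans (shs-cong (length ρ) (rmul*-rmul Ss F w)) (shs-sh (length ρ) (F w))))

  Lop-injective : ∀ {ρ} → All S ρ → ∀ {F F′} → Lop ρ F ≑ Lop ρ F′ → F ≑ F′
  Lop-injective [] h = h
  Lop-injective (Ss ∷ Sρ) h = Lop-injective Sρ (lmul-injective Ss h)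

  rmul-δe : ∀ {s} → S s → ∀ c → rmul s (δ e c) ≑ lmul s (δ e c)
  rmul-δe {s} Ss c w with w ≟W e | w ≟W s
  ... | yes refl | _ = λ i → cong₂ (λ t x → op (N e t) (δ e c x) (δ e c e) i)
          (grp (s ∷ []) [] (ε ⊙ var 0 ⊙ ε ⁻) (var 0) refl) (trans (identityˡ s) (sym (identityʳ s)))
  ... | no _ | yes refl = λ i → cong (λ t → op (N s t) (δ e c (s · s)) (δ e c s) i) (grp (s ∷ []) [] (var 0 ⊙ var 0 ⊙ var 0 ⁻) (var 0) refl)
  ... | no w≢e | no w≢s = λ i → trans (vanish (N w (right w s)) (λ eq → w≢s (trans (·gen-swap Ss eq) (identityˡ s))) i)
          (sym (vanish (N w s) (λ eq → w≢s (trans (sym (gen·gen· Ss w)) (trans (cong (s ·_) (sym eq)) (identityʳ s)))) i))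
    where
    vanish : ∀ d {x} → e ≢ x → op d (δ e c x) (δ e c w) ≐ 𝟎
    vanish d ne i = trans (op-cong d (δ-≢ c ne) (δ-≢ c (w≢e ∘ sym)) i) (op-𝟎 d i)

  Rop-δe : ∀ {ρ} → All S ρ → ∀ c → Rop ρ (δ e c) ≑ Lop ρ (δ e c)
  Rop-δe [] c w i = refl
  Rop-δe {s ∷ ρ} (Ss ∷ Sρ) c = ≑-trans (Rop-cong ρ (rmul-δe Ss c))
    (≑-trans (≑-sym (lmul-Rop Ss Sρ (δ e c))) (lmul-cong s (Rop-δe Sρ c)))

  -- A descent anywhere along the word would make the end point too short, so every letter is an
  -- ascent and the product remains a single term.
  Rop-reduced : ∀ {σ} → All S σ → ∀ x c → len (x · prod σ) ≡ len x + length σ → Rop σ (δ x c) ≑ δ (x · prod σ) c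
  Rop-reduced [] x c _ w i = cong (λ y → δ y c w i) (sym (identityʳ x))
  Rop-reduced {s ∷ σ} (Ss ∷ Sσ) x c eq = ≑-trans (Rop-cong σ ascent) (≑-trans (Rop-reduced Sσ (x · s) c eq″)
      (λ w i → cong (λ y → δ y c w i) (assoc x s _)))
    where
    len-·prod : ∀ {σ} → All S σ → ∀ y → len (y · prod σ) ≤ len y + length σ
    len-·prod [] y = ℕP.≤-reflexive (trans (cong len (identityʳ y)) (sym (ℕP.+-identityʳ _)))
    len-·prod {t ∷ σ} (St ∷ Sσ) y = ℕP.≤-trans (ℕP.≤-reflexive (cong len (sym (assoc y t _)))) (ℕP.≤-trans (len-·prod Sσ (y · t))
      (ℕP.≤-trans (ℕP.+-monoˡ-≤ (length σ) (·gen-≤ y St)) (ℕP.≤-reflexive (sym (ℕP.+-suc (len y) _)))))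
    asc : N x (right x s) ≡ false
    asc = ¬-not λ desc → ℕP.<-irrefl eq (ℕP.<-≤-trans (s≤s (ℕP.≤-trans (ℕP.≤-reflexive (cong len (sym (assoc x s _)))) (len-·prod Sσ (x · s))))
      (ℕP.≤-trans (ℕP.≤-reflexive (cong (_+ length σ) (sym (descent-len x Ss desc)))) (ℕP.+-monoʳ-≤ (len x) (ℕP.n≤1+n _))))
    ascent : rmul s (δ x c) ≑ δ (x · s) c
    ascent w i = trans (rmul-δ x Ss c w i) (cong (λ d → (if d then (λ i → (x · s == w) ▹ sh c i +ᶻ (x == w) ▹ (sh c i -ᶻ c i)) else δ (x · s) c w) i) asc)
    eq″ : len (x · s · prod σ) ≡ len (x · s) + length σ
    eq″ = trans (cong len (assoc x s _)) (trans eq (trans (ℕP.+-suc (len x) _) (cong (_+ length σ) (sym (ascent-len x Ss asc)))))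

  <ᵇ-ascent : ∀ w {s} → S s → (len w <ᵇ len (w · s)) ≡ not (N w (right w s))
  <ᵇ-ascent w {s} Ss with N w (right w s) in eq
  ... | true = ¬-not λ lt → ℕP.<-asym (ℕP.<ᵇ⇒< (len w) (len (w · s)) (Equivalence.from T-≡ lt))
                 (subst (λ z → len z < len w) (right-· w s) (N⇒< eq))
  ... | false = Equivalence.to T-≡ (ℕP.<⇒<ᵇ (subst (λ z → len w < len z) (right-· w s) (¬N⇒> (right-refl w Ss) eq)))

  coef-scaleE : ∀ c x w i → coefE (scaleE c x) w i ≡ ∑ x (λ t → δ (proj₂ t) (coefP (mulP c (proj₁ t))) w i)
  coef-scaleE c x w i = ∑-map (λ t → mulP c (proj₁ t) , proj₂ t) x _

  ∑-Fn : Elt → (Poly × W → Fn) → Fn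
  ∑-Fn x f w i = ∑ x (λ t → f t w i)

  rmul-∑ : ∀ s x f → rmul s (∑-Fn x f) ≑ ∑-Fn x (rmul s ∘ f)
  rmul-∑ s [] f w = op-𝟎 (N w (right w s))
  rmul-∑ s (t ∷ x) f w = ≐-trans (rmul-⊕ s (f t) (∑-Fn x f) w) (⊕-cong {rmul s (f t) w} (λ _ → refl) (rmul-∑ s x f w))

  rmulTerm-δ : ∀ c p x {s} → S s → (λ w i → ∑ (rmulTerm (p , x) s) (λ t → δ (proj₂ t) (coefP (mulP c (proj₁ t))) w i)) ≑ rmul s (δ x (coefP (mulP c p)))
  rmulTerm-δ c p x {s} Ss w i with len x <ᵇ len (x · s) | <ᵇ-ascent x Ss | rmul-δ x Ss (coefP (mulP c p)) w i
  ... | b | eq | step with N x (right x s)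
  rmulTerm-δ c p x {s} Ss w i | .true | refl | step | false = trans (ℤP.+-identityʳ _) (sym step)
  rmulTerm-δ c p x {s} Ss w i | .false | refl | step | true = trans (cong₂ (λ y z → (x · s == w) ▹ y +ᶻ z) (coefP-mulP-sh c (coefP-qP p) i)
    (trans (ℤP.+-identityʳ _) (cong ((x == w) ▹_) (trans (coefP-mulP-⊖ c {mulP qm1P p} {mulP qP p} {p} (λ j → trans (coefP-qm1P p j) (cong (_-ᶻ coefP p j) (sym (coefP-qP p j)))) i)
      (cong (_-ᶻ coefP (mulP c p) i) (coefP-mulP-sh c (coefP-qP p) i)))))) (sym step)

  coef-rmulS : ∀ c x {s} → S s → coefE (scaleE c (rmulS x s)) ≑ rmul s (coefE (scaleE c x))
  coef-rmulS c x {s} Ss w i = begin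
    coefE (scaleE c (rmulS x s)) w i
      ≡⟨ coef-scaleE c (rmulS x s) w i ⟩
    ∑ (concatMap (λ t → rmulTerm t s) x) (λ t → δ (proj₂ t) (coefP (mulP c (proj₁ t))) w i)
      ≡⟨ ∑-concatMap (λ t → rmulTerm t s) x _ ⟩
    ∑ x (λ t → ∑ (rmulTerm t s) (λ t → δ (proj₂ t) (coefP (mulP c (proj₁ t))) w i))
      ≡⟨ ∑-cong x (λ {t} _ → rmulTerm-δ c (proj₁ t) (proj₂ t) Ss w i) ⟩
    ∑ x (λ t → rmul s (δ (proj₂ t) (coefP (mulP c (proj₁ t)))) w i)
      ≡⟨ rmul-∑ s x (λ t → δ (proj₂ t) (coefP (mulP c (proj₁ t)))) w i ⟨
    rmul s (λ w i → ∑ x (λ t → δ (proj₂ t) (coefP (mulP c (proj₁ t))) w i)) w i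
      ≡⟨ rmul-cong s (λ w i → coef-scaleE c x w i) w i ⟨
    rmul s (coefE (scaleE c x)) w i ∎
    where open ≡-Reasoning

  coef-rmulWord : ∀ c {σ} → All S σ → ∀ x → coefE (scaleE c (rmulWord x σ)) ≑ Rop σ (coefE (scaleE c x))
  coef-rmulWord c [] x w i = refl
  coef-rmulWord c {s ∷ σ} (Ss ∷ Sσ) x = ≑-trans (coef-rmulWord c Sσ (rmulS x s)) (Rop-cong σ (coef-rmulS c x Ss))

  len-e : len e ≡ 0
  len-e = ℕP.n≤0⇒n≡0 (len-prod [])

  module _ {ρ : List W} (Sρ : All S ρ) where
    -- The definition multiplies T_e by T_ρ and then by T_σ on the right. T_ρ may be moved to the
    -- left of T_e, left and right multiplications commute, and T_e T_σ = T_x.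
    coef-term : ∀ c {x σ} → Reduced σ x → coefE (scaleE c (rmulWord (Tword ρ) σ)) ≑ Lop ρ (δ x (coefP c))
    coef-term c {x} {σ} (Sσ , refl , l) = ≑-trans (coef-rmulWord c Sσ (Tword ρ)) (≑-trans (Rop-cong σ (≑-trans (coef-rmulWord c Sρ _)
        (≑-trans (Rop-cong ρ start) (Rop-δe Sρ (coefP c))))) (≑-trans (≑-sym (Lop-Rop Sρ Sσ (δ e (coefP c)))) (Lop-cong ρ
          (≑-trans (Rop-reduced Sσ e (coefP c) (trans (cong len (identityˡ _)) (trans (sym l) (cong (_+ length σ) (sym len-e)))))
            λ w i → cong (λ y → δ y (coefP c) w i) (identityˡ _)))))
      where
      start : coefE (scaleE c ((1ℤ ∷ [] , e) ∷ [])) ≑ δ e (coefP c)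
      start w i = trans (ℤP.+-identityʳ _) (cong ((e == w) ▹_) (coefP-mulP-one c coefP-one i))

    coef-sum : (c : W → Poly) → ∀ {I σs} → Pointwise (λ x σ → Reduced σ x) I σs →
      coefE (concat (zipWith (λ x σ → scaleE (c x) (rmulWord (Tword ρ) σ)) I σs)) ≑ Lop ρ (λ w i → ∑ I (λ x → δ x (coefP (c x)) w i))
    coef-sum c [] w i = sym (Lop-𝟎 ρ w i)
    coef-sum c {x ∷ I} {σ ∷ σs} (r ∷ rs) w i = trans (∑-++ (scaleE (c x) (rmulWord (Tword ρ) σ)) _ _)
      (trans (cong₂ _+ᶻ_ (coef-term (c x) r w i) (coef-sum c rs w i)) (sym (Lop-⊕ ρ (δ x (coefP (c x))) _ w i)))

  len-⁻¹ : ∀ w → len (w ⁻¹) ≡ len w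
  len-⁻¹ w = ℕP.≤-antisym (half w) (subst (λ z → len z ≤ len (w ⁻¹)) (⁻¹-involutive w) (half (w ⁻¹)))
    where
    inverse-word : ∀ ws → All S ws → Σ (List W) λ ws′ → All S ws′ × prod ws′ ≡ prod ws ⁻¹ × length ws′ ≡ length ws
    inverse-word [] [] = [] , [] , sym ε⁻¹≈ε , refl
    inverse-word (s ∷ ws) (Ss ∷ Sws) with inverse-word ws Sws
    ... | ws′ , Sws′ , eq , l = ws′ ++ s ∷ [] , AllP.++⁺ Sws′ (Ss ∷ []) ,
      trans (prod-++ ws′) (trans (cong₂ _·_ eq (trans (identityʳ s) (sym (invol⁻¹ (invol s Ss))))) (sym (⁻¹-anti-homo-∙ s _))) ,
      trans (LP.length-++ ws′) (trans (ℕP.+-comm (length ws′) 1) (cong suc l))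
      where
      prod-++ : ∀ xs → prod (xs ++ s ∷ []) ≡ prod xs · (s · e)
      prod-++ [] = sym (identityˡ _)
      prod-++ (x ∷ xs) = trans (cong (x ·_) (prod-++ xs)) (sym (assoc _ _ _))
    half : ∀ w → len (w ⁻¹) ≤ len w
    half w with inverse-word (word w) (word-S w)
    ... | ws′ , Sws′ , eq , l = subst₂ _≤_ (cong len (trans eq (cong _⁻¹ (word-prod w)))) (trans l (word-length w)) (len-prod Sws′)

  -- `Lop ρ` is injective, and it sends both the sum in `IsRPolys` and `Yop ρ (δ e 𝟏)`, which is
  -- q^{l(v)} times the inverse of T_{v⁻¹}, to q^{l(v)} T_e.
  R-polynomial : ∀ {R} → IsRPolys R → ∀ v → Σ (List W) λ ρ → Reduced ρ (v ⁻¹) ×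
    (∀ x → x ≤B v → sgn (len v ∸ len x) ⊛ coefP (R x v) ≐ Yop ρ (δ e 𝟏) x)
  R-polynomial {R} isR v with isR v
  ... | ρ , red@(Sρ , ρ≡ , lρ) , I , uI , I⇒ , ⇒I , σs , reds , eq = ρ , red , λ x x≤v i → trans (sym (coefs x x≤v i)) (Lop-injective Sρ same x i)
    where
    c : W → Poly
    c x = scalP (sgn (len v ∸ len x)) (R x v)
    total : Elt
    total = concat (zipWith (λ x σ → scaleE (c x) (rmulWord (Tword ρ) σ)) I σs)
    h : Fn
    h w i = ∑ I (λ x → δ x (coefP (c x)) w i)
    same : Lop ρ h ≑ Lop ρ (Yop ρ (δ e 𝟏))
    same w = begin
      Lop ρ h w                                   ≈⟨ ≐-sym (coef-sum Sρ c reds w) ⟩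
      coefE total w                               ≈⟨ eq w ⟩
      coefE ((monoP (len v) , e) ∷ []) w          ≈⟨ (λ i → trans (ℤP.+-identityʳ _) (cong ((e == w) ▹_) (coefP-monoP (len v) i))) ⟩
      δ e (shs (len v) 𝟏) w                       ≈⟨ shs-δ (e == w) (len v) ⟩
      shs (len v) (δ e 𝟏 w)                       ≡⟨ cong (λ n → shs n (δ e 𝟏 w)) (sym (trans lρ (len-⁻¹ v))) ⟩
      shs (length ρ) (δ e 𝟏 w)                    ≈⟨ ≐-sym (Yop-Rop Sρ (δ e 𝟏) w) ⟩
      Yop ρ (Rop ρ (δ e 𝟏)) w                     ≈⟨ Yop-cong ρ (Rop-δe Sρ 𝟏) w ⟩
      Yop ρ (Lop ρ (δ e 𝟏)) w                     ≈⟨ ≐-sym (Lop-Yop Sρ Sρ (δ e 𝟏) w) ⟩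
      Lop ρ (Yop ρ (δ e 𝟏)) w ∎
      where
      open ≐-Reasoning
      shs-δ : ∀ b n → (λ i → b ▹ shs n 𝟏 i) ≐ shs n (λ i → b ▹ 𝟏 i)
      shs-δ true n i = refl
      shs-δ false n i = sym (shs-𝟎 n i)
    coefs : ∀ x → x ≤B v → h x ≐ sgn (len v ∸ len x) ⊛ coefP (R x v)
    coefs x x≤v i = trans (∑-cong I λ {y} _ → cong (_▹ coefP (c y) i) (==-⇔ sym sym))
      (trans (∑-δ _≟W_ (λ y → coefP (c y) i) uI (⇒I x x≤v)) (coefP-scalP (sgn (len v ∸ len x)) (R x v) i))

-- R̃-polynomials count increasing paths

H-𝟎 : ∀ d → H d 𝟎 ≐ 𝟎
H-𝟎 zero i = refl
H-𝟎 (suc d) i = trans (cong₂ _+ᶻ_ (ℤP.*-zeroˡ (shs (suc d) 𝟏 i)) (τ-cong (H-𝟎 d) i)) (trans (ℤP.+-identityˡ _) (τs-𝟎 1 i))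

H-𝟏 : ∀ d → H (suc d) 𝟏 ≐ shs (suc d) 𝟏
H-𝟏 d i = trans (cong₂ _+ᶻ_ (ℤP.*-identityˡ (shs (suc d) 𝟏 i)) (trans (τ-cong (H-𝟎 d) i) (τs-𝟎 1 i))) (ℤP.+-identityʳ _)

module ReversedWords (C : CoxeterSystem) (len : CoxeterSystem.W C → ℕ) (isLen : CoxDefs.IsLength C len) where
  open Inversions C len isLen
  open Hecke C len isLen using (len-⁻¹; len-e)

  -- With ρ a reduced word of v⁻¹, v is read as the inverse of `prod ρ`: the first letter s of ρ is
  -- then a right descent of v, and dropping it passes to vs.
  reversed-· : ∀ {s} → S s → ∀ p → (s · p) ⁻¹ · s ≡ p ⁻¹
  reversed-· {s} Ss p = grp (p ∷ []) ((s , invol s Ss) ∷ []) ((ivar 0 ⊙ var 0) ⁻ ⊙ ivar 0) (var 0 ⁻) refl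

  reversed-length : ∀ {s ρ} → S s → All S ρ → len (prod (s ∷ ρ) ⁻¹) ≡ suc (length ρ) → len (prod ρ ⁻¹) ≡ length ρ
  reversed-length {s} {ρ} Ss Sρ eq = ℕP.≤-antisym (subst (_≤ length ρ) (sym (len-⁻¹ (prod ρ))) (len-prod Sρ))
    (ℕP.≤-pred (ℕP.≤-trans (ℕP.≤-reflexive (sym eq)) (subst (λ z → len v ≤ suc (len z)) (reversed-· Ss (prod ρ))
      (subst (λ z → len z ≤ suc (len (v · s))) (·gen·gen v Ss) (·gen-≤ (v · s) Ss)))))
    where v = prod (s ∷ ρ) ⁻¹

  reversed-descent : ∀ {s ρ} → S s → All S ρ → len (prod (s ∷ ρ) ⁻¹) ≡ suc (length ρ) →
    N (prod (s ∷ ρ) ⁻¹) (right (prod (s ∷ ρ) ⁻¹) s) ≡ true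
  reversed-descent {s} {ρ} Ss Sρ eq with N v (right v s) in d
    where v = prod (s ∷ ρ) ⁻¹
  ... | true = refl
  ... | false = ⊥-elim (ℕP.<-irrefl (sym (trans (sym (ascent-len v Ss d)) (trans (cong len (reversed-· Ss (prod ρ))) (reversed-length Ss Sρ eq))))
          (s≤s (ℕP.≤-trans (ℕP.n≤1+n _) (ℕP.≤-reflexive (sym eq)))))
    where v = prod (s ∷ ρ) ⁻¹

  descent-induction : (P : W → Set) → P e → (∀ v {s} → S s → N v (right v s) ≡ true → P (v · s) → P v) → ∀ v → P v
  descent-induction P base step v = subst P (trans (cong _⁻¹ (word-prod (v ⁻¹))) (⁻¹-involutive v))
    (go (word-S (v ⁻¹)) (trans (cong (λ z → len (z ⁻¹)) (word-prod (v ⁻¹))) (trans (cong len (⁻¹-involutive v)) (trans (sym (len-⁻¹ v)) (sym (word-length (v ⁻¹)))))))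
    where
    go : ∀ {ρ} → All S ρ → len (prod ρ ⁻¹) ≡ length ρ → P (prod ρ ⁻¹)
    go [] _ = subst P (sym ε⁻¹≈ε) base
    go (Ss ∷ Sρ) eq = step _ Ss (reversed-descent Ss Sρ eq) (subst P (sym (reversed-· Ss _)) (go Sρ (reversed-length Ss Sρ eq)))

module CountingRecursion (C : CoxeterSystem) (len : CoxeterSystem.W C → ℕ) (isLen : CoxDefs.IsLength C len)
                (lt : CoxeterSystem.W C → CoxeterSystem.W C → Bool)
                (O : ReflectionOrders.ReflectionOrder C len isLen lt) where
  open Inversions C len isLen
  open Counting C len isLen lt O

  Gs : W → W → Series
  Gs u v n = G n u v nothing

  private
    lower : ∀ v {s} → S s → N v (right v s) ≡ true → N (v · s) (right (v · s) s) xor true ≡ true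
    lower v Ss d = trans (cong (_xor true) (trans (cong (N _) (right-·gen v Ss)) (trans (descent-flip v Ss) (cong not d)))) refl

  G-descent : ∀ {u v s} → S s → N v (right v s) ≡ true → N u (right u s) ≡ true → Gs u v ≐ Gs (u · s) (v · s)
  G-descent {u} {v} {s} Ss dv du n = sym (trans (proj₁ (ladder n (v · s) nothing id (sym (·gen·gen v Ss)) (lower v Ss dv)))
      (cong (λ z → G n z v nothing) (·gen·gen u Ss)))
    where open Ladder (u · s) s Ss (trans (cong (N _) (right-·gen u Ss)) (trans (descent-flip u Ss) (cong not du)))

  G-ascent : ∀ {u v s} → S s → N v (right v s) ≡ true → N u (right u s) ≡ false → Gs u v ≐ Gs (u · s) (v · s) ⊕ λ n → qG n u (v · s) nothing
  G-ascent {u} {v} {s} Ss dv du n = proj₂ (ladder n (v · s) nothing id (sym (·gen·gen v Ss)) (lower v Ss dv))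
    where open Ladder u s Ss du

  G-e : ∀ u → Gs u e ≐ λ n → (u == e) ▹ 𝟏 n
  G-e u zero = refl
  G-e u (suc n) = trans (∑-zero (Inv e) λ t∈ → ⊥-elim (true≢false (trans (sym (Inv⇒N t∈)) (N-e _)))) (sym (▹-zero (u == e)))

module OrderIndependence (C : CoxeterSystem) (len : CoxeterSystem.W C → ℕ) (isLen : CoxDefs.IsLength C len)
    (lt lt′ : CoxeterSystem.W C → CoxeterSystem.W C → Bool)
    (O : ReflectionOrders.ReflectionOrder C len isLen lt) (O′ : ReflectionOrders.ReflectionOrder C len isLen lt′) where
  open Inversions C len isLen
  open ReversedWords C len isLen
  private
    module A = CountingRecursion C len isLen lt O
    module B = CountingRecursion C len isLen lt′ O′
    module A′ = Counting C len isLen lt O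
    module B′ = Counting C len isLen lt′ O′

  -- The recursion along right descents and the values at e determine the counts, and neither refers
  -- to the order.
  Gs-independent : ∀ u v → A.Gs u v ≐ B.Gs u v
  Gs-independent u v = descent-induction (λ v → ∀ u → A.Gs u v ≐ B.Gs u v) (λ u → ≐-trans (A.G-e u) (≐-sym (B.G-e u))) step v u
    where
    step : ∀ v {s} → S s → N v (right v s) ≡ true → (∀ u → A.Gs u (v · s) ≐ B.Gs u (v · s)) → ∀ u → A.Gs u v ≐ B.Gs u v
    step v {s} Ss d ih u n with N u (right u s) in eq
    ... | true = trans (A.G-descent Ss d eq n) (trans (ih (u · s) n) (sym (B.G-descent Ss d eq n)))
    ... | false = trans (A.G-ascent Ss d eq n) (trans (cong₂ _+ᶻ_ (ih (u · s) n) (q n)) (sym (B.G-ascent Ss d eq n)))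
      where
      q : ∀ n → A′.qG n u (v · s) nothing ≡ B′.qG n u (v · s) nothing
      q zero = refl
      q (suc n) = ih u n

module RTilde (C : CoxeterSystem) (len : CoxeterSystem.W C → ℕ) (isLen : CoxDefs.IsLength C len)
              (lt : CoxeterSystem.W C → CoxeterSystem.W C → Bool)
              (O : ReflectionOrders.ReflectionOrder C len isLen lt) where
  open Inversions C len isLen
  open Hecke C len isLen
  open ReversedWords C len isLen
  open Counting C len isLen lt O
  open CountingRecursion C len isLen lt O

  -- R_{u,v} for v = (prod ρ)⁻¹
  rpoly : List W → Fn
  rpoly [] = δ e 𝟏
  rpoly (s ∷ ρ) u = if N u (right u s) then rpoly ρ (u · s) else sh (rpoly ρ (u · s)) ⊕ (sh (rpoly ρ u) ⊖ rpoly ρ u)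

  -- Multiplication by q T_s⁻¹ yields F (us) at a descent and q F (us) - (q - 1) F u at an ascent;
  -- the alternating sign turns this into the usual recursion of the R-polynomials.
  Yop-rpoly : ∀ {ρ} → All S ρ → ∀ u → Yop ρ (δ e 𝟏) u ≐ sgn (length ρ + len u) ⊛ rpoly ρ u
  Yop-rpoly [] u i with e ≟W u
  ... | yes refl = sym (trans (cong (λ n → sgn n *ᶻ 𝟏 i) len-e) (ℤP.*-identityˡ (𝟏 i)))
  ... | no _ = sym (ℤP.*-zeroʳ (sgn (len u)))
  Yop-rpoly {s ∷ ρ} (Ss ∷ Sρ) u with N u (right u s) in eq
  ... | true = λ i → trans (lemma (Yop ρ (δ e 𝟏) (u · s) i) _) (trans (Yop-rpoly Sρ (u · s) i)
          (cong (_*ᶻ rpoly ρ (u · s) i) (trans (sym (ℤP.neg-involutive _)) (cong (λ n → sgn (suc n)) (trans (sym (ℕP.+-suc (length ρ) _)) (cong (length ρ +_) (sym (descent-len u Ss eq))))))))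
    where
    lemma : ∀ x y → x +ᶻ y -ᶻ y ≡ x
    lemma = ℤSolver.solve-∀
  ... | false = λ i → trans (cong₂ _-ᶻ_ (trans (sh-cong (Yop-rpoly Sρ (u · s)) i) (trans (sh-⊛ (sgn (length ρ + len (u · s))) (rpoly ρ (u · s)) i)
            (cong (λ n → sgn n *ᶻ sh (rpoly ρ (u · s)) i) (trans (cong (length ρ +_) (ascent-len u Ss eq)) (ℕP.+-suc (length ρ) (len u))))))
            (cong₂ _-ᶻ_ (trans (sh-cong (Yop-rpoly Sρ u) i) (sh-⊛ (sgn (length ρ + len u)) (rpoly ρ u) i)) (Yop-rpoly Sρ u i)))
          (lemma (sgn (length ρ + len u)) (sh (rpoly ρ (u · s)) i) (sh (rpoly ρ u) i) (rpoly ρ u i))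
    where
    lemma : ∀ a x y z → -ᶻ a *ᶻ x -ᶻ (a *ᶻ y -ᶻ a *ᶻ z) ≡ -ᶻ a *ᶻ (x +ᶻ (y -ᶻ z))
    lemma = ℤSolver.solve-∀

  -- This is R = t^{l(v)-l(u)} R̃(t - t⁻¹) multiplied by t^{d+l(u)}, so that neither negative powers
  -- nor truncated subtraction occur. In the term q R̃ the induction lowers d together with the
  -- length of ρ, whence the bound on d.
  spec : ∀ {ρ} → All S ρ → len (prod ρ ⁻¹) ≡ length ρ → ∀ u d → length ρ < d →
    shs (d + len u) (sq (rpoly ρ u)) ≐ shs (length ρ) (H d (Gs u (prod ρ ⁻¹)))
  spec [] _ u (suc d) _ = λ i → trans (start (e ≟W u) i) (sym (H-cong (suc d) (≐-trans (λ n → cong (λ z → Gs u z n) ε⁻¹≈ε) (G-e u)) i))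
    where
    sq-zero : ∀ i → sq 𝟎 i ≡ 0ℤ
    sq-zero zero = refl
    sq-zero (suc zero) = refl
    sq-zero (suc (suc i)) = sq-zero i
    start : (dec : Dec (e ≡ u)) → shs (suc d + len u) (sq (λ i → does dec ▹ 𝟏 i)) ≐ H (suc d) (λ n → (u == e) ▹ 𝟏 n)
    start (yes refl) i = trans (cong (λ n → shs (suc d + n) (sq 𝟏) i) len-e) (trans (cong (λ n → shs n (sq 𝟏) i) (ℕP.+-identityʳ (suc d)))
      (trans (shs-cong (suc d) sq-𝟏 i) (trans (sym (H-𝟏 d i)) (H-cong (suc d) (λ n → cong (_▹ 𝟏 n) (sym (==-refl e))) i))))
    start (no ne) i = trans (shs-cong (suc d + len u) sq-zero i) (trans (shs-𝟎 (suc d + len u) i)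
      (trans (sym (H-𝟎 (suc d) i)) (H-cong (suc d) (λ n → cong (_▹ 𝟏 n) (sym (dec-false (u ≟W e) (ne ∘ sym)))) i)))
  spec {s ∷ ρ} (Ss ∷ Sρ) lv u (suc d) (s≤s l<d) with N u (right u s) in eq
  ... | true = begin
    shs (suc d + len u) (sq (rpoly ρ (u · s)))
      ≡⟨ cong (λ n → shs n (sq (rpoly ρ (u · s)))) (trans (cong (suc d +_) (descent-len u Ss eq)) (ℕP.+-suc (suc d) _)) ⟩
    sh (shs (suc d + len (u · s)) (sq (rpoly ρ (u · s))))
      ≈⟨ sh-cong (spec Sρ (reversed-length Ss Sρ lv) (u · s) (suc d) (ℕP.m≤n⇒m≤1+n l<d)) ⟩
    sh (shs (length ρ) (H (suc d) (Gs (u · s) (prod ρ ⁻¹))))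
      ≈⟨ sh-cong (shs-cong (length ρ) (H-cong (suc d) (λ n → sym (trans (G-descent Ss (reversed-descent Ss Sρ lv) eq n) (cong (λ z → Gs (u · s) z n) (reversed-· Ss (prod ρ))))))) ⟩
    shs (suc (length ρ)) (H (suc d) (Gs u (prod (s ∷ ρ) ⁻¹))) ∎
    where open ≐-Reasoning
  ... | false = begin
    shs m (sq (sh R′ ⊕ (sh R″ ⊖ R″)))
      ≈⟨ shs-cong m (≐-trans (sq-⊕ (sh R′) (sh R″ ⊖ R″)) (⊕-cong (sq-sh R′) (≐-trans (sq-⊖ (sh R″) R″) (⊖-cong (sq-sh R″) (λ _ → refl))))) ⟩
    shs m (sh (sh (sq R′)) ⊕ τ (sq R″))
      ≈⟨ shs-⊕ m (sh (sh (sq R′))) (τ (sq R″)) ⟩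
    shs m (sh (sh (sq R′))) ⊕ shs m (τ (sq R″))
      ≈⟨ ⊕-cong left (≐-trans (≐-sym (τ-shs m (sq R″))) (≐-trans (τ-sh (shs (d + len u) (sq R″))) (sh-cong (τ-cong right-part)))) ⟩
    sh (shs l (H (suc d) (Gs (u · s) v′))) ⊕ sh (τ (shs l (H d (Gs u v′))))
      ≈⟨ ≐-trans (≐-sym (sh-⊕ (shs l (H (suc d) (Gs (u · s) v′))) (τ (shs l (H d (Gs u v′)))))) (sh-cong (⊕-cong {shs l (H (suc d) (Gs (u · s) v′))} (λ _ → refl) (τ-shs l (H d (Gs u v′))))) ⟩
    sh (shs l (H (suc d) (Gs (u · s) v′)) ⊕ shs l (τ (H d (Gs u v′))))
      ≈⟨ sh-cong (≐-sym (shs-⊕ l (H (suc d) (Gs (u · s) v′)) (τ (H d (Gs u v′))))) ⟩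
    sh (shs l (H (suc d) (Gs (u · s) v′) ⊕ τ (H d (Gs u v′))))
      ≈⟨ sh-cong (shs-cong l (≐-trans (⊕-cong {H (suc d) (Gs (u · s) v′)} (λ _ → refl) qpart) (≐-sym (H-⊕ (suc d) (Gs (u · s) v′) q)))) ⟩
    sh (shs l (H (suc d) (Gs (u · s) v′ ⊕ q)))
      ≈⟨ sh-cong (shs-cong l (H-cong (suc d) (λ n → sym (trans (G-ascent Ss (reversed-descent Ss Sρ lv) eq n)
           (cong (λ z → (Gs (u · s) z ⊕ λ n → qG n u z nothing) n) (reversed-· Ss (prod ρ))))))) ⟩
    sh (shs l (H (suc d) (Gs u (prod (s ∷ ρ) ⁻¹)))) ∎
    where
    open ≐-Reasoning
    m = suc d + len u
    l = length ρ
    v′ = prod ρ ⁻¹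
    R′ = rpoly ρ (u · s)
    R″ = rpoly ρ u
    q : Series
    q n = qG n u v′ nothing
    lv′ = reversed-length Ss Sρ lv
    left : shs m (sh (sh (sq R′))) ≐ sh (shs l (H (suc d) (Gs (u · s) v′)))
    left = ≐-trans (shs-sh m (sh (sq R′))) (sh-cong (≐-trans (shs-sh m (sq R′)) (≐-trans
      (λ i → cong (λ n → shs n (sq R′) i) (trans (sym (ℕP.+-suc (suc d) (len u))) (cong (suc d +_) (sym (ascent-len u Ss eq)))))
      (spec Sρ lv′ (u · s) (suc d) (ℕP.m≤n⇒m≤1+n l<d)))))
    right-part : shs (d + len u) (sq R″) ≐ shs l (H d (Gs u v′))
    right-part = spec Sρ lv′ u d l<d
    qpart : τ (H d (Gs u v′)) ≐ H (suc d) q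
    qpart i = sym (trans (cong (_+ᶻ τ (H d (Gs u v′)) i) (ℤP.*-zeroˡ (shs (suc d) 𝟏 i))) (ℤP.+-identityˡ _))

  ≤B⇒len≤ : ∀ {x y} → x ≤B y → len x ≤ len y
  ≤B⇒len≤ (as , p) = go as p
    where
    go : ∀ {x y} as → PathFrom x as y → len x ≤ len y
    go [] refl = ℕP.≤-refl
    go (a ∷ as) ((_ , l) , p) = ℕP.≤-trans (ℕP.<⇒≤ l) (go as p)

  Rtilde-G : ∀ {R Rt} → IsRPolys R → IsRtildes R Rt → ∀ {u v} → u ≤B v → coefP (Rt u v) ≐ Gs u v
  Rtilde-G {R} {Rt} isR isRt {u} {v} u≤v n with R-polynomial {R} isR v
  ... | ρ , (Sρ , ρ≡ , lρ) , h = H-injective D {coefP (Rt u v)} {Gs u v} (shs-injective (len v) (begin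
      shs (len v) (H D (coefP rt))                     ≡⟨ cong (λ m → shs m (H D (coefP rt))) (sym (ℕP.m+[n∸m]≡n (≤B⇒len≤ u≤v))) ⟩
      shs (len u + l) (H D (coefP rt))                 ≈⟨ shs-+ (len u) l (H D (coefP rt)) ⟩
      shs (len u) (shs l (H D (coefP rt)))             ≈⟨ shs-cong (len u) (≐-sym (RtSpec-extend l (R u v) rt k (isRt u v u≤v))) ⟩
      shs (len u) (shs D (sq (coefP (R u v))))         ≈⟨ ≐-sym (shs-+ (len u) D (sq (coefP (R u v)))) ⟩
      shs (len u + D) (sq (coefP (R u v)))             ≡⟨ cong (λ m → shs m (sq (coefP (R u v)))) (ℕP.+-comm (len u) D) ⟩
      shs (D + len u) (sq (coefP (R u v)))             ≈⟨ shs-cong (D + len u) (sq-cong R≐) ⟩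
      shs (D + len u) (sq (rpoly ρ u))                 ≈⟨ spec Sρ (trans (cong len v≡) (sym lρ′)) u D ρ<D ⟩
      shs (length ρ) (H D (Gs u (prod ρ ⁻¹)))          ≡⟨ cong₂ (λ m z → shs m (H D (Gs u z))) lρ′ v≡ ⟩
      shs (len v) (H D (Gs u v)) ∎)) n n<D
    where
    open ≐-Reasoning
    rt = Rt u v
    l = len v ∸ len u
    -- Makes `D` exceed l(v), as `spec` demands, and n, so that `H-injective` reaches this
    -- coefficient, while `RtSpec-extend` raises the bound from `length rt` by k.
    k = suc (length ρ) + suc n
    D = k + length rt
    v≡ : prod ρ ⁻¹ ≡ v
    v≡ = trans (cong _⁻¹ ρ≡) (⁻¹-involutive v)
    lρ′ : length ρ ≡ len v
    lρ′ = trans lρ (len-⁻¹ v)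
    ρ<D : length ρ < D
    ρ<D = ℕP.≤-trans (ℕP.m≤m+n (suc (length ρ)) (suc n)) (ℕP.m≤m+n k (length rt))
    n<D : n < D
    n<D = ℕP.≤-trans (ℕP.m≤n+m (suc n) (suc (length ρ))) (ℕP.m≤m+n k (length rt))
    R≐ : coefP (R u v) ≐ rpoly ρ u
    R≐ i = *-sgn-cancel (len v + len u) (trans (ℤP.*-comm (coefP (R u v) i) _) (trans (cong (_*ᶻ coefP (R u v) i) (sym (sgn-∸ (≤B⇒len≤ u≤v))))
      (trans (h u u≤v i) (trans (Yop-rpoly Sρ u i) (trans (cong (λ m → sgn (m + len u) *ᶻ rpoly ρ u i) lρ′) (ℤP.*-comm _ (rpoly ρ u i)))))))

-- The peak algebra and cd-polynomials

-- conv k f = Σ_{i+j=k} f i j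
conv : ℕ → (ℕ → ℕ → ℤ) → ℤ
conv zero f = f 0 0
conv (suc k) f = f 0 (suc k) +ᶻ conv k (λ i j → f (suc i) j)

conv-cong : ∀ k {f g} → (∀ i j → i + j ≡ k → f i j ≡ g i j) → conv k f ≡ conv k g
conv-cong zero h = h 0 0 refl
conv-cong (suc k) h = cong₂ _+ᶻ_ (h 0 (suc k) refl) (conv-cong k λ i j eq → h (suc i) j (cong suc eq))

conv-+ : ∀ k f g → conv k (λ i j → f i j +ᶻ g i j) ≡ conv k f +ᶻ conv k g
conv-+ zero f g = refl
conv-+ (suc k) f g = trans (cong (f 0 (suc k) +ᶻ g 0 (suc k) +ᶻ_) (conv-+ k (f ∘ suc) (g ∘ suc))) (+-interchange (f 0 (suc k)) (g 0 (suc k)) (conv k (f ∘ suc)) (conv k (g ∘ suc)))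

conv-* : ∀ k a f → conv k (λ i j → a *ᶻ f i j) ≡ a *ᶻ conv k f
conv-* zero a f = refl
conv-* (suc k) a f = trans (cong (a *ᶻ f 0 (suc k) +ᶻ_) (conv-* k a (f ∘ suc))) (sym (ℤP.*-distribˡ-+ a (f 0 (suc k)) (conv k (f ∘ suc))))

conv-linear : ∀ k a f g → conv k (λ i j → f i j +ᶻ a *ᶻ g i j) ≡ conv k f +ᶻ a *ᶻ conv k g
conv-linear k a f g = trans (conv-+ k f (λ i j → a *ᶻ g i j)) (cong (conv k f +ᶻ_) (conv-* k a g))

conv-∑ : ∀ {A : Set} k (xs : List A) (f : ℕ → ℕ → A → ℤ) → conv k (λ i j → ∑ xs (f i j)) ≡ ∑ xs (λ x → conv k (λ i j → f i j x))
conv-∑ zero xs f = refl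
conv-∑ (suc k) xs f = trans (cong (∑ xs (f 0 (suc k)) +ᶻ_) (conv-∑ k xs (λ i j → f (suc i) j)))
  (sym (∑-+ xs (f 0 (suc k)) (λ x → conv k (λ i j → f (suc i) j x))))

-- A functional on noncommutative symmetric functions, given by its values
-- φ γ on h_{γ₁} h_{γ₂} ⋯, that kills the ideal generated by h(q) h(−q) = 1.
record PeakFunctional (φ : List ℕ → ℤ) : Set where
  field
    zero-part : ∀ β γ → φ (β ++ 0 ∷ γ) ≡ φ (β ++ γ)
    euler     : ∀ β k γ → conv (suc k) (λ i j → sgn j *ᶻ φ (β ++ i ∷ j ∷ γ)) ≡ 0ℤ

open PeakFunctional

prefix-functional : ∀ {φ} β → PeakFunctional φ → PeakFunctional (λ γ → φ (β ++ γ))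
prefix-functional {φ} β P = record
  { zero-part = λ β′ γ → trans (cong φ (assoc β β′ (0 ∷ γ))) (trans (zero-part P (β ++ β′) γ) (cong φ (sym (assoc β β′ γ))))
  ; euler = λ β′ k γ → trans (conv-cong (suc k) λ i j _ → cong (λ δ → sgn j *ᶻ φ δ) (assoc β β′ (i ∷ j ∷ γ))) (euler P (β ++ β′) k γ)
  }
  where
  assoc : ∀ (α β γ : List ℕ) → α ++ (β ++ γ) ≡ (α ++ β) ++ γ
  assoc [] β γ = refl
  assoc (a ∷ α) β γ = cong (a ∷_) (assoc α β γ)

difference-functional : ∀ {φ ψ} a → PeakFunctional φ → PeakFunctional ψ → PeakFunctional (λ γ → φ γ -ᶻ a *ᶻ ψ γ)
difference-functional {φ} {ψ} a P P′ = record
  { zero-part = λ β γ → cong₂ (λ x y → x -ᶻ a *ᶻ y) (zero-part P β γ) (zero-part P′ β γ)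
  ; euler = λ β k γ → trans (conv-cong (suc k) λ i j _ → lemma (sgn j) (φ (β ++ i ∷ j ∷ γ)) (ψ (β ++ i ∷ j ∷ γ)) a)
      (trans (conv-linear (suc k) (-ᶻ a) (λ i j → sgn j *ᶻ φ (β ++ i ∷ j ∷ γ)) (λ i j → sgn j *ᶻ ψ (β ++ i ∷ j ∷ γ)))
        (cong₂ _+ᶻ_ (euler P β k γ) (trans (cong (-ᶻ a *ᶻ_) (euler P′ β k γ)) (ℤP.*-zeroʳ (-ᶻ a)))))
  }
  where
  lemma : ∀ s x y a → s *ᶻ (x -ᶻ a *ᶻ y) ≡ s *ᶻ x +ᶻ -ᶻ a *ᶻ (s *ᶻ y)
  lemma = ℤSolver.solve-∀

-- A power series Q(q) = Σ Qᵢ qⁱ with functionals as coefficients, where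
-- (Qᵢ · h_j) γ = Qᵢ (j ∷ γ), that satisfies Q(q) h(−q) = Q(−q).
record EvenSeries (Q : ℕ → List ℕ → ℤ) : Set where
  field
    functional : ∀ i → PeakFunctional (Q i)
    even       : ∀ k γ → conv k (λ i j → sgn j *ᶻ Q i (j ∷ γ)) ≡ sgn k *ᶻ Q k γ

open EvenSeries

module _ {Q : ℕ → List ℕ → ℤ} (E : EvenSeries Q) where
  -- The coefficient of q in Q(q) h(-q) = Q(-q) reads Q₁ - Q₀h₁ = -Q₁.
  twice-Q₁ : ∀ γ → ℤ.+ 2 *ᶻ Q 1 γ ≡ Q 0 (1 ∷ γ)
  twice-Q₁ γ = begin
    ℤ.+ 2 *ᶻ Q 1 γ                                       ≡⟨ lemma (Q 0 (1 ∷ γ)) (Q 1 γ) ⟩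
    Q 0 (1 ∷ γ) +ᶻ Q 1 γ +ᶻ (-ᶻ 1ℤ *ᶻ Q 0 (1 ∷ γ) +ᶻ 1ℤ *ᶻ Q 1 γ) ≡⟨ cong (Q 0 (1 ∷ γ) +ᶻ Q 1 γ +ᶻ_)
                                                               (trans (cong (λ z → -ᶻ 1ℤ *ᶻ Q 0 (1 ∷ γ) +ᶻ 1ℤ *ᶻ z) (sym (zero-part (functional E 1) [] γ))) (even E 1 γ)) ⟩
    Q 0 (1 ∷ γ) +ᶻ Q 1 γ +ᶻ -ᶻ 1ℤ *ᶻ Q 1 γ               ≡⟨ lemma′ (Q 0 (1 ∷ γ)) (Q 1 γ) ⟩
    Q 0 (1 ∷ γ) ∎
    where
    open ≡-Reasoning
    lemma : ∀ x y → ℤ.+ 2 *ᶻ y ≡ x +ᶻ y +ᶻ (-ᶻ 1ℤ *ᶻ x +ᶻ 1ℤ *ᶻ y)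
    lemma = ℤSolver.solve-∀
    lemma′ : ∀ x y → x +ᶻ y +ᶻ -ᶻ 1ℤ *ᶻ y ≡ x
    lemma′ = ℤSolver.solve-∀

  -- the series Q₀ K with K(q) = (h(q) − 1)/q
  Q₀K : ℕ → List ℕ → ℤ
  Q₀K i γ = Q 0 (suc i ∷ γ)

  -- From h(q) h(-q) = 1 follows K(q) h(-q) = (1 - h(-q))/q = K(-q).
  Q₀K-even : EvenSeries Q₀K
  Q₀K-even = record
    { functional = λ i → prefix-functional (suc i ∷ []) (functional E 0)
    ; even = λ k γ → begin
        rest k γ
          ≡⟨ lemma (sgn k) (Q 0 (suc k ∷ γ)) (rest k γ) ⟩
        -ᶻ sgn k *ᶻ Q 0 (suc k ∷ γ) +ᶻ rest k γ +ᶻ sgn k *ᶻ Q 0 (suc k ∷ γ)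
          ≡⟨ cong (λ z → -ᶻ sgn k *ᶻ z +ᶻ rest k γ +ᶻ sgn k *ᶻ Q 0 (suc k ∷ γ)) (sym (zero-part (functional E 0) [] (suc k ∷ γ))) ⟩
        conv (suc k) (λ i j → sgn j *ᶻ Q 0 (i ∷ j ∷ γ)) +ᶻ sgn k *ᶻ Q 0 (suc k ∷ γ)
          ≡⟨ cong (_+ᶻ sgn k *ᶻ Q 0 (suc k ∷ γ)) (euler (functional E 0) [] k γ) ⟩
        0ℤ +ᶻ sgn k *ᶻ Q 0 (suc k ∷ γ)
          ≡⟨ ℤP.+-identityˡ _ ⟩
        sgn k *ᶻ Q 0 (suc k ∷ γ) ∎
    }
    where
    open ≡-Reasoning
    rest : ℕ → List ℕ → ℤ
    rest k γ = conv k (λ i j → sgn j *ᶻ Q 0 (suc i ∷ j ∷ γ))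
    lemma : ∀ s x r → r ≡ -ᶻ s *ᶻ x +ᶻ r +ᶻ s *ᶻ x
    lemma = ℤSolver.solve-∀

  -- q² D(q) = Q₀ (h(q) + 1) − 2 Q(q); multiplying by h(−q) turns the right-hand
  -- side into its value at −q, so D is even again.
  D : ℕ → List ℕ → ℤ
  D i γ = Q 0 (suc (suc i) ∷ γ) -ᶻ ℤ.+ 2 *ᶻ Q (suc (suc i)) γ

  D-even : EvenSeries D
  D-even = record
    { functional = λ i → difference-functional (ℤ.+ 2) (prefix-functional (suc (suc i) ∷ []) (functional E 0)) (functional E (suc (suc i)))
    ; even = λ k γ → begin
        conv k (λ i j → sgn j *ᶻ D i (j ∷ γ))
          ≡⟨ conv-cong k (λ i j _ → distribute (sgn j) (Q 0 (2 + i ∷ j ∷ γ)) (Q (2 + i) (j ∷ γ))) ⟩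
        conv k (λ i j → sgn j *ᶻ Q 0 (2 + i ∷ j ∷ γ) +ᶻ -ᶻ (ℤ.+ 2) *ᶻ (sgn j *ᶻ Q (2 + i) (j ∷ γ)))
          ≡⟨ conv-linear k (-ᶻ (ℤ.+ 2)) (λ i j → sgn j *ᶻ Q 0 (2 + i ∷ j ∷ γ)) (λ i j → sgn j *ᶻ Q (2 + i) (j ∷ γ)) ⟩
        a k γ +ᶻ -ᶻ (ℤ.+ 2) *ᶻ b k γ
          -- The coefficient of q^{k+2}: `D` leaves out the terms i = 0 and i = 1, and these are
          -- supplied by the Euler relation, the evenness of Q and 2Q₁ = Q₀h₁.
          ≡⟨ combine (sgn k) (a k γ) (b k γ) (Q 0 (2 + k ∷ γ)) (Q 0 (1 ∷ suc k ∷ γ)) (Q 1 (suc k ∷ γ)) (Q (2 + k) γ)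
               (trans (cong (λ z → sgn (2 + k) *ᶻ z +ᶻ (sgn (suc k) *ᶻ Q 0 (1 ∷ suc k ∷ γ) +ᶻ a k γ)) (sym (zero-part (functional E 0) [] (2 + k ∷ γ))))
                 (euler (functional E 0) [] (suc k) γ))
               (even E (2 + k) γ) (twice-Q₁ (suc k ∷ γ)) ⟩
        sgn k *ᶻ D k γ ∎
    }
    where
    open ≡-Reasoning
    a b : ℕ → List ℕ → ℤ
    a k γ = conv k (λ i j → sgn j *ᶻ Q 0 (2 + i ∷ j ∷ γ))
    b k γ = conv k (λ i j → sgn j *ᶻ Q (2 + i) (j ∷ γ))
    distribute : ∀ s x y → s *ᶻ (x -ᶻ ℤ.+ 2 *ᶻ y) ≡ s *ᶻ x +ᶻ -ᶻ (ℤ.+ 2) *ᶻ (s *ᶻ y)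
    distribute = ℤSolver.solve-∀
    combine : ∀ s a b x y z w → -ᶻ -ᶻ s *ᶻ x +ᶻ (-ᶻ s *ᶻ y +ᶻ a) ≡ 0ℤ → -ᶻ -ᶻ s *ᶻ x +ᶻ (-ᶻ s *ᶻ z +ᶻ b) ≡ -ᶻ -ᶻ s *ᶻ w →
      ℤ.+ 2 *ᶻ z ≡ y → a +ᶻ -ᶻ (ℤ.+ 2) *ᶻ b ≡ s *ᶻ (x -ᶻ ℤ.+ 2 *ᶻ w)
    combine s a b x y z w h₁ h₂ h₃ = trans (cong₂ (λ p q → p +ᶻ -ᶻ (ℤ.+ 2) *ᶻ q) a≡ b≡)
      (trans (cong (λ y → s *ᶻ y -ᶻ s *ᶻ x +ᶻ -ᶻ (ℤ.+ 2) *ᶻ (s *ᶻ w +ᶻ s *ᶻ z -ᶻ s *ᶻ x)) (sym h₃)) (final s x z w))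
      where
      a≡ : a ≡ s *ᶻ y -ᶻ s *ᶻ x
      a≡ = trans (solve₁ s a x y) (trans (cong (_+ᶻ (s *ᶻ y -ᶻ s *ᶻ x)) h₁) (ℤP.+-identityˡ _))
        where
        solve₁ : ∀ s a x y → a ≡ -ᶻ -ᶻ s *ᶻ x +ᶻ (-ᶻ s *ᶻ y +ᶻ a) +ᶻ (s *ᶻ y -ᶻ s *ᶻ x)
        solve₁ = ℤSolver.solve-∀
      b≡ : b ≡ s *ᶻ w +ᶻ s *ᶻ z -ᶻ s *ᶻ x
      b≡ = trans (solve₂ s b x z) (trans (cong (_+ᶻ (s *ᶻ z -ᶻ s *ᶻ x)) h₂) (solve₃ s w z x))
        where
        solve₂ : ∀ s b x z → b ≡ -ᶻ -ᶻ s *ᶻ x +ᶻ (-ᶻ s *ᶻ z +ᶻ b) +ᶻ (s *ᶻ z -ᶻ s *ᶻ x)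
        solve₂ = ℤSolver.solve-∀
        solve₃ : ∀ s w z x → -ᶻ -ᶻ s *ᶻ w +ᶻ (s *ᶻ z -ᶻ s *ᶻ x) ≡ s *ᶻ w +ᶻ s *ᶻ z -ᶻ s *ᶻ x
        solve₃ = ℤSolver.solve-∀
      final : ∀ s x z w → s *ᶻ (ℤ.+ 2 *ᶻ z) -ᶻ s *ᶻ x +ᶻ -ᶻ (ℤ.+ 2) *ᶻ (s *ᶻ w +ᶻ s *ᶻ z -ᶻ s *ᶻ x) ≡ s *ᶻ (x -ᶻ ℤ.+ 2 *ᶻ w)
      final = ℤSolver.solve-∀

-- r Q w is the coefficient of the ab-word w (a = false, b = true) in
-- Q(a−b) (1 + bΨ), where Ψ = K(a−b) (1 + bΨ); the tail of γ is evaluated at [].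
r : (ℕ → List ℕ → ℤ) → List Bool → ℤ
r Q [] = Q 0 []
r Q (false ∷ w) = r (Q ∘ suc) w
r Q (true ∷ w) = r (λ i γ → Q 0 (suc i ∷ γ)) w -ᶻ r (Q ∘ suc) w

r-cong : ∀ {Q Q′} → (∀ i γ → Q i γ ≡ Q′ i γ) → ∀ w → r Q w ≡ r Q′ w
r-cong h [] = h 0 []
r-cong h (false ∷ w) = r-cong (h ∘ suc) w
r-cong h (true ∷ w) = cong₂ _-ᶻ_ (r-cong (λ i γ → h 0 (suc i ∷ γ)) w) (r-cong (h ∘ suc) w)

r-linear : ∀ a b Q Q′ w → r (λ i γ → a *ᶻ Q i γ -ᶻ b *ᶻ Q′ i γ) w ≡ a *ᶻ r Q w -ᶻ b *ᶻ r Q′ w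
r-linear a b Q Q′ [] = refl
r-linear a b Q Q′ (false ∷ w) = r-linear a b (Q ∘ suc) (Q′ ∘ suc) w
r-linear a b Q Q′ (true ∷ w) = trans (cong₂ _-ᶻ_ (r-linear a b (λ i γ → Q 0 (suc i ∷ γ)) (λ i γ → Q′ 0 (suc i ∷ γ)) w) (r-linear a b (Q ∘ suc) (Q′ ∘ suc) w))
  (lemma a b (r (λ i γ → Q 0 (suc i ∷ γ)) w) (r (λ i γ → Q′ 0 (suc i ∷ γ)) w) (r (Q ∘ suc) w) (r (Q′ ∘ suc) w))
  where
  lemma : ∀ a b x y z w → a *ᶻ x -ᶻ b *ᶻ y -ᶻ (a *ᶻ z -ᶻ b *ᶻ w) ≡ a *ᶻ (x -ᶻ z) -ᶻ b *ᶻ (y -ᶻ w)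
  lemma = ℤSolver.solve-∀

r-zero : ∀ {Q} → (∀ i γ → Q i γ ≡ 0ℤ) → ∀ w → r Q w ≡ 0ℤ
r-zero h [] = h 0 []
r-zero h (false ∷ w) = r-zero (h ∘ suc) w
r-zero h (true ∷ w) = cong₂ _-ᶻ_ (r-zero (λ i γ → h 0 (suc i ∷ γ)) w) (r-zero (h ∘ suc) w)

module _ {Q : ℕ → List ℕ → ℤ} (E : EvenSeries Q) where
  -- `r-a` and `r-b` are the two halves of one identity: twice the ab-polynomial of `Q ∘ suc` minus
  -- that of `Q₀K` is (b - a) times that of `D`.
  r-a : ∀ w → ℤ.+ 2 *ᶻ r (Q ∘ suc) (false ∷ w) -ᶻ r (Q₀K E) (false ∷ w) ≡ -ᶻ r (D E) w
  r-a w = begin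
    ℤ.+ 2 *ᶻ r (Q ∘ suc) (false ∷ w) -ᶻ r (Q₀K E) (false ∷ w)     ≡⟨ lemma (r (Q ∘ suc) (false ∷ w)) (r (Q₀K E) (false ∷ w)) ⟩
    -ᶻ (1ℤ *ᶻ r (Q₀K E ∘ suc) w -ᶻ ℤ.+ 2 *ᶻ r (Q ∘ suc ∘ suc) w) ≡⟨ cong -ᶻ_ (r-linear 1ℤ (ℤ.+ 2) (Q₀K E ∘ suc) (Q ∘ suc ∘ suc) w) ⟨
    -ᶻ r (λ i γ → 1ℤ *ᶻ Q 0 (2 + i ∷ γ) -ᶻ ℤ.+ 2 *ᶻ Q (2 + i) γ) w ≡⟨ cong -ᶻ_ (r-cong (λ i γ → cong (_-ᶻ ℤ.+ 2 *ᶻ Q (2 + i) γ) (ℤP.*-identityˡ (Q 0 (2 + i ∷ γ)))) w) ⟩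
    -ᶻ r (D E) w ∎
    where
    open ≡-Reasoning
    lemma : ∀ x y → ℤ.+ 2 *ᶻ x -ᶻ y ≡ -ᶻ (1ℤ *ᶻ y -ᶻ ℤ.+ 2 *ᶻ x)
    lemma = ℤSolver.solve-∀

  -- By 2Q₁ = Q₀h₁ the parts in which a new factor K begins cancel; what remains is `r-a` with the
  -- opposite sign.
  r-b : ∀ w → ℤ.+ 2 *ᶻ r (Q ∘ suc) (true ∷ w) -ᶻ r (Q₀K E) (true ∷ w) ≡ r (D E) w
  r-b w = begin
    ℤ.+ 2 *ᶻ (x -ᶻ y) -ᶻ (x′ -ᶻ y′)               ≡⟨ lemma x y x′ y′ ⟩
    ℤ.+ 2 *ᶻ x -ᶻ 1ℤ *ᶻ x′ -ᶻ (ℤ.+ 2 *ᶻ y -ᶻ y′)   ≡⟨ cong₂ _-ᶻ_ (trans (sym (r-linear (ℤ.+ 2) 1ℤ (λ i γ → Q 1 (suc i ∷ γ)) (λ i γ → Q 0 (1 ∷ suc i ∷ γ)) w))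
                                                        (r-zero (λ i γ → trans (cong₂ _-ᶻ_ (twice-Q₁ E (suc i ∷ γ)) (ℤP.*-identityˡ (Q 0 (1 ∷ suc i ∷ γ)))) (ℤP.+-inverseʳ (Q 0 (1 ∷ suc i ∷ γ)))) w)) (r-a w) ⟩
    0ℤ -ᶻ -ᶻ r (D E) w                             ≡⟨ lemma′ (r (D E) w) ⟩
    r (D E) w ∎
    where
    open ≡-Reasoning
    x = r (λ i γ → Q 1 (suc i ∷ γ)) w
    y = r (Q ∘ suc ∘ suc) w
    x′ = r (λ i γ → Q 0 (1 ∷ suc i ∷ γ)) w
    y′ = r (λ i γ → Q 0 (2 + i ∷ γ)) w
    lemma : ∀ x y x′ y′ → ℤ.+ 2 *ᶻ (x -ᶻ y) -ᶻ (x′ -ᶻ y′) ≡ ℤ.+ 2 *ᶻ x -ᶻ 1ℤ *ᶻ x′ -ᶻ (ℤ.+ 2 *ᶻ y -ᶻ y′)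
    lemma = ℤSolver.solve-∀
    lemma′ : ∀ x → 0ℤ -ᶻ -ᶻ x ≡ x
    lemma′ = ℤSolver.solve-∀

-- homogeneous cd-polynomials: node g h stands for c g + d h
data CDPoly : ℕ → Set where
  const₀ : ℤ → CDPoly 0
  const₁ : ℤ → CDPoly 1
  node   : ∀ {n} → CDPoly (suc n) → CDPoly n → CDPoly (suc (suc n))

-- the coefficient of an ab-word after substituting c = a + b and d = ab + ba
expand : ∀ {n} → CDPoly n → List Bool → ℤ
expand (const₀ a) w = a
expand (const₁ a) w = a
expand (node g h) (x ∷ y ∷ w) = expand g (y ∷ w) +ᶻ (x xor y) ▹ expand h w
expand (node g h) _ = 0ℤ

const𝟎 : ∀ n → CDPoly n
const𝟎 zero = const₀ 0ℤ
const𝟎 (suc zero) = const₁ 0ℤ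
const𝟎 (suc (suc n)) = node (const𝟎 (suc n)) (const𝟎 n)

expand-𝟎 : ∀ n w → expand (const𝟎 n) w ≡ 0ℤ
expand-𝟎 zero w = refl
expand-𝟎 (suc zero) w = refl
expand-𝟎 (suc (suc n)) [] = refl
expand-𝟎 (suc (suc n)) (x ∷ []) = refl
expand-𝟎 (suc (suc n)) (x ∷ y ∷ w) = cong₂ _+ᶻ_ (expand-𝟎 (suc n) (y ∷ w)) (trans (cong ((x xor y) ▹_) (expand-𝟎 n w)) (▹-zero (x xor y)))

c·_ : ∀ {n} → CDPoly n → CDPoly (suc n)
c·_ {zero} (const₀ a) = const₁ a
c·_ {suc n} t = node t (const𝟎 n)

expand-c· : ∀ {n} (t : CDPoly n) x w → length w ≡ n → expand (c· t) (x ∷ w) ≡ expand t w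
expand-c· {zero} (const₀ a) x [] _ = refl
expand-c· {suc n} t x (y ∷ w) _ = trans (cong (expand t (y ∷ w) +ᶻ_) (trans (cong ((x xor y) ▹_) (expand-𝟎 n w)) (▹-zero (x xor y)))) (ℤP.+-identityʳ _)

_⊟_ : ∀ {n} → CDPoly n → CDPoly n → CDPoly n
const₀ a ⊟ const₀ b = const₀ (a -ᶻ b)
const₁ a ⊟ const₁ b = const₁ (a -ᶻ b)
node g h ⊟ node g′ h′ = node (g ⊟ g′) (h ⊟ h′)

expand-⊟ : ∀ {n} (t t′ : CDPoly n) w → expand (t ⊟ t′) w ≡ expand t w -ᶻ expand t′ w
expand-⊟ (const₀ a) (const₀ b) w = refl
expand-⊟ (const₁ a) (const₁ b) w = refl
expand-⊟ (node g h) (node g′ h′) [] = refl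
expand-⊟ (node g h) (node g′ h′) (x ∷ []) = refl
expand-⊟ (node g h) (node g′ h′) (x ∷ y ∷ w) = trans (cong₂ (λ p q → p +ᶻ (x xor y) ▹ q) (expand-⊟ g g′ (y ∷ w)) (expand-⊟ h h′ w))
  (lemma (x xor y) (expand g (y ∷ w)) (expand g′ (y ∷ w)) (expand h w) (expand h′ w))
  where
  ring : ∀ x x′ y y′ → x -ᶻ x′ +ᶻ (y -ᶻ y′) ≡ x +ᶻ y -ᶻ (x′ +ᶻ y′)
  ring = ℤSolver.solve-∀
  lemma : ∀ b x x′ y y′ → x -ᶻ x′ +ᶻ b ▹ (y -ᶻ y′) ≡ x +ᶻ b ▹ y -ᶻ (x′ +ᶻ b ▹ y′)
  lemma b x x′ y y′ = trans (cong (x -ᶻ x′ +ᶻ_) (▹-- b y y′)) (ring x x′ (b ▹ y) (b ▹ y′))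

-- An integral ab-polynomial whose double is a cd-polynomial is a cd-polynomial:
-- the coefficients of a cd-polynomial are integral combinations of those of its expansion.
halve : ∀ {n} (t : CDPoly n) (g : List Bool → ℤ) → (∀ w → length w ≡ n → ℤ.+ 2 *ᶻ g w ≡ expand t w) →
  Σ (CDPoly n) λ t′ → ∀ w → length w ≡ n → ℤ.+ 2 *ᶻ expand t′ w ≡ expand t w
halve (const₀ a) g h = const₀ (g []) , λ { [] _ → h [] refl }
halve (const₁ a) g h = const₁ (g (false ∷ [])) , λ _ _ → h (false ∷ []) refl
halve {suc (suc n)} (node t s) g h with halve s gₛ hₛ
  where
  gₛ : List Bool → ℤ
  -- The words baw and aaw have the same c-part, so their difference isolates the d-part.
  gₛ w = g (true ∷ false ∷ w) -ᶻ g (false ∷ false ∷ w)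
  hₛ : ∀ w → length w ≡ n → ℤ.+ 2 *ᶻ gₛ w ≡ expand s w
  hₛ w l = trans (lemma (g (true ∷ false ∷ w)) (g (false ∷ false ∷ w))) (trans (cong₂ _-ᶻ_ (h (true ∷ false ∷ w) (cong (suc ∘ suc) l)) (h (false ∷ false ∷ w) (cong (suc ∘ suc) l)))
    (lemma′ (expand t (false ∷ w)) (expand s w)))
    where
    lemma : ∀ x y → ℤ.+ 2 *ᶻ (x -ᶻ y) ≡ ℤ.+ 2 *ᶻ x -ᶻ ℤ.+ 2 *ᶻ y
    lemma = ℤSolver.solve-∀
    lemma′ : ∀ x y → x +ᶻ y -ᶻ (x +ᶻ 0ℤ) ≡ y
    lemma′ = ℤSolver.solve-∀
... | s′ , hs′ with halve t gₜ hₜ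
  where
  gₜ : List Bool → ℤ
  gₜ [] = 0ℤ
  gₜ (y ∷ w) = g (false ∷ y ∷ w) -ᶻ y ▹ expand s′ w
  hₜ : ∀ w → length w ≡ suc n → ℤ.+ 2 *ᶻ gₜ w ≡ expand t w
  hₜ (y ∷ w) l = trans (lemma y (g (false ∷ y ∷ w)) (expand s′ w)) (trans (cong₂ (λ p q → p -ᶻ y ▹ q) (h (false ∷ y ∷ w) (cong suc l)) (hs′ w (ℕP.suc-injective l)))
    (lemma′ y (expand t (y ∷ w)) (expand s w)))
    where
    ring : ∀ x y → ℤ.+ 2 *ᶻ (x -ᶻ y) ≡ ℤ.+ 2 *ᶻ x -ᶻ ℤ.+ 2 *ᶻ y
    ring = ℤSolver.solve-∀
    lemma : ∀ b x y → ℤ.+ 2 *ᶻ (x -ᶻ b ▹ y) ≡ ℤ.+ 2 *ᶻ x -ᶻ b ▹ (ℤ.+ 2 *ᶻ y)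
    lemma b x y = trans (ring x (b ▹ y)) (cong (λ z → ℤ.+ 2 *ᶻ x -ᶻ z) (sym (▹-*ʳ b (ℤ.+ 2) y)))
    ring′ : ∀ x y → x +ᶻ y -ᶻ y ≡ x
    ring′ = ℤSolver.solve-∀
    lemma′ : ∀ b x y → x +ᶻ (false xor b) ▹ y -ᶻ b ▹ y ≡ x
    lemma′ b x y = ring′ x (b ▹ y)
... | t′ , ht′ = node t′ s′ , correct
  where
  correct : ∀ w → length w ≡ suc (suc n) → ℤ.+ 2 *ᶻ expand (node t′ s′) w ≡ expand (node t s) w
  correct (x ∷ y ∷ w) l = trans (lemma (x xor y) (expand t′ (y ∷ w)) (expand s′ w))
    (cong₂ (λ p q → p +ᶻ (x xor y) ▹ q) (ht′ (y ∷ w) (ℕP.suc-injective l)) (hs′ w (ℕP.suc-injective (ℕP.suc-injective l))))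
    where
    lemma : ∀ b x y → ℤ.+ 2 *ᶻ (x +ᶻ b ▹ y) ≡ ℤ.+ 2 *ᶻ x +ᶻ b ▹ (ℤ.+ 2 *ᶻ y)
    lemma b x y = trans (ℤP.*-distribˡ-+ (ℤ.+ 2) x (b ▹ y)) (cong (ℤ.+ 2 *ᶻ x +ᶻ_) (sym (▹-*ʳ b (ℤ.+ 2) y)))

cancel-2 : ∀ {x y} → ℤ.+ 2 *ᶻ x ≡ ℤ.+ 2 *ᶻ y → x ≡ y
cancel-2 {x} {y} = ℤP.*-cancelˡ-≡ (ℤ.+ 2) x y

-- Writing the ab-polynomial r Q as c g + d h, one finds h = r D and 2g = r (Q₀K) − c h.
cd-expansion : ∀ n {Q} → EvenSeries Q → Σ (CDPoly n) λ t → ∀ w → length w ≡ n → r Q w ≡ expand t w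
cd-expansion zero {Q} E = const₀ (Q 0 []) , λ { [] _ → refl }
cd-expansion (suc zero) {Q} E = const₁ (Q 1 []) , λ
  { (false ∷ []) _ → refl
  ; (true ∷ []) _ → trans (cong (_-ᶻ Q 1 []) (sym (twice-Q₁ E []))) (lemma (Q 1 [])) }
  where
  lemma : ∀ x → ℤ.+ 2 *ᶻ x -ᶻ x ≡ x
  lemma = ℤSolver.solve-∀
cd-expansion (suc (suc n)) {Q} E with cd-expansion (suc n) (Q₀K-even E) | cd-expansion n (D-even E)
... | p , hp | h , hh with halve (p ⊟ (c· h)) g double
  where
  g : List Bool → ℤ
  g [] = 0ℤ
  -- The coefficient of ayw in r Q without its d-part. It is visibly integral, and its double is the
  -- expansion of p - c h.
  g (y ∷ w) = r (Q ∘ suc) (y ∷ w) -ᶻ y ▹ r (D E) w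
  double : ∀ w → length w ≡ suc n → ℤ.+ 2 *ᶻ g w ≡ expand (p ⊟ (c· h)) w
  double (y ∷ w) l = trans (step y) (trans (cong₂ _-ᶻ_ (hp (y ∷ w) l) (trans (hh w (ℕP.suc-injective l)) (sym (expand-c· h y w (ℕP.suc-injective l)))))
    (sym (expand-⊟ p (c· h) (y ∷ w))))
    where
    step : ∀ y → ℤ.+ 2 *ᶻ g (y ∷ w) ≡ r (Q₀K E) (y ∷ w) -ᶻ r (D E) w
    step false = trans (lemma (r (Q ∘ suc) (false ∷ w)) (r (Q₀K E) (false ∷ w))) (cong (r (Q₀K E) (false ∷ w) +ᶻ_) (r-a E w))
      where
      lemma : ∀ x y → ℤ.+ 2 *ᶻ (x -ᶻ 0ℤ) ≡ y +ᶻ (ℤ.+ 2 *ᶻ x -ᶻ y)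
      lemma = ℤSolver.solve-∀
    step true = trans (lemma (r (Q ∘ suc) (true ∷ w)) (r (Q₀K E) (true ∷ w)) (r (D E) w))
      (trans (cong (λ z → r (Q₀K E) (true ∷ w) +ᶻ z -ᶻ ℤ.+ 2 *ᶻ r (D E) w) (r-b E w)) (lemma′ (r (Q₀K E) (true ∷ w)) (r (D E) w)))
      where
      lemma : ∀ x y z → ℤ.+ 2 *ᶻ (x -ᶻ z) ≡ y +ᶻ (ℤ.+ 2 *ᶻ x -ᶻ y) -ᶻ ℤ.+ 2 *ᶻ z
      lemma = ℤSolver.solve-∀
      lemma′ : ∀ y z → y +ᶻ z -ᶻ ℤ.+ 2 *ᶻ z ≡ y -ᶻ z
      lemma′ = ℤSolver.solve-∀
... | g′ , hg = node g′ h , correct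
  where
  g-value : ∀ y w → length w ≡ n → ℤ.+ 2 *ᶻ expand g′ (y ∷ w) ≡ r (Q₀K E) (y ∷ w) -ᶻ r (D E) w
  g-value y w l = trans (hg (y ∷ w) (cong suc l)) (trans (expand-⊟ p (c· h) (y ∷ w)) (cong₂ _-ᶻ_ (sym (hp (y ∷ w) (cong suc l)))
    (trans (expand-c· h y w l) (sym (hh w l)))))
  correct : ∀ w → length w ≡ suc (suc n) → r Q w ≡ expand (node g′ h) w
  correct (x ∷ y ∷ w) l = cancel-2 (trans (step x y) (trans (cong₂ (λ p q → p +ᶻ (x xor y) ▹ (ℤ.+ 2 *ᶻ q)) (sym (g-value y w l′)) (hh w l′))
    (lemma (x xor y) (expand g′ (y ∷ w)) (expand h w))))
    where
    l′ = ℕP.suc-injective (ℕP.suc-injective l)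
    lemma : ∀ b x y → ℤ.+ 2 *ᶻ x +ᶻ b ▹ (ℤ.+ 2 *ᶻ y) ≡ ℤ.+ 2 *ᶻ (x +ᶻ b ▹ y)
    lemma b x y = trans (cong (ℤ.+ 2 *ᶻ x +ᶻ_) (▹-*ʳ b (ℤ.+ 2) y)) (sym (ℤP.*-distribˡ-+ (ℤ.+ 2) x (b ▹ y)))
    k = λ y → r (Q₀K E) (y ∷ w)
    f = λ y → r (Q ∘ suc) (y ∷ w)
    d = r (D E) w
    isolate : ∀ f k z → ℤ.+ 2 *ᶻ f -ᶻ k ≡ z → ℤ.+ 2 *ᶻ f ≡ k +ᶻ z
    isolate f k z eq = trans (lem f k) (cong (k +ᶻ_) eq)
      where
      lem : ∀ f k → ℤ.+ 2 *ᶻ f ≡ k +ᶻ (ℤ.+ 2 *ᶻ f -ᶻ k)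
      lem = ℤSolver.solve-∀
    twice-diff : ∀ f k z → ℤ.+ 2 *ᶻ f -ᶻ k ≡ z → ℤ.+ 2 *ᶻ (k -ᶻ f) ≡ k -ᶻ z
    twice-diff f k z eq = trans (lem f k) (cong (λ x → k -ᶻ x) eq)
      where
      lem : ∀ f k → ℤ.+ 2 *ᶻ (k -ᶻ f) ≡ k -ᶻ (ℤ.+ 2 *ᶻ f -ᶻ k)
      lem = ℤSolver.solve-∀
    step : ∀ x y → ℤ.+ 2 *ᶻ r Q (x ∷ y ∷ w) ≡ r (Q₀K E) (y ∷ w) -ᶻ d +ᶻ (x xor y) ▹ (ℤ.+ 2 *ᶻ d)
    step false false = trans (isolate (f false) (k false) (-ᶻ d) (r-a E w)) (lem (k false) d)
      where
      lem : ∀ k d → k +ᶻ -ᶻ d ≡ k -ᶻ d +ᶻ 0ℤ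
      lem = ℤSolver.solve-∀
    step false true = trans (isolate (f true) (k true) d (r-b E w)) (lem (k true) d)
      where
      lem : ∀ k d → k +ᶻ d ≡ k -ᶻ d +ᶻ ℤ.+ 2 *ᶻ d
      lem = ℤSolver.solve-∀
    step true false = trans (twice-diff (f false) (k false) (-ᶻ d) (r-a E w)) (lem (k false) d)
      where
      lem : ∀ k d → k -ᶻ -ᶻ d ≡ k -ᶻ d +ᶻ ℤ.+ 2 *ᶻ d
      lem = ℤSolver.solve-∀
    step true true = trans (twice-diff (f true) (k true) d (r-b E w)) (lem (k true) d)
      where
      lem : ∀ k d → k -ᶻ d ≡ k -ᶻ d +ᶻ 0ℤ
      lem = ℤSolver.solve-∀

-- Compositions, words and the functions Θ

words : ℕ → List (List Bool)
words zero = [] ∷ []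
words (suc n) = concatMap (λ w → (true ∷ w) ∷ (false ∷ w) ∷ []) (words n)

-- the composition of length w + 1 whose partial sums are the positions of true in w
wtc : List Bool → List ℕ
wtc [] = 1 ∷ []
wtc (true ∷ w) = 1 ∷ wtc w
wtc (false ∷ w) = incHead (wtc w)

wtc-nonempty : ∀ w → Σ ℕ λ a → Σ (List ℕ) λ c → wtc w ≡ suc a ∷ c
wtc-nonempty [] = 0 , [] , refl
wtc-nonempty (true ∷ w) = 0 , wtc w , refl
wtc-nonempty (false ∷ w) with wtc w | wtc-nonempty w
... | _ | a , c , refl = suc a , c , refl

comps-words : ∀ n → comps (suc n) ≡ map wtc (words n)
comps-words zero = refl
comps-words (suc n) = trans (cong (concatMap _) (comps-words n)) (lemma (words n))
  where
  lemma : ∀ ws → concatMap (λ c → (1 ∷ c) ∷ incHead c ∷ []) (map wtc ws) ≡ map wtc (concatMap (λ w → (true ∷ w) ∷ (false ∷ w) ∷ []) ws)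
  lemma [] = refl
  lemma (w ∷ ws) = cong (λ z → (1 ∷ wtc w) ∷ incHead (wtc w) ∷ z) (lemma ws)

∑-words-suc : ∀ n f → ∑ (words (suc n)) f ≡ ∑ (words n) (λ w → f (true ∷ w)) +ᶻ ∑ (words n) (λ w → f (false ∷ w))
∑-words-suc n f = trans (∑-concatMap _ (words n) f) (trans (∑-cong (words n) λ {w} _ → cong (f (true ∷ w) +ᶻ_) (ℤP.+-identityʳ (f (false ∷ w))))
  (∑-+ (words n) (λ w → f (true ∷ w)) (λ w → f (false ∷ w))))

∑-words-cong : ∀ n {f g} → (∀ w → length w ≡ n → f w ≡ g w) → ∑ (words n) f ≡ ∑ (words n) g
∑-words-cong zero h = cong (_+ᶻ 0ℤ) (h [] refl)
∑-words-cong (suc n) {f} {g} h = trans (∑-words-suc n f) (trans (cong₂ _+ᶻ_ (∑-words-cong n λ w l → h (true ∷ w) (cong suc l)) (∑-words-cong n λ w l → h (false ∷ w) (cong suc l)))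
  (sym (∑-words-suc n g)))

∑-words-snoc : ∀ n f → ∑ (words (suc n)) f ≡ ∑ (words n) (λ w → f (w ++ false ∷ [])) +ᶻ ∑ (words n) (λ w → f (w ++ true ∷ []))
∑-words-snoc zero f = lemma (f (true ∷ [])) (f (false ∷ []))
  where
  lemma : ∀ x y → x +ᶻ (y +ᶻ 0ℤ) ≡ y +ᶻ 0ℤ +ᶻ (x +ᶻ 0ℤ)
  lemma = ℤSolver.solve-∀
∑-words-snoc (suc n) f = trans (∑-words-suc (suc n) f) (trans (cong₂ _+ᶻ_ (∑-words-snoc n (λ w → f (true ∷ w))) (∑-words-snoc n (λ w → f (false ∷ w))))
  (trans (+-interchange (S true false) (S true true) (S false false) (S false true))
    (cong₂ _+ᶻ_ (sym (∑-words-suc n (λ w → f (w ++ false ∷ [])))) (sym (∑-words-suc n (λ w → f (w ++ true ∷ [])))))))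
  where
  S : Bool → Bool → ℤ
  S x y = ∑ (words n) (λ w → f (x ∷ w ++ y ∷ []))

_==ᵇ_ : List Bool → List Bool → Bool
[] ==ᵇ [] = true
(true ∷ w) ==ᵇ (x ∷ w′) = x ∧ (w ==ᵇ w′)
(false ∷ w) ==ᵇ (x ∷ w′) = not x ∧ (w ==ᵇ w′)
_ ==ᵇ _ = false

∑-words-δ : ∀ w (f : List Bool → ℤ) → ∑ (words (length w)) (λ x → (w ==ᵇ x) ▹ f x) ≡ f w
∑-words-δ [] f = ℤP.+-identityʳ (f [])
∑-words-δ (true ∷ w) f = trans (∑-words-suc (length w) _) (trans (cong₂ _+ᶻ_ (∑-words-δ w (f ∘ (true ∷_))) (∑-zero (words (length w)) λ _ → refl)) (ℤP.+-identityʳ _))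
∑-words-δ (false ∷ w) f = trans (∑-words-suc (length w) _) (trans (cong₂ _+ᶻ_ (∑-zero (words (length w)) λ _ → refl) (∑-words-δ w (f ∘ (false ∷_)))) (ℤP.+-identityˡ _))

==ᵇ-refl : ∀ w → (w ==ᵇ w) ≡ true
==ᵇ-refl [] = refl
==ᵇ-refl (true ∷ w) = ==ᵇ-refl w
==ᵇ-refl (false ∷ w) = ==ᵇ-refl w

==ᵇ⇒≡ : ∀ w w′ → (w ==ᵇ w′) ≡ true → w ≡ w′
==ᵇ⇒≡ [] [] _ = refl
==ᵇ⇒≡ (true ∷ w) (true ∷ w′) eq = cong (true ∷_) (==ᵇ⇒≡ w w′ eq)
==ᵇ⇒≡ (false ∷ w) (false ∷ w′) eq = cong (false ∷_) (==ᵇ⇒≡ w w′ eq)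

_⊑_ : List Bool → List Bool → Bool
[] ⊑ w = true
(x ∷ w) ⊑ [] = false
(x ∷ w) ⊑ (y ∷ w′) = (not x ∨ y) ∧ (w ⊑ w′)

incHead-injective : ∀ {a b c d} → incHead (a ∷ c) ≡ incHead (b ∷ d) → _≡_ {A = List ℕ} (a ∷ c) (b ∷ d)
incHead-injective refl = refl

wtc-injective : ∀ w w′ → wtc w ≡ wtc w′ → w ≡ w′
wtc-injective [] [] _ = refl
wtc-injective [] (true ∷ w′) eq with wtc w′ | wtc-nonempty w′
wtc-injective [] (true ∷ w′) () | _ | _ , _ , refl
wtc-injective [] (false ∷ w′) eq with wtc w′ | wtc-nonempty w′
wtc-injective [] (false ∷ w′) () | _ | _ , _ , refl
wtc-injective (true ∷ w) [] eq with wtc w | wtc-nonempty w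
wtc-injective (true ∷ w) [] () | _ | _ , _ , refl
wtc-injective (false ∷ w) [] eq with wtc w | wtc-nonempty w
wtc-injective (false ∷ w) [] () | _ | _ , _ , refl
wtc-injective (true ∷ w) (true ∷ w′) eq = cong (true ∷_) (wtc-injective w w′ (cong tail eq))
  where
  tail : List ℕ → List ℕ
  tail [] = []
  tail (_ ∷ c) = c
wtc-injective (true ∷ w) (false ∷ w′) eq with wtc w′ | wtc-nonempty w′
wtc-injective (true ∷ w) (false ∷ w′) () | _ | _ , _ , refl
wtc-injective (false ∷ w) (true ∷ w′) eq with wtc w | wtc-nonempty w
wtc-injective (false ∷ w) (true ∷ w′) () | _ | _ , _ , refl
wtc-injective (false ∷ w) (false ∷ w′) eq with wtc-nonempty w | wtc-nonempty w′
... | a , c , p | b , d , q = cong (false ∷_) (wtc-injective w w′ (trans p (trans (incHead-injective (trans (cong incHead (sym p)) (trans eq (cong incHead q)))) (sym q))))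

wtc-sum : ∀ w → sum (wtc w) ≡ suc (length w)
wtc-sum [] = refl
wtc-sum (true ∷ w) = cong suc (wtc-sum w)
wtc-sum (false ∷ w) with wtc w | wtc-nonempty w | wtc-sum w
... | _ | a , c , refl | eq = cong suc eq

wtc-positive : ∀ w → All (0 <_) (wtc w)
wtc-positive [] = s≤s z≤n ∷ []
wtc-positive (true ∷ w) = s≤s z≤n ∷ wtc-positive w
wtc-positive (false ∷ w) with wtc w | wtc-nonempty w | wtc-positive w
... | _ | a , c , refl | _ ∷ ps = s≤s z≤n ∷ ps

composition-word : ∀ n α → All (0 <_) α → sum α ≡ suc n → Σ (List Bool) λ w → length w ≡ n × α ≡ wtc w
composition-word n (zero ∷ α) (() ∷ _) _
composition-word zero (suc zero ∷ []) _ _ = [] , refl , refl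
composition-word zero (suc zero ∷ suc b ∷ α) _ ()
composition-word n (suc zero ∷ zero ∷ α) (_ ∷ () ∷ _) _
composition-word zero (suc (suc a) ∷ α) _ ()
composition-word (suc n) (suc zero ∷ α) (_ ∷ ps) eq with composition-word n α ps (ℕP.suc-injective eq)
... | w , l , refl = true ∷ w , cong suc l , refl
composition-word (suc n) (suc (suc a) ∷ α) (_ ∷ ps) eq with composition-word n (suc a ∷ α) (s≤s z≤n ∷ ps) (ℕP.suc-injective eq)
... | w , l , p = false ∷ w , cong suc l , cong incHead p

setOf : ℕ → List Bool → List ℕ
setOf k [] = []
setOf k (true ∷ w) = suc k ∷ setOf (suc k) w
setOf k (false ∷ w) = setOf (suc k) w

psums-wtc : ∀ k w → psums k (wtc w) ≡ setOf k w
psums-wtc k [] = refl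
psums-wtc k (true ∷ w) with wtc w | wtc-nonempty w | psums-wtc (suc k) w
... | _ | a , c , refl | eq = cong₂ _∷_ (ℕP.+-comm k 1) (trans (cong (λ m → psums m (suc a ∷ c)) (ℕP.+-comm k 1)) eq)
psums-wtc k (false ∷ w) with wtc w | wtc-nonempty w | psums-wtc (suc k) w
... | _ | a , [] , refl | eq = eq
... | _ | a , b ∷ c , refl | eq = trans (cong₂ _∷_ (ℕP.+-suc k (suc a)) (cong (λ m → psums m (b ∷ c)) (ℕP.+-suc k (suc a)))) eq

compSet-wtc : ∀ w → compSet (wtc w) ≡ setOf 0 w
compSet-wtc = psums-wtc 0

≡ᵇ-refl : ∀ n → (n ≡ᵇ n) ≡ true
≡ᵇ-refl zero = refl
≡ᵇ-refl (suc n) = ≡ᵇ-refl n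

≡ᵇ-≢ : ∀ {m n} → m ≢ n → (m ≡ᵇ n) ≡ false
≡ᵇ-≢ {zero} {zero} ne = ⊥-elim (ne refl)
≡ᵇ-≢ {zero} {suc n} ne = refl
≡ᵇ-≢ {suc m} {zero} ne = refl
≡ᵇ-≢ {suc m} {suc n} ne = ≡ᵇ-≢ (ne ∘ cong suc)

memᵇ-setOf-≤ : ∀ i k w → i ≤ k → memᵇ i (setOf k w) ≡ false
memᵇ-setOf-≤ i k [] _ = refl
memᵇ-setOf-≤ i k (true ∷ w) l = cong₂ _∨_ (≡ᵇ-≢ (ℕP.<⇒≢ (s≤s l))) (memᵇ-setOf-≤ i (suc k) w (ℕP.m≤n⇒m≤1+n l))
memᵇ-setOf-≤ i k (false ∷ w) l = memᵇ-setOf-≤ i (suc k) w (ℕP.m≤n⇒m≤1+n l)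

-- Positions up to k are left free, and beyond the end of the word f must be `false`. Sets of
-- partial sums and descents of paths are both matched with words in this form.
Agree : ℕ → List Bool → (ℕ → Bool) → Set
Agree k [] f = ∀ i → k < i → f i ≡ false
Agree k (x ∷ w) f = f (suc k) ≡ x × Agree (suc k) w f

Agree-cong : ∀ k w {f g} → (∀ i → k < i → f i ≡ g i) → Agree k w f → Agree k w g
Agree-cong k [] h a i l = trans (sym (h i l)) (a i l)
Agree-cong k (x ∷ w) h (p , a) = trans (sym (h (suc k) ℕP.≤-refl)) p , Agree-cong (suc k) w (λ i l → h i (ℕP.<⇒≤ l)) a

setOf-agrees : ∀ k w → Agree k w (λ i → memᵇ i (setOf k w))
setOf-agrees k [] i _ = refl
setOf-agrees k (true ∷ w) = cong (_∨ memᵇ (suc k) (setOf (suc k) w)) (≡ᵇ-refl k) ,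
  Agree-cong (suc k) w (λ i l → sym (cong (_∨ memᵇ i (setOf (suc k) w)) (≡ᵇ-≢ (ℕP.<⇒≢ l ∘ sym)))) (setOf-agrees (suc k) w)
setOf-agrees k (false ∷ w) = memᵇ-setOf-≤ (suc k) (suc k) w ℕP.≤-refl , setOf-agrees (suc k) w

Agree-unique : ∀ k {w w′ f} → length w ≡ length w′ → Agree k w f → Agree k w′ f → w ≡ w′
Agree-unique k {[]} {[]} _ _ _ = refl
Agree-unique k {x ∷ w} {y ∷ w′} l (p , a) (q , b) = cong₂ _∷_ (trans (sym p) q) (Agree-unique (suc k) (ℕP.suc-injective l) a b)

allᵇ-setOf : ∀ k x p f → length x ≡ length p → Agree k p f → allᵇ f (setOf k x) ≡ (x ⊑ p)
allᵇ-setOf k [] p f _ _ = refl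
allᵇ-setOf k (true ∷ x) (y ∷ p) f l (h , a) = cong₂ _∧_ h (allᵇ-setOf (suc k) x p f (ℕP.suc-injective l) a)
allᵇ-setOf k (false ∷ x) (y ∷ p) f l (h , a) = allᵇ-setOf (suc k) x p f (ℕP.suc-injective l) a

refines-wtc : ∀ p x → length x ≡ length p → refinesᵇ (wtc p) (wtc x) ≡ (x ⊑ p)
refines-wtc p x l = begin
  (sum (wtc p) ≡ᵇ sum (wtc x)) ∧ allᵇ (λ i → memᵇ i (compSet (wtc p))) (compSet (wtc x))
    ≡⟨ cong₂ (λ m n → (m ≡ᵇ n) ∧ allᵇ (λ i → memᵇ i (compSet (wtc p))) (compSet (wtc x))) (trans (wtc-sum p) (cong suc (sym l))) (wtc-sum x) ⟩
  (length x ≡ᵇ length x) ∧ allᵇ (λ i → memᵇ i (compSet (wtc p))) (compSet (wtc x))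
    ≡⟨ cong (_∧ allᵇ (λ i → memᵇ i (compSet (wtc p))) (compSet (wtc x))) (≡ᵇ-refl (length x)) ⟩
  allᵇ (λ i → memᵇ i (compSet (wtc p))) (compSet (wtc x))
    ≡⟨ cong₂ (λ A B → allᵇ (λ i → memᵇ i A) B) (compSet-wtc p) (compSet-wtc x) ⟩
  allᵇ (λ i → memᵇ i (setOf 0 p)) (setOf 0 x)
    ≡⟨ allᵇ-setOf 0 x p _ l (setOf-agrees 0 p) ⟩
  (x ⊑ p) ∎
  where open ≡-Reasoning

Mser-wtc : ∀ {γ p} → flat γ ≡ wtc p → ∀ x → Mser (wtc x) γ ≡ (p ==ᵇ x) ▹ 1ℤ
Mser-wtc {γ} {p} eq x with ≡-dec ℕP._≟_ (flat γ) (wtc x)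
... | yes q = cong (_▹ 1ℤ) (sym (trans (cong (p ==ᵇ_) (sym (wtc-injective p x (trans (sym eq) q)))) (==ᵇ-refl p)))
... | no ne with p ==ᵇ x in h
... | true = ⊥-elim (ne (trans eq (cong wtc (==ᵇ⇒≡ p x h))))
... | false = refl

∑-comps-Mser : ∀ {γ p} → flat γ ≡ wtc p → ∀ f → ∑ (comps (suc (length p))) (λ α → f α *ᶻ Mser α γ) ≡ f (wtc p)
∑-comps-Mser {γ} {p} eq f = trans (cong (λ cs → ∑ cs (λ α → f α *ᶻ Mser α γ)) (comps-words (length p)))
  (trans (∑-map wtc (words (length p)) _) (trans (∑-cong (words (length p)) λ {x} _ → trans (cong (f (wtc x) *ᶻ_) (Mser-wtc {γ} {p} eq x))
    (trans (ℤP.*-comm (f (wtc x)) _) (sym (▹-* (p ==ᵇ x) (f (wtc x)))))) (∑-words-δ p (f ∘ wtc))))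

sum-flat : ∀ γ → sum (flat γ) ≡ sum γ
sum-flat [] = refl
sum-flat (zero ∷ γ) = sum-flat γ
sum-flat (suc a ∷ γ) = cong (suc a +_) (sum-flat γ)

flat-positive : ∀ γ → All (0 <_) (flat γ)
flat-positive [] = []
flat-positive (zero ∷ γ) = flat-positive γ
flat-positive (suc a ∷ γ) = s≤s z≤n ∷ flat-positive γ

-- Of the M in the expansion of L only that of `flat γ` contributes, and refinement is inclusion of
-- the sets of partial sums.
Lser-wtc : ∀ {γ p} → flat γ ≡ wtc p → ∀ x → length x ≡ length p → Lser (wtc x) γ ≡ (x ⊑ p) ▹ 1ℤ
Lser-wtc {γ} {p} eq x l = begin
  ∑ (comps (sum (wtc x))) (λ α → refinesᵇ α (wtc x) ▹ Mser α γ)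
    ≡⟨ cong (λ n → ∑ (comps n) (λ α → refinesᵇ α (wtc x) ▹ Mser α γ)) (trans (wtc-sum x) (cong suc l)) ⟩
  ∑ (comps (suc (length p))) (λ α → refinesᵇ α (wtc x) ▹ Mser α γ)
    ≡⟨ ∑-cong (comps (suc (length p))) (λ {α} _ → ▹-* (refinesᵇ α (wtc x)) (Mser α γ)) ⟩
  ∑ (comps (suc (length p))) (λ α → (refinesᵇ α (wtc x) ▹ 1ℤ) *ᶻ Mser α γ)
    ≡⟨ ∑-comps-Mser {γ} {p} eq (λ α → refinesᵇ α (wtc x) ▹ 1ℤ) ⟩
  refinesᵇ (wtc p) (wtc x) ▹ 1ℤ
    ≡⟨ cong (_▹ 1ℤ) (refines-wtc p x l) ⟩
  (x ⊑ p) ▹ 1ℤ ∎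
  where open ≡-Reasoning

Mser-degree : ∀ α γ → sum γ ≢ sum α → Mser α γ ≡ 0ℤ
Mser-degree α γ ne with ≡-dec ℕP._≟_ (flat γ) α
... | yes refl = ⊥-elim (ne (sym (sum-flat γ)))
... | no _ = refl

Lser-degree : ∀ x γ → sum γ ≢ suc (length x) → Lser (wtc x) γ ≡ 0ℤ
Lser-degree x γ ne = trans (cong (λ n → ∑ (comps n) (λ α → refinesᵇ α (wtc x) ▹ Mser α γ)) (wtc-sum x))
  (trans (cong (λ cs → ∑ cs (λ α → refinesᵇ α (wtc x) ▹ Mser α γ)) (comps-words (length x)))
  (trans (∑-map wtc (words (length x)) _) (trans (∑-words-cong (length x) {g = λ _ → 0ℤ} λ y l →
    trans (cong (refinesᵇ (wtc y) (wtc x) ▹_) (Mser-degree (wtc y) γ (λ eq → ne (trans eq (trans (wtc-sum y) (cong suc l)))))) (▹-zero (refinesᵇ (wtc y) (wtc x))))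
    (∑-zero (words (length x)) λ _ → refl))))

addHead : ℕ → List ℕ → List ℕ
addHead n [] = []
addHead n (a ∷ c) = n + a ∷ c

addHead-incHead : ∀ n c → addHead n (incHead c) ≡ addHead (suc n) c
addHead-incHead n [] = refl
addHead-incHead n (a ∷ c) = cong (_∷ c) (ℕP.+-suc n a)

addHead-0 : ∀ c → addHead 0 c ≡ c
addHead-0 [] = refl
addHead-0 (a ∷ c) = refl

-- The local function of setToComp, recovered as the tail of a longer value.
parts : ℕ → ℕ → List ℕ → List ℕ
parts m t ts with setToComp m (t ∷ ts)
... | [] = []
... | _ ∷ c = c

-- Here t is the last partial sum already passed and d the number of positions read since then.
parts-setOf : ∀ m t d w → m ≡ suc (t + d + length w) → parts m t (setOf (t + d) w) ≡ addHead d (wtc w)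
parts-setOf m t d [] eq = cong (_∷ []) (trans (cong (_∸ t) (trans eq (trans (cong suc (ℕP.+-identityʳ (t + d))) (sym (ℕP.+-suc t d))))) (trans (ℕP.m+n∸m≡n t (suc d)) (ℕP.+-comm 1 d)))
parts-setOf m t d (true ∷ w) eq = cong₂ _∷_ (trans (cong (_∸ t) (sym (ℕP.+-suc t d))) (trans (ℕP.m+n∸m≡n t (suc d)) (ℕP.+-comm 1 d)))
  (trans (cong (λ k → parts m (suc (t + d)) (setOf k w)) (sym (ℕP.+-identityʳ (suc (t + d))))) (trans (parts-setOf m (suc (t + d)) 0 w
    (trans eq (cong suc (trans (ℕP.+-suc (t + d) (length w)) (cong (λ k → suc k + length w) (sym (ℕP.+-identityʳ (t + d)))))))) (addHead-0 (wtc w))))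
parts-setOf m t d (false ∷ w) eq = trans (cong (λ k → parts m t (setOf k w)) (sym (ℕP.+-suc t d))) (trans (parts-setOf m t (suc d) w
  (trans eq (cong suc (trans (ℕP.+-suc (t + d) (length w)) (cong (_+ length w) (sym (ℕP.+-suc t d))))))) (sym (addHead-incHead d (wtc w))))

setToComp-setOf : ∀ w → setToComp (suc (length w)) (setOf 0 w) ≡ wtc w
setToComp-setOf w = trans (parts-setOf (suc (length w)) 0 0 w refl) (addHead-0 (wtc w))

setOf-snoc : ∀ k w → setOf k (w ++ false ∷ []) ≡ setOf k w × setOf k (w ++ true ∷ []) ≡ setOf k w ++ suc (k + length w) ∷ []
setOf-snoc k [] = refl , cong (λ n → suc n ∷ []) (sym (ℕP.+-identityʳ k))
setOf-snoc k (true ∷ w) = cong (suc k ∷_) (proj₁ (setOf-snoc (suc k) w)) ,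
  cong (suc k ∷_) (trans (proj₂ (setOf-snoc (suc k) w)) (cong (λ n → setOf (suc k) w ++ suc n ∷ []) (sym (ℕP.+-suc k (length w)))))
setOf-snoc k (false ∷ w) = proj₁ (setOf-snoc (suc k) w) ,
  trans (proj₂ (setOf-snoc (suc k) w)) (cong (λ n → setOf (suc k) w ++ suc n ∷ []) (sym (ℕP.+-suc k (length w))))

∑-subs : ∀ n (f : List ℕ → ℤ) → ∑ (subs n) f ≡ ∑ (words n) (λ w → f (setOf 0 w))
∑-subs zero f = refl
∑-subs (suc n) f = begin
  ∑ (subs n ++ map (λ T → T ++ suc n ∷ []) (subs n)) f
    ≡⟨ ∑-++ (subs n) _ f ⟩
  ∑ (subs n) f +ᶻ ∑ (map (λ T → T ++ suc n ∷ []) (subs n)) f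
    ≡⟨ cong (∑ (subs n) f +ᶻ_) (∑-map (λ T → T ++ suc n ∷ []) (subs n) f) ⟩
  ∑ (subs n) f +ᶻ ∑ (subs n) (λ T → f (T ++ suc n ∷ []))
    ≡⟨ cong₂ _+ᶻ_ (∑-subs n f) (∑-subs n (λ T → f (T ++ suc n ∷ []))) ⟩
  ∑ (words n) (λ w → f (setOf 0 w)) +ᶻ ∑ (words n) (λ w → f (setOf 0 w ++ suc n ∷ []))
    ≡⟨ cong₂ _+ᶻ_ (∑-words-cong n λ w _ → cong f (sym (proj₁ (setOf-snoc 0 w))))
                  (∑-words-cong n λ w l → cong f (sym (trans (proj₂ (setOf-snoc 0 w)) (cong (λ k → setOf 0 w ++ suc k ∷ []) l)))) ⟩
  ∑ (words n) (λ w → f (setOf 0 (w ++ false ∷ []))) +ᶻ ∑ (words n) (λ w → f (setOf 0 (w ++ true ∷ [])))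
    ≡⟨ ∑-words-snoc n (λ w → f (setOf 0 w)) ⟨
  ∑ (words (suc n)) (λ w → f (setOf 0 w)) ∎
  where open ≡-Reasoning

-- Whether the ab-word is a term of the cd-word under c = a + b and d = ab + ba. This is the
-- condition defining B[I^w]: a letter d ending at m asks for exactly one of m - 1, m in T.
occurs : List CD → List Bool → Bool
occurs [] x = true
occurs (𝐜 ∷ w) (_ ∷ x) = occurs w x
occurs (𝐝 ∷ w) (a ∷ b ∷ x) = (a xor b) ∧ occurs w x
occurs _ _ = false

splits : List ℕ → ℕ → Bool
splits T m = (memᵇ (m ∸ 1) T ∨ memᵇ m T) ∧ (not (memᵇ (m ∸ 1) T) ∨ not (memᵇ m T))

split-xor : ∀ a b → (a ∨ b) ∧ (not a ∨ not b) ≡ a xor b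
split-xor true true = refl
split-xor true false = refl
split-xor false true = refl
split-xor false false = refl

-- The local function of dEnds has no name outside Defs; abstracting its
-- accumulator 0 lets unification find it.
mutual
  ends : ℕ → List CD → List ℕ
  ends = _

  dEnds-ends : ∀ w → dEnds w ≡ ends 0 w
  dEnds-ends w with 0
  ... | k = refl {x = ends k w}

ends-occurs : ∀ T k w x → length x ≡ degCD w → Agree k x (λ i → memᵇ i T) → allᵇ (splits T) (ends k w) ≡ occurs w x
ends-occurs T k [] [] _ _ = refl
ends-occurs T k (𝐜 ∷ w) (_ ∷ x) l (_ , a) = ends-occurs T (suc k) w x (ℕP.suc-injective l) a
ends-occurs T k (𝐝 ∷ w) (a ∷ b ∷ x) l (p , q , ag) = cong₂ _∧_
  (trans (cong (λ m → splits T m) (ℕP.+-comm k 2)) (trans (cong₂ (λ y z → (y ∨ z) ∧ (not y ∨ not z)) p q) (split-xor a b)))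
  (trans (cong (λ m → allᵇ (splits T) (ends m w)) (ℕP.+-comm k 2)) (ends-occurs T (suc (suc k)) w x (ℕP.suc-injective (ℕP.suc-injective l)) ag))

inB-occurs : ∀ w x → length x ≡ degCD w → inB w (setOf 0 x) ≡ occurs w x
inB-occurs w x l = trans (cong (allᵇ (splits (setOf 0 x))) (dEnds-ends w)) (ends-occurs (setOf 0 x) 0 w x l (setOf-agrees 0 x))

Θ-words : ∀ w γ → Θ w γ ≡ ∑ (words (degCD w)) (λ x → occurs w x ▹ Lser (wtc x) γ)
Θ-words w γ = trans (∑-subs (degCD w) (λ T → inB w T ▹ Lser (setToComp (suc (degCD w)) T) γ))
  (∑-words-cong (degCD w) λ x l → cong₂ (λ b c → b ▹ Lser c γ) (inB-occurs w x l)
    (trans (cong (λ n → setToComp (suc n) (setOf 0 x)) (sym l)) (setToComp-setOf x)))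

Θ-value : ∀ w {γ p} → flat γ ≡ wtc p → length p ≡ degCD w → Θ w γ ≡ ∑ (words (degCD w)) (λ x → occurs w x ▹ ((x ⊑ p) ▹ 1ℤ))
Θ-value w {γ} {p} eq l = trans (Θ-words w γ) (∑-words-cong (degCD w) λ x lx → cong (occurs w x ▹_) (Lser-wtc {γ} {p} eq x (trans lx (sym l))))

Θ-degree : ∀ w γ → sum γ ≢ suc (degCD w) → Θ w γ ≡ 0ℤ
Θ-degree w γ ne = trans (Θ-words w γ) (trans (∑-words-cong (degCD w) {g = λ _ → 0ℤ} λ x l →
  trans (cong (occurs w x ▹_) (Lser-degree x γ (λ eq → ne (trans eq (cong suc l))))) (▹-zero (occurs w x))) (∑-zero (words (degCD w)) λ _ → refl))

-- From cd-polynomials to combinations of Θ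

terms : ∀ {n} → CDPoly n → List (ℤ × List CD)
terms (const₀ a) = (a , []) ∷ []
terms (const₁ a) = (a , 𝐜 ∷ []) ∷ []
terms (node g h) = map (λ t → proj₁ t , 𝐜 ∷ proj₂ t) (terms g) ++ map (λ t → proj₁ t , 𝐝 ∷ proj₂ t) (terms h)

terms-degree : ∀ {n} (t : CDPoly n) → All (λ t → degCD (proj₂ t) ≡ n) (terms t)
terms-degree (const₀ a) = refl ∷ []
terms-degree (const₁ a) = refl ∷ []
terms-degree (node g h) = AllP.++⁺ (AllP.map⁺ (All.map (cong suc) (terms-degree g))) (AllP.map⁺ (All.map (cong (suc ∘ suc)) (terms-degree h)))

expand-terms : ∀ {n} (t : CDPoly n) x → length x ≡ n → expand t x ≡ ∑ (terms t) (λ t → proj₁ t *ᶻ (occurs (proj₂ t) x ▹ 1ℤ))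
expand-terms (const₀ a) [] _ = sym (trans (ℤP.+-identityʳ _) (ℤP.*-identityʳ a))
expand-terms (const₁ a) (_ ∷ []) _ = sym (trans (ℤP.+-identityʳ _) (ℤP.*-identityʳ a))
expand-terms (node g h) (x ∷ y ∷ w) l = sym (trans (∑-++ (map _ (terms g)) _ _) (cong₂ _+ᶻ_
  (trans (∑-map _ (terms g) _) (sym (expand-terms g (y ∷ w) (ℕP.suc-injective l))))
  (trans (∑-map _ (terms h) _) (trans (∑-cong (terms h) λ {t} _ → trans (cong (proj₁ t *ᶻ_) (▹-∧ (x xor y) (occurs (proj₂ t) w) 1ℤ)) (sym (▹-*ʳ (x xor y) (proj₁ t) (occurs (proj₂ t) w ▹ 1ℤ))))
    (trans (∑-▹ (x xor y) (terms h) _) (cong ((x xor y) ▹_) (sym (expand-terms h w (ℕP.suc-injective (ℕP.suc-injective l))))))))))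

ΣΘ : ∀ {n} → CDPoly n → List ℕ → ℤ
ΣΘ t γ = ∑ (terms t) (λ t → proj₁ t *ᶻ Θ (proj₂ t) γ)

ΣΘ-degree : ∀ {n} (t : CDPoly n) γ → sum γ ≢ suc n → ΣΘ t γ ≡ 0ℤ
ΣΘ-degree t γ ne = ∑-zero (terms t) λ {u} u∈ → trans (cong (proj₁ u *ᶻ_) (Θ-degree (proj₂ u) γ λ eq → ne (trans eq (cong suc (All.lookup (terms-degree t) u∈))))) (ℤP.*-zeroʳ (proj₁ u))

-- Exchanging the sums collects, for each ab-word, the coefficients of all cd-words in whose
-- expansion it occurs.
ΣΘ-value : ∀ {n} (t : CDPoly n) {γ p} → flat γ ≡ wtc p → length p ≡ n → ΣΘ t γ ≡ ∑ (words n) (λ x → (x ⊑ p) ▹ expand t x)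
ΣΘ-value {n} t {γ} {p} eq l = begin
  ∑ (terms t) (λ u → proj₁ u *ᶻ Θ (proj₂ u) γ)
    ≡⟨ ∑-cong (terms t) (λ {u} u∈ → cong (proj₁ u *ᶻ_) (trans (Θ-value (proj₂ u) {γ} {p} eq (trans l (sym (All.lookup (terms-degree t) u∈))))
         (cong (λ m → ∑ (words m) (λ x → occurs (proj₂ u) x ▹ ((x ⊑ p) ▹ 1ℤ))) (All.lookup (terms-degree t) u∈)))) ⟩
  ∑ (terms t) (λ u → proj₁ u *ᶻ ∑ (words n) (λ x → occurs (proj₂ u) x ▹ ((x ⊑ p) ▹ 1ℤ)))
    ≡⟨ ∑-cong (terms t) (λ {u} _ → sym (∑-* (proj₁ u) (words n) _)) ⟩
  ∑ (terms t) (λ u → ∑ (words n) (λ x → proj₁ u *ᶻ (occurs (proj₂ u) x ▹ ((x ⊑ p) ▹ 1ℤ))))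
    ≡⟨ ∑-swap (terms t) (words n) (λ u x → proj₁ u *ᶻ (occurs (proj₂ u) x ▹ ((x ⊑ p) ▹ 1ℤ))) ⟩
  ∑ (words n) (λ x → ∑ (terms t) (λ u → proj₁ u *ᶻ (occurs (proj₂ u) x ▹ ((x ⊑ p) ▹ 1ℤ))))
    ≡⟨ ∑-words-cong n (λ x lx → trans (∑-cong (terms t) λ {u} _ → exchange (proj₁ u) (occurs (proj₂ u) x) (x ⊑ p))
         (trans (∑-▹ (x ⊑ p) (terms t) _) (cong ((x ⊑ p) ▹_) (sym (expand-terms t x lx))))) ⟩
  ∑ (words n) (λ x → (x ⊑ p) ▹ expand t x) ∎
  where
  open ≡-Reasoning
  exchange : ∀ a b c → a *ᶻ (b ▹ (c ▹ 1ℤ)) ≡ c ▹ (a *ᶻ (b ▹ 1ℤ))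
  exchange a true true = refl
  exchange a true false = ℤP.*-zeroʳ a
  exchange a false true = refl
  exchange a false false = ℤP.*-zeroʳ a

-- Q applied to a product of complete functions: `true` closes the current part of the composition,
-- `false` enlarges it by one.
h-value : (ℕ → List ℕ → ℤ) → List Bool → ℤ
h-value Q [] = Q 0 []
h-value Q (true ∷ p) = h-value (λ i γ → Q 0 (suc i ∷ γ)) p
h-value Q (false ∷ p) = h-value (Q ∘ suc) p

-- a product of complete functions is the sum of the ribbons below it
ribbons : ∀ p Q → ∑ (words (length p)) (λ x → (x ⊑ p) ▹ r Q x) ≡ h-value Q p
ribbons [] Q = ℤP.+-identityʳ _
ribbons (true ∷ p) Q = begin
  ∑ (words (suc (length p))) (λ x → (x ⊑ (true ∷ p)) ▹ r Q x)
    ≡⟨ ∑-words-suc (length p) _ ⟩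
  ∑ (words (length p)) (λ x → (x ⊑ p) ▹ (r Q′ x -ᶻ r (Q ∘ suc) x)) +ᶻ ∑ (words (length p)) (λ x → (x ⊑ p) ▹ r (Q ∘ suc) x)
    ≡⟨ ∑-+ (words (length p)) _ _ ⟨
  ∑ (words (length p)) (λ x → (x ⊑ p) ▹ (r Q′ x -ᶻ r (Q ∘ suc) x) +ᶻ (x ⊑ p) ▹ r (Q ∘ suc) x)
    ≡⟨ ∑-cong (words (length p)) (λ {x} _ → trans (sym (▹-+ (x ⊑ p) _ _)) (cong ((x ⊑ p) ▹_) (lemma (r Q′ x) (r (Q ∘ suc) x)))) ⟩
  ∑ (words (length p)) (λ x → (x ⊑ p) ▹ r Q′ x)
    ≡⟨ ribbons p Q′ ⟩
  h-value Q′ p ∎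
  where
  open ≡-Reasoning
  Q′ : ℕ → List ℕ → ℤ
  Q′ i γ = Q 0 (suc i ∷ γ)
  lemma : ∀ x y → x -ᶻ y +ᶻ y ≡ x
  lemma = ℤSolver.solve-∀
ribbons (false ∷ p) Q = trans (∑-words-suc (length p) _) (trans (cong (_+ᶻ ∑ (words (length p)) (λ x → (x ⊑ p) ▹ r (Q ∘ suc) x)) (∑-zero (words (length p)) λ _ → refl))
  (trans (ℤP.+-identityˡ _) (ribbons p (Q ∘ suc))))

h-value-wtc : ∀ (φ : List ℕ → ℤ) m p → h-value (λ i γ → φ (suc (m + i) ∷ γ)) p ≡ φ (addHead m (wtc p))
h-value-wtc φ m [] = cong (λ n → φ (n ∷ [])) (sym (ℕP.+-suc m 0))
h-value-wtc φ m (true ∷ p) = trans (h-value-wtc (λ γ → φ (suc (m + 0) ∷ γ)) 0 p) (cong φ (cong₂ _∷_ (sym (ℕP.+-suc m 0)) (addHead-0 (wtc p))))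
h-value-wtc φ m (false ∷ p) = trans (h-value-cong p (λ i γ → cong (λ n → φ (suc n ∷ γ)) (ℕP.+-suc m i))) (trans (h-value-wtc φ (suc m) p) (cong φ (sym (addHead-incHead m (wtc p)))))
  where
  h-value-cong : ∀ p {Q Q′} → (∀ i γ → Q i γ ≡ Q′ i γ) → h-value Q p ≡ h-value Q′ p
  h-value-cong [] h = h 0 []
  h-value-cong (true ∷ p) h = h-value-cong p (λ i γ → h 0 (suc i ∷ γ))
  h-value-cong (false ∷ p) h = h-value-cong p (h ∘ suc)

-- The argument of `Q₀K-even`, with φ in place of Q₀.
K-even : ∀ {φ} → PeakFunctional φ → EvenSeries (λ i γ → φ (suc i ∷ γ))
K-even {φ} P = record
  { functional = λ i → prefix-functional (suc i ∷ []) P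
  ; even = λ k γ → trans (lemma (sgn k) (φ (suc k ∷ γ)) (conv k (λ i j → sgn j *ᶻ φ (suc i ∷ j ∷ γ))))
      (trans (cong (_+ᶻ sgn k *ᶻ φ (suc k ∷ γ)) (trans (cong (λ x → -ᶻ sgn k *ᶻ x +ᶻ conv k (λ i j → sgn j *ᶻ φ (suc i ∷ j ∷ γ))) (sym (PeakFunctional.zero-part P [] (suc k ∷ γ))))
        (PeakFunctional.euler P [] k γ))) (ℤP.+-identityˡ _))
  }
  where
  lemma : ∀ s x y → y ≡ -ᶻ s *ᶻ x +ᶻ y +ᶻ s *ᶻ x
  lemma = ℤSolver.solve-∀

abstract
  -- `ΣΘ-value` gives the sum of the ribbon values below p, and `ribbons` identifies it with the
  -- value of φ on a product of complete functions.
  peak-expansion : ∀ {φ} → PeakFunctional φ → ∀ n → Σ (CDPoly n) λ t → ∀ {γ p} → flat γ ≡ wtc p → length p ≡ n → ΣΘ t γ ≡ φ (flat γ)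
  peak-expansion {φ} P n with cd-expansion n (K-even P)
  ... | t , h = t , λ {γ} {p} eq l → trans (ΣΘ-value t {γ} {p} eq l) (trans (∑-words-cong n λ x lx → cong ((x ⊑ p) ▹_) (sym (h x lx)))
      (trans (cong (λ m → ∑ (words m) (λ x → (x ⊑ p) ▹ r (λ i γ → φ (suc i ∷ γ)) x)) (sym l)) (trans (ribbons p _) (trans (h-value-wtc φ 0 p) (cong φ (trans (addHead-0 (wtc p)) (sym eq)))))))

-- Lists of Bruhat paths

concatMap-∈⁺ : ∀ {A B : Set} {g : A → List B} {x xs y} → x ∈ xs → y ∈ g x → y ∈ concatMap g xs
concatMap-∈⁺ (here refl) y∈ = ∈-++⁺ˡ y∈
concatMap-∈⁺ {g = g} {xs = x′ ∷ _} (there x∈) y∈ = ∈-++⁺ʳ (g x′) (concatMap-∈⁺ x∈ y∈)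

concatMap-∈⁻ : ∀ {A B : Set} (g : A → List B) xs {y} → y ∈ concatMap g xs → Σ A λ x → x ∈ xs × y ∈ g x
concatMap-∈⁻ g (x ∷ xs) y∈ with ∈-++⁻ (g x) y∈
... | inj₁ p = x , here refl , p
... | inj₂ p with concatMap-∈⁻ g xs p
... | x′ , x∈ , q = x′ , there x∈ , q

concatMap-unique : ∀ {A B : Set} (g : A → List B) {xs} → Unique xs → (∀ {x} → x ∈ xs → Unique (g x)) →
  (∀ {x x′ y} → x ∈ xs → x′ ∈ xs → y ∈ g x → y ∈ g x′ → x ≡ x′) → Unique (concatMap g xs)
concatMap-unique g [] _ _ = []
concatMap-unique g {x ∷ xs} (x∉ ∷ u) ug inj = UniqueP.++⁺ (ug (here refl))
  (concatMap-unique g u (ug ∘ there) (λ p q → inj (there p) (there q)))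
  λ { (y∈ , y∈′) → let (x′ , x′∈ , y∈x′) = concatMap-∈⁻ g xs y∈′ in All.lookup x∉ x′∈ (inj (here refl) (there x′∈) y∈ y∈x′) }


module PathLists (C : CoxeterSystem) (len : CoxeterSystem.W C → ℕ) (isLen : CoxDefs.IsLength C len) where
  open Inversions C len isLen

  -- Built from the end: the edges into v are indexed by the finite list `Inv v`, while those out of
  -- u may be infinite in number.
  VP : ℕ → W → W → List (List W)
  VP zero u v with u ≟W v
  ... | yes _ = [] ∷ []
  ... | no _ = []
  VP (suc n) u v = concatMap (λ t → map (_∷ʳ v) (VP n u (t · v))) (Inv v)

  PathFrom-snoc : ∀ as {u x v} → PathFrom u as x → Edge x v → PathFrom u (as ∷ʳ v) v
  PathFrom-snoc [] refl e = e , refl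
  PathFrom-snoc (a ∷ as) (e , p) e′ = e , PathFrom-snoc as p e′

  PathFrom-unsnoc : ∀ as {u a v} → PathFrom u (as ∷ʳ a) v → a ≡ v × Σ W λ x → PathFrom u as x × Edge x v
  PathFrom-unsnoc [] {u} (e , refl) = refl , u , refl , e
  PathFrom-unsnoc (a ∷ as) (e , p) with PathFrom-unsnoc as p
  ... | eq , x , q , e′ = eq , x , (e , q) , e′

  PathFrom-end : ∀ as {u x y} → PathFrom u as x → PathFrom u as y → x ≡ y
  PathFrom-end [] refl refl = refl
  PathFrom-end (a ∷ as) (_ , p) (_ , q) = PathFrom-end as p q

  PathFrom-++ : ∀ as {bs u x v} → PathFrom u as x → PathFrom x bs v → PathFrom u (as ++ bs) v
  PathFrom-++ [] refl q = q
  PathFrom-++ (a ∷ as) (e , p) q = e , PathFrom-++ as p q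

  ·-⁻¹ : ∀ {t} v → IsRefl t → v · (t · v) ⁻¹ ≡ t
  ·-⁻¹ {t} v Rt = grp (v ∷ []) ((t , refl-invol Rt) ∷ []) (var 0 ⊙ (ivar 0 ⊙ var 0) ⁻) (ivar 0) refl

  Inv-edge : ∀ {v t} → t ∈ Inv v → Edge (t · v) v
  Inv-edge {v} t∈ = subst IsRefl (sym (·-⁻¹ v (N⇒refl (Inv⇒N t∈)))) (N⇒refl (Inv⇒N t∈)) , N⇒< (Inv⇒N t∈)

  edge-Inv : ∀ {x v} → Edge x v → Σ W λ t → t ∈ Inv v × t · v ≡ x
  edge-Inv {x} {v} (R , l) = t , N⇒Inv (<⇒N R (subst (λ z → len z < len v) (sym t·v) l)) , t·v
    where
    t = v · x ⁻¹
    t·v : t · v ≡ x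
    t·v = trans (cong (_· v) (sym (invol⁻¹ (refl-invol R)))) (grp (v ∷ x ∷ []) [] ((var 0 ⊙ var 1 ⁻) ⁻ ⊙ var 0) (var 1) refl)

  VP-sound : ∀ n {u v as} → as ∈ VP n u v → PathFrom u as v × length as ≡ n
  VP-sound zero {u} {v} as∈ with u ≟W v
  VP-sound zero (here refl) | yes refl = refl , refl
  VP-sound (suc n) {u} {v} as∈ with concatMap-∈⁻ _ (Inv v) as∈
  ... | t , t∈ , p with ∈-map⁻ (_∷ʳ v) p
  ... | as′ , as′∈ , refl with VP-sound n as′∈
  ... | q , l = PathFrom-snoc as′ q (Inv-edge t∈) , trans (LP.length-++ as′) (trans (ℕP.+-comm _ 1) (cong suc l))

  VP-complete : ∀ n {u v as} → PathFrom u as v → length as ≡ n → as ∈ VP n u v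
  VP-complete zero {u} {v} {[]} refl _ with u ≟W u
  ... | yes _ = here refl
  ... | no ne = ⊥-elim (ne refl)
  VP-complete (suc n) {u} {v} {as} p l with initLast as
  ... | bs ∷ʳ′ b with PathFrom-unsnoc bs p
  ... | refl , x , q , e with edge-Inv e
  ... | t , t∈ , refl = concatMap-∈⁺ t∈ (∈-map⁺ (_∷ʳ v) (VP-complete n q (ℕP.suc-injective (trans (sym (trans (LP.length-++ bs) (ℕP.+-comm _ 1))) l))))

  VP-unique : ∀ n u v → Unique (VP n u v)
  VP-unique zero u v with u ≟W v
  ... | yes _ = [] ∷ []
  ... | no _ = []
  VP-unique (suc n) u v = concatMap-unique _ (Inv-unique v) (λ {t} _ → UniqueP.map⁺ (proj₁ ∘ LP.∷ʳ-injective _ _) (VP-unique n u (t · v))) separate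
    where
    separate : ∀ {t t′ as} → t ∈ Inv v → t′ ∈ Inv v → as ∈ map (_∷ʳ v) (VP n u (t · v)) → as ∈ map (_∷ʳ v) (VP n u (t′ · v)) → t ≡ t′
    separate {t} {t′} _ _ p q with ∈-map⁻ (_∷ʳ v) p | ∈-map⁻ (_∷ʳ v) q
    ... | bs , bs∈ , refl | cs , cs∈ , eq with LP.∷ʳ-injective bs cs eq
    ... | refl , _ = ∙-cancelʳ v t t′ (PathFrom-end bs (proj₁ (VP-sound n bs∈)) (proj₁ (VP-sound n cs∈)))

  ∑-VP-suc : ∀ n u v f → ∑ (VP (suc n) u v) f ≡ ∑ (Inv v) (λ t → ∑ (VP n u (t · v)) (λ as → f (as ∷ʳ v)))
  ∑-VP-suc n u v f = trans (∑-concatMap _ (Inv v) f) (∑-cong (Inv v) λ {t} _ → ∑-map (_∷ʳ v) (VP n u (t · v)) f)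

  ∑-VP-zero : ∀ u v f → ∑ (VP 0 u v) f ≡ (u == v) ▹ f []
  ∑-VP-zero u v f with u ≟W v
  ... | yes _ = ℤP.+-identityʳ _
  ... | no _ = refl

  labels-snoc : ∀ as {u x} → PathFrom u as x → ∀ v → labels u (as ∷ʳ v) ≡ labels u as ∷ʳ (v · x ⁻¹)
  labels-snoc [] refl v = refl
  labels-snoc (a ∷ as) {u} (_ , p) v = cong ((a · u ⁻¹) ∷_) (labels-snoc as p v)

  labels-++ : ∀ as {bs u x} → PathFrom u as x → labels u (as ++ bs) ≡ labels u as ++ labels x bs
  labels-++ [] refl = refl
  labels-++ (a ∷ as) {u = u} (_ , p) = cong ((a · u ⁻¹) ∷_) (labels-++ as p)

  labels-length : ∀ u as → length (labels u as) ≡ length as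
  labels-length u [] = refl
  labels-length u (a ∷ as) = cong suc (labels-length a as)

  labels-refl : ∀ {u} as {v} → PathFrom u as v → All IsRefl (labels u as)
  labels-refl [] _ = []
  labels-refl (a ∷ as) ((R , _) , p) = R ∷ labels-refl as p

  -- Reflections are odd, so each edge raises the length by an odd number. This is the source of the
  -- steps of two in the grading.
  PathFrom-len : ∀ as {u v} → PathFrom u as v → Σ ℕ λ j → len v ≡ len u + length as + (j + j)
  PathFrom-len [] {u} refl = 0 , trans (sym (ℕP.+-identityʳ (len u))) (sym (ℕP.+-identityʳ _))
  PathFrom-len (a ∷ as) {u} ((R , l) , p) with PathFrom-len as p | odd-gap (len u) (len a) l parity
    where
    parity : odd (len a) ≡ not (odd (len u))
    parity = begin
      odd (len a)                       ≡⟨ par-len a ⟨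
      par a                             ≡⟨ cong par (grp (a ∷ u ∷ []) [] (var 0) (var 0 ⊙ var 1 ⁻ ⊙ var 1) refl) ⟩
      par (a · u ⁻¹ · u)                ≡⟨ par-· (a · u ⁻¹) u ⟩
      par (a · u ⁻¹) xor par u          ≡⟨ cong₂ _xor_ (par-refl R) (par-len u) ⟩
      not (odd (len u)) ∎
      where open ≡-Reasoning
    odd-gap : ∀ m n → m < n → odd n ≡ not (odd m) → Σ ℕ λ j → n ≡ suc m + (j + j)
    odd-gap zero (suc zero) _ _ = 0 , refl
    odd-gap zero (suc (suc n)) _ eq with odd-gap zero n (odd⇒positive n eq) (trans (sym (not-involutive (odd n))) eq)
      where
      odd⇒positive : ∀ n → odd (suc (suc n)) ≡ true → 0 < n
      odd⇒positive (suc n) _ = s≤s z≤n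
    ... | j , eq′ = suc j , trans (cong (suc ∘ suc) eq′) (cong (suc ∘ suc) (sym (ℕP.+-suc j j)))
    odd-gap (suc m) (suc n) (s≤s l) eq with odd-gap m n l (not-injective eq)
      where
      not-injective : ∀ {x y} → not x ≡ not y → x ≡ y
      not-injective {true} {true} _ = refl
      not-injective {false} {false} _ = refl
    ... | j , eq′ = j , cong suc eq′
  ... | j , eq | i , eq′ = i + j , trans eq (trans (cong (λ m → m + length as + (j + j)) eq′) (rearrange (len u) (length as) i j))
    where
    rearrange : ∀ u l i j → suc u + (i + i) + l + (j + j) ≡ u + suc l + (i + j + (i + j))
    rearrange = ℕSolver.solve-∀

  -- Finite lower sets of the Bruhat order, later supplied by the hypothesis on the R-polynomials.
  -- They also make the order decidable.
  record Intervals : Set where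
    field
      below    : W → List W
      unique   : ∀ v → Unique (below v)
      sound    : ∀ {x v} → x ∈ below v → x ≤B v
      complete : ∀ {x v} → x ≤B v → x ∈ below v

  ≤B-refl : ∀ v → v ≤B v
  ≤B-refl v = [] , refl

  ≤B-trans : ∀ {x y z} → x ≤B y → y ≤B z → x ≤B z
  ≤B-trans (as , p) (bs , q) = as ++ bs , PathFrom-++ as p q

  VP⇒≤B : ∀ n {u v as} → as ∈ VP n u v → u ≤B v
  VP⇒≤B n {as = as} as∈ = as , proj₁ (VP-sound n as∈)

  ∑-VP-≰ : ∀ n {u v} f → ¬ (u ≤B v) → ∑ (VP n u v) f ≡ 0ℤ
  ∑-VP-≰ n f u≰v = ∑-zero (VP n _ _) λ as∈ → ⊥-elim (u≰v (VP⇒≤B n as∈))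

  module _ (I : Intervals) where
    open Intervals I

    ∑-below-support : ∀ {z v} → z ≤B v → ∀ f → (∀ {w} → ¬ (w ≤B z) → f w ≡ 0ℤ) → ∑ (below v) f ≡ ∑ (below z) f
    ∑-below-support {z} {v} z≤v f h = ∑-support _≟W_ f (unique v) (unique z) (λ _ x∉ → h (x∉ ∘ complete))
      (λ x∈ x∉ → ⊥-elim (x∉ (complete (≤B-trans (sound x∈) z≤v))))

    -- A path of length i + j is cut at its i-th vertex w. The induction strips last edges from the
    -- second piece, in accordance with `VP`.
    ∑-VP-+ : ∀ i j u v f → ∑ (VP (i + j) u v) f ≡ ∑ (below v) (λ w → ∑ (VP i u w) (λ p → ∑ (VP j w v) (λ q → f (p ++ q))))
    ∑-VP-+ i zero u v f = begin
      ∑ (VP (i + 0) u v) f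
        ≡⟨ cong (λ n → ∑ (VP n u v) f) (ℕP.+-identityʳ i) ⟩
      ∑ (VP i u v) f
        ≡⟨ ∑-cong (VP i u v) (λ {p} _ → cong f (sym (LP.++-identityʳ p))) ⟩
      ∑ (VP i u v) (λ p → f (p ++ []))
        ≡⟨ ∑-δ _≟W_ (λ w → ∑ (VP i u w) (λ p → f (p ++ []))) (unique v) (complete (≤B-refl v)) ⟨
      ∑ (below v) (λ w → (v == w) ▹ ∑ (VP i u w) (λ p → f (p ++ [])))
        ≡⟨ ∑-cong (below v) (λ {w} _ → trans (sym (∑-▹ (v == w) (VP i u w) (λ p → f (p ++ [])))) (∑-cong (VP i u w) λ {p} _ →
             trans (cong (_▹ f (p ++ [])) (==-⇔ sym sym)) (sym (∑-VP-zero w v (λ q → f (p ++ q)))))) ⟩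
      ∑ (below v) (λ w → ∑ (VP i u w) (λ p → ∑ (VP 0 w v) (λ q → f (p ++ q)))) ∎
      where open ≡-Reasoning
    ∑-VP-+ i (suc j) u v f = begin
      ∑ (VP (i + suc j) u v) f
        ≡⟨ cong (λ n → ∑ (VP n u v) f) (ℕP.+-suc i j) ⟩
      ∑ (VP (suc (i + j)) u v) f
        ≡⟨ ∑-VP-suc (i + j) u v f ⟩
      ∑ (Inv v) (λ t → ∑ (VP (i + j) u (t · v)) (λ as → f (as ∷ʳ v)))
        ≡⟨ ∑-cong (Inv v) (λ {t} t∈ → trans (∑-VP-+ i j u (t · v) (λ as → f (as ∷ʳ v))) (sym (∑-below-support (t·v≤v t∈) _
             λ {w} w≰ → ∑-zero (VP i u w) λ _ → ∑-VP-≰ j _ w≰))) ⟩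
      ∑ (Inv v) (λ t → ∑ (below v) (λ w → ∑ (VP i u w) (λ p → ∑ (VP j w (t · v)) (λ q → f ((p ++ q) ∷ʳ v)))))
        ≡⟨ ∑-swap (Inv v) (below v) _ ⟩
      ∑ (below v) (λ w → ∑ (Inv v) (λ t → ∑ (VP i u w) (λ p → ∑ (VP j w (t · v)) (λ q → f ((p ++ q) ∷ʳ v)))))
        ≡⟨ ∑-cong (below v) (λ {w} _ → ∑-swap (Inv v) (VP i u w) _) ⟩
      ∑ (below v) (λ w → ∑ (VP i u w) (λ p → ∑ (Inv v) (λ t → ∑ (VP j w (t · v)) (λ q → f ((p ++ q) ∷ʳ v)))))
        ≡⟨ ∑-cong (below v) (λ {w} _ → ∑-cong (VP i u w) λ {p} _ → trans (∑-cong (Inv v) λ {t} _ → ∑-cong (VP j w (t · v)) λ {q} _ →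
             cong f (LP.++-assoc p q (v ∷ []))) (sym (∑-VP-suc j w v (λ q → f (p ++ q))))) ⟩
      ∑ (below v) (λ w → ∑ (VP i u w) (λ p → ∑ (VP (suc j) w v) (λ q → f (p ++ q)))) ∎
      where
      open ≡-Reasoning
      t·v≤v : ∀ {t} → t ∈ Inv v → (t · v) ≤B v
      t·v≤v t∈ = v ∷ [] , Inv-edge t∈ , refl

-- Increasing blocks and descent words of label sequences

module LabelTests {W : Set} (lt : W → W → Bool) where
  below : Maybe W → W → Bool
  below nothing t = true
  below (just c) t = lt t c

  -- The bound c is tested on the last label only; in an increasing sequence this bounds all labels,
  -- as in the count `G`.
  increasing : Maybe W → List W → Bool
  increasing c [] = true
  increasing c (l ∷ []) = below c l
  increasing c (l ∷ l′ ∷ ls) = lt l l′ ∧ increasing c (l′ ∷ ls)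

  increasing-snoc : ∀ c ls t → increasing c (ls ∷ʳ t) ≡ below c t ∧ increasing (just t) ls
  increasing-snoc c [] t = sym (∧-identityʳ _)
  increasing-snoc c (l ∷ []) t = ∧-comm (lt l t) (below c t)
  increasing-snoc c (l ∷ l′ ∷ ls) t = trans (cong (lt l l′ ∧_) (increasing-snoc c (l′ ∷ ls) t)) (∧-swap (lt l l′) (below c t) _)
    where
    ∧-swap : ∀ x y z → x ∧ (y ∧ z) ≡ y ∧ (x ∧ z)
    ∧-swap true y z = refl
    ∧-swap false true z = refl
    ∧-swap false false z = refl

  blocks-increase : List ℕ → List W → Bool
  blocks-increase [] ls = true
  blocks-increase (a ∷ γ) ls = increasing nothing (take a ls) ∧ blocks-increase γ (drop a ls)

  descentWord : List W → List Bool
  descentWord [] = []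
  descentWord (l ∷ []) = []
  descentWord (l ∷ l′ ∷ ls) = lt l′ l ∷ descentWord (l′ ∷ ls)

  descentWord-length : ∀ ls n → length ls ≡ suc n → length (descentWord ls) ≡ n
  descentWord-length (l ∷ []) zero _ = refl
  descentWord-length (l ∷ l′ ∷ ls) (suc n) eq = cong suc (descentWord-length (l′ ∷ ls) n (ℕP.suc-injective eq))

  Comparable : List W → Set
  Comparable [] = ⊤
  Comparable (l ∷ []) = ⊤
  Comparable (l ∷ l′ ∷ ls) = lt l′ l ≡ not (lt l l′) × Comparable (l′ ∷ ls)

  -- Blocks break exactly at the positions marked in p, so they all increase iff every descent is
  -- marked; comparability makes each step that is not an ascent a descent.
  blocks-wtc : ∀ p ls → Comparable ls → length ls ≡ suc (length p) → blocks-increase (wtc p) ls ≡ (descentWord ls ⊑ p)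
  blocks-wtc [] (l ∷ []) _ _ = refl
  blocks-wtc (true ∷ p) (l ∷ l′ ∷ ls) (_ , c) eq = trans (blocks-wtc p (l′ ∷ ls) c (ℕP.suc-injective eq))
    (cong (_∧ (descentWord (l′ ∷ ls) ⊑ p)) (sym (∨-zeroʳ (not (lt l′ l)))))
  blocks-wtc (false ∷ p) (l ∷ l′ ∷ ls) (h , c) eq with wtc p | wtc-nonempty p | blocks-wtc p (l′ ∷ ls) c (ℕP.suc-injective eq)
  ... | _ | a , γ , refl | ih = trans (∧-assoc (lt l l′) _ _) (cong₂ _∧_ (sym (trans (∨-identityʳ _) (trans (cong not h) (not-involutive _)))) ih)

-- the sum telescopes: a list increasing up to position i and decreasing
-- afterwards is counted at its peak from both sides
module Telescope {W : Set} (lt : W → W → Bool) where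
  open LabelTests lt
  open LabelTests (flip lt) using () renaming (increasing to decreasing)

  -- These are the terms with l in the increasing part. If l < l′, the term i = 0 cancels the
  -- others, which are known by induction; otherwise it alone remains.
  partial : ∀ l ls → Comparable (l ∷ ls) →
    conv (length ls) (λ i j → sgn j *ᶻ ((increasing nothing (l ∷ take i ls) ∧ decreasing nothing (drop i ls)) ▹ 1ℤ)) ≡
    sgn (length ls) *ᶻ (decreasing nothing (l ∷ ls) ▹ 1ℤ)
  partial l [] _ = refl
  partial l (l′ ∷ ls) (h , c) = begin
    -ᶻ s *ᶻ (d ▹ 1ℤ) +ᶻ conv (length ls) (λ i j → sgn j *ᶻ (((lt l l′ ∧ increasing nothing (l′ ∷ take i ls)) ∧ decreasing nothing (drop i ls)) ▹ 1ℤ))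
      ≡⟨ cong (-ᶻ s *ᶻ (d ▹ 1ℤ) +ᶻ_) (trans (conv-cong (length ls) λ i j _ → factor (lt l l′) (increasing nothing (l′ ∷ take i ls)) (decreasing nothing (drop i ls)) (sgn j))
           (trans (conv-* (length ls) (lt l l′ ▹ 1ℤ) (λ i j → sgn j *ᶻ ((increasing nothing (l′ ∷ take i ls) ∧ decreasing nothing (drop i ls)) ▹ 1ℤ)))
             (cong ((lt l l′ ▹ 1ℤ) *ᶻ_) (partial l′ ls c)))) ⟩
    -ᶻ s *ᶻ (d ▹ 1ℤ) +ᶻ (lt l l′ ▹ 1ℤ) *ᶻ (s *ᶻ (d ▹ 1ℤ))
      ≡⟨ final (lt l l′) (lt l′ l) h (d ▹ 1ℤ) ⟩
    -ᶻ s *ᶻ (lt l′ l ▹ (d ▹ 1ℤ))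
      ≡⟨ cong (-ᶻ s *ᶻ_) (sym (▹-∧ (lt l′ l) d 1ℤ)) ⟩
    -ᶻ s *ᶻ ((lt l′ l ∧ d) ▹ 1ℤ) ∎
    where
    open ≡-Reasoning
    s = sgn (length ls)
    d = decreasing nothing (l′ ∷ ls)
    factor : ∀ a b c s → s *ᶻ (((a ∧ b) ∧ c) ▹ 1ℤ) ≡ (a ▹ 1ℤ) *ᶻ (s *ᶻ ((b ∧ c) ▹ 1ℤ))
    factor true b c s = sym (ℤP.*-identityˡ _)
    factor false b c s = trans (ℤP.*-zeroʳ s) (sym (ℤP.*-zeroˡ (s *ᶻ ((b ∧ c) ▹ 1ℤ))))
    lemma₁ : ∀ s x → -ᶻ s *ᶻ x +ᶻ 1ℤ *ᶻ (s *ᶻ x) ≡ -ᶻ s *ᶻ 0ℤ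
    lemma₁ = ℤSolver.solve-∀
    lemma₂ : ∀ s x → -ᶻ s *ᶻ x +ᶻ 0ℤ *ᶻ (s *ᶻ x) ≡ -ᶻ s *ᶻ x
    lemma₂ = ℤSolver.solve-∀
    final : ∀ a b → b ≡ not a → ∀ x → -ᶻ s *ᶻ x +ᶻ (a ▹ 1ℤ) *ᶻ (s *ᶻ x) ≡ -ᶻ s *ᶻ (b ▹ x)
    final true .false refl x = lemma₁ s x
    final false .true refl x = lemma₂ s x

  telescope : ∀ l ls → Comparable (l ∷ ls) →
    conv (suc (length ls)) (λ i j → sgn j *ᶻ ((increasing nothing (take i (l ∷ ls)) ∧ decreasing nothing (drop i (l ∷ ls))) ▹ 1ℤ)) ≡ 0ℤ
  telescope l ls c = trans (cong (-ᶻ sgn (length ls) *ᶻ (decreasing nothing (l ∷ ls) ▹ 1ℤ) +ᶻ_) (partial l ls c))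
    (cancel (sgn (length ls)) (decreasing nothing (l ∷ ls) ▹ 1ℤ))
    where
    cancel : ∀ s x → -ᶻ s *ᶻ x +ᶻ s *ᶻ x ≡ 0ℤ
    cancel = ℤSolver.solve-∀

-- Flag counts

module PathCounts (C : CoxeterSystem) (len : CoxeterSystem.W C → ℕ) (isLen : CoxDefs.IsLength C len)
                  (lt : CoxeterSystem.W C → CoxeterSystem.W C → Bool)
                  (O : ReflectionOrders.ReflectionOrder C len isLen lt) where
  open Inversions C len isLen
  open PathLists C len isLen
  open LabelTests lt using (increasing; increasing-snoc)
  open Counting C len isLen lt O using (G)
  private
    module ByLabels = LabelTests lt
    module ByOrder = Counting C len isLen lt O

  G-VP : ∀ n u v c → G n u v c ≡ ∑ (VP n u v) (λ as → increasing c (labels u as) ▹ 1ℤ)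
  G-VP zero u v c = sym (∑-VP-zero u v (λ as → increasing c (labels u as) ▹ 1ℤ))
  G-VP (suc n) u v c = trans (∑-cong (Inv v) step) (sym (∑-VP-suc n u v _))
    where
    below-same : ∀ c t → ByOrder.below c t ≡ ByLabels.below c t
    below-same nothing t = refl
    below-same (just c) t = refl
    step : ∀ {t} → t ∈ Inv v → ByOrder.below c t ▹ G n u (t · v) (just t) ≡ ∑ (VP n u (t · v)) (λ as → increasing c (labels u (as ∷ʳ v)) ▹ 1ℤ)
    step {t} t∈ = trans (cong₂ _▹_ (below-same c t) (G-VP n u (t · v) (just t))) (trans (sym (∑-▹ (ByLabels.below c t) (VP n u (t · v)) _))
      (∑-cong (VP n u (t · v)) λ {as} as∈ → trans (sym (▹-∧ (ByLabels.below c t) (increasing (just t) (labels u as)) 1ℤ)) (cong (_▹ 1ℤ)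
        (trans (sym (increasing-snoc c (labels u as) t)) (cong (increasing c) (sym (trans (labels-snoc as (proj₁ (VP-sound n as∈)) v)
          (cong (labels u as ∷ʳ_) (·-⁻¹ v (N⇒refl (Inv⇒N t∈)))))))))))

module Flags (C : CoxeterSystem) (len : CoxeterSystem.W C → ℕ) (isLen : CoxDefs.IsLength C len)
             (lt : CoxeterSystem.W C → CoxeterSystem.W C → Bool)
             (O : ReflectionOrders.ReflectionOrder C len isLen lt) where
  open Inversions C len isLen
  open ReflectionOrders C len isLen using (ReflectionOrder; flip-order)
  open ReflectionOrder O
  open PathLists C len isLen
  open LabelTests lt using (increasing; blocks-increase; Comparable; descentWord; blocks-wtc)
  open Counting C len isLen lt O using (G)
  open PathCounts C len isLen lt O

  -- Two equal consecutive labels t would lead from u to tu and back to u, although the length grows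
  -- along edges.
  comparable : ∀ {u} as {v} → PathFrom u as v → Comparable (labels u as)
  comparable [] _ = tt
  comparable (a ∷ []) _ = tt
  comparable {u} (a ∷ b ∷ as) ((R , l) , (R′ , l′) , p) = lt-total R R′ distinct , comparable (b ∷ as) ((R′ , l′) , p)
    where
    distinct : a · u ⁻¹ ≢ b · a ⁻¹
    distinct eq = ℕP.<-asym l (subst (λ z → len a < len z) b≡u l′)
      where
      b≡u : b ≡ u
      b≡u = trans (grp (b ∷ a ∷ []) [] (var 0) (var 0 ⊙ var 1 ⁻ ⊙ var 1) refl) (trans (cong (_· a) (trans (sym eq) (sym (invol⁻¹ (refl-invol R)))))
        (grp (a ∷ u ∷ []) [] ((var 0 ⊙ var 1 ⁻) ⁻ ⊙ var 0) (var 1) refl))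

  Gs : W → W → ℕ → ℤ
  Gs u v n = G n u v nothing

  G-≰ : ∀ n {u v} → ¬ (u ≤B v) → Gs u v n ≡ 0ℤ
  G-≰ n {u} {v} u≰v = trans (G-VP n u v nothing) (∑-VP-≰ n _ u≰v)

  no-loop : ∀ n {v} as → ¬ (PathFrom v as v × length as ≡ suc n)
  no-loop n {v} as (p , l) with PathFrom-len as p
  ... | j , eq = ℕP.<⇒≢ (ℕP.≤-trans (ℕP.≤-reflexive (ℕP.+-comm 1 (len v))) (ℕP.≤-trans (ℕP.+-monoʳ-≤ (len v) (subst (1 ≤_) (sym l) (s≤s z≤n))) (ℕP.m≤m+n _ (j + j)))) eq

  G-loop : ∀ n v → Gs v v (suc n) ≡ 0ℤ
  G-loop n v = trans (G-VP (suc n) v v nothing) (∑-zero (VP (suc n) v v) λ {as} as∈ → ⊥-elim (no-loop n as (VP-sound (suc n) as∈)))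

  module Series (I : Intervals) where
    open Intervals I renaming (below to lower)

    ∑-convolution : ∀ i j u v (f g : W → List W → ℤ) →
      ∑ (lower v) (λ w → ∑ (VP i u w) (f w) *ᶻ ∑ (VP j w v) (g w)) ≡ ∑ (lower v) (λ w → ∑ (VP i u w) (λ p → ∑ (VP j w v) (λ q → f w p *ᶻ g w q)))
    ∑-convolution i j u v f g = ∑-cong (lower v) λ {w} _ → trans (sym (∑-*ʳ (∑ (VP j w v) (g w)) (VP i u w) (f w)))
      (∑-cong (VP i u w) λ {p} _ → sym (∑-* (f w p) (VP j w v) (g w)))

    -- c γ u v counts the paths from u to v that are concatenations of increasing
    -- paths of lengths γ₁, γ₂, …
    c : List ℕ → W → W → ℤ
    c [] u v = (u == v) ▹ 1ℤ
    c (a ∷ γ) u v = ∑ (lower v) λ w → Gs u w a *ᶻ c γ w v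

    take-++ : ∀ {A : Set} {n} (xs ys : List A) → length xs ≡ n → take n (xs ++ ys) ≡ xs × drop n (xs ++ ys) ≡ ys
    take-++ [] ys refl = refl , refl
    take-++ (x ∷ xs) ys refl = cong (x ∷_) (proj₁ (take-++ xs ys refl)) , proj₂ (take-++ xs ys refl)

    ▹-product : ∀ a b → (a ▹ 1ℤ) *ᶻ (b ▹ 1ℤ) ≡ (a ∧ b) ▹ 1ℤ
    ▹-product true b = ℤP.*-identityˡ _
    ▹-product false b = refl

    c-paths : ∀ γ u v → c γ u v ≡ ∑ (VP (sum γ) u v) (λ as → blocks-increase γ (labels u as) ▹ 1ℤ)
    c-paths [] u v = sym (∑-VP-zero u v (λ _ → 1ℤ))
    c-paths (a ∷ γ) u v = begin
      ∑ (lower v) (λ w → Gs u w a *ᶻ c γ w v)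
        ≡⟨ ∑-cong (lower v) (λ {w} _ → cong₂ _*ᶻ_ (G-VP a u w nothing) (c-paths γ w v)) ⟩
      ∑ (lower v) (λ w → ∑ (VP a u w) (λ p → increasing nothing (labels u p) ▹ 1ℤ) *ᶻ ∑ (VP (sum γ) w v) (λ q → blocks-increase γ (labels w q) ▹ 1ℤ))
        ≡⟨ ∑-convolution a (sum γ) u v (λ w p → increasing nothing (labels u p) ▹ 1ℤ) (λ w q → blocks-increase γ (labels w q) ▹ 1ℤ) ⟩
      ∑ (lower v) (λ w → ∑ (VP a u w) (λ p → ∑ (VP (sum γ) w v) (λ q → (increasing nothing (labels u p) ▹ 1ℤ) *ᶻ (blocks-increase γ (labels w q) ▹ 1ℤ))))
        ≡⟨ ∑-cong (lower v) (λ {w} _ → ∑-cong (VP a u w) λ {p} p∈ → ∑-cong (VP (sum γ) w v) λ {q} _ → join w p q (VP-sound a p∈)) ⟩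
      ∑ (lower v) (λ w → ∑ (VP a u w) (λ p → ∑ (VP (sum γ) w v) (λ q → blocks-increase (a ∷ γ) (labels u (p ++ q)) ▹ 1ℤ)))
        ≡⟨ ∑-VP-+ I a (sum γ) u v (λ as → blocks-increase (a ∷ γ) (labels u as) ▹ 1ℤ) ⟨
      ∑ (VP (a + sum γ) u v) (λ as → blocks-increase (a ∷ γ) (labels u as) ▹ 1ℤ) ∎
      where
      open ≡-Reasoning
      join : ∀ w p q → PathFrom u p w × length p ≡ a → (increasing nothing (labels u p) ▹ 1ℤ) *ᶻ (blocks-increase γ (labels w q) ▹ 1ℤ) ≡ blocks-increase (a ∷ γ) (labels u (p ++ q)) ▹ 1ℤ
      join w p q (path , l) = trans (▹-product (increasing nothing (labels u p)) (blocks-increase γ (labels w q))) (cong (_▹ 1ℤ) (sym (trans (cong (blocks-increase (a ∷ γ)) (labels-++ p path))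
        (cong₂ (λ x y → increasing nothing x ∧ blocks-increase γ y) (proj₁ cut) (proj₂ cut)))))
        where
        cut = take-++ (labels u p) (labels w q) (trans (labels-length u p) l)

    c-≰ : ∀ γ {u v} → ¬ (u ≤B v) → c γ u v ≡ 0ℤ
    c-≰ γ {u} {v} u≰v = trans (c-paths γ u v) (∑-VP-≰ (sum γ) _ u≰v)

    _≤?_ : ∀ u v → Dec (u ≤B v)
    u ≤? v with DecMem._∈?_ _≟W_ u (lower v)
    ... | yes u∈ = yes (sound u∈)
    ... | no u∉ = no (u∉ ∘ complete)

    c-zero : ∀ γ u v → c (0 ∷ γ) u v ≡ c γ u v
    c-zero γ u v with u ≤? v
    ... | no u≰v = trans (c-≰ (0 ∷ γ) u≰v) (sym (c-≰ γ u≰v))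
    ... | yes u≤v = trans (∑-cong (lower v) λ {w} _ → sym (▹-* (u == w) (c γ w v))) (∑-δ _≟W_ (λ w → c γ w v) (unique v) (complete u≤v))

    c-prefix : ∀ {γ γ′} β → (∀ u v → c γ u v ≡ c γ′ u v) → ∀ u v → c (β ++ γ) u v ≡ c (β ++ γ′) u v
    c-prefix [] h u v = h u v
    c-prefix (a ∷ β) h u v = ∑-cong (lower v) λ {w} _ → cong (Gs u w a *ᶻ_) (c-prefix β h w v)

    c-flat : ∀ γ u v → c γ u v ≡ c (flat γ) u v
    c-flat [] u v = refl
    c-flat (zero ∷ γ) u v = trans (c-zero γ u v) (c-flat γ u v)
    c-flat (suc a ∷ γ) u v = ∑-cong (lower v) λ {w} _ → cong (Gs u w (suc a) *ᶻ_) (c-flat γ w v)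

    -- Once the second factor counts decreasing paths, all terms are counts over the one list
    -- `VP (suc k) u v`, and the alternating sum can be taken path by path.
    G-inverse : ∀ k u v → conv (suc k) (λ i j → sgn j *ᶻ ∑ (lower v) (λ w → Gs u w i *ᶻ Gs w v j)) ≡ 0ℤ
    G-inverse k u v = begin
      conv (suc k) (λ i j → sgn j *ᶻ ∑ (lower v) (λ w → Gs u w i *ᶻ Gs w v j))
        ≡⟨ conv-cong (suc k) (λ i j i+j → trans (cong (sgn j *ᶻ_) (trans (count i j) (cong (λ n → ∑ (VP n u v) (λ as → test i as ▹ 1ℤ)) i+j))) (sym (∑-* (sgn j) (VP (suc k) u v) _))) ⟩
      conv (suc k) (λ i j → ∑ (VP (suc k) u v) (λ as → sgn j *ᶻ (test i as ▹ 1ℤ)))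
        ≡⟨ conv-∑ (suc k) (VP (suc k) u v) (λ i j as → sgn j *ᶻ (test i as ▹ 1ℤ)) ⟩
      ∑ (VP (suc k) u v) (λ as → conv (suc k) (λ i j → sgn j *ᶻ (test i as ▹ 1ℤ)))
        ≡⟨ ∑-zero (VP (suc k) u v) (λ {as} as∈ → vanish as (VP-sound (suc k) as∈)) ⟩
      0ℤ ∎
      where
      open ≡-Reasoning
      module Down = LabelTests (flip lt)
      test : ℕ → List W → Bool
      test i as = increasing nothing (take i (labels u as)) ∧ Down.increasing nothing (drop i (labels u as))
      G-down : ∀ j w → Gs w v j ≡ ∑ (VP j w v) (λ q → Down.increasing nothing (labels w q) ▹ 1ℤ)
      G-down j w = trans (OrderIndependence.Gs-independent C len isLen lt (flip lt) O (flip-order O) w v j)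
        (PathCounts.G-VP C len isLen (flip lt) (flip-order O) j w v nothing)
      count : ∀ i j → ∑ (lower v) (λ w → Gs u w i *ᶻ Gs w v j) ≡ ∑ (VP (i + j) u v) (λ as → test i as ▹ 1ℤ)
      count i j = trans (∑-cong (lower v) λ {w} _ → cong₂ _*ᶻ_ (G-VP i u w nothing) (G-down j w))
        (trans (∑-convolution i j u v (λ w p → increasing nothing (labels u p) ▹ 1ℤ) (λ w q → Down.increasing nothing (labels w q) ▹ 1ℤ))
          (trans (∑-cong (lower v) λ {w} _ → ∑-cong (VP i u w) λ {p} p∈ → ∑-cong (VP j w v) λ {q} _ → join w p q (VP-sound i p∈))
            (sym (∑-VP-+ I i j u v (λ as → test i as ▹ 1ℤ)))))
        where
        join : ∀ w p q → PathFrom u p w × length p ≡ i → (increasing nothing (labels u p) ▹ 1ℤ) *ᶻ (Down.increasing nothing (labels w q) ▹ 1ℤ) ≡ test i (p ++ q) ▹ 1ℤ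
        join w p q (path , l) = trans (▹-product (increasing nothing (labels u p)) (Down.increasing nothing (labels w q))) (cong (_▹ 1ℤ) (sym
          (trans (cong (λ ls → increasing nothing (take i ls) ∧ Down.increasing nothing (drop i ls)) (labels-++ p path))
            (cong₂ (λ x y → increasing nothing x ∧ Down.increasing nothing y) (proj₁ cut) (proj₂ cut)))))
          where
          cut = take-++ (labels u p) (labels w q) (trans (labels-length u p) l)
      vanish : ∀ as → PathFrom u as v × length as ≡ suc k → conv (suc k) (λ i j → sgn j *ᶻ (test i as ▹ 1ℤ)) ≡ 0ℤ
      vanish (a ∷ as) (p , l) = subst (λ n → conv n (λ i j → sgn j *ᶻ (test i (a ∷ as) ▹ 1ℤ)) ≡ 0ℤ) (trans (cong suc (labels-length a as)) l)
        (Telescope.telescope lt (a · u ⁻¹) (labels a as) (comparable (a ∷ as) p))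

    -- Summing over the middle vertex w first isolates the product between u and z, to which
    -- `G-inverse` applies. There w may be restricted to elements below z because `Gs` vanishes
    -- otherwise.
    euler-pair : ∀ k γ u v → conv (suc k) (λ i j → sgn j *ᶻ c (i ∷ j ∷ γ) u v) ≡ 0ℤ
    euler-pair k γ u v = begin
      conv (suc k) (λ i j → sgn j *ᶻ c (i ∷ j ∷ γ) u v)
        ≡⟨ conv-cong (suc k) (λ i j _ → trans (cong (sgn j *ᶻ_) (regroup i j)) (trans (sym (∑-* (sgn j) (lower v) _))
             (∑-cong (lower v) λ {z} _ → swap-factors (sgn j) (c γ z v) (pair i j z)))) ⟩
      conv (suc k) (λ i j → ∑ (lower v) (λ z → c γ z v *ᶻ (sgn j *ᶻ pair i j z)))
        ≡⟨ conv-∑ (suc k) (lower v) (λ i j z → c γ z v *ᶻ (sgn j *ᶻ pair i j z)) ⟩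
      ∑ (lower v) (λ z → conv (suc k) (λ i j → c γ z v *ᶻ (sgn j *ᶻ pair i j z)))
        ≡⟨ ∑-zero (lower v) (λ {z} _ → trans (conv-* (suc k) (c γ z v) (λ i j → sgn j *ᶻ pair i j z)) (trans (cong (c γ z v *ᶻ_) (G-inverse k u z)) (ℤP.*-zeroʳ (c γ z v)))) ⟩
      0ℤ ∎
      where
      open ≡-Reasoning
      pair : ℕ → ℕ → W → ℤ
      pair i j z = ∑ (lower z) (λ w → Gs u w i *ᶻ Gs w z j)
      swap-factors : ∀ s x y → s *ᶻ (x *ᶻ y) ≡ x *ᶻ (s *ᶻ y)
      swap-factors = ℤSolver.solve-∀
      shuffle : ∀ a b c → a *ᶻ (b *ᶻ c) ≡ c *ᶻ (a *ᶻ b)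
      shuffle = ℤSolver.solve-∀
      regroup : ∀ i j → c (i ∷ j ∷ γ) u v ≡ ∑ (lower v) (λ z → c γ z v *ᶻ pair i j z)
      regroup i j = begin
        ∑ (lower v) (λ w → Gs u w i *ᶻ ∑ (lower v) (λ z → Gs w z j *ᶻ c γ z v))
          ≡⟨ ∑-cong (lower v) (λ {w} _ → sym (∑-* (Gs u w i) (lower v) _)) ⟩
        ∑ (lower v) (λ w → ∑ (lower v) (λ z → Gs u w i *ᶻ (Gs w z j *ᶻ c γ z v)))
          ≡⟨ ∑-swap (lower v) (lower v) _ ⟩
        ∑ (lower v) (λ z → ∑ (lower v) (λ w → Gs u w i *ᶻ (Gs w z j *ᶻ c γ z v)))
          ≡⟨ ∑-cong (lower v) (λ {z} z∈ → trans (∑-cong (lower v) λ {w} _ → shuffle (Gs u w i) (Gs w z j) (c γ z v)) (trans (∑-* (c γ z v) (lower v) (λ w → Gs u w i *ᶻ Gs w z j))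
               (cong (c γ z v *ᶻ_) (∑-below-support I (sound z∈) _ λ {w} w≰z → trans (cong (Gs u w i *ᶻ_) (G-≰ j w≰z)) (ℤP.*-zeroʳ (Gs u w i)))))) ⟩
        ∑ (lower v) (λ z → c γ z v *ᶻ pair i j z) ∎

    c-functional : ∀ u v → PeakFunctional (λ γ → c γ u v)
    c-functional u v = record { zero-part = λ β γ → c-prefix β (c-zero γ) u v ; euler = λ β k γ → euler-at β k γ u v }
      where
      swap-factors : ∀ s x y → s *ᶻ (x *ᶻ y) ≡ x *ᶻ (s *ᶻ y)
      swap-factors = ℤSolver.solve-∀
      euler-at : ∀ β k γ u v → conv (suc k) (λ i j → sgn j *ᶻ c (β ++ i ∷ j ∷ γ) u v) ≡ 0ℤ
      euler-at [] k γ u v = euler-pair k γ u v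
      euler-at (a ∷ β) k γ u v = trans (conv-cong (suc k) λ i j _ → trans (sym (∑-* (sgn j) (lower v) _)) (∑-cong (lower v) λ {w} _ → swap-factors (sgn j) (Gs u w a) (c (β ++ i ∷ j ∷ γ) w v)))
        (trans (conv-∑ (suc k) (lower v) (λ i j w → Gs u w a *ᶻ (sgn j *ᶻ c (β ++ i ∷ j ∷ γ) w v)))
          (∑-zero (lower v) λ {w} _ → trans (conv-* (suc k) (Gs u w a) (λ i j → sgn j *ᶻ c (β ++ i ∷ j ∷ γ) w v)) (trans (cong (Gs u w a *ᶻ_) (euler-at β k γ w v)) (ℤP.*-zeroʳ (Gs u w a)))))

-- The theorem

-- Degrees n of cd-words that may occur: Θ of such a word has degree n + 1, which runs through the
-- positive numbers among l, l - 2, l - 4, ....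
degrees : ℕ → List ℕ
degrees zero = []
degrees (suc zero) = 0 ∷ []
degrees (suc (suc l)) = suc l ∷ degrees l

degrees-sound : ∀ l {n} → n ∈ degrees l → Σ ℕ λ j → l ≡ suc n + 2 * j
degrees-sound (suc zero) (here refl) = 0 , refl
degrees-sound (suc (suc l)) (here refl) = 0 , sym (ℕP.+-identityʳ _)
degrees-sound (suc (suc l)) {n} (there n∈) with degrees-sound l n∈
... | j , eq = suc j , trans (cong (suc ∘ suc) eq) (lemma n j)
  where
  lemma : ∀ n j → suc (suc (suc n + 2 * j)) ≡ suc n + 2 * suc j
  lemma = ℕSolver.solve-∀

degrees-complete : ∀ n j → n ∈ degrees (suc n + (j + j))
degrees-complete zero zero = here refl
degrees-complete (suc n) zero = here (cong suc (sym (ℕP.+-identityʳ n)))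
degrees-complete n (suc j) = subst (λ l → n ∈ degrees l) (lemma n j) (there {xs = degrees (suc n + (j + j))} (degrees-complete n j))
  where
  lemma : ∀ n j → suc (suc (suc n + (j + j))) ≡ suc n + (suc j + suc j)
  lemma = ℕSolver.solve-∀

degrees-unique : ∀ l → Unique (degrees l)
degrees-unique zero = []
degrees-unique (suc zero) = [] ∷ []
degrees-unique (suc (suc l)) = All.tabulate (λ {n} n∈ → λ { refl → ℕP.<⇒≱ (ℕP.n<1+n (suc l)) (ℕP.≤-trans (suc-≤ l n∈) (ℕP.n≤1+n l)) }) ∷ degrees-unique l
  where
  suc-≤ : ∀ l {n} → n ∈ degrees l → suc n ≤ l
  suc-≤ l {n} n∈ with degrees-sound l n∈
  ... | j , eq = ℕP.≤-trans (ℕP.m≤m+n (suc n) (2 * j)) (ℕP.≤-reflexive (sym eq))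

∑-one : ∀ {A : Set} (xs : List A) → ∑ xs (λ _ → 1ℤ) ≡ ℤ.+ length xs
∑-one [] = refl
∑-one (x ∷ xs) = cong (1ℤ +ᶻ_) (∑-one xs)

Agree-pointwise : ∀ k w {f g} → Agree k w f → Agree k w g → ∀ i → k < i → f i ≡ g i
Agree-pointwise k [] a b i l = trans (a i l) (sym (b i l))
Agree-pointwise k (x ∷ w) (p , a) (q , b) i l with ℕP.m≤n⇒m<n∨m≡n l
... | inj₁ l′ = Agree-pointwise (suc k) w a b i l′
... | inj₂ refl = trans p (sym q)

iff⇒≡ : ∀ {a b} → (a ≡ true → b ≡ true) → (b ≡ true → a ≡ true) → a ≡ b
iff⇒≡ {true} {b} f _ = sym (f refl)
iff⇒≡ {false} {true} _ g = g refl
iff⇒≡ {false} {false} _ _ = refl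

words-length : ∀ n {w} → w ∈ words n → length w ≡ n
words-length zero (here refl) = refl
words-length (suc n) w∈ with concatMap-∈⁻ _ (words n) w∈
... | w , w∈′ , here refl = cong suc (words-length n w∈′)
... | w , w∈′ , there (here refl) = cong suc (words-length n w∈′)

comps-word : ∀ n {α} → α ∈ comps (suc n) → Σ (List Bool) λ p → length p ≡ n × α ≡ wtc p
comps-word n α∈ with ∈-map⁻ wtc (subst (_ ∈_) (comps-words n) α∈)
... | p , p∈ , refl = p , words-length n p∈ , refl

flat-word : ∀ n γ → sum γ ≡ suc n → Σ (List Bool) λ p → length p ≡ n × flat γ ≡ wtc p
flat-word n γ eq = composition-word n (flat γ) (flat-positive γ) (trans (sum-flat γ) eq)

flat-zero : ∀ γ → sum γ ≡ 0 → flat γ ≡ []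
flat-zero [] _ = refl
flat-zero (zero ∷ γ) eq = flat-zero γ eq

allZero⇒sum : ∀ γ → allZeroᵇ γ ≡ true → sum γ ≡ 0
allZero⇒sum [] _ = refl
allZero⇒sum (zero ∷ γ) eq = allZero⇒sum γ eq

sum⇒allZero : ∀ γ → sum γ ≡ 0 → allZeroᵇ γ ≡ true
sum⇒allZero [] _ = refl
sum⇒allZero (zero ∷ γ) eq = sum⇒allZero γ eq

collect : ∀ {A : Set} (R : A → ℕ → Set) (val : A → ℤ) xs → (∀ {x} → x ∈ xs → Σ ℕ λ m → R x m × ℤ.+ m ≡ val x) →
  Σ (List ℕ) λ cs → Pointwise R xs cs × (∀ (F : A → ℤ) → sumℤ (zipWith (λ x m → ℤ.+ m *ᶻ F x) xs cs) ≡ ∑ xs (λ x → val x *ᶻ F x))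
collect R val [] h = [] , [] , λ F → refl
collect R val (x ∷ xs) h with h (here refl) | collect R val xs (h ∘ there)
... | m , r , eq | cs , rs , sums = m ∷ cs , r ∷ rs , λ F → cong₂ _+ᶻ_ (cong (_*ᶻ F x) eq) (sums F)

Pointwise-map : ∀ {A B : Set} {R : A → B → Set} (f : A → B) xs → (∀ x → R x (f x)) → Pointwise R xs (map f xs)
Pointwise-map f [] h = []
Pointwise-map f (x ∷ xs) h = h x ∷ Pointwise-map f xs h

∑-upTo-suc : ∀ n (f : ℕ → ℤ) → ∑ (upTo (suc n)) f ≡ f 0 +ᶻ ∑ (upTo n) (f ∘ suc)
∑-upTo-suc n f = cong (f 0 +ᶻ_) (trans (cong (λ xs → ∑ xs f) (sym (LP.map-applyUpTo id suc n))) (∑-map suc (upTo n) f))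

nth : ℕ → List ℕ → ℕ
nth k [] = 0
nth zero (a ∷ γ) = a
nth (suc k) (a ∷ γ) = nth k γ

nonzero : ℕ → Bool
nonzero zero = false
nonzero (suc _) = true

-- only the last nonzero part of γ contributes
last-part : ∀ γ (x : ℤ) → ∑ (upTo (length γ)) (λ k → allZeroᵇ (drop (suc k) γ) ▹ (nonzero (nth k γ) ▹ x)) ≡ not (allZeroᵇ γ) ▹ x
last-part [] x = refl
last-part (a ∷ γ) x = trans (∑-upTo-suc (length γ) (λ k → allZeroᵇ (drop (suc k) (a ∷ γ)) ▹ (nonzero (nth k (a ∷ γ)) ▹ x))) (trans (cong (allZeroᵇ γ ▹ (nonzero a ▹ x) +ᶻ_) (last-part γ x)) (combine a (allZeroᵇ γ)))
  where
  combine : ∀ a b → b ▹ (nonzero a ▹ x) +ᶻ not b ▹ x ≡ not ((a ≡ᵇ 0) ∧ b) ▹ x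
  combine zero true = refl
  combine zero false = ℤP.+-identityˡ x
  combine (suc a) true = ℤP.+-identityʳ x
  combine (suc a) false = ℤP.+-identityˡ x

module Main (C : CoxeterSystem) (len : CoxeterSystem.W C → ℕ) (isLen : CoxDefs.IsLength C len)
            (R : CoxeterSystem.W C → CoxeterSystem.W C → Poly) (isR : CoxDefs.IsRPolys C len R)
            (Rt : CoxeterSystem.W C → CoxeterSystem.W C → Poly) (isRt : CoxDefs.IsRtildes C len R Rt)
            (_<T_ : CoxeterSystem.W C → CoxeterSystem.W C → Set) (isRO : CoxDefs.IsReflOrder C len _<T_) where
  open Inversions C len isLen
  open PathLists C len isLen
  open ReflectionOrders.Decide C len isLen _<T_ isRO
  open LabelTests lt using (blocks-increase; descentWord; descentWord-length; blocks-wtc)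
  open Flags C len isLen lt order
  open RTilde C len isLen lt order using (Rtilde-G; ≤B⇒len≤)

  I : Intervals
  I = record
    { below = λ v → proj₁ (proj₂ (proj₂ (isR v)))
    ; unique = λ v → proj₁ (proj₂ (proj₂ (proj₂ (isR v))))
    ; sound = λ {x} {v} → proj₁ (proj₂ (proj₂ (proj₂ (proj₂ (isR v))))) x
    ; complete = λ {x} {v} → proj₁ (proj₂ (proj₂ (proj₂ (proj₂ (proj₂ (isR v)))))) x
    }

  open Intervals I renaming (below to lower)
  open Series I

  -- Descent compositions and the counts of paths

  isDescent : List W → ℕ → Bool
  isDescent (x ∷ y ∷ ls) (suc zero) = lt y x
  isDescent (x ∷ ls) (suc (suc i)) = isDescent ls (suc i)
  isDescent _ _ = false

  isDescent⇒ : ∀ ls i → isDescent ls i ≡ true → DescAt _<T_ ls i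
  isDescent⇒ (x ∷ y ∷ ls) (suc zero) eq = lt⇒< eq
  isDescent⇒ (x ∷ []) (suc (suc i)) ()
  isDescent⇒ (x ∷ y ∷ ls) (suc (suc i)) eq = isDescent⇒ (y ∷ ls) (suc i) eq

  ⇒isDescent : ∀ {ls} → All IsRefl ls → ∀ i → DescAt _<T_ ls i → isDescent ls i ≡ true
  ⇒isDescent (Rx ∷ Ry ∷ _) (suc zero) d = <⇒lt Ry Rx d
  ⇒isDescent (_ ∷ []) (suc (suc i)) ()
  ⇒isDescent (_ ∷ Ry ∷ Rs) (suc (suc i)) d = ⇒isDescent (Ry ∷ Rs) (suc i) d

  -- The offset k counts the labels already passed: position i of the whole sequence is position i -
  -- k of the rest.
  descents-agree : ∀ k l ls → Agree k (descentWord (l ∷ ls)) (λ i → isDescent (l ∷ ls) (i ∸ k))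
  descents-agree k l [] i _ = none (i ∸ k)
    where
    none : ∀ i → isDescent (l ∷ []) i ≡ false
    none zero = refl
    none (suc zero) = refl
    none (suc (suc i)) = refl
  descents-agree k l (l′ ∷ ls) = cong (isDescent (l ∷ l′ ∷ ls)) (ℕP.m+n∸n≡m 1 k) ,
    Agree-cong (suc k) (descentWord (l′ ∷ ls)) shift (descents-agree (suc k) l′ ls)
    where
    shift : ∀ i → suc k < i → isDescent (l′ ∷ ls) (i ∸ suc k) ≡ isDescent (l ∷ l′ ∷ ls) (i ∸ k)
    shift i k<i with i ∸ suc (suc k) | ℕP.m+[n∸m]≡n k<i
    ... | m | refl = trans (cong (isDescent (l′ ∷ ls)) (trans (cong (_∸ suc k) (sym (ℕP.+-suc (suc k) m))) (ℕP.m+n∸m≡n (suc k) (suc m))))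
      (sym (cong (isDescent (l ∷ l′ ∷ ls)) (trans (cong (_∸ k) (trans (sym (ℕP.+-suc (suc k) m)) (sym (ℕP.+-suc k (suc m))))) (ℕP.m+n∸m≡n k (suc (suc m))))))

  module _ {u v : W} where
    dw : List W → List Bool
    dw as = descentWord (labels u as)

    dw-length : ∀ {n} as → length as ≡ suc n → length (dw as) ≡ n
    dw-length {n} as l = descentWord-length (labels u as) n (trans (labels-length u as) l)

    descents : ∀ {n} as → length as ≡ suc n → Agree 0 (dw as) (isDescent (labels u as))
    descents (a ∷ as) _ = descents-agree 0 (a · u ⁻¹) (labels a as)

    isDescent-0 : ∀ ls → isDescent ls 0 ≡ false
    isDescent-0 [] = refl
    isDescent-0 (_ ∷ []) = refl
    isDescent-0 (_ ∷ _ ∷ _) = refl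

    descentComposition⇒ : ∀ {n} as {α} → PathFrom u as v → length as ≡ suc n → HasDescComp _<T_ u as α → α ≡ wtc (dw as)
    descentComposition⇒ {n} as {α} p l (pos , sumα , iff) with composition-word n α pos (trans sumα l)
    ... | w , lw , refl = cong wtc (Agree-unique 0 (trans lw (sym (dw-length as l))) (Agree-cong 0 w same (setOf-agrees 0 w)) (descents as l))
      where
      same : ∀ i → 0 < i → memᵇ i (setOf 0 w) ≡ isDescent (labels u as) i
      same i _ = trans (cong (memᵇ i) (sym (compSet-wtc w)))
        (iff⇒≡ (λ m → ⇒isDescent (labels-refl as p) i (proj₁ (iff i) m)) (λ d → proj₂ (iff i) (isDescent⇒ (labels u as) i d)))

    ⇒descentComposition : ∀ {n} as → PathFrom u as v → length as ≡ suc n → HasDescComp _<T_ u as (wtc (dw as))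
    ⇒descentComposition {n} as p l = wtc-positive (dw as) , trans (wtc-sum (dw as)) (trans (cong suc (dw-length as l)) (sym l)) ,
      λ i → (λ m → isDescent⇒ (labels u as) i (trans (sym (same i)) m)) , (λ d → trans (same i) (⇒isDescent (labels-refl as p) i d))
      where
      same : ∀ i → memᵇ i (compSet (wtc (dw as))) ≡ isDescent (labels u as) i
      same zero = trans (cong (memᵇ 0) (compSet-wtc (dw as))) (trans (memᵇ-setOf-≤ 0 0 (dw as) z≤n) (sym (isDescent-0 (labels u as))))
      same (suc i) = trans (cong (memᵇ (suc i)) (compSet-wtc (dw as))) (Agree-pointwise 0 (dw as) (setOf-agrees 0 (dw as)) (descents as l) (suc i) (s≤s z≤n))

    count : ∀ (P : List W → Set) (test : List W → Bool) n → (∀ {as} → P as → as ∈ VP n u v × test as ≡ true) →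
      (∀ {as} → as ∈ VP n u v → test as ≡ true → P as) → Σ ℕ λ m → Count P m × ℤ.+ m ≡ ∑ (VP n u v) (λ as → test as ▹ 1ℤ)
    count P test n to from = length xs ,
      (xs , UniqueP.filter⁺ test? (VP-unique n u v) ,
        (λ as as∈ → let (p , q) = ∈-filter⁻ test? {xs = VP n u v} as∈ in from p q) ,
        (λ as Pas → let (p , q) = to Pas in ∈-filter⁺ test? p q) , ∑-one xs) ,
      trans (sym (∑-one xs)) (trans (∑-filter test? (VP n u v) (λ _ → 1ℤ)) (∑-cong (VP n u v) λ {as} _ → cong (_▹ 1ℤ) (does-≟ (test as))))
      where
      test? = λ as → test as ≟B true
      xs = filter test? (VP n u v)
      does-≟ : ∀ b → does (b ≟B true) ≡ b
      does-≟ true = refl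
      does-≟ false = refl

    empty-path : HasDescComp _<T_ u [] []
    empty-path = [] , refl , λ i → (λ ()) , λ ()

    c-wtc : ∀ p → c (wtc p) u v ≡ ∑ (VP (suc (length p)) u v) (λ as → (dw as ⊑ p) ▹ 1ℤ)
    c-wtc p = trans (c-paths (wtc p) u v) (trans (cong (λ k → ∑ (VP k u v) (λ as → blocks-increase (wtc p) (labels u as) ▹ 1ℤ)) (wtc-sum p))
      (∑-cong (VP (suc (length p)) u v) λ {as} as∈ → let (path , l) = VP-sound (suc (length p)) as∈ in
        cong (_▹ 1ℤ) (blocks-wtc p (labels u as) (comparable as path) (trans (labels-length u as) l))))

    length-wtc : ∀ p {n} (as : List W) → length p ≡ n → length as ≡ sum (wtc p) → length as ≡ suc n
    length-wtc p as lp l = trans l (trans (wtc-sum p) (cong suc lp))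

    c-count : ∀ n {α} → α ∈ comps n → Σ ℕ λ m → cCount _<T_ u v α m × ℤ.+ m ≡ c α u v
    c-count zero (here refl) with count _ (λ _ → true) 0 (λ { (p , l , _) → VP-complete 0 p l , refl }) (λ as∈ _ → empty _ (VP-sound 0 as∈))
      where
      empty : ∀ as → PathFrom u as v × length as ≡ 0 → PathFrom u as v × length as ≡ 0 × Σ (List ℕ) λ β → HasDescComp _<T_ u as β × refinesᵇ [] β ≡ true
      empty [] (p , _) = p , refl , [] , empty-path , refl
    ... | m , cnt , eq = m , cnt , trans eq (∑-VP-zero u v (λ _ → 1ℤ))
    c-count (suc n) α∈ with comps-word n α∈
    ... | p , lp , refl with count _ (λ as → dw as ⊑ p) (suc n) to from
      where
      P = λ as → PathFrom u as v × length as ≡ sum (wtc p) × Σ (List ℕ) λ β → HasDescComp _<T_ u as β × refinesᵇ (wtc p) β ≡ true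
      to : ∀ {as} → P as → as ∈ VP (suc n) u v × (dw as ⊑ p) ≡ true
      to {as} (path , l , β , d , ref) = VP-complete (suc n) path l′ ,
        trans (sym (refines-wtc p (dw as) (trans (dw-length as l′) (sym lp)))) (trans (cong (refinesᵇ (wtc p)) (sym (descentComposition⇒ as path l′ d))) ref)
        where l′ = length-wtc p as lp l
      from : ∀ {as} → as ∈ VP (suc n) u v → (dw as ⊑ p) ≡ true → P as
      from {as} as∈ t with VP-sound (suc n) as∈
      ... | path , l = path , trans l (sym (trans (wtc-sum p) (cong suc lp))) , wtc (dw as) , ⇒descentComposition as path l ,
        trans (refines-wtc p (dw as) (trans (dw-length as l) (sym lp))) t
    ... | m , cnt , eq = m , cnt , trans eq (trans (cong (λ k → ∑ (VP (suc k) u v) (λ as → (dw as ⊑ p) ▹ 1ℤ)) (sym lp)) (sym (c-wtc p)))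

    -- the number of paths of length sum α with descent composition α
    b : List ℕ → ℤ
    b [] = (u == v) ▹ 1ℤ
    b α@(_ ∷ _) = ∑ (VP (sum α) u v) (λ as → does (≡-dec ℕP._≟_ α (wtc (dw as))) ▹ 1ℤ)

    b-wtc : ∀ x → b (wtc x) ≡ ∑ (VP (suc (length x)) u v) (λ as → (dw as ==ᵇ x) ▹ 1ℤ)
    b-wtc x = trans (unfold (wtc-nonempty x)) (trans (cong (λ k → ∑ (VP k u v) (λ as → does (≡-dec ℕP._≟_ (wtc x) (wtc (dw as))) ▹ 1ℤ)) (wtc-sum x))
      (∑-cong (VP (suc (length x)) u v) λ {as} _ → cong (_▹ 1ℤ) (test (dw as))))
      where
      unfold : (Σ ℕ λ a → Σ (List ℕ) λ c → wtc x ≡ suc a ∷ c) → b (wtc x) ≡ ∑ (VP (sum (wtc x)) u v) (λ as → does (≡-dec ℕP._≟_ (wtc x) (wtc (dw as))) ▹ 1ℤ)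
      unfold (a , c , eq) with wtc x | eq
      ... | _ | refl = refl
      test : ∀ y → does (≡-dec ℕP._≟_ (wtc x) (wtc y)) ≡ (y ==ᵇ x)
      test y with ≡-dec ℕP._≟_ (wtc x) (wtc y)
      ... | yes eq = sym (trans (cong (y ==ᵇ_) (wtc-injective x y eq)) (==ᵇ-refl y))
      ... | no ne = sym (¬-not λ eq → ne (cong wtc (sym (==ᵇ⇒≡ y x eq))))

    b-count : ∀ n {α} → α ∈ comps n → Σ ℕ λ m → bCount _<T_ u v α m × ℤ.+ m ≡ b α
    b-count zero (here refl) with count _ (λ _ → true) 0 to (λ as∈ _ → empty _ (VP-sound 0 as∈))
      where
      to : ∀ {as} → PathFrom u as v × HasDescComp _<T_ u as [] → as ∈ VP 0 u v × true ≡ true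
      to (p , _ , l , _) = VP-complete 0 p (sym l) , refl
      empty : ∀ as → PathFrom u as v × length as ≡ 0 → PathFrom u as v × HasDescComp _<T_ u as []
      empty [] (p , _) = p , empty-path
    ... | m , cnt , eq = m , cnt , trans eq (∑-VP-zero u v (λ _ → 1ℤ))
    b-count (suc n) α∈ with comps-word n α∈
    ... | x , lx , refl with count _ (λ as → dw as ==ᵇ x) (suc n) to from
      where
      to : ∀ {as} → PathFrom u as v × HasDescComp _<T_ u as (wtc x) → as ∈ VP (suc n) u v × (dw as ==ᵇ x) ≡ true
      to {as} (path , d) = VP-complete (suc n) path l , trans (cong (dw as ==ᵇ_) (wtc-injective x (dw as) (descentComposition⇒ as path l d))) (==ᵇ-refl (dw as))
        where l = length-wtc x as lx (sym (proj₁ (proj₂ d)))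
      from : ∀ {as} → as ∈ VP (suc n) u v → (dw as ==ᵇ x) ≡ true → PathFrom u as v × HasDescComp _<T_ u as (wtc x)
      from {as} as∈ t with VP-sound (suc n) as∈
      ... | path , l = path , subst (HasDescComp _<T_ u as) (cong wtc (==ᵇ⇒≡ (dw as) x t)) (⇒descentComposition as path l)
    ... | m , cnt , eq = m , cnt , trans eq (trans (cong (λ k → ∑ (VP (suc k) u v) (λ as → (dw as ==ᵇ x) ▹ 1ℤ)) (sym lx)) (sym (b-wtc x)))

    M-expansion : ∀ γ → ∑ (comps (sum γ)) (λ α → c α u v *ᶻ Mser α γ) ≡ c γ u v
    M-expansion γ = trans (go (sum γ) refl) (sym (c-flat γ u v))
      where
      go : ∀ n → sum γ ≡ n → ∑ (comps n) (λ α → c α u v *ᶻ Mser α γ) ≡ c (flat γ) u v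
      go zero eq = trans (ℤP.+-identityʳ _) (trans (cong (λ b → c [] u v *ᶻ (b ▹ 1ℤ)) (dec-true (≡-dec ℕP._≟_ (flat γ) []) (flat-zero γ eq)))
        (trans (ℤP.*-identityʳ _) (cong (λ α → c α u v) (sym (flat-zero γ eq)))))
      go (suc n) eq with flat-word n γ eq
      ... | p , refl , fl = trans (∑-comps-Mser {γ} {p} fl (λ α → c α u v)) (cong (λ α → c α u v) (sym fl))

    -- Every path belongs to exactly one word, its descent word, so the sum over the words below p
    -- counts the paths whose descents are all marked in p.
    L-expansion : ∀ γ → ∑ (comps (sum γ)) (λ α → b α *ᶻ Lser α γ) ≡ c γ u v
    L-expansion γ = trans (go (sum γ) refl) (sym (c-flat γ u v))
      where
      open ≡-Reasoning
      go : ∀ n → sum γ ≡ n → ∑ (comps n) (λ α → b α *ᶻ Lser α γ) ≡ c (flat γ) u v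
      go zero eq = trans (ℤP.+-identityʳ _) (trans (cong (λ b → c [] u v *ᶻ ((b ▹ 1ℤ) +ᶻ 0ℤ)) (dec-true (≡-dec ℕP._≟_ (flat γ) []) (flat-zero γ eq)))
        (trans (ℤP.*-identityʳ _) (cong (λ α → c α u v) (sym (flat-zero γ eq)))))
      go (suc n) eq with flat-word n γ eq
      ... | p , refl , fl = begin
        ∑ (comps (suc n)) (λ α → b α *ᶻ Lser α γ)
          ≡⟨ trans (cong (λ cs → ∑ cs (λ α → b α *ᶻ Lser α γ)) (comps-words n)) (∑-map wtc (words n) (λ α → b α *ᶻ Lser α γ)) ⟩
        ∑ (words n) (λ x → b (wtc x) *ᶻ Lser (wtc x) γ)
          ≡⟨ ∑-words-cong n (λ x lx → trans (cong₂ _*ᶻ_ (trans (b-wtc x) (cong (λ k → ∑ (VP (suc k) u v) (λ as → (dw as ==ᵇ x) ▹ 1ℤ)) lx)) (Lser-wtc {γ} {p} fl x lx))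
               (trans (sym (∑-*ʳ ((x ⊑ p) ▹ 1ℤ) (VP (suc n) u v) (λ as → (dw as ==ᵇ x) ▹ 1ℤ))) (∑-cong (VP (suc n) u v) λ {as} _ → sym (▹-* (dw as ==ᵇ x) ((x ⊑ p) ▹ 1ℤ))))) ⟩
        ∑ (words n) (λ x → ∑ (VP (suc n) u v) (λ as → (dw as ==ᵇ x) ▹ ((x ⊑ p) ▹ 1ℤ)))
          ≡⟨ ∑-swap (words n) (VP (suc n) u v) (λ x as → (dw as ==ᵇ x) ▹ ((x ⊑ p) ▹ 1ℤ)) ⟩
        ∑ (VP (suc n) u v) (λ as → ∑ (words n) (λ x → (dw as ==ᵇ x) ▹ ((x ⊑ p) ▹ 1ℤ)))
          ≡⟨ ∑-cong (VP (suc n) u v) (λ {as} as∈ → trans (cong (λ k → ∑ (words k) (λ x → (dw as ==ᵇ x) ▹ ((x ⊑ p) ▹ 1ℤ))) (sym (dw-length as (proj₂ (VP-sound (suc n) as∈)))))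
               (∑-words-δ (dw as) (λ x → (x ⊑ p) ▹ 1ℤ))) ⟩
        ∑ (VP (suc n) u v) (λ as → (dw as ⊑ p) ▹ 1ℤ)
          ≡⟨ c-wtc p ⟨
        c (wtc p) u v
          ≡⟨ cong (λ α → c α u v) (sym fl) ⟩
        c (flat γ) u v ∎

  -- Multichains and the coefficients of the R-quasisymmetric function

  module _ (v : W) where
    strict : W → List (List W)
    strict u with u ≤? v | u ≟W v
    ... | yes _ | no _ = (v ∷ []) ∷ []
    ... | _ | _ = []

    above : W → List W
    above u = filter (u ≤?_) (lower v)

    -- the multichains from u to v with k+1 steps
    chains : ℕ → W → List (List W)
    chains zero u = strict u
    chains (suc k) u = concatMap (λ y → map (y ∷_) (chains k y)) (above u)

    chains-sound : ∀ k u {ys} → ys ∈ chains k u → length ys ≡ suc k × MC u ys v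
    chains-sound zero u ys∈ with u ≤? v | u ≟W v
    chains-sound zero u (here refl) | yes u≤v | no ne = refl , refl , u≤v , ne
    chains-sound (suc k) u ys∈ with concatMap-∈⁻ _ (above u) ys∈
    ... | y , y∈ , p with ∈-map⁻ (y ∷_) p
    ... | zs , zs∈ , refl with chains-sound k y zs∈
    chains-sound (suc k) u ys∈ | y , y∈ , p | z ∷ zs , zs∈ , refl | l , mc = cong suc l , proj₂ (∈-filter⁻ (u ≤?_) {xs = lower v} y∈) , mc

    MC⇒≤ : ∀ u ys → MC u ys v → u ≤B v
    MC⇒≤ u (y ∷ []) (refl , u≤v , _) = u≤v
    MC⇒≤ u (y ∷ z ∷ ys) (u≤y , mc) = ≤B-trans u≤y (MC⇒≤ y (z ∷ ys) mc)

    chains-complete : ∀ k u {ys} → length ys ≡ suc k → MC u ys v → ys ∈ chains k u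
    chains-complete zero u {y ∷ []} _ (refl , u≤v , ne) with u ≤? v | u ≟W v
    ... | yes _ | no _ = here refl
    ... | no n | _ = ⊥-elim (n u≤v)
    ... | yes _ | yes p = ⊥-elim (ne p)
    chains-complete (suc k) u {y ∷ z ∷ ys} l (u≤y , mc) = concatMap-∈⁺ (∈-filter⁺ (u ≤?_) (complete (MC⇒≤ y (z ∷ ys) mc)) u≤y)
      (∈-map⁺ (y ∷_) (chains-complete k y (ℕP.suc-injective l) mc))

    chains-unique : ∀ k u → Unique (chains k u)
    chains-unique zero u with u ≤? v | u ≟W v
    ... | yes _ | no _ = [] ∷ []
    ... | yes _ | yes _ = []
    ... | no _ | _ = []
    chains-unique (suc k) u = concatMap-unique _ (UniqueP.filter⁺ (u ≤?_) (unique v)) (λ {y} _ → UniqueP.map⁺ LP.∷-injectiveʳ (chains-unique k y)) separate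
      where
      separate : ∀ {y y′ ys} → y ∈ above u → y′ ∈ above u → ys ∈ map (y ∷_) (chains k y) → ys ∈ map (y′ ∷_) (chains k y′) → y ≡ y′
      separate {y} {y′} _ _ p q with ∈-map⁻ (y ∷_) p | ∈-map⁻ (y′ ∷_) q
      ... | zs , _ , refl | zs′ , _ , eq = LP.∷-injectiveˡ eq

    c-allZero : ∀ γ w → allZeroᵇ γ ≡ true → c γ w v ≡ (w == v) ▹ 1ℤ
    c-allZero γ w eq = trans (c-flat γ w v) (cong (λ α → c α w v) (flat-zero γ (allZero⇒sum γ eq)))

    Rt-G : ∀ {u y} n → u ≤B y → coefP (Rt u y) n ≡ Gs u y n
    Rt-G n u≤y = Rtilde-G {R} {Rt} isR isRt u≤y n

    chain-sum-suc : ∀ k u γ → ∑ (chains (suc k) u) (λ ys → weight Rt u ys γ) ≡ ∑ (lower v) (λ y → Gs u y (hd γ) *ᶻ ∑ (chains k y) (λ ys → weight Rt y ys (tl γ)))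
    chain-sum-suc k u γ = trans (∑-concatMap _ (above u) _) (trans (∑-filter (u ≤?_) (lower v) _) (∑-cong (lower v) λ {y} _ →
      trans (cong (does (u ≤? y) ▹_) (trans (∑-map (y ∷_) (chains k y) _) (∑-* (coefP (Rt u y) (hd γ)) (chains k y) (λ ys → weight Rt y ys (tl γ))))) (term y (u ≤? y))))
      where
      term : ∀ y (d : Dec (u ≤B y)) → does d ▹ (coefP (Rt u y) (hd γ) *ᶻ ∑ (chains k y) (λ ys → weight Rt y ys (tl γ))) ≡ Gs u y (hd γ) *ᶻ ∑ (chains k y) (λ ys → weight Rt y ys (tl γ))
      term y (yes u≤y) = cong (_*ᶻ ∑ (chains k y) (λ ys → weight Rt y ys (tl γ))) (Rt-G (hd γ) u≤y)
      term y (no u≰y) = sym (trans (cong (_*ᶻ ∑ (chains k y) (λ ys → weight Rt y ys (tl γ))) (G-≰ (hd γ) u≰y)) (ℤP.*-zeroˡ (∑ (chains k y) (λ ys → weight Rt y ys (tl γ)))))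

    chain-sum-zero : ∀ u γ → ∑ (chains 0 u) (λ ys → weight Rt u ys γ) ≡ nonzero (hd γ) ▹ Gs u v (hd γ)
    chain-sum-zero u γ with u ≤? v | u ≟W v
    ... | no u≰v | _ = sym (trans (cong (nonzero (hd γ) ▹_) (G-≰ (hd γ) u≰v)) (▹-zero (nonzero (hd γ))))
    ... | yes _ | yes refl = sym (loop (hd γ))
      where
      loop : ∀ n → nonzero n ▹ Gs u u n ≡ 0ℤ
      loop zero = refl
      loop (suc n) = G-loop n u
    ... | yes u≤v | no ne = trans (ℤP.+-identityʳ _) (trans (ℤP.*-identityʳ _) (trans (Rt-G (hd γ) u≤v) (start (hd γ))))
      where
      start : ∀ n → Gs u v n ≡ nonzero n ▹ Gs u v n
      start zero = cong (_▹ 1ℤ) (dec-false (u ≟W v) ne)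
      start (suc n) = refl

    -- The factor records that the last step is strict: in degree 0 `Gs` is a Kronecker delta, and
    -- no path of positive length is closed, so a last step of nonzero weight is strict exactly when
    -- its exponent is positive.
    chain-sum : ∀ k u γ → allZeroᵇ (drop (suc k) γ) ≡ true → ∑ (chains k u) (λ ys → weight Rt u ys γ) ≡ nonzero (nth k γ) ▹ c γ u v
    chain-sum zero u [] _ = chain-sum-zero u []
    chain-sum zero u (zero ∷ γ) _ = chain-sum-zero u (zero ∷ γ)
    chain-sum zero u (suc a ∷ γ) z = trans (chain-sum-zero u (suc a ∷ γ)) (sym (trans (∑-cong (lower v) λ {w} _ → trans (cong (Gs u w (suc a) *ᶻ_) (c-allZero γ w z))
        (trans (ℤP.*-comm (Gs u w (suc a)) _) (trans (sym (▹-* (w == v) (Gs u w (suc a)))) (cong (_▹ Gs u w (suc a)) (==-⇔ sym sym)))))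
      (∑-δ _≟W_ (λ w → Gs u w (suc a)) (unique v) (complete (≤B-refl v)))))
    chain-sum (suc k) u [] z = trans (chain-sum-suc k u []) (∑-zero (lower v) λ {y} _ → trans (cong (Gs u y 0 *ᶻ_) (chain-sum k y [] refl)) (vanish k (Gs u y 0) (c [] y v)))
      where
      vanish : ∀ k x z → x *ᶻ (nonzero (nth k []) ▹ z) ≡ 0ℤ
      vanish zero x z = ℤP.*-zeroʳ x
      vanish (suc k) x z = ℤP.*-zeroʳ x
    chain-sum (suc k) u (a ∷ γ) z = trans (chain-sum-suc k u (a ∷ γ)) (trans (∑-cong (lower v) λ {y} _ → trans (cong (Gs u y a *ᶻ_) (chain-sum k y γ z)) (sym (▹-*ʳ (nonzero (nth k γ)) (Gs u y a) (c γ y v))))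
      (∑-▹ (nonzero (nth k γ)) (lower v) (λ y → Gs u y a *ᶻ c γ y v)))

    contribution : ∀ k u γ → Contrib Rt u v (suc k) γ (allZeroᵇ (drop (suc k) γ) ▹ (nonzero (nth k γ) ▹ c γ u v))
    contribution k u γ with allZeroᵇ (drop (suc k) γ) in eq
    ... | true = chains k u , chains-unique k u , (λ ys → chains-sound k u) , (λ { ys (l , mc) → chains-complete k u l mc }) , chain-sum k u γ eq
    ... | false = refl

    c-diagonal : ∀ γ → oneSer γ ≡ c γ v v
    c-diagonal γ = trans (go (sum γ) refl) (sym (c-flat γ v v))
      where
      go : ∀ n → sum γ ≡ n → oneSer γ ≡ c (flat γ) v v
      go zero eq = trans (cong (_▹ 1ℤ) (sum⇒allZero γ eq)) (sym (trans (cong (λ α → c α v v) (flat-zero γ eq)) (cong (_▹ 1ℤ) (==-refl v))))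
      go (suc n) eq = trans (cong (_▹ 1ℤ) (¬-not λ z → ℕP.1+n≢0 (trans (sym eq) (allZero⇒sum γ z))))
        (sym (trans (c-paths (flat γ) v v) (trans (cong (λ m → ∑ (VP m v v) (λ as → blocks-increase (flat γ) (labels v as) ▹ 1ℤ)) (trans (sum-flat γ) eq))
          (∑-zero (VP (suc n) v v) λ {as} as∈ → ⊥-elim (no-loop n as (VP-sound (suc n) as∈))))))

    -- Only the multichains whose number of steps is the position of the last nonzero exponent
    -- contribute, so `length γ` bounds the steps to be considered. If γ is zero there are none, and
    -- c vanishes as well for u ≠ v.
    F-coefficient : ∀ u γ → FCoef Rt u v γ (c γ u v)
    F-coefficient u γ = (λ { refl → sym (c-diagonal γ) }) , λ u≢v → length γ , map z (upTo (length γ)) , Pointwise-map z (upTo (length γ)) (λ k → contribution k u γ) ,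
        (λ k K≤k → subst (Contrib Rt u v (suc k) γ) (beyond k K≤k) (contribution k u γ)) , trans (last-part γ (c γ u v)) (total u≢v)
      where
      z : ℕ → ℤ
      z k = allZeroᵇ (drop (suc k) γ) ▹ (nonzero (nth k γ) ▹ c γ u v)
      nth-≥ : ∀ k γ → length γ ≤ k → nth k γ ≡ 0
      nth-≥ k [] _ = refl
      nth-≥ (suc k) (a ∷ γ) (s≤s l) = nth-≥ k γ l
      beyond : ∀ k → length γ ≤ k → z k ≡ 0ℤ
      beyond k l = trans (cong (λ n → allZeroᵇ (drop (suc k) γ) ▹ (nonzero n ▹ c γ u v)) (nth-≥ k γ l)) (▹-zero (allZeroᵇ (drop (suc k) γ)))
      total : u ≢ v → not (allZeroᵇ γ) ▹ c γ u v ≡ c γ u v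
      total u≢v with allZeroᵇ γ in eq
      ... | false = refl
      ... | true = sym (trans (c-allZero γ u eq) (cong (_▹ 1ℤ) (dec-false (u ≟W v) u≢v)))

  claimM : ∀ u v → ClaimM Rt _<T_ u v
  claimM u v γ with collect (cCount _<T_ u v) (λ α → c α u v) (comps (sum γ)) (c-count (sum γ))
  ... | cs , counts , sums = cs , counts , subst (FCoef Rt u v γ) (sym (trans (sums (λ α → Mser α γ)) (M-expansion γ))) (F-coefficient v u γ)

  claimL : ∀ u v → ClaimL Rt _<T_ u v
  claimL u v γ with collect (bCount _<T_ u v) b (comps (sum γ)) (b-count (sum γ))
  ... | bs , counts , sums = bs , counts , subst (FCoef Rt u v γ) (sym (trans (sums (λ α → Lser α γ)) (L-expansion γ))) (F-coefficient v u γ)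

  -- Membership in the peak algebra and the grading

  module _ {u v : W} (u≤v : u ≤B v) where
    private
      cd : ∀ n → CDPoly n
      cd n = proj₁ (peak-expansion (c-functional u v) n)

    cd-value : ∀ n γ → sum γ ≡ suc n → ΣΘ (cd n) γ ≡ c γ u v
    cd-value n γ eq with flat-word n γ eq
    ... | p , lp , fl = trans (proj₂ (peak-expansion (c-functional u v) n) {γ} {p} fl lp) (sym (c-flat γ u v))

    c-degree : ∀ n γ → sum γ ≡ suc n → n ∉ degrees (len v ∸ len u) → c γ u v ≡ 0ℤ
    c-degree n γ eq n∉ = trans (c-paths γ u v) (∑-zero (VP (sum γ) u v) λ {as} as∈ → ⊥-elim (n∉ (path-degree as (VP-sound (sum γ) as∈))))
      where
      path-degree : ∀ as → PathFrom u as v × length as ≡ sum γ → n ∈ degrees (len v ∸ len u)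
      path-degree as (p , l) with PathFrom-len as p
      ... | j , eq′ = subst (λ d → n ∈ degrees d) (sym (trans (cong (_∸ len u) (trans eq′ (ℕP.+-assoc (len u) (length as) (j + j)))) (trans (ℕP.m+n∸m≡n (len u) _)
            (cong (_+ (j + j)) (trans l eq))))) (degrees-complete n j)

    -- Θ is homogeneous, so only the summand of degree |γ| contributes; if that degree is not
    -- listed, the parity of path lengths makes c vanish too.
    homogeneous-sum : u ≢ v → ∀ γ → ∑ (degrees (len v ∸ len u)) (λ n → ΣΘ (cd n) γ) ≡ c γ u v
    homogeneous-sum u≢v γ = go (sum γ) refl
      where
      ds = degrees (len v ∸ len u)
      go : ∀ m → sum γ ≡ m → ∑ ds (λ n → ΣΘ (cd n) γ) ≡ c γ u v
      go zero eq = trans (∑-zero ds λ {n} _ → ΣΘ-degree (cd n) γ λ eq′ → ℕP.1+n≢0 (trans (sym eq′) eq))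
        (sym (trans (c-allZero v γ u (sum⇒allZero γ eq)) (cong (_▹ 1ℤ) (dec-false (u ≟W v) u≢v))))
      go (suc n) eq with DecMem._∈?_ ℕP._≟_ n ds
      ... | yes n∈ = trans (∑-support ℕP._≟_ {ys = n ∷ []} (λ n → ΣΘ (cd n) γ) (degrees-unique (len v ∸ len u)) ([] ∷ [])
              (λ {m} _ m∉ → ΣΘ-degree (cd m) γ λ eq′ → m∉ (here (ℕP.suc-injective (trans (sym eq′) eq)))) (λ { (here refl) n∉ → ⊥-elim (n∉ n∈) }))
            (trans (ℤP.+-identityʳ _) (cd-value n γ eq))
      ... | no n∉ = trans (∑-zero ds λ {m} m∈ → ΣΘ-degree (cd m) γ λ eq′ → n∉ (subst (_∈ ds) (ℕP.suc-injective (trans (sym eq′) eq)) m∈)) (sym (c-degree n γ eq n∉))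

    inPeakGraded : InPeakGraded Rt u v
    inPeakGraded with u ≟W v
    -- Here F̃ = 1, which lies in degree 0 = l(u,u); this is the only case with a constant term.
    ... | yes refl = 1ℤ , [] , inj₂ (0 , ℕP.n∸n≡0 (len u)) , [] ,
      λ γ → subst (FCoef Rt u u γ) (sym (trans (ℤP.+-identityʳ _) (trans (ℤP.*-identityˡ _) (c-diagonal u γ)))) (F-coefficient u u γ)
    ... | no u≢v = 0ℤ , ts , inj₁ refl , All.tabulate allowed ,
      λ γ → subst (FCoef Rt u v γ) (sym (trans (cong (_+ᶻ ∑ ts (λ t → proj₁ t *ᶻ Θ (proj₂ t) γ)) (ℤP.*-zeroˡ (oneSer γ))) (trans (ℤP.+-identityˡ _)
          (trans (∑-concatMap (λ n → terms (cd n)) ds _) (homogeneous-sum u≢v γ))))) (F-coefficient v u γ)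
      where
      ds = degrees (len v ∸ len u)
      ts = concatMap (λ n → terms (cd n)) ds
      allowed : ∀ {t} → t ∈ ts → Σ ℕ λ j → len v ∸ len u ≡ suc (degCD (proj₂ t)) + 2 * j
      allowed {t} t∈ with concatMap-∈⁻ (λ n → terms (cd n)) ds t∈
      ... | n , n∈ , t∈′ with degrees-sound (len v ∸ len u) n∈
      ... | j , eq = j , trans eq (cong (λ d → suc d + 2 * j) (sym (All.lookup (terms-degree (cd n)) t∈′)))

    inPeak : InPeak Rt u v
    inPeak with inPeakGraded
    ... | a , ts , _ , _ , coefficients = a , ts , inj₂ tt , All.tabulate (λ _ → tt) , coefficients

theorem2p2 : (C : CoxeterSystem) (len : CoxeterSystem.W C → ℕ) →
    let open CoxeterSystem C
        open CoxDefs C len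
    in IsLength →
       (R : W → W → Poly) → IsRPolys R →
       (Rt : W → W → Poly) → IsRtildes R Rt →
       (_<T_ : W → W → Set) → IsReflOrder _<T_ →
       (u v : W) → u ≤B v →
       ClaimM Rt _<T_ u v × ClaimL Rt _<T_ u v × InPeak Rt u v × InPeakGraded Rt u v
theorem2p2 C len isLen R isR Rt isRt _<T_ isRO u v u≤v = claimM u v , claimL u v , inPeak u≤v , inPeakGraded u≤v
  where open Main C len isLen R isR Rt isRt _<T_ isRO
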